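{- There exists an absolute constant $c>0$ such that the following holds. Let $\mathbb{F}$ be a field of characteristic $p$, where $p$ is an odd prime, and let $\omega$ be a non-degenerate symmetric or skew-symmetric bilinear form on $\mathbb{F}^2$. Let $S\subseteq\mathbb{F}^2$ be a set of $N$ points not contained in a single line. Then $$|\omega(S)|\geq c\min\left(N^{2/3},p\right),\qquad \omega(S)=\{\omega(s,s'): s,s'\in S\}.$$ Moreover, if $S$ has a subset $S'$ of $N'<p$ points lying on pairwise distinct lines through the origin, then $|\omega(S)|\geq cN'$. -}

module Defs where

open import Level using (Level; _⊔_; Setω) renaming (suc to lsuc)
open import Data.Nat as ℕ using (ℕ; zero; suc; _<_; _≤_; _^_)
open import Data.Nat.Primality using (Prime)
open import Data.Product using (_×_; _,_; ∃; Σ)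
open import Data.Sum using (_⊎_)
open import Data.List using (List; length)
open import Data.List.Relation.Unary.All using (All)
open import Data.List.Relation.Unary.Any using (Any)
open import Data.List.Relation.Unary.AllPairs using (AllPairs)
open import Data.List.Relation.Binary.Pointwise using (Pointwise)
open import Data.List.Membership.Propositional using (_∈_)
open import Relation.Nullary using (¬_)
open import Algebra.Bundles using (CommutativeRing)

record Field (c ℓ : Level) : Set (lsuc (c ⊔ ℓ)) where
  field
    commutativeRing : CommutativeRing c ℓ
  open CommutativeRing commutativeRing public
  field
    0≉1 : ¬ (0# ≈ 1#)
    inverse : ∀ x → ¬ (x ≈ 0#) → ∃ λ y → (x * y) ≈ 1#

-- "There is k ≥ 1 with P k", where P k lives in Setω (needed because the
-- constant is quantified before all fields of all universe levels).
record ∃ℕ⁺ω (P : ℕ → Setω) : Setω where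
  field
    witness  : ℕ
    positive : 1 ≤ witness
    proof    : P witness

module _ {c ℓ : Level} (F : Field c ℓ) where
  open Field F

  ι : ℕ → Carrier
  ι zero    = 0#
  ι (suc n) = 1# + ι n

  HasCharacteristic : ℕ → Set ℓ
  HasCharacteristic p = (ι p ≈ 0#) × (∀ n → 0 < n → n < p → ¬ (ι n ≈ 0#))

  Pt : Set c
  Pt = Carrier × Carrier

  _≈ᵖ_ : Pt → Pt → Set ℓ
  (x , y) ≈ᵖ (x′ , y′) = (x ≈ x′) × (y ≈ y′)

  0ᵖ : Pt
  0ᵖ = 0# , 0#

  _+ᵖ_ : Pt → Pt → Pt
  (x , y) +ᵖ (x′ , y′) = (x + x′) , (y + y′)

  _·ᵖ_ : Carrier → Pt → Pt
  a ·ᵖ (x , y) = (a * x) , (a * y)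

  record IsBilinear (ω : Pt → Pt → Carrier) : Set (c ⊔ ℓ) where
    field
      cong   : ∀ {u u′ v v′} → u ≈ᵖ u′ → v ≈ᵖ v′ → ω u v ≈ ω u′ v′
      +-left  : ∀ u u′ v → ω (u +ᵖ u′) v ≈ (ω u v + ω u′ v)
      +-right : ∀ u v v′ → ω u (v +ᵖ v′) ≈ (ω u v + ω u v′)
      ·-left  : ∀ a u v → ω (a ·ᵖ u) v ≈ (a * ω u v)
      ·-right : ∀ a u v → ω u (a ·ᵖ v) ≈ (a * ω u v)

  NonDegenerate : (Pt → Pt → Carrier) → Set (c ⊔ ℓ)
  NonDegenerate ω = ∀ u → (∀ v → ω u v ≈ 0#) → u ≈ᵖ 0ᵖ

  Symmetric : (Pt → Pt → Carrier) → Set (c ⊔ ℓ)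
  Symmetric ω = ∀ u v → ω u v ≈ ω v u

  SkewSymmetric : (Pt → Pt → Carrier) → Set (c ⊔ ℓ)
  SkewSymmetric ω = ∀ u v → ω u v ≈ (- ω v u)

  record Line : Set (c ⊔ ℓ) where
    constructor line
    field
      a b d : Carrier
      nonzero : ¬ ((a ≈ 0#) × (b ≈ 0#))

  OnLine : Pt → Line → Set ℓ
  OnLine (x , y) L = ((Line.a L * x) + (Line.b L * y)) ≈ Line.d L

  ThroughOrigin : Line → Set ℓ
  ThroughOrigin L = Line.d L ≈ 0#

  SameLine : Line → Line → Set (c ⊔ ℓ)
  SameLine L L′ = ∀ P → (OnLine P L → OnLine P L′) × (OnLine P L′ → OnLine P L)

  -- a finite list of points is a set of points if its entries are pairwise distinct
  DistinctPts : List Pt → Set (c ⊔ ℓ)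
  DistinctPts = AllPairs (λ u v → ¬ (u ≈ᵖ v))

  ContainedInALine : List Pt → Set (c ⊔ ℓ)
  ContainedInALine S = ∃ λ L → All (λ P → OnLine P L) S

  CoversImage : (Pt → Pt → Carrier) → List Pt → List Carrier → Set (c ⊔ ℓ)
  CoversImage ω S T = ∀ s s′ → s ∈ S → s′ ∈ S → Any (λ t → ω s s′ ≈ t) T

  -- |ω(S)| ≥ m, in the form: every list covering ω(S) has length ≥ m.
  -- More generally, "k · |ω(S)| satisfies Q" is expressed as
  -- Q holds of k · length T for every cover T of ω(S).
  ScaledImageSize : (Pt → Pt → Carrier) → List Pt → ℕ → (ℕ → Set) → Set (c ⊔ ℓ)
  ScaledImageSize ω S k Q = ∀ T → CoversImage ω S T → Q (k ℕ.* length T)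

  OnDistinctLinesThroughOrigin : List Pt → Set (c ⊔ ℓ)
  OnDistinctLinesThroughOrigin S′ =
    ∃ λ (Ls : List Line) →
      Pointwise OnLine S′ Ls × All ThroughOrigin Ls × AllPairs (λ L L′ → ¬ SameLine L L′) Ls

{-# OPTIONS --safe #-}
module Submission where

-- Let t = |ω(S)|, let X be pairwise non-parallel points of S (for the second claim those of S′, for the first one
-- point from each direction), Y a set of non-zero points of S, and choose r with r² ≤ |X||Y| ≤ 2r². By Cauchy-Schwarz at
-- least (|X||Y|)²/t quadruples satisfy ω(x , y′) = ω(x′ , y). Write ω(x , y) = xᵀ W y and fix an invertible 2×2 matrix P.
-- To (x , y) attach the line {g : g x = P y} in the space of symmetric matrices g, and to (x′ , y′) the line
-- {g : g q = det P · W y′} with q = adj(P)ᵀ Wᵀ x′; symmetry of g makes these two lines meet (or be parallel) exactly when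
-- ω(x , y′) = ω(x′ , y). Averaging over a one-parameter family of matrices P, few lines of the same kind meet each other.
-- So at least about r⁴/t pairs of lines cross, whereas the polynomial method bounds their number by O(r³) when r is below
-- the characteristic: cover groups of lines by surfaces of low degree; on an irreducible surface either all but
-- few lines (Bezout) have few crossings, or the lines rule the surface, and then the differential equation satisfied by
-- the second ruling along a line bounds its crossings. Hence r = O(t).
-- For the first claim, every direction contains at most t points of S, and the fibres of ω(x , ·) have O(t) points: on a
-- fibre over a non-zero value the points are pairwise non-parallel, so the second claim applies to them.

open import Level using (Level; _⊔_; Lift; lift) renaming (suc to lsuc)
open import Algebra.Bundles using (CommutativeRing; AbelianGroup; RawRing)
import Algebra.Properties.Ring
import Algebra.Properties.Semiring.Mult.TCOptimised
import Algebra.Solver.Ring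
import Algebra.Solver.Ring.AlmostCommutativeRing as ACR
open import Data.Bool using (Bool; true; false; T; _∧_; not)
open import Data.Empty using (⊥; ⊥-elim)
open import Data.Fin as Fin using (Fin; zero; suc; toℕ)
import Data.Fin.Properties as Finₚ
open import Data.Integer as ℤ using (ℤ; +_; -[1+_]; _⊖_)
import Data.Integer.Properties as ℤₚ
open import Data.List as List using (List; []; _∷_; length; map; allFin; cartesianProduct; tabulate; take; drop)
open import Data.List.Membership.Propositional using (_∈_; find)
import Data.List.Membership.Propositional.Properties as ∈ₚ
import Data.List.Properties as Listₚ
open import Data.List.Relation.Unary.All as All using (All; []; _∷_)
import Data.List.Relation.Unary.All.Properties as Allₚ
open import Data.List.Relation.Unary.AllPairs as AllPairs using (AllPairs; []; _∷_)
import Data.List.Relation.Unary.AllPairs.Properties as Pairsₚ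
open import Data.List.Relation.Unary.Any as Any using (Any; here; there; any?)
import Data.List.Relation.Unary.Any.Properties as Anyₚ
open import Data.List.Relation.Unary.Unique.Propositional.Properties using (allFin⁺; cartesianProduct⁺)
open import Data.Maybe using (Maybe; just; nothing)
open import Data.Nat as ℕ using (ℕ; zero; suc; _<_; _≤_; _∸_; z≤n; s≤s)
open import Data.Nat.DivMod using (_/_; _%_; m/n*n≤m; m≡m%n+[m/n]*n; m%n<n)
open import Data.Nat.Induction using (<-rec)
import Data.Nat.Properties as ℕₚ
open import Data.Nat.Tactic.RingSolver using (solve-∀)
open import Data.Product using (_×_; _,_; ∃; ∃₂; Σ; proj₁; proj₂)
open import Data.Product.Properties using (≡-dec)
open import Data.Sum using (_⊎_; inj₁; inj₂)
open import Data.Unit using (⊤; tt)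
open import Data.Vec as Vec using (Vec; []; _∷_; lookup; _++_; replicate)
import Data.Vec.Properties as Vecₚ
open import Relation.Binary.Definitions using (DecidableEquality; tri<; tri≈; tri>)
open import Relation.Binary.PropositionalEquality as ≡ using (_≡_; _≢_)
import Relation.Binary.Reasoning.Setoid
open import Relation.Binary.Structures using (IsEquivalence)
open import Relation.Nullary using (¬_; Dec; yes; no)
open import Relation.Nullary.Decidable using (decidable-stable; ⌊_⌋; toWitness; fromWitness)

-- The lines used have direction `(1, -ρ, ρ²)`, isotropic for the determinant `x z - y²`. A tangent
-- plane contains at most two such directions, the roots of a quadratic, and at a crossing these
-- roots are the two slopes. This replaces the flecnode polynomial: a crossing kills the remainder
-- of the quartic `second` modulo the quadratic `first`, which is two polynomials of at most four
-- times the degree of the surface. Planes and quadrics can carry as many crossings as there are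
-- pairs of lines, so geometry alone gives no bound. The extra input is `κ`: a line crosses at most
-- `κ` lines of the other family with pairwise different slopes, and at most `κ` with equal slopes.
-- The differential equation forces one of these two cases on all but few crossings of a line. Small
-- characteristic matters twice: a zero derivative must force a constant, and the equation must be
-- integrated. Both need degrees below `p`. Equality in the field is not decidable. The final
-- estimates are inequalities of natural numbers, hence stable, so the argument runs classically
-- under `¬¬`.

-- Classical reasoning under double negation.

infix 3 ¬¬_
¬¬_ : ∀ {a} → Set a → Set a
¬¬ A = ¬ ¬ A

η : ∀ {a} {A : Set a} → A → ¬¬ A
η x k = k x

infixl 1 _>>=_ _>>_
_>>=_ : ∀ {a b} {A : Set a} {B : Set b} → ¬¬ A → (A → ¬¬ B) → ¬¬ B
(m >>= f) k = m (λ x → f x k)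

_>>_ : ∀ {a b} {A : Set a} {B : Set b} → ¬¬ A → ¬¬ B → ¬¬ B
(m >> n) k = m (λ _ → n k)

em : ∀ {a} (P : Set a) → ¬¬ Dec P
em P k = k (no (λ p → k (yes p)))

¬¬-map : ∀ {a b} {A : Set a} {B : Set b} → (A → B) → ¬¬ A → ¬¬ B
¬¬-map f m k = m (λ x → k (f x))

-- The exit from double negation: every estimate that leaves the classical part is an inequality of
-- natural numbers.
≤-stable : ∀ {m n} → ¬¬ (m ≤ n) → m ≤ n
≤-stable {m} {n} = decidable-stable (m ℕ.≤? n)

-- Double negation passes through a universal quantifier over a finite domain. This is how all
-- equalities among finitely many lines are decided at once.
¬¬-Fin : ∀ {a n} {P : Fin n → Set a} → (∀ i → ¬¬ P i) → ¬¬ (∀ i → P i)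
¬¬-Fin {n = zero} h = η (λ ())
¬¬-Fin {n = suc n} h = do
  p ← h zero
  q ← ¬¬-Fin (λ i → h (suc i))
  η (λ { zero → p ; (suc i) → q i })

-- Searches upwards from 0, deciding `P` at each step under `¬¬`. It provides exact degrees and
-- ideal elements of least degree.
¬¬-least : ∀ {a} (P : ℕ → Set a) n → P n → ¬¬ ∃ λ m → P m × (∀ k → k < m → ¬ P k)
¬¬-least P n pn = go n 0 (λ k ()) (≡.subst P (≡.sym (ℕₚ.+-identityʳ n)) pn)
  where
  go : ∀ f m → (∀ k → k < m → ¬ P k) → P (f ℕ.+ m) → ¬¬ ∃ λ m → P m × (∀ k → k < m → ¬ P k)
  go zero m low p = η (m , p , low)
  go (suc f) m low p = do
    no ¬pm ← em (P m)
      where yes pm → η (m , pm , low)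
    go f (suc m)
      (λ { k (s≤s k≤m) pk → case-≤ k k≤m pk ¬pm })
      (≡.subst P (≡.sym (ℕₚ.+-suc f m)) p)
    where
    case-≤ : ∀ k → k ≤ m → P k → ¬ P m → ⊥
    case-≤ k k≤m pk ¬pm with ℕₚ.m≤n⇒m<n∨m≡n k≤m
    ... | inj₁ k<m = low k k<m pk
    ... | inj₂ ≡.refl = ¬pm pk

-- Ring identities, derivations and homomorphisms.

module IntSolver {c ℓ} (R : CommutativeRing c ℓ) where
  open CommutativeRing R
  open Algebra.Properties.Semiring.Mult.TCOptimised semiring using (×-homo-+; ×1-homo-*; 1+×) renaming (_×_ to _×′_)
  open Algebra.Properties.Ring ring using (-0#≈0#; -‿distribˡ-*; -‿distribʳ-*; -‿involutive; -‿+-comm)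
  open Relation.Binary.Reasoning.Setoid setoid

  -- The solver has to compare coefficients. Equality in `R` is not decidable, so the coefficients
  -- are integers, interpreted as multiples of `1#`.
  ⟦_⟧ℤ : ℤ → Carrier
  ⟦ + n ⟧ℤ = n ×′ 1#
  ⟦ -[1+ n ] ⟧ℤ = - (suc n ×′ 1#)

  ⊖-homo : ∀ m n → ⟦ m ⊖ n ⟧ℤ ≈ (m ×′ 1#) + (- (n ×′ 1#))
  ⊖-homo m zero = sym (trans (+-congˡ -0#≈0#) (+-identityʳ _))
  ⊖-homo zero (suc n) = sym (+-identityˡ _)
  ⊖-homo (suc m) (suc n) = begin
    ⟦ suc m ⊖ suc n ⟧ℤ ≡⟨ ≡.cong ⟦_⟧ℤ (ℤₚ.[1+m]⊖[1+n]≡m⊖n m n) ⟩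
    ⟦ m ⊖ n ⟧ℤ ≈⟨ ⊖-homo m n ⟩
    a + - b ≈⟨ +-congʳ (sym (+-identityʳ a)) ⟩
    (a + 0#) + - b ≈⟨ +-congʳ (+-congˡ (sym (-‿inverseʳ 1#))) ⟩
    (a + (1# + - 1#)) + - b ≈⟨ +-congʳ (sym (+-assoc a 1# (- 1#))) ⟩
    ((a + 1#) + - 1#) + - b ≈⟨ +-assoc _ _ _ ⟩
    (a + 1#) + (- 1# + - b) ≈⟨ +-cong (+-comm a 1#) (-‿+-comm 1# b) ⟩
    (1# + a) + - (1# + b) ≈⟨ +-cong (sym (1+× m 1#)) (-‿cong (sym (1+× n 1#))) ⟩
    (suc m ×′ 1#) + - (suc n ×′ 1#) ∎
    where
    a = m ×′ 1#
    b = n ×′ 1#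

  neg-homo : ∀ i → ⟦ ℤ.- i ⟧ℤ ≈ - ⟦ i ⟧ℤ
  neg-homo (+ zero) = sym -0#≈0#
  neg-homo (+ suc n) = refl
  neg-homo -[1+ n ] = sym (-‿involutive _)

  +-homoℤ : ∀ i j → ⟦ i ℤ.+ j ⟧ℤ ≈ ⟦ i ⟧ℤ + ⟦ j ⟧ℤ
  +-homoℤ (+ m) (+ n) = ×-homo-+ 1# m n
  +-homoℤ (+ m) -[1+ n ] = ⊖-homo m (suc n)
  +-homoℤ -[1+ m ] (+ n) = trans (⊖-homo n (suc m)) (+-comm _ _)
  +-homoℤ -[1+ m ] -[1+ n ] = begin
    - (suc (suc (m ℕ.+ n)) ×′ 1#) ≡⟨ ≡.cong (λ k → - (k ×′ 1#)) (≡.cong suc (≡.sym (ℕₚ.+-suc m n))) ⟩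
    - ((suc m ℕ.+ suc n) ×′ 1#) ≈⟨ -‿cong (×-homo-+ 1# (suc m) (suc n)) ⟩
    - ((suc m ×′ 1#) + (suc n ×′ 1#)) ≈⟨ sym (-‿+-comm _ _) ⟩
    - (suc m ×′ 1#) + - (suc n ×′ 1#) ∎

  -- A product of integers is reduced to the case of two naturals by pulling signs out.
  *-homoℤ : ∀ i j → ⟦ i ℤ.* j ⟧ℤ ≈ ⟦ i ⟧ℤ * ⟦ j ⟧ℤ
  *-homoℤ (+ m) (+ n) = trans (reflexive (≡.cong ⟦_⟧ℤ (≡.sym (ℤₚ.pos-* m n)))) (×1-homo-* m n)
  *-homoℤ (+ m) -[1+ n ] = begin
    ⟦ + m ℤ.* -[1+ n ] ⟧ℤ ≡⟨ ≡.cong ⟦_⟧ℤ (≡.sym (ℤₚ.neg-distribʳ-* (+ m) (+ suc n))) ⟩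
    ⟦ ℤ.- (+ m ℤ.* + suc n) ⟧ℤ ≈⟨ neg-homo (+ m ℤ.* + suc n) ⟩
    - ⟦ + m ℤ.* + suc n ⟧ℤ ≈⟨ -‿cong (*-homoℤ (+ m) (+ suc n)) ⟩
    - (⟦ + m ⟧ℤ * ⟦ + suc n ⟧ℤ) ≈⟨ -‿distribʳ-* _ _ ⟩
    ⟦ + m ⟧ℤ * ⟦ -[1+ n ] ⟧ℤ ∎
  *-homoℤ -[1+ m ] (+ n) = begin
    ⟦ -[1+ m ] ℤ.* + n ⟧ℤ ≡⟨ ≡.cong ⟦_⟧ℤ (≡.sym (ℤₚ.neg-distribˡ-* (+ suc m) (+ n))) ⟩
    ⟦ ℤ.- (+ suc m ℤ.* + n) ⟧ℤ ≈⟨ neg-homo (+ suc m ℤ.* + n) ⟩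
    - ⟦ + suc m ℤ.* + n ⟧ℤ ≈⟨ -‿cong (*-homoℤ (+ suc m) (+ n)) ⟩
    - (⟦ + suc m ⟧ℤ * ⟦ + n ⟧ℤ) ≈⟨ -‿distribˡ-* _ _ ⟩
    ⟦ -[1+ m ] ⟧ℤ * ⟦ + n ⟧ℤ ∎
  *-homoℤ -[1+ m ] -[1+ n ] = begin
    ⟦ + suc m ℤ.* + suc n ⟧ℤ ≈⟨ *-homoℤ (+ suc m) (+ suc n) ⟩
    a * b ≈⟨ sym (-‿involutive _) ⟩
    - - (a * b) ≈⟨ -‿cong (-‿distribʳ-* a b) ⟩
    - (a * - b) ≈⟨ -‿distribˡ-* a (- b) ⟩
    - a * - b ∎
    where
    a = ⟦ + suc m ⟧ℤ
    b = ⟦ + suc n ⟧ℤ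

  ℤ-raw : RawRing _ _
  ℤ-raw = record { Carrier = ℤ ; _≈_ = _≡_ ; _+_ = ℤ._+_ ; _*_ = ℤ._*_ ; -_ = ℤ.-_ ; 0# = + 0 ; 1# = + 1 }

  morphism : ℤ-raw ACR.-Raw-AlmostCommutative⟶ ACR.fromCommutativeRing R
  morphism = record
    { ⟦_⟧ = ⟦_⟧ℤ ; +-homo = +-homoℤ ; *-homo = *-homoℤ ; -‿homo = neg-homo ; 0-homo = refl ; 1-homo = refl }

  dec-coeff : ∀ i j → Maybe (⟦ i ⟧ℤ ≈ ⟦ j ⟧ℤ)
  dec-coeff i j with i ℤₚ.≟ j
  ... | yes ≡.refl = just refl
  ... | no _ = nothing

  open Algebra.Solver.Ring ℤ-raw (ACR.fromCommutativeRing R) morphism dec-coeff public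
    using (solve; _:=_; _:+_; _:*_; _:-_; :-_; con; Polynomial)

record Derivation {c ℓ} (R : CommutativeRing c ℓ) : Set (c ⊔ ℓ) where
  open CommutativeRing R
  field
    δ : Carrier → Carrier
    δ-cong : ∀ {a b} → a ≈ b → δ a ≈ δ b
    δ-+ : ∀ a b → δ (a + b) ≈ δ a + δ b
    δ-* : ∀ a b → δ (a * b) ≈ δ a * b + a * δ b

  open IntSolver R
  open Relation.Binary.Reasoning.Setoid setoid

  cancel-double : ∀ {a} → a ≈ a + a → a ≈ 0#
  cancel-double {a} h = begin
    a ≈⟨ solve 1 (λ a → a := (a :+ a) :- a) refl a ⟩
    (a + a) + - a ≈⟨ +-congʳ (sym h) ⟩
    a + - a ≈⟨ -‿inverseʳ a ⟩
    0# ∎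

  δ-0 : δ 0# ≈ 0#
  δ-0 = cancel-double (trans (δ-cong (sym (+-identityʳ 0#))) (δ-+ 0# 0#))

  δ-neg : ∀ a → δ (- a) ≈ - δ a
  δ-neg a = begin
    δ (- a) ≈⟨ solve 2 (λ x y → x := (x :+ y) :- y) refl (δ (- a)) (δ a) ⟩
    (δ (- a) + δ a) + - δ a ≈⟨ +-congʳ (sym (δ-+ (- a) a)) ⟩
    δ (- a + a) + - δ a ≈⟨ +-congʳ (trans (δ-cong (-‿inverseˡ a)) δ-0) ⟩
    0# + - δ a ≈⟨ +-identityˡ _ ⟩
    - δ a ∎

record RingHom {c ℓ c′ ℓ′} (R : CommutativeRing c ℓ) (S : CommutativeRing c′ ℓ′) : Set (c ⊔ ℓ ⊔ c′ ⊔ ℓ′) where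
  private
    module R = CommutativeRing R
    module S = CommutativeRing S
  field
    ap : R.Carrier → S.Carrier
    ap-cong : ∀ {a b} → a R.≈ b → ap a S.≈ ap b
    ap-+ : ∀ a b → ap (a R.+ b) S.≈ ap a S.+ ap b
    ap-* : ∀ a b → ap (a R.* b) S.≈ ap a S.* ap b
    ap-1 : ap R.1# S.≈ S.1#

  open IntSolver S
  open Relation.Binary.Reasoning.Setoid S.setoid

  ap-0 : ap R.0# S.≈ S.0#
  ap-0 = begin
    a ≈⟨ solve 1 (λ a → a := (a :+ a) :- a) S.refl a ⟩
    (a S.+ a) S.+ S.- a ≈⟨ S.+-congʳ (S.trans (S.sym (ap-+ R.0# R.0#)) (ap-cong (R.+-identityʳ R.0#))) ⟩
    a S.+ S.- a ≈⟨ S.-‿inverseʳ a ⟩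
    S.0# ∎
    where a = ap R.0#

  ap-neg : ∀ a → ap (R.- a) S.≈ S.- ap a
  ap-neg a = begin
    ap (R.- a) ≈⟨ solve 2 (λ x y → x := (x :+ y) :- y) S.refl (ap (R.- a)) (ap a) ⟩
    (ap (R.- a) S.+ ap a) S.+ S.- ap a ≈⟨ S.+-congʳ (S.sym (ap-+ (R.- a) a)) ⟩
    ap (R.- a R.+ a) S.+ S.- ap a ≈⟨ S.+-congʳ (S.trans (ap-cong (R.-‿inverseˡ a)) ap-0) ⟩
    S.0# S.+ S.- ap a ≈⟨ S.+-identityˡ _ ⟩
    S.- ap a ∎

_∘ʰ_ : ∀ {c₁ ℓ₁ c₂ ℓ₂ c₃ ℓ₃} {A : CommutativeRing c₁ ℓ₁} {B : CommutativeRing c₂ ℓ₂} {C : CommutativeRing c₃ ℓ₃} →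
       RingHom B C → RingHom A B → RingHom A C
_∘ʰ_ {C = C} g f = record
  { ap = λ a → g.ap (f.ap a)
  ; ap-cong = λ e → g.ap-cong (f.ap-cong e)
  ; ap-+ = λ a b → C.trans (g.ap-cong (f.ap-+ a b)) (g.ap-+ _ _)
  ; ap-* = λ a b → C.trans (g.ap-cong (f.ap-* a b)) (g.ap-* _ _)
  ; ap-1 = C.trans (g.ap-cong f.ap-1) g.ap-1
  }
  where
  module g = RingHom g
  module f = RingHom f
  module C = CommutativeRing C

-- Polynomials in one variable over a commutative ring.

module PolyRing {c ℓ} (R : CommutativeRing c ℓ) where
  open CommutativeRing R
  open Algebra.Properties.Ring ring using (-0#≈0#; -‿distribˡ-*; -‿distribʳ-*; -‿involutive; -‿+-comm)
  private module S = IntSolver R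

  Poly : Set c
  Poly = List Carrier

  coef : Poly → ℕ → Carrier
  coef [] _ = 0#
  coef (a ∷ f) zero = a
  coef (a ∷ f) (suc i) = coef f i

  infix 4 _≋_
  -- Trailing zeros cannot be stripped, since vanishing of a coefficient is not decidable. So
  -- equality is coefficientwise, and the length of a list only bounds the degree.
  record _≋_ (f g : Poly) : Set ℓ where
    constructor mk
    field at : ∀ i → coef f i ≈ coef g i
  open _≋_ public

  infixl 6 _⊕_
  infixl 7 _⊛_
  infixr 7 _∙_

  _⊕_ : Poly → Poly → Poly
  [] ⊕ g = g
  (a ∷ f) ⊕ [] = a ∷ f
  (a ∷ f) ⊕ (b ∷ g) = (a + b) ∷ (f ⊕ g)

  _∙_ : Carrier → Poly → Poly
  a ∙ f = map (a *_) f

  ⊖_ : Poly → Poly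
  ⊖ f = map -_ f

  _⊛_ : Poly → Poly → Poly
  [] ⊛ g = []
  (a ∷ f) ⊛ g = (a ∙ g) ⊕ (0# ∷ (f ⊛ g))

  coef-⊕ : ∀ f g i → coef (f ⊕ g) i ≈ coef f i + coef g i
  coef-⊕ [] g i = sym (+-identityˡ _)
  coef-⊕ (a ∷ f) [] i = sym (+-identityʳ _)
  coef-⊕ (a ∷ f) (b ∷ g) zero = refl
  coef-⊕ (a ∷ f) (b ∷ g) (suc i) = coef-⊕ f g i

  coef-∙ : ∀ a f i → coef (a ∙ f) i ≈ a * coef f i
  coef-∙ a [] i = sym (zeroʳ a)
  coef-∙ a (b ∷ f) zero = refl
  coef-∙ a (b ∷ f) (suc i) = coef-∙ a f i

  coef-⊖ : ∀ f i → coef (⊖ f) i ≈ - coef f i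
  coef-⊖ [] i = sym -0#≈0#
  coef-⊖ (b ∷ f) zero = refl
  coef-⊖ (b ∷ f) (suc i) = coef-⊖ f i

  ≋-isEquivalence : IsEquivalence _≋_
  ≋-isEquivalence = record
    { refl = mk (λ i → refl) ; sym = λ p → mk (λ i → sym (at p i)) ; trans = λ p q → mk (λ i → trans (at p i) (at q i)) }

  ⊕-cong : ∀ {f f′ g g′} → f ≋ f′ → g ≋ g′ → (f ⊕ g) ≋ (f′ ⊕ g′)
  ⊕-cong {f} {f′} {g} {g′} p q = mk λ i → trans (coef-⊕ f g i) (trans (+-cong (at p i) (at q i)) (sym (coef-⊕ f′ g′ i)))

  ⊕-assoc : ∀ f g h → ((f ⊕ g) ⊕ h) ≋ (f ⊕ (g ⊕ h))
  ⊕-assoc f g h = mk λ i → trans (coef-⊕ (f ⊕ g) h i) (trans (+-congʳ (coef-⊕ f g i)) (trans (+-assoc _ _ _)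
    (sym (trans (coef-⊕ f (g ⊕ h) i) (+-congˡ (coef-⊕ g h i))))))

  ⊕-comm : ∀ f g → (f ⊕ g) ≋ (g ⊕ f)
  ⊕-comm f g = mk λ i → trans (coef-⊕ f g i) (trans (+-comm _ _) (sym (coef-⊕ g f i)))

  ⊕-identityʳ : ∀ f → (f ⊕ []) ≋ f
  ⊕-identityʳ f = mk λ i → trans (coef-⊕ f [] i) (+-identityʳ _)

  ⊖-cong : ∀ {f g} → f ≋ g → ⊖ f ≋ ⊖ g
  ⊖-cong {f} {g} p = mk λ i → trans (coef-⊖ f i) (trans (-‿cong (at p i)) (sym (coef-⊖ g i)))

  ⊖-inverseʳ : ∀ f → (f ⊕ (⊖ f)) ≋ []
  ⊖-inverseʳ f = mk λ i → trans (coef-⊕ f (⊖ f) i) (trans (+-congˡ (coef-⊖ f i)) (-‿inverseʳ _))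

  ∙-cong : ∀ {a b f g} → a ≈ b → f ≋ g → a ∙ f ≋ b ∙ g
  ∙-cong {a} {b} {f} {g} e p = mk λ i → trans (coef-∙ a f i) (trans (*-cong e (at p i)) (sym (coef-∙ b g i)))

  ∙-⊕ : ∀ a f g → a ∙ (f ⊕ g) ≋ (a ∙ f) ⊕ (a ∙ g)
  ∙-⊕ a f g = mk λ i → trans (coef-∙ a (f ⊕ g) i) (trans (*-congˡ (coef-⊕ f g i)) (trans (distribˡ _ _ _)
    (sym (trans (coef-⊕ (a ∙ f) (a ∙ g) i) (+-cong (coef-∙ a f i) (coef-∙ a g i))))))

  ∙-∙ : ∀ a b f → a ∙ (b ∙ f) ≋ (a * b) ∙ f
  ∙-∙ a b f = mk λ i → trans (coef-∙ a (b ∙ f) i) (trans (*-congˡ (coef-∙ b f i)) (trans (sym (*-assoc _ _ _)) (sym (coef-∙ (a * b) f i))))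

  0∙ : ∀ f → 0# ∙ f ≋ []
  0∙ f = mk λ i → trans (coef-∙ 0# f i) (zeroˡ _)

  1∙ : ∀ f → 1# ∙ f ≋ f
  1∙ f = mk λ i → trans (coef-∙ 1# f i) (*-identityˡ _)

  ∷-cong : ∀ {a b f g} → a ≈ b → f ≋ g → (a ∷ f) ≋ (b ∷ g)
  ∷-cong e p = mk λ { zero → e ; (suc i) → at p i }

  tail-≋ : ∀ {a b f g} → (a ∷ f) ≋ (b ∷ g) → f ≋ g
  tail-≋ p = mk λ i → at p (suc i)

  tail-≋0 : ∀ {a f} → (a ∷ f) ≋ [] → f ≋ []
  tail-≋0 p = mk λ i → at p (suc i)

  0∷-≋ : ∀ {f} → f ≋ [] → (0# ∷ f) ≋ []
  0∷-≋ p = mk λ { zero → refl ; (suc i) → at p i }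

  shift-⊕ : ∀ f g → (0# ∷ (f ⊕ g)) ≋ ((0# ∷ f) ⊕ (0# ∷ g))
  shift-⊕ f g = ∷-cong (sym (+-identityˡ 0#)) (mk λ i → refl)

  +-abelian : AbelianGroup c ℓ
  +-abelian = record
    { Carrier = Poly ; _≈_ = _≋_ ; _∙_ = _⊕_ ; ε = [] ; _⁻¹ = ⊖_
    ; isAbelianGroup = record
      { isGroup = record
        { isMonoid = record
          { isSemigroup = record
            { isMagma = record { isEquivalence = ≋-isEquivalence ; ∙-cong = ⊕-cong }
            ; assoc = ⊕-assoc }
          ; identity = (λ f → IsEquivalence.refl ≋-isEquivalence) , ⊕-identityʳ }
        ; inverse = (λ f → IsEquivalence.trans ≋-isEquivalence (⊕-comm (⊖ f) f) (⊖-inverseʳ f)) , ⊖-inverseʳ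
        ; ⁻¹-cong = ⊖-cong }
      ; comm = ⊕-comm } }

  private module A = AbelianGroup +-abelian
  open Relation.Binary.Reasoning.Setoid A.setoid

  interchange : ∀ f g h k → ((f ⊕ g) ⊕ (h ⊕ k)) ≋ ((f ⊕ h) ⊕ (g ⊕ k))
  interchange f g h k = mk λ i → trans (trans (coef-⊕ (f ⊕ g) (h ⊕ k) i) (+-cong (coef-⊕ f g i) (coef-⊕ h k i)))
    (trans (S.solve 4 (λ f g h k → (f S.:+ g) S.:+ (h S.:+ k) S.:= (f S.:+ h) S.:+ (g S.:+ k)) refl _ _ _ _)
    (sym (trans (coef-⊕ (f ⊕ h) (g ⊕ k) i) (+-cong (coef-⊕ f h i) (coef-⊕ g k i)))))

  ⊕-congˡ : ∀ f {g h} → g ≋ h → f ⊕ g ≋ f ⊕ h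
  ⊕-congˡ f {g} {h} p = ⊕-cong (A.refl {f}) p

  ⊕-congʳ : ∀ f {g h} → g ≋ h → g ⊕ f ≋ h ⊕ f
  ⊕-congʳ f {g} {h} p = ⊕-cong p (A.refl {f})

  ⊛-congʳ : ∀ f {g h} → g ≋ h → f ⊛ g ≋ f ⊛ h
  ⊛-congʳ [] p = A.refl
  ⊛-congʳ (a ∷ f) p = ⊕-cong (∙-cong refl p) (∷-cong refl (⊛-congʳ f p))

  ⊛-zeroʳ : ∀ f → f ⊛ [] ≋ []
  ⊛-zeroʳ [] = A.refl
  ⊛-zeroʳ (a ∷ f) = 0∷-≋ (⊛-zeroʳ f)

  -- The product is defined by recursion on the left factor; this is the mirror recursion, from
  -- which commutativity follows.
  ⊛-∷ : ∀ f b g → f ⊛ (b ∷ g) ≋ (b ∙ f) ⊕ (0# ∷ (f ⊛ g))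
  ⊛-∷ [] b g = A.sym (0∷-≋ A.refl)
  ⊛-∷ (a ∷ f) b g = ∷-cong (+-cong (*-comm a b) refl) (begin
    (a ∙ g) ⊕ (f ⊛ (b ∷ g)) ≈⟨ ⊕-cong A.refl (⊛-∷ f b g) ⟩
    (a ∙ g) ⊕ ((b ∙ f) ⊕ (0# ∷ (f ⊛ g))) ≈⟨ A.sym (⊕-assoc (a ∙ g) (b ∙ f) _) ⟩
    ((a ∙ g) ⊕ (b ∙ f)) ⊕ (0# ∷ (f ⊛ g)) ≈⟨ ⊕-cong (⊕-comm (a ∙ g) (b ∙ f)) A.refl ⟩
    ((b ∙ f) ⊕ (a ∙ g)) ⊕ (0# ∷ (f ⊛ g)) ≈⟨ ⊕-assoc (b ∙ f) (a ∙ g) _ ⟩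
    (b ∙ f) ⊕ ((a ∙ g) ⊕ (0# ∷ (f ⊛ g))) ∎)

  ⊛-comm : ∀ f g → f ⊛ g ≋ g ⊛ f
  ⊛-comm [] g = A.sym (⊛-zeroʳ g)
  ⊛-comm (a ∷ f) g = A.trans (⊕-cong A.refl (∷-cong refl (⊛-comm f g))) (A.sym (⊛-∷ g a f))

  ⊛-cong : ∀ {f f′ g g′} → f ≋ f′ → g ≋ g′ → f ⊛ g ≋ f′ ⊛ g′
  ⊛-cong {f} {f′} {g} {g′} p q = A.trans (⊛-congʳ f q) (A.trans (⊛-comm f g′) (A.trans (⊛-congʳ g′ p) (⊛-comm g′ f′)))

  ⊛-distribˡ : ∀ f g h → f ⊛ (g ⊕ h) ≋ (f ⊛ g) ⊕ (f ⊛ h)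
  ⊛-distribˡ [] g h = A.refl
  ⊛-distribˡ (a ∷ f) g h = begin
    (a ∙ (g ⊕ h)) ⊕ (0# ∷ (f ⊛ (g ⊕ h))) ≈⟨ ⊕-cong (∙-⊕ a g h) (A.trans (∷-cong refl (⊛-distribˡ f g h)) (shift-⊕ (f ⊛ g) (f ⊛ h))) ⟩
    ((a ∙ g) ⊕ (a ∙ h)) ⊕ ((0# ∷ (f ⊛ g)) ⊕ (0# ∷ (f ⊛ h))) ≈⟨ interchange (a ∙ g) (a ∙ h) _ _ ⟩
    ((a ∙ g) ⊕ (0# ∷ (f ⊛ g))) ⊕ ((a ∙ h) ⊕ (0# ∷ (f ⊛ h))) ∎

  ⊛-distribʳ : ∀ f g h → (g ⊕ h) ⊛ f ≋ (g ⊛ f) ⊕ (h ⊛ f)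
  ⊛-distribʳ f g h = A.trans (⊛-comm (g ⊕ h) f) (A.trans (⊛-distribˡ f g h) (⊕-cong (⊛-comm f g) (⊛-comm f h)))

  ∙-⊛ : ∀ a f g → (a ∙ f) ⊛ g ≋ a ∙ (f ⊛ g)
  ∙-⊛ a [] g = A.refl
  ∙-⊛ a (b ∷ f) g = A.sym (begin
    a ∙ ((b ∙ g) ⊕ (0# ∷ (f ⊛ g))) ≈⟨ ∙-⊕ a (b ∙ g) _ ⟩
    (a ∙ (b ∙ g)) ⊕ ((a * 0#) ∷ (a ∙ (f ⊛ g))) ≈⟨ ⊕-cong (∙-∙ a b g) (∷-cong (zeroʳ a) (A.sym (∙-⊛ a f g))) ⟩
    ((a * b) ∙ g) ⊕ (0# ∷ ((a ∙ f) ⊛ g)) ∎)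

  0∷-⊛ : ∀ f g → (0# ∷ f) ⊛ g ≋ (0# ∷ (f ⊛ g))
  0∷-⊛ f g = ⊕-cong (0∙ g) A.refl

  ⊛-assoc : ∀ f g h → (f ⊛ g) ⊛ h ≋ f ⊛ (g ⊛ h)
  ⊛-assoc [] g h = A.refl
  ⊛-assoc (a ∷ f) g h = begin
    ((a ∙ g) ⊕ (0# ∷ (f ⊛ g))) ⊛ h ≈⟨ ⊛-distribʳ h (a ∙ g) _ ⟩
    ((a ∙ g) ⊛ h) ⊕ ((0# ∷ (f ⊛ g)) ⊛ h) ≈⟨ ⊕-cong (∙-⊛ a g h) (A.trans (0∷-⊛ (f ⊛ g) h) (∷-cong refl (⊛-assoc f g h))) ⟩
    (a ∙ (g ⊛ h)) ⊕ (0# ∷ (f ⊛ (g ⊛ h))) ∎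

  const : Carrier → Poly
  const a = a ∷ []

  const-⊛ : ∀ a f → const a ⊛ f ≋ a ∙ f
  const-⊛ a f = A.trans (⊕-cong A.refl (0∷-≋ A.refl)) (⊕-identityʳ _)

  ⊛-identityˡ : ∀ f → const 1# ⊛ f ≋ f
  ⊛-identityˡ f = A.trans (const-⊛ 1# f) (1∙ f)

  polyRing : CommutativeRing c ℓ
  polyRing = record
    { Carrier = Poly ; _≈_ = _≋_ ; _+_ = _⊕_ ; _*_ = _⊛_ ; -_ = ⊖_ ; 0# = [] ; 1# = const 1#
    ; isCommutativeRing = record
      { isRing = record
        { +-isAbelianGroup = A.isAbelianGroup
        ; *-cong = ⊛-cong
        ; *-assoc = ⊛-assoc
        ; *-identity = ⊛-identityˡ , λ f → A.trans (⊛-comm f _) (⊛-identityˡ f)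
        ; distrib = ⊛-distribˡ , ⊛-distribʳ }
      ; *-comm = ⊛-comm } }

  constHom : RingHom R polyRing
  constHom = record
    { ap = const
    ; ap-cong = λ e → ∷-cong e A.refl
    ; ap-+ = λ a b → A.refl
    ; ap-* = λ a b → A.sym (const-⊛ a (const b))
    ; ap-1 = A.refl }

  const-0 : const 0# ≋ []
  const-0 = 0∷-≋ A.refl

  const-cong⁻¹ : ∀ {a b} → const a ≋ const b → a ≈ b
  const-cong⁻¹ p = at p 0

  X⊛ : ∀ f → (0# ∷ const 1#) ⊛ f ≋ (0# ∷ f)
  X⊛ f = A.trans (0∷-⊛ (const 1#) f) (∷-cong refl (⊛-identityˡ f))

  module Eval (r : Carrier) where
    module E = Relation.Binary.Reasoning.Setoid setoid

    eval : Poly → Carrier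
    eval [] = 0#
    eval (a ∷ f) = a + r * eval f

    eval-≋0 : ∀ f → f ≋ [] → eval f ≈ 0#
    eval-≋0 [] p = refl
    eval-≋0 (a ∷ f) p = trans (+-cong (at p 0) (trans (*-congˡ (eval-≋0 f (tail-≋0 p))) (zeroʳ r))) (+-identityˡ 0#)

    eval-cong : ∀ {f g} → f ≋ g → eval f ≈ eval g
    eval-cong {[]} {g} p = sym (eval-≋0 g (A.sym p))
    eval-cong {a ∷ f} {[]} p = eval-≋0 (a ∷ f) p
    eval-cong {a ∷ f} {b ∷ g} p = +-cong (at p 0) (*-congˡ (eval-cong (tail-≋ p)))

    eval-⊕ : ∀ f g → eval (f ⊕ g) ≈ eval f + eval g
    eval-⊕ [] g = sym (+-identityˡ _)
    eval-⊕ (a ∷ f) [] = sym (+-identityʳ _)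
    eval-⊕ (a ∷ f) (b ∷ g) = trans (+-congˡ (*-congˡ (eval-⊕ f g)))
      (S.solve 5 (λ a b r x y → (a S.:+ b) S.:+ r S.:* (x S.:+ y) S.:= (a S.:+ r S.:* x) S.:+ (b S.:+ r S.:* y)) refl a b r _ _)

    eval-∙ : ∀ a f → eval (a ∙ f) ≈ a * eval f
    eval-∙ a [] = sym (zeroʳ a)
    eval-∙ a (b ∷ f) = trans (+-congˡ (*-congˡ (eval-∙ a f)))
      (S.solve 4 (λ a b r x → a S.:* b S.:+ r S.:* (a S.:* x) S.:= a S.:* (b S.:+ r S.:* x)) refl a b r _)

    eval-⊛ : ∀ f g → eval (f ⊛ g) ≈ eval f * eval g
    eval-⊛ [] g = sym (zeroˡ _)
    eval-⊛ (a ∷ f) g = trans (eval-⊕ (a ∙ g) _) (trans (+-cong (eval-∙ a g) (trans (+-identityˡ _) (*-congˡ (eval-⊛ f g))))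
      (S.solve 4 (λ a r x y → a S.:* y S.:+ r S.:* (x S.:* y) S.:= (a S.:+ r S.:* x) S.:* y) refl a r _ _))

    eval-const : ∀ a → eval (const a) ≈ a
    eval-const a = trans (+-congˡ (zeroʳ r)) (+-identityʳ a)

    evalHom : RingHom polyRing R
    evalHom = record { ap = eval ; ap-cong = λ {f} {g} p → eval-cong {f} {g} p ; ap-+ = eval-⊕ ; ap-* = eval-⊛ ; ap-1 = eval-const 1# }

  open Eval public using (eval; evalHom; eval-const)

  -- Leibniz applied to `a + X f`, whose derivative is `f + X f′`.
  deriv : Poly → Poly
  deriv [] = []
  deriv (a ∷ f) = f ⊕ (0# ∷ deriv f)

  deriv-≋0 : ∀ f → f ≋ [] → deriv f ≋ []
  deriv-≋0 [] p = A.refl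
  deriv-≋0 (a ∷ f) p = A.trans (⊕-cong (tail-≋0 p) (0∷-≋ (deriv-≋0 f (tail-≋0 p)))) A.refl

  deriv-cong : ∀ {f g} → f ≋ g → deriv f ≋ deriv g
  deriv-cong {[]} {g} p = A.sym (deriv-≋0 g (A.sym p))
  deriv-cong {a ∷ f} {[]} p = deriv-≋0 (a ∷ f) p
  deriv-cong {a ∷ f} {b ∷ g} p = ⊕-cong (tail-≋ p) (∷-cong refl (deriv-cong (tail-≋ p)))

  deriv-⊕ : ∀ f g → deriv (f ⊕ g) ≋ deriv f ⊕ deriv g
  deriv-⊕ [] g = A.refl
  deriv-⊕ (a ∷ f) [] = A.sym (⊕-identityʳ _)
  deriv-⊕ (a ∷ f) (b ∷ g) = begin
    (f ⊕ g) ⊕ (0# ∷ deriv (f ⊕ g)) ≈⟨ ⊕-cong A.refl (A.trans (∷-cong refl (deriv-⊕ f g)) (shift-⊕ (deriv f) (deriv g))) ⟩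
    (f ⊕ g) ⊕ ((0# ∷ deriv f) ⊕ (0# ∷ deriv g)) ≈⟨ interchange f g _ _ ⟩
    (f ⊕ (0# ∷ deriv f)) ⊕ (g ⊕ (0# ∷ deriv g)) ∎

  deriv-∙ : ∀ a f → deriv (a ∙ f) ≋ a ∙ deriv f
  deriv-∙ a [] = A.refl
  deriv-∙ a (b ∷ f) = A.sym (A.trans (∙-⊕ a f _) (⊕-cong A.refl (∷-cong (zeroʳ a) (A.sym (deriv-∙ a f)))))

  deriv-⊛ : ∀ f g → deriv (f ⊛ g) ≋ (deriv f ⊛ g) ⊕ (f ⊛ deriv g)
  deriv-⊛ [] g = A.refl
  deriv-⊛ (a ∷ f) g = begin
    deriv ((a ∙ g) ⊕ (0# ∷ (f ⊛ g))) ≈⟨ deriv-⊕ (a ∙ g) _ ⟩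
    deriv (a ∙ g) ⊕ ((f ⊛ g) ⊕ (0# ∷ deriv (f ⊛ g))) ≈⟨ ⊕-cong (deriv-∙ a g) (⊕-congˡ (f ⊛ g) (A.trans (∷-cong refl (deriv-⊛ f g)) (shift-⊕ (deriv f ⊛ g) (f ⊛ deriv g)))) ⟩
    (a ∙ deriv g) ⊕ ((f ⊛ g) ⊕ (P ⊕ Q)) ≈⟨ ⊕-congˡ (a ∙ deriv g) (A.sym (⊕-assoc (f ⊛ g) P Q)) ⟩
    (a ∙ deriv g) ⊕ (((f ⊛ g) ⊕ P) ⊕ Q) ≈⟨ A.sym (⊕-assoc (a ∙ deriv g) ((f ⊛ g) ⊕ P) Q) ⟩
    ((a ∙ deriv g) ⊕ ((f ⊛ g) ⊕ P)) ⊕ Q ≈⟨ ⊕-congʳ Q (⊕-comm (a ∙ deriv g) _) ⟩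
    (((f ⊛ g) ⊕ P) ⊕ (a ∙ deriv g)) ⊕ Q ≈⟨ ⊕-assoc ((f ⊛ g) ⊕ P) (a ∙ deriv g) Q ⟩
    ((f ⊛ g) ⊕ P) ⊕ ((a ∙ deriv g) ⊕ Q) ≈⟨ ⊕-congʳ ((a ∙ deriv g) ⊕ Q) (A.sym (A.trans (⊛-distribʳ g f _) (⊕-congˡ (f ⊛ g) (0∷-⊛ (deriv f) g)))) ⟩
    ((f ⊕ (0# ∷ deriv f)) ⊛ g) ⊕ ((a ∷ f) ⊛ deriv g) ∎
    where
    P = 0# ∷ (deriv f ⊛ g)
    Q = 0# ∷ (f ⊛ deriv g)

  derivation : Derivation polyRing
  derivation = record { δ = deriv ; δ-cong = λ {f} {g} → deriv-cong {f} {g} ; δ-+ = deriv-⊕ ; δ-* = deriv-⊛ }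

  module LiftDerivation (D : Derivation R) where
    open Derivation D

    mapδ : Poly → Poly
    mapδ = map δ

    coef-mapδ : ∀ f i → coef (mapδ f) i ≈ δ (coef f i)
    coef-mapδ [] i = sym δ-0
    coef-mapδ (a ∷ f) zero = refl
    coef-mapδ (a ∷ f) (suc i) = coef-mapδ f i

    mapδ-cong : ∀ {f g} → f ≋ g → mapδ f ≋ mapδ g
    mapδ-cong {f} {g} p = mk λ i → trans (coef-mapδ f i) (trans (δ-cong (at p i)) (sym (coef-mapδ g i)))

    mapδ-⊕ : ∀ f g → mapδ (f ⊕ g) ≋ mapδ f ⊕ mapδ g
    mapδ-⊕ f g = mk λ i → trans (coef-mapδ (f ⊕ g) i) (trans (δ-cong (coef-⊕ f g i)) (trans (δ-+ _ _)
      (sym (trans (coef-⊕ (mapδ f) (mapδ g) i) (+-cong (coef-mapδ f i) (coef-mapδ g i))))))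

    mapδ-∙ : ∀ a f → mapδ (a ∙ f) ≋ (δ a ∙ f) ⊕ (a ∙ mapδ f)
    mapδ-∙ a f = mk λ i → trans (coef-mapδ (a ∙ f) i) (trans (δ-cong (coef-∙ a f i)) (trans (δ-* _ _)
      (sym (trans (coef-⊕ (δ a ∙ f) (a ∙ mapδ f) i) (+-cong (coef-∙ (δ a) f i) (trans (coef-∙ a (mapδ f) i) (*-congˡ (coef-mapδ f i))))))))

    mapδ-⊛ : ∀ f g → mapδ (f ⊛ g) ≋ (mapδ f ⊛ g) ⊕ (f ⊛ mapδ g)
    mapδ-⊛ [] g = A.refl
    mapδ-⊛ (a ∷ f) g = begin
      mapδ ((a ∙ g) ⊕ (0# ∷ (f ⊛ g))) ≈⟨ mapδ-⊕ (a ∙ g) _ ⟩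
      mapδ (a ∙ g) ⊕ (δ 0# ∷ mapδ (f ⊛ g)) ≈⟨ ⊕-cong (mapδ-∙ a g) (A.trans (∷-cong δ-0 (mapδ-⊛ f g)) (shift-⊕ (mapδ f ⊛ g) (f ⊛ mapδ g))) ⟩
      ((δ a ∙ g) ⊕ (a ∙ mapδ g)) ⊕ ((0# ∷ (mapδ f ⊛ g)) ⊕ (0# ∷ (f ⊛ mapδ g))) ≈⟨ interchange (δ a ∙ g) _ _ _ ⟩
      ((δ a ∙ g) ⊕ (0# ∷ (mapδ f ⊛ g))) ⊕ ((a ∙ mapδ g) ⊕ (0# ∷ (f ⊛ mapδ g))) ∎

    coefficientwise : Derivation polyRing
    coefficientwise = record { δ = mapδ ; δ-cong = mapδ-cong ; δ-+ = mapδ-⊕ ; δ-* = mapδ-⊛ }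

    deriv-mapδ : ∀ f → deriv (mapδ f) ≋ mapδ (deriv f)
    deriv-mapδ [] = A.refl
    deriv-mapδ (a ∷ f) = A.sym (A.trans (mapδ-⊕ f _) (⊕-cong A.refl (∷-cong δ-0 (A.sym (deriv-mapδ f)))))

    -- One term differentiates the coefficients, the other the point of evaluation. It is used to
    -- differentiate the restriction of a polynomial to a line.
    chain-rule : ∀ r f → δ (eval r f) ≈ eval r (mapδ f) + δ r * eval r (deriv f)
    chain-rule r [] = trans δ-0 (sym (trans (+-congˡ (zeroʳ _)) (+-identityʳ _)))
    chain-rule r (a ∷ f) = trans (δ-+ _ _) (trans (+-congˡ (trans (δ-* _ _) (+-congˡ (*-congˡ (chain-rule r f)))))
      (trans (S.solve 6 (λ da dr e r m d → da S.:+ (dr S.:* e S.:+ r S.:* (m S.:+ dr S.:* d)) S.:= (da S.:+ r S.:* m) S.:+ dr S.:* (e S.:+ (con0 S.:+ r S.:* d))) refl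
        (δ a) (δ r) (eval r f) r (eval r (mapδ f)) (eval r (deriv f)))
      (+-congˡ (*-congˡ (sym (Eval.eval-⊕ r f _))))))
      where con0 = S.con (+ 0)

-- Divisibility and factorisation in domains with a degree.

module Divisibility {c ℓ} (R : CommutativeRing c ℓ) where
  open CommutativeRing R

  Unit : Carrier → Set (c ⊔ ℓ)
  Unit a = ∃ λ b → a * b ≈ 1#

  infix 4 _∣_
  _∣_ : Carrier → Carrier → Set (c ⊔ ℓ)
  a ∣ b = ∃ λ q → b ≈ a * q

  record Irreducible (a : Carrier) : Set (c ⊔ ℓ) where
    field
      nonzero : ¬ (a ≈ 0#)
      nonunit : ¬ Unit a
      split : ∀ b d → a ≈ b * d → ¬¬ (Unit b ⊎ Unit d)

  record Prime (a : Carrier) : Set (c ⊔ ℓ) where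
    field
      nonzero : ¬ (a ≈ 0#)
      nonunit : ¬ Unit a
      prime : ∀ b d → a ∣ b * d → ¬¬ (a ∣ b ⊎ a ∣ d)

  prime-cong : ∀ {a b} → a ≈ b → Prime a → Prime b
  prime-cong e p = record
    { nonzero = λ z → P.nonzero (trans e z)
    ; nonunit = λ { (u , eu) → P.nonunit (u , trans (*-congʳ e) eu) }
    ; prime = λ { x y (q , eq) → ¬¬-map
        (λ { (inj₁ (k , ek)) → inj₁ (k , trans ek (*-congʳ e)) ; (inj₂ (k , ek)) → inj₂ (k , trans ek (*-congʳ e)) })
        (P.prime x y (q , trans eq (*-congʳ (sym e)))) } }
    where
    module P = Prime p

-- A domain with a degree function, presented by the filtration Lt n a, "a has degree less than n";
-- Lt-* says degrees are subadditive and exact that they are superadditive.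
record GradedDomain (c ℓ : Level) : Set (lsuc (c ⊔ ℓ)) where
  field
    ring : CommutativeRing c ℓ
  open CommutativeRing ring using (Carrier; _≈_; _+_; _*_; -_; 0#; 1#)
  open Divisibility ring
  field
    stable : ∀ {a b} → ¬¬ (a ≈ b) → a ≈ b
    Lt : ℕ → Carrier → Set ℓ
    Lt-cong : ∀ {n a b} → a ≈ b → Lt n a → Lt n b
    Lt-stable : ∀ {n a} → ¬¬ Lt n a → Lt n a
    Lt-zero : ∀ {a} → Lt 0 a → a ≈ 0#
    0-Lt : ∀ n → Lt n 0#
    1-Lt : Lt 1 1#
    Lt-mono : ∀ {m n a} → m ≤ n → Lt m a → Lt n a
    Lt-+ : ∀ {n a b} → Lt n a → Lt n b → Lt n (a + b)
    Lt-neg : ∀ {n a} → Lt n a → Lt n (- a)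
    Lt-* : ∀ {m n k a b} → Lt m a → Lt n b → m ℕ.+ n ≤ suc k → Lt k (a * b)
    exact : ∀ {m n a b} → ¬ Lt m a → ¬ Lt n b → ¬ Lt (m ℕ.+ n) (a * b)
    unit : ∀ {a} → Lt 1 a → ¬ (a ≈ 0#) → Unit a
    finite : ∀ a → ∃ λ n → Lt n a
    1≉0 : ¬ (1# ≈ 0#)
    -- Unique factorisation is part of the structure because polynomial rings inherit it by Gauss's
    -- lemma, one variable at a time.
    irreducible⇒prime : ∀ {a} → Irreducible a → Prime a

module GradedDomainProps {c ℓ} (G : GradedDomain c ℓ) where
  open GradedDomain G
  open CommutativeRing ring hiding (ring)
  open Divisibility ring public
  open Relation.Binary.Reasoning.Setoid setoid
  private module S = IntSolver ring
  open S using (_:=_; _:+_; _:*_; _:-_)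

  nonzero-Lt : ∀ {a} → ¬ (a ≈ 0#) → ¬ Lt 0 a
  nonzero-Lt h z = h (Lt-zero z)

  *-nonzero : ∀ {a b} → ¬ (a ≈ 0#) → ¬ (b ≈ 0#) → ¬ (a * b ≈ 0#)
  *-nonzero p q z = exact (nonzero-Lt p) (nonzero-Lt q) (Lt-cong (sym z) (0-Lt 0))

  cancel-zero : ∀ {a b} → ¬ (a ≈ 0#) → a * b ≈ 0# → b ≈ 0#
  cancel-zero p z = stable (λ q → *-nonzero p q z)

  cancel : ∀ {a b d} → ¬ (a ≈ 0#) → a * b ≈ a * d → b ≈ d
  cancel {a} {b} {d} p e = begin
    b ≈⟨ S.solve 2 (λ b d → b := d :+ (b :- d)) refl b d ⟩
    d + (b + - d) ≈⟨ +-congˡ (cancel-zero p (trans (S.solve 3 (λ a b d → a :* (b :- d) := a :* b :- a :* d) refl a b d)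
                       (trans (+-congʳ e) (-‿inverseʳ _)))) ⟩
    d + 0# ≈⟨ +-identityʳ d ⟩
    d ∎

  exact-degree : ∀ {a} → ¬ (a ≈ 0#) → ¬¬ ∃ λ d → Lt (suc d) a × ¬ Lt d a
  exact-degree {a} h = do
    zero , z , _ ← ¬¬-least (λ n → Lt n a) _ (proj₂ (finite a))
      where suc d , p , low → η (d , p , low d ℕₚ.≤-refl)
    ⊥-elim (h (Lt-zero z))

  -- Nonzero elements of degree 0 are units, so a nonzero nonunit has degree at least 1 and removing
  -- it lowers the degree.
  factor-Lt : ∀ {d a b} → ¬ Unit a → ¬ (a ≈ 0#) → Lt (suc d) (a * b) → Lt d b
  factor-Lt {d} na a≉0 h = Lt-stable λ k → exact {1} {d} (λ l → na (unit l a≉0)) k h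

  -- Induction on the degree: an element that splits into two nonunits has a factor of smaller
  -- degree, and one that does not is irreducible, hence prime.
  prime-factor : ∀ d a → Lt d a → ¬ (a ≈ 0#) → ¬ Unit a → ¬¬ ∃₂ λ q b → Prime q × a ≈ q * b
  prime-factor zero a l h nu = ⊥-elim (h (Lt-zero l))
  prime-factor (suc d) a l h nu = do
    no ¬split ← em (∃₂ λ b e → a ≈ b * e × ¬ Unit b × ¬ Unit e)
      where
      yes (b , e , eq , nb , ne) → do
        let b≉0 = λ z → h (trans eq (trans (*-congʳ z) (zeroˡ e)))
            e≉0 = λ z → h (trans eq (trans (*-congˡ z) (zeroʳ b)))
        q , b′ , pq , eb ← prime-factor d b (factor-Lt {d} {e} {b} ne e≉0 (Lt-cong (trans eq (*-comm b e)) l)) b≉0 nb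
        η (q , b′ * e , pq , trans eq (trans (*-congʳ eb) (*-assoc q b′ e)))
    η (a , 1# , irreducible⇒prime (record
      { nonzero = h ; nonunit = nu
      ; split = λ b e eq → do
          no nb ← em (Unit b)
            where yes ub → η (inj₁ ub)
          no ne ← em (Unit e)
            where yes ue → η (inj₂ ue)
          ⊥-elim (¬split (b , e , eq , nb , ne)) }) , sym (*-identityʳ a))

  -- Induction along a factorisation into primes. Its purpose is to cancel a nonzero constant from
  -- an identity between polynomials, one prime factor of the constant at a time.
  prime-induction : ∀ {p} (P : Carrier → Set p) → (∀ {a b} → a ≈ b → P a → P b) →
    (∀ u → Unit u → P u) → (∀ q b → Prime q → ¬ (b ≈ 0#) → P b → ¬¬ P (q * b)) →
    ∀ a → ¬ (a ≈ 0#) → ¬¬ P a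
  prime-induction P resp base step a = go (proj₁ (finite a)) a (proj₂ (finite a))
    where
    go : ∀ d a → Lt d a → ¬ (a ≈ 0#) → ¬¬ P a
    go zero a l h = ⊥-elim (h (Lt-zero l))
    go (suc d) a l h = do
      no nu ← em (Unit a)
        where yes u → η (base a u)
      q , b , pq , e ← prime-factor (suc d) a l h nu
      let b≉0 = λ z → h (trans e (trans (*-congˡ z) (zeroʳ q)))
      pb ← go d b (factor-Lt (Prime.nonunit pq) (Prime.nonzero pq) (Lt-cong e l)) b≉0
      ¬¬-map (resp (sym e)) (step q b pq b≉0 pb)

-- Total degree on a polynomial ring.

module PolyGraded {c ℓ} (G : GradedDomain c ℓ) where
  open GradedDomain G
  open GradedDomainProps G
  open CommutativeRing ring hiding (ring)
  open PolyRing ring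
  open Algebra.Properties.Ring (CommutativeRing.ring ring) using (-0#≈0#)
  private
    module S = IntSolver ring
    module P = CommutativeRing polyRing
    module D = Divisibility polyRing
    module SP = IntSolver polyRing
  module C = RingHom constHom

  -- Total degree with `X` of degree 1: the coefficient of index `i` must have degree below `n - i`.
  -- The extra variable `j` replaces the subtraction; `j = 0` makes the coefficients of index at
  -- least `n` vanish.
  record LtP (n : ℕ) (f : Poly) : Set ℓ where
    constructor mkLt
    field lt : ∀ i j → n ≤ i ℕ.+ j → Lt j (coef f i)
  open LtP public

  stableP : ∀ {f g} → ¬¬ (f ≋ g) → f ≋ g
  stableP h = mk λ i → stable (¬¬-map (λ p → at p i) h)

  LtP-cong : ∀ {n f g} → f ≋ g → LtP n f → LtP n g
  LtP-cong p l = mkLt λ i j h → Lt-cong (at p i) (lt l i j h)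

  LtP-stable : ∀ {n f} → ¬¬ LtP n f → LtP n f
  LtP-stable h = mkLt λ i j n≤ → Lt-stable (¬¬-map (λ l → lt l i j n≤) h)

  LtP-zero : ∀ {f} → LtP 0 f → f ≋ []
  LtP-zero l = mk λ i → Lt-zero (lt l i 0 z≤n)

  LtP-[] : ∀ n → LtP n []
  LtP-[] n = mkLt λ i j _ → 0-Lt j

  LtP-mono : ∀ {m n f} → m ≤ n → LtP m f → LtP n f
  LtP-mono m≤n l = mkLt λ i j h → lt l i j (ℕₚ.≤-trans m≤n h)

  LtP-⊕ : ∀ {n f g} → LtP n f → LtP n g → LtP n (f ⊕ g)
  LtP-⊕ {n} {f} {g} p q = mkLt λ i j h → Lt-cong (sym (coef-⊕ f g i)) (Lt-+ (lt p i j h) (lt q i j h))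

  LtP-⊖ : ∀ {n f} → LtP n f → LtP n (⊖ f)
  LtP-⊖ {n} {f} p = mkLt λ i j h → Lt-cong (sym (coef-⊖ f i)) (Lt-neg (lt p i j h))

  LtP-const : ∀ {n a} → Lt n a → LtP n (const a)
  LtP-const l = mkLt λ { zero j h → Lt-mono h l ; (suc i) j h → 0-Lt j }

  LtP-shift : ∀ {n f} → LtP n f → LtP (suc n) (0# ∷ f)
  LtP-shift l = mkLt λ { zero j h → 0-Lt j ; (suc i) j (s≤s h) → lt l i j h }

  LtP-tail : ∀ {n a f} → LtP (suc n) (a ∷ f) → LtP n f
  LtP-tail l = mkLt λ i j h → lt l (suc i) j (s≤s h)

  -- Here `b` is the coefficient of index `k` in a polynomial of degree below `n`. It is zero if
  -- `n ≤ k` and has degree below `n - k` otherwise.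
  scale-Lt : ∀ {m n k l a b} → Lt m a → (∀ j → n ≤ k ℕ.+ j → Lt j b) → m ℕ.+ n ≤ suc (k ℕ.+ l) → Lt l (a * b)
  scale-Lt {m} {n} {k} {l} {a} {b} la lb h with n ℕ.≤? k
  ... | yes n≤k = Lt-cong (sym (trans (*-congˡ (Lt-zero (lb 0 (ℕₚ.≤-trans n≤k (ℕₚ.m≤m+n k 0))))) (zeroʳ a))) (0-Lt l)
  ... | no n≰k = Lt-* la (lb (n ∸ k) (ℕₚ.≤-reflexive (≡.sym (ℕₚ.m+[n∸m]≡n k≤n))))
          (ℕₚ.+-cancelˡ-≤ k _ _ (≡.subst₂ _≤_ e (≡.sym (ℕₚ.+-suc k l)) h))
    where
    k≤n = ℕₚ.<⇒≤ (ℕₚ.≰⇒> n≰k)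
    e : m ℕ.+ n ≡ k ℕ.+ (m ℕ.+ (n ∸ k))
    e = ≡.trans (≡.cong (m ℕ.+_) (≡.sym (ℕₚ.m+[n∸m]≡n k≤n))) (swap m k (n ∸ k))
      where
      swap : ∀ m k x → m ℕ.+ (k ℕ.+ x) ≡ k ℕ.+ (m ℕ.+ x)
      swap = solve-∀

  LtP-∙ : ∀ {m n k a f} → Lt m a → LtP n f → m ℕ.+ n ≤ suc k → LtP k (a ∙ f)
  LtP-∙ {m} {n} {k} {a} {f} la lf h = mkLt λ i j k≤ → Lt-cong (sym (coef-∙ a f i))
    (scale-Lt la (λ j′ → lt lf i j′) (ℕₚ.≤-trans h (s≤s k≤)))

  LtP-⊛ : ∀ {m n k} f {g} → LtP m f → LtP n g → m ℕ.+ n ≤ suc k → LtP k (f ⊛ g)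
  LtP-⊛ {k = k} [] lf lg h = LtP-[] k
  LtP-⊛ {zero} {n} {k} (a ∷ f) {g} lf lg h =
    LtP-cong {k} {[]} (P.sym (P.trans (P.*-congʳ {g} (LtP-zero lf)) P.refl)) (LtP-[] k)
  LtP-⊛ {suc m} {n} {zero} (a ∷ f) {g} lf lg (s≤s h) =
    LtP-cong {0} {[]} (P.sym (P.trans (P.*-congˡ {a ∷ f} g≋0) (P.zeroʳ (a ∷ f)))) (LtP-[] 0)
    where
    g≋0 : g ≋ []
    g≋0 = LtP-zero (LtP-mono (ℕₚ.≤-trans (ℕₚ.m≤n+m n m) h) lg)
  LtP-⊛ {suc m} {n} {suc k} (a ∷ f) {g} lf lg (s≤s h) =
    LtP-⊕ (LtP-∙ (lt lf 0 (suc m) ℕₚ.≤-refl) lg (s≤s h)) (LtP-shift (LtP-⊛ f (LtP-tail lf) lg h))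

  -- The top coefficient for the lexicographic order: i is the largest index carrying the degree M.
  record Top (f : Poly) (M i : ℕ) : Set (c ⊔ ℓ) where
    field
      bound : LtP (suc M) f
      rest : ℕ
      sum : i ℕ.+ rest ≡ M
      attained : ¬ Lt rest (coef f i)
      above : ∀ k j → i < k → M ≤ k ℕ.+ j → Lt j (coef f k)

  -- The coefficient of index `i + j` in the product is the product of the two top coefficients plus
  -- terms of lower degree, so `exact` in the coefficient ring applies. The recursion drops the
  -- coefficients of `f` in front of its top one.
  Top-⊛ : ∀ f {g M N i j} → Top f M i → Top g N j → Top (f ⊛ g) (M ℕ.+ N) (i ℕ.+ j)
  Top-⊛ [] tf tg = ⊥-elim (Top.attained tf (0-Lt _))
  Top-⊛ (a ∷ f) {g} {M} {N} {zero} {j} tf tg = record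
    { bound = LtP-⊛ (a ∷ f) F.bound G′.bound (s≤s (ℕₚ.≤-reflexive (ℕₚ.+-suc M N)))
    ; rest = M ℕ.+ G′.rest
    ; sum = ≡.trans (e₁ j M G′.rest) (≡.cong (M ℕ.+_) G′.sum)
    ; attained = λ l → exact {M} {G′.rest} (≡.subst (λ r → ¬ Lt r a) F.sum F.attained) G′.attained
        (Lt-cong (S.solve 2 (λ x y → (x S.:+ y) S.:- y S.:= x) refl _ _)
          (Lt-+ (Lt-cong (trans (coef-⊕ (a ∙ g) low j) (+-congʳ (coef-∙ a g j))) l)
                (Lt-neg (lt low-Lt j _ (ℕₚ.≤-reflexive (≡.sym (≡.trans (e₁ j M G′.rest) (≡.cong (M ℕ.+_) G′.sum))))))))
    ; above = λ k l j<k h → Lt-cong (sym (trans (coef-⊕ (a ∙ g) low k) (+-congʳ (coef-∙ a g k))))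
        (Lt-+ (scale-Lt (lt F.bound 0 (suc M) ℕₚ.≤-refl) (λ l′ → G′.above k l′ j<k) (s≤s h)) (lt low-Lt k l h))
    }
    where
    module F = Top tf
    module G′ = Top tg
    low = 0# ∷ (f ⊛ g)
    low-Lt : LtP (M ℕ.+ N) low
    low-Lt = LtP-cong (0∷-⊛ f g) (LtP-⊛ (0# ∷ f) (mkLt λ { zero l _ → 0-Lt l ; (suc k) l h → F.above (suc k) l (s≤s z≤n) h }) G′.bound
      (ℕₚ.≤-reflexive (ℕₚ.+-suc M N)))
    e₁ : ∀ j M r → j ℕ.+ (M ℕ.+ r) ≡ M ℕ.+ (j ℕ.+ r)
    e₁ = solve-∀
  Top-⊛ (a ∷ f) {g} {zero} {N} {suc i} {j} tf tg with () ← Top.sum tf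
  Top-⊛ (a ∷ f) {g} {suc M} {N} {suc i} {j} tf tg = record
    { bound = LtP-⊛ (a ∷ f) F.bound G′.bound (s≤s (ℕₚ.≤-reflexive (ℕₚ.+-suc (suc M) N)))
    ; rest = I.rest
    ; sum = ≡.cong suc I.sum
    ; attained = λ l → I.attained
        (Lt-cong (S.solve 2 (λ x y → (x S.:+ y) S.:- x S.:= y) refl _ _)
          (Lt-+ (Lt-cong (trans (coef-⊕ (a ∙ g) low (suc (i ℕ.+ j))) (+-congʳ (coef-∙ a g (suc (i ℕ.+ j))))) l)
                (Lt-neg (scale-Lt (lt F.bound 0 (suc (suc M)) ℕₚ.≤-refl)
                  (λ l′ → G′.above (suc (i ℕ.+ j)) l′ (s≤s (ℕₚ.m≤n+m j i))) (s≤s (ℕₚ.≤-reflexive (≡.cong suc (≡.sym I.sum))))))))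
    ; above = λ { (suc k) l (s≤s lt-k) (s≤s h) → Lt-cong (sym (trans (coef-⊕ (a ∙ g) low (suc k)) (+-congʳ (coef-∙ a g (suc k)))))
        (Lt-+ (scale-Lt (lt F.bound 0 (suc (suc M)) ℕₚ.≤-refl)
                (λ l′ → G′.above (suc k) l′ (s≤s (ℕₚ.≤-trans (ℕₚ.m≤n+m j i) (ℕₚ.<⇒≤ lt-k)))) (s≤s (s≤s h)))
              (I.above k l lt-k h)) }
    }
    where
    module F = Top tf
    module G′ = Top tg
    low = 0# ∷ (f ⊛ g)
    tf′ : Top f M i
    tf′ = record
      { bound = LtP-tail F.bound ; rest = F.rest ; sum = ℕₚ.suc-injective F.sum ; attained = F.attained
      ; above = λ k l i<k h → F.above (suc k) l (s≤s i<k) (s≤s h) }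
    module I = Top (Top-⊛ f tf′ tg)

  top-exists : ∀ f M → LtP (suc M) f → ¬ LtP M f → ¬¬ ∃ (Top f M)
  top-exists [] M l nl = ⊥-elim (nl (LtP-[] M))
  top-exists (a ∷ f) M l nl = do
    no high ← em (LtP M (0# ∷ f))
      where yes low → η (0 , record
             { bound = l ; rest = M ; sum = ≡.refl
             ; attained = λ la → nl (mkLt λ { zero j h → Lt-mono h la ; (suc i) j h → lt low (suc i) j h })
             ; above = λ { (suc k) j _ h → lt low (suc k) j h } })
    go M l high
    where
    go : ∀ M → LtP (suc M) (a ∷ f) → ¬ LtP M (0# ∷ f) → ¬¬ ∃ (Top (a ∷ f) M)
    go zero l high = ⊥-elim (high (mkLt λ { zero j _ → 0-Lt j ; (suc i) j _ → Lt-mono z≤n (lt (LtP-tail l) i 0 z≤n) }))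
    go (suc M) l high = do
      i , t ← top-exists f M (LtP-tail l) (λ low → high (LtP-shift low))
      let module T = Top t
      η (suc i , record
        { bound = l ; rest = T.rest ; sum = ≡.cong suc T.sum ; attained = T.attained
        ; above = λ { (suc k) j (s≤s i<k) (s≤s h) → T.above k j i<k h } })

  finiteP : ∀ f → ∃ λ n → LtP n f
  finiteP [] = 0 , LtP-[] 0
  finiteP (a ∷ f) = n ℕ.⊔ suc m , mkLt
      λ { zero j h → Lt-mono (ℕₚ.≤-trans (ℕₚ.m≤m⊔n n (suc m)) h) (proj₂ (finite a))
        ; (suc i) j h → lt (proj₂ (finiteP f)) i j (ℕₚ.≤-pred (ℕₚ.≤-trans (ℕₚ.m≤n⊔m n (suc m)) h)) }
    where
    n = proj₁ (finite a)
    m = proj₁ (finiteP f)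

  top-above : ∀ {m f} → ¬ LtP m f → ¬¬ ∃₂ λ M i → m ≤ M × Top f M i
  top-above {m} {f} h = do
    suc M , l , low ← ¬¬-least (λ n → LtP n f) _ (proj₂ (finiteP f))
      where zero , l , _ → ⊥-elim (h (LtP-mono z≤n l))
    i , t ← top-exists f M l (low M ℕₚ.≤-refl)
    η (M , i , ℕₚ.≤-pred (ℕₚ.≰⇒> (λ M<m → h (LtP-mono M<m l))) , t)

  exactP : ∀ {m n f g} → ¬ LtP m f → ¬ LtP n g → ¬ LtP (m ℕ.+ n) (f ⊛ g)
  exactP {m} {n} {f} {g} nf ng l = (do
    M , i , m≤M , tf ← top-above nf
    N , j , n≤N , tg ← top-above ng
    let module T = Top (Top-⊛ f tf tg)
    η (T.attained (lt l (i ℕ.+ j) T.rest (ℕₚ.≤-trans (ℕₚ.+-mono-≤ m≤M n≤N) (ℕₚ.≤-reflexive (≡.sym T.sum)))))) (λ x → x)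

  Lt1-const : ∀ {f} → LtP 1 f → f ≋ const (coef f 0)
  Lt1-const l = mk λ { zero → refl ; (suc i) → Lt-zero (lt l (suc i) 0 (s≤s z≤n)) }

  unitP : ∀ {f} → LtP 1 f → ¬ (f ≋ []) → D.Unit f
  unitP {f} l nz = const b , P.trans (P.*-congʳ {const b} (Lt1-const l)) (P.trans (P.sym (C.ap-* _ b)) (C.ap-cong e))
    where
    a≉0 : ¬ (coef f 0 ≈ 0#)
    a≉0 z = nz (P.trans (Lt1-const l) (P.trans (C.ap-cong z) const-0))
    u = unit (lt l 0 1 (s≤s z≤n)) a≉0
    b = proj₁ u
    e = proj₂ u

-- Gauss's lemma: irreducible polynomials are prime.

module PolyPrime {c ℓ} (G : GradedDomain c ℓ) where
  open GradedDomain G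
  open GradedDomainProps G
  open CommutativeRing ring hiding (ring)
  open PolyRing ring
  open PolyGraded G
  private
    module S = IntSolver ring
    module P = CommutativeRing polyRing
    module D = Divisibility polyRing
    module SP = IntSolver polyRing
  open Relation.Binary.Reasoning.Setoid P.setoid

  module _ (q : Carrier) (pq : Prime q) where
    private module Q = Prime pq

    Div : Poly → Set (c ⊔ ℓ)
    Div f = ∀ i → q ∣ coef f i

    ∣⇒Div : ∀ {f} → const q D.∣ f → Div f
    ∣⇒Div (k , e) i = coef k i , trans (at e i) (trans (at (const-⊛ q k) i) (coef-∙ q k i))

    Div⇒∣ : ∀ f → Div f → const q D.∣ f
    Div⇒∣ [] h = [] , P.sym (P.zeroʳ (const q))
    Div⇒∣ (a ∷ f) h with h 0 | Div⇒∣ f (λ i → h (suc i))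
    ... | (k₀ , e₀) | (k , e) = k₀ ∷ k , P.trans (∷-cong e₀ (P.trans e (const-⊛ q k))) (P.sym (const-⊛ q (k₀ ∷ k)))

    ∣-diff : ∀ {x y z} → q ∣ z → q ∣ y → z ≈ y + x → q ∣ x
    ∣-diff {x} {y} {z} (k , ez) (l , ey) e = (k + - l) ,
      trans (S.solve 2 (λ x y → x S.:= (y S.:+ x) S.:- y) refl x y)
      (trans (+-cong (trans (sym e) ez) (-‿cong ey))
        (S.solve 3 (λ q k l → q S.:* k S.:- q S.:* l S.:= q S.:* (k S.:- l)) refl q k l))

    ∣-mul : ∀ {x} y → q ∣ x → q ∣ x * y
    ∣-mul y (k , e) = k * y , trans (*-congʳ e) (*-assoc q k y)

    -- The prime `q` divides the product of the two constant coefficients, hence one of them.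
    -- Dropping that coefficient leaves a product with a shorter factor that `q` still divides.
    Div-⊛ : ∀ f g → Div (f ⊛ g) → ¬¬ (Div f ⊎ Div g)
    Div-⊛ [] g h = η (inj₁ (λ i → 0# , sym (zeroʳ q)))
    Div-⊛ (a ∷ f) [] h = η (inj₂ (λ i → 0# , sym (zeroʳ q)))
    Div-⊛ (a ∷ f) (b ∷ g) h = step (Div-⊛ f (b ∷ g)) (Div-⊛ (a ∷ f) g)
      where
      step : (Div (f ⊛ (b ∷ g)) → ¬¬ (Div f ⊎ Div (b ∷ g))) → (Div ((a ∷ f) ⊛ g) → ¬¬ (Div (a ∷ f) ⊎ Div g)) →
             ¬¬ (Div (a ∷ f) ⊎ Div (b ∷ g))
      step ihˡ ihʳ = do
        inj₁ qa ← Q.prime a b (∣-diff (h 0) (0# , sym (zeroʳ q)) (+-comm _ _))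
          where
          inj₂ qb → do
            inj₁ x ← ihʳ (λ i → ∣-diff (h (suc i)) (∣-mul (coef f i) qb)
                (trans (at (⊛-∷ (a ∷ f) b g) (suc i)) (trans (coef-⊕ (b ∙ f) ((a ∷ f) ⊛ g) i) (+-congʳ (coef-∙ b f i)))))
              where inj₂ y → η (inj₂ (λ { zero → qb ; (suc i) → y i }))
            η (inj₁ x)
        inj₁ x ← ihˡ (λ i → ∣-diff (h (suc i)) (∣-mul (coef g i) qa)
            (trans (coef-⊕ (a ∙ g) (f ⊛ (b ∷ g)) i) (+-congʳ (coef-∙ a g i))))
          where inj₂ y → η (inj₂ y)
        η (inj₁ (λ { zero → qa ; (suc i) → x i }))

    const-prime : D.Prime (const q)
    const-prime = record
      { nonzero = λ z → Q.nonzero (at z 0)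
      ; nonunit = λ { (g , e) → Q.nonunit (coef g 0 , trans (sym (trans (at (const-⊛ q g) 0) (coef-∙ q g 0))) (at e 0)) }
      ; prime = λ f g d → ¬¬-map (λ { (inj₁ x) → inj₁ (Div⇒∣ f x) ; (inj₂ y) → inj₂ (Div⇒∣ g y) }) (Div-⊛ f g (∣⇒Div d)) }

  const-cancel : ∀ {a f g} → ¬ (a ≈ 0#) → const a ⊛ f ≋ const a ⊛ g → f ≋ g
  const-cancel {a} {f} {g} h e = mk λ i → cancel h
    (trans (sym (coef-∙ a f i)) (trans (at (P.trans (P.sym (const-⊛ a f)) (P.trans e (const-⊛ a g))) i) (coef-∙ a g i)))

  DegLt : ℕ → Poly → Set ℓ
  DegLt n f = ∀ i → n ≤ i → coef f i ≈ 0#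

  monomial : ℕ → Carrier → Poly
  monomial zero a = const a
  monomial (suc k) a = 0# ∷ monomial k a

  coef-monomial : ∀ k a g i → coef (monomial k a ⊛ g) (k ℕ.+ i) ≈ a * coef g i
  coef-monomial zero a g i = trans (at (const-⊛ a g) i) (coef-∙ a g i)
  coef-monomial (suc k) a g i = trans (at (0∷-⊛ (monomial k a) g) (suc (k ℕ.+ i))) (coef-monomial k a g i)

  -- Long division without inverting the leading coefficient of `g`: `f` is multiplied by it at each
  -- step, and the accumulated factor `a` is nonzero in a domain.
  pseudo-division : ∀ g m → ¬ (coef g m ≈ 0#) → DegLt (suc m) g → ∀ n f → DegLt n f →
    ∃ λ a → ∃₂ λ s r → ¬ (a ≈ 0#) × const a ⊛ f ≋ (s ⊛ g) ⊕ r × DegLt m r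
  pseudo-division g m lead dg n f df with n ℕ.≤? m
  pseudo-division g m lead dg n f df | yes n≤m = 1# , [] , f , 1≉0 , P.*-identityˡ f , λ i m≤i → df i (ℕₚ.≤-trans n≤m m≤i)
  pseudo-division g m lead dg zero f df | no n≰m = ⊥-elim (n≰m z≤n)
  pseudo-division g m lead dg (suc n) f df | no n≰m = step (pseudo-division g m lead dg n f₁ df₁)
    where
    m≤n = ℕₚ.≤-pred (ℕₚ.≰⇒> n≰m)
    k = n ∸ m
    l = coef g m
    a = coef f n
    h = monomial k a
    f₁ = (const l ⊛ f) ⊕ (⊖ (h ⊛ g))
    k+m : k ℕ.+ m ≡ n
    k+m = ℕₚ.m∸n+n≡m m≤n
    value : ∀ i → coef f₁ (k ℕ.+ i) ≈ l * coef f (k ℕ.+ i) + - (a * coef g i)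
    value i = trans (coef-⊕ (const l ⊛ f) (⊖ (h ⊛ g)) (k ℕ.+ i))
      (+-cong (trans (at (const-⊛ l f) (k ℕ.+ i)) (coef-∙ l f (k ℕ.+ i)))
              (trans (coef-⊖ (h ⊛ g) (k ℕ.+ i)) (-‿cong (coef-monomial k a g i))))
    df₁ : DegLt n f₁
    df₁ i n≤i = ≡.subst (λ j → coef f₁ j ≈ 0#) ke (trans (value i′) (vanish (ℕₚ.m≤n⇒m<n∨m≡n m≤i′)))
      where
      i′ = i ∸ k
      ke : k ℕ.+ i′ ≡ i
      ke = ℕₚ.m+[n∸m]≡n (ℕₚ.≤-trans (ℕₚ.m∸n≤m n m) n≤i)
      m≤i′ : m ≤ i′
      m≤i′ = ℕₚ.+-cancelˡ-≤ k m i′ (≡.subst₂ _≤_ (≡.sym k+m) (≡.sym ke) n≤i)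
      vanish : (m < i′) ⊎ (m ≡ i′) → l * coef f (k ℕ.+ i′) + - (a * coef g i′) ≈ 0#
      vanish (inj₁ m<i′) = trans (+-cong (*-congˡ (df _ (≡.subst (_≤ k ℕ.+ i′) (≡.trans (ℕₚ.+-suc k m) (≡.cong suc k+m)) (ℕₚ.+-monoʳ-≤ k m<i′))))
                                         (-‿cong (*-congˡ (dg i′ m<i′))))
        (S.solve 2 (λ l a → l S.:* S.con (+ 0) S.:- a S.:* S.con (+ 0) S.:= S.con (+ 0)) refl l a)
      vanish (inj₂ m≡i′) = trans (+-cong (*-congˡ (reflexive (≡.cong (coef f) (≡.trans (≡.cong (k ℕ.+_) (≡.sym m≡i′)) k+m))))
                                         (-‿cong (*-congˡ (reflexive (≡.cong (coef g) (≡.sym m≡i′))))))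
        (S.solve 2 (λ l a → l S.:* a S.:- a S.:* l S.:= S.con (+ 0)) refl l a)
    step : (∃ λ b → ∃₂ λ s r → ¬ (b ≈ 0#) × const b ⊛ f₁ ≋ (s ⊛ g) ⊕ r × DegLt m r) →
           ∃ λ b → ∃₂ λ s r → ¬ (b ≈ 0#) × const b ⊛ f ≋ (s ⊛ g) ⊕ r × DegLt m r
    step (b , s , r , b≉0 , e , dr) = b * l , s ⊕ (const b ⊛ h) , r , *-nonzero b≉0 lead , (begin
      const (b * l) ⊛ f ≈⟨ P.*-congʳ {f} (C.ap-* b l) ⟩
      (const b ⊛ const l) ⊛ f ≈⟨ SP.solve 5 (λ b l f h g → (b SP.:* l) SP.:* f SP.:= b SP.:* (l SP.:* f SP.:- h SP.:* g) SP.:+ (b SP.:* h) SP.:* g) P.refl (const b) (const l) f h g ⟩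
      (const b ⊛ f₁) ⊕ ((const b ⊛ h) ⊛ g) ≈⟨ P.+-congʳ {(const b ⊛ h) ⊛ g} e ⟩
      ((s ⊛ g) ⊕ r) ⊕ ((const b ⊛ h) ⊛ g) ≈⟨ SP.solve 4 (λ s g r x → (s SP.:* g SP.:+ r) SP.:+ x SP.:* g SP.:= (s SP.:+ x) SP.:* g SP.:+ r) P.refl s g r (const b ⊛ h) ⟩
      ((s ⊕ (const b ⊛ h)) ⊛ g) ⊕ r ∎) , dr

  DegLt-length : ∀ f → DegLt (length f) f
  DegLt-length [] i _ = refl
  DegLt-length (a ∷ f) (suc i) (s≤s h) = DegLt-length f i h

  const-assoc : ∀ a b f → const (a * b) ⊛ f ≋ const a ⊛ (const b ⊛ f)
  const-assoc a b f = P.trans (P.*-congʳ {f} (C.ap-* a b)) (P.*-assoc (const a) (const b) f)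

  Clearing : Poly → Poly → Poly → Set (c ⊔ ℓ)
  Clearing f h k = ∃₂ λ h′ k′ → ∃₂ λ a b → f ≋ h′ ⊛ k′ × h ≋ const a ⊛ h′ × k ≋ const b ⊛ k′

  -- A prime factor of `a` divides `h` or `k` by `const-prime`, and can be cancelled there.
  -- Repeating this distributes the whole constant over the two factors.
  clear : ∀ {a} → ¬ (a ≈ 0#) → ∀ f h k → const a ⊛ f ≋ h ⊛ k → ¬¬ Clearing f h k
  clear {a} a≉0 f h k e = prime-induction
    (λ a → ∀ f h k → const a ⊛ f ≋ h ⊛ k → ¬¬ Clearing f h k)
    (λ e p f h k e′ → p f h k (P.trans (P.*-congʳ {f} (C.ap-cong e)) e′))
    (λ { u (v , uv) f h k e → let cuv = P.trans (P.sym (C.ap-* u v)) (C.ap-cong uv) in η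
        (const v ⊛ h , k , u , 1# ,
         (begin
           f ≈⟨ P.sym (P.*-identityˡ f) ⟩
           const 1# ⊛ f ≈⟨ P.*-congʳ {f} (P.sym cuv) ⟩
           (const u ⊛ const v) ⊛ f ≈⟨ SP.solve 3 (λ u v f → (u SP.:* v) SP.:* f SP.:= v SP.:* (u SP.:* f)) P.refl (const u) (const v) f ⟩
           const v ⊛ (const u ⊛ f) ≈⟨ P.*-congˡ {const v} e ⟩
           const v ⊛ (h ⊛ k) ≈⟨ P.sym (P.*-assoc (const v) h k) ⟩
           (const v ⊛ h) ⊛ k ∎) ,
         (begin
           h ≈⟨ P.sym (P.*-identityˡ h) ⟩
           const 1# ⊛ h ≈⟨ P.*-congʳ {h} (P.sym cuv) ⟩
           (const u ⊛ const v) ⊛ h ≈⟨ P.*-assoc (const u) (const v) h ⟩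
           const u ⊛ (const v ⊛ h) ∎) ,
         P.sym (P.*-identityˡ k)) })
    (λ q b pq b≉0 ih → η λ f h k e → do
      inj₁ (h₁ , eh) ← D.Prime.prime (const-prime q pq) h k (const b ⊛ f , P.trans (P.sym e) (const-assoc q b f))
        where
        inj₂ (k₁ , ek) → do
          h′ , k′ , x , y , ef , eh′ , ek′ ← ih f h k₁ (const-cancel (Prime.nonzero pq) (P.trans (P.sym (const-assoc q b f)) (P.trans e
            (P.trans (P.*-congˡ {h} ek) (SP.solve 3 (λ h q k → h SP.:* (q SP.:* k) SP.:= q SP.:* (h SP.:* k)) P.refl h (const q) k₁)))))
          η (h′ , k′ , x , q * y , ef , eh′ , P.trans ek (P.trans (P.*-congˡ {const q} ek′) (P.sym (const-assoc q y k′))))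
      h′ , k′ , x , y , ef , eh′ , ek′ ← ih f h₁ k (const-cancel (Prime.nonzero pq) (P.trans (P.sym (const-assoc q b f)) (P.trans e
            (P.trans (P.*-congʳ {k} eh) (P.*-assoc (const q) h₁ k)))))
      η (h′ , k′ , q * x , y , ef , P.trans eh (P.trans (P.*-congˡ {const q} eh′) (P.sym (const-assoc q x h′))) , ek′))
    a a≉0 >>= (λ p → p f h k e)

  module _ {f : Poly} (irr : D.Irreducible f) (nonconst : ¬ (f ≋ const (coef f 0))) where
    private module I = D.Irreducible irr

    unit⇒const : ∀ {k} → D.Unit k → k ≋ const (coef k 0)
    unit⇒const {k} (g , e) = Lt1-const (LtP-stable λ h →
      exactP {1} {0} h (λ z → 1≉0 (at (P.trans (P.sym e) (P.trans (P.*-congˡ {k} (LtP-zero z)) (P.zeroʳ k))) 0)) (LtP-cong (P.sym e) (LtP-const 1-Lt)))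

    -- A prime constant dividing `f ⊛ w` cannot divide `f`, which is irreducible and not constant;
    -- so it divides `w` and cancels.
    strip : ∀ {a} → ¬ (a ≈ 0#) → ∀ u w → const a ⊛ u ≋ f ⊛ w → ¬¬ (f D.∣ u)
    strip {a} a≉0 u w e = prime-induction
      (λ a → ∀ u w → const a ⊛ u ≋ f ⊛ w → ¬¬ (f D.∣ u))
      (λ e p u w e′ → p u w (P.trans (P.*-congʳ {u} (C.ap-cong e)) e′))
      (λ { a (v , av) u w e → η (const v ⊛ w , (begin
          u ≈⟨ P.sym (P.*-identityˡ u) ⟩
          const 1# ⊛ u ≈⟨ P.*-congʳ {u} (P.trans (C.ap-cong (sym av)) (C.ap-* a v)) ⟩
          (const a ⊛ const v) ⊛ u ≈⟨ SP.solve 3 (λ u v f → (u SP.:* v) SP.:* f SP.:= v SP.:* (u SP.:* f)) P.refl (const a) (const v) u ⟩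
          const v ⊛ (const a ⊛ u) ≈⟨ P.*-congˡ {const v} e ⟩
          const v ⊛ (f ⊛ w) ≈⟨ SP.solve 3 (λ v f w → v SP.:* (f SP.:* w) SP.:= f SP.:* (v SP.:* w)) P.refl (const v) f w ⟩
          f ⊛ (const v ⊛ w) ∎)) })
      (λ q b pq b≉0 ih → η λ u w e → do
        inj₂ (w₁ , ew) ← D.Prime.prime (const-prime q pq) f w (const b ⊛ u , P.trans (P.sym e) (const-assoc q b u))
          where
          inj₁ (k , ef) → do
            inj₂ uk ← I.split (const q) k ef
              where inj₁ uq → ⊥-elim (D.Prime.nonunit (const-prime q pq) uq)
            let f≋ = P.trans ef (P.trans (P.*-congˡ {const q} (unit⇒const uk)) (P.sym (C.ap-* q (coef k 0))))
            ⊥-elim (nonconst (P.trans f≋ (C.ap-cong (sym (at f≋ 0)))))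
        ih u w₁ (const-cancel (Prime.nonzero pq) (P.trans (P.sym (const-assoc q b u)) (P.trans e
          (P.trans (P.*-congˡ {f} ew) (SP.solve 3 (λ h q k → h SP.:* (q SP.:* k) SP.:= q SP.:* (h SP.:* k)) P.refl f (const q) w₁))))))
      a a≉0 >>= (λ p → p u w e)

    Ideal : Poly → Poly → Set (c ⊔ ℓ)
    Ideal u e = ∃₂ λ α β → e ≋ (α ⊛ f) ⊕ (β ⊛ u)

    -- The argument for principal ideal domains, up to constants. An element `g` of least degree in
    -- the ideal of `f` and `u` divides constant multiples of both. By `clear`, `f = s′ g′` with `g`
    -- a constant multiple of `g′`. If `g′` is a unit then `g` is a constant, and multiplying its
    -- expression by `v` gives `f ∣ v`. If `s′` is a unit then `f` agrees with `g` up to constants,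
    -- and `f ∣ u`.
    nonconst-prime : ∀ u v → f D.∣ u ⊛ v → ¬¬ (f D.∣ u ⊎ f D.∣ v)
    nonconst-prime u v (w , uv) = do
      no f∤u ← em (f D.∣ u)
        where yes f∣u → η (inj₁ f∣u)
      suc m , (g , g≉0 , dg , α , β , eg) , least ← ¬¬-least (λ m → ∃ λ g → ¬ (g ≋ []) × DegLt m g × Ideal u g) (length f)
          (f , I.nonzero , DegLt-length f , const 1# , [] , SP.solve 1 (λ f → f SP.:= SP.con (+ 1) SP.:* f SP.:+ SP.con (+ 0)) P.refl f)
        where zero , (g , g≉0 , dg , _) , _ → ⊥-elim (g≉0 (mk λ i → dg i z≤n))
      let lead : ¬ (coef g m ≈ 0#)
          lead z = least m ℕₚ.≤-refl (g , g≉0 , (λ i m≤i → low {g} {m} z i (ℕₚ.m≤n⇒m<n∨m≡n m≤i) dg) , α , β , eg)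
          divides : ∀ e → Ideal u e → ¬¬ ∃₂ λ a s → ¬ (a ≈ 0#) × const a ⊛ e ≋ s ⊛ g
          divides = λ { e (γ , δ , ee) → do
            let a , s , r , a≉0 , er , dr = pseudo-division g m lead dg (length e) e (DegLt-length e)
            no r≉0 ← em (r ≋ [])
              where yes r≋0 → η (a , s , a≉0 , P.trans er (P.trans (P.+-congˡ {s ⊛ g} r≋0) (P.+-identityʳ _)))
            ⊥-elim (least m ℕₚ.≤-refl (r , r≉0 , dr , (const a ⊛ γ) ⊕ (⊖ (s ⊛ α)) , (const a ⊛ δ) ⊕ (⊖ (s ⊛ β)) , (begin
              r ≈⟨ SP.solve 2 (λ r x → r SP.:= (x SP.:+ r) SP.:- x) P.refl r (s ⊛ g) ⟩
              ((s ⊛ g) ⊕ r) ⊕ (⊖ (s ⊛ g)) ≈⟨ P.+-cong (P.sym er) (P.-‿cong (P.*-congˡ {s} eg)) ⟩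
              (const a ⊛ e) ⊕ (⊖ (s ⊛ ((α ⊛ f) ⊕ (β ⊛ u)))) ≈⟨ P.+-congʳ {⊖ (s ⊛ ((α ⊛ f) ⊕ (β ⊛ u)))} (P.*-congˡ {const a} ee) ⟩
              (const a ⊛ ((γ ⊛ f) ⊕ (δ ⊛ u))) ⊕ (⊖ (s ⊛ ((α ⊛ f) ⊕ (β ⊛ u))))
                ≈⟨ SP.solve 8 (λ a γ f δ u s α β → a SP.:* (γ SP.:* f SP.:+ δ SP.:* u) SP.:- s SP.:* (α SP.:* f SP.:+ β SP.:* u)
                     SP.:= (a SP.:* γ SP.:- s SP.:* α) SP.:* f SP.:+ (a SP.:* δ SP.:- s SP.:* β) SP.:* u) P.refl (const a) γ f δ u s α β ⟩
              (((const a ⊛ γ) ⊕ (⊖ (s ⊛ α))) ⊛ f) ⊕ (((const a ⊛ δ) ⊕ (⊖ (s ⊛ β))) ⊛ u) ∎))) }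
      a , s , a≉0 , es ← divides f (const 1# , [] , SP.solve 1 (λ f → f SP.:= SP.con (+ 1) SP.:* f SP.:+ SP.con (+ 0)) P.refl f)
      s′ , g′ , x , y , ef , _ , eg′ ← clear a≉0 f s g es
      inj₁ (t , st) ← I.split s′ g′ ef
        where
        inj₂ ug′ → do
          let r = y * coef g′ 0
              g≋r = P.trans eg′ (P.trans (P.*-congˡ {const y} (unit⇒const ug′)) (P.sym (C.ap-* y (coef g′ 0))))
              r≉0 = λ z → g≉0 (P.trans g≋r (P.trans (C.ap-cong z) const-0))
          ¬¬-map inj₂ (strip r≉0 v ((α ⊛ v) ⊕ (β ⊛ w)) (begin
            const r ⊛ v ≈⟨ P.*-congʳ {v} (P.trans (P.sym g≋r) eg) ⟩
            ((α ⊛ f) ⊕ (β ⊛ u)) ⊛ v ≈⟨ SP.solve 5 (λ α f β u v → (α SP.:* f SP.:+ β SP.:* u) SP.:* v SP.:= α SP.:* f SP.:* v SP.:+ β SP.:* (u SP.:* v)) P.refl α f β u v ⟩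
            ((α ⊛ f) ⊛ v) ⊕ (β ⊛ (u ⊛ v)) ≈⟨ P.+-congˡ {(α ⊛ f) ⊛ v} (P.*-congˡ {β} uv) ⟩
            ((α ⊛ f) ⊛ v) ⊕ (β ⊛ (f ⊛ w)) ≈⟨ SP.solve 5 (λ α f β w v → α SP.:* f SP.:* v SP.:+ β SP.:* (f SP.:* w) SP.:= f SP.:* (α SP.:* v SP.:+ β SP.:* w)) P.refl α f β w v ⟩
            f ⊛ ((α ⊛ v) ⊕ (β ⊛ w)) ∎))
      b , k , b≉0 , ek ← divides u ([] , const 1# , SP.solve 2 (λ f u → u SP.:= SP.con (+ 0) SP.:* f SP.:+ SP.con (+ 1) SP.:* u) P.refl f u)
      f∣u ← strip b≉0 u (k ⊛ (const y ⊛ t)) (begin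
        const b ⊛ u ≈⟨ ek ⟩
        k ⊛ g ≈⟨ P.*-congˡ {k} eg′ ⟩
        k ⊛ (const y ⊛ g′) ≈⟨ P.*-congˡ {k} (P.*-congˡ {const y} (P.sym (P.*-identityˡ g′))) ⟩
        k ⊛ (const y ⊛ (const 1# ⊛ g′)) ≈⟨ P.*-congˡ {k} (P.*-congˡ {const y} (P.*-congʳ {g′} (P.sym st))) ⟩
        k ⊛ (const y ⊛ ((s′ ⊛ t) ⊛ g′)) ≈⟨ SP.solve 5 (λ k y s t g → k SP.:* (y SP.:* ((s SP.:* t) SP.:* g)) SP.:= (s SP.:* g) SP.:* (k SP.:* (y SP.:* t))) P.refl k (const y) s′ t g′ ⟩
        (s′ ⊛ g′) ⊛ (k ⊛ (const y ⊛ t)) ≈⟨ P.*-congʳ {k ⊛ (const y ⊛ t)} (P.sym ef) ⟩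
        f ⊛ (k ⊛ (const y ⊛ t)) ∎)
      ⊥-elim (f∤u f∣u)
      where
      low : ∀ {g m} → coef g m ≈ 0# → ∀ i → (m < i) ⊎ (m ≡ i) → DegLt (suc m) g → coef g i ≈ 0#
      low z i (inj₁ m<i) dg = dg i m<i
      low z i (inj₂ ≡.refl) dg = z

  irreducible⇒primeP : ∀ {f} → D.Irreducible f → D.Prime f
  irreducible⇒primeP {f} irr = record
    { nonzero = I.nonzero ; nonunit = I.nonunit
    ; prime = λ u v d → do
        no nc ← em (f ≋ const (coef f 0))
          where yes f≋ → D.Prime.prime (D.prime-cong (P.sym f≋) (const-prime (coef f 0) (irreducible⇒prime (record
                   { nonzero = λ z → I.nonzero (P.trans f≋ (P.trans (C.ap-cong z) const-0))
                   ; nonunit = λ { (b , e) → I.nonunit (const b , P.trans (P.*-congʳ {const b} f≋) (P.trans (P.sym (C.ap-* _ b)) (C.ap-cong e))) }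
                   ; split = λ b d e → ¬¬-map
                       (λ { (inj₁ x) → inj₁ (coef-unit x) ; (inj₂ y) → inj₂ (coef-unit y) })
                       (I.split (const b) (const d) (P.trans f≋ (P.trans (C.ap-cong e) (C.ap-* b d)))) })))) u v d
        nonconst-prime irr nc u v d }
    where
    module I = D.Irreducible irr
    coef-unit : ∀ {b} → D.Unit (const b) → Unit b
    coef-unit {b} (g , e) = coef g 0 , trans (sym (trans (at (const-⊛ b g) 0) (coef-∙ b g 0))) (at e 0)

  polyGraded : GradedDomain c ℓ
  polyGraded = record
    { ring = polyRing ; stable = stableP ; Lt = LtP ; Lt-cong = LtP-cong ; Lt-stable = LtP-stable
    ; Lt-zero = LtP-zero ; 0-Lt = LtP-[] ; 1-Lt = LtP-const 1-Lt ; Lt-mono = LtP-mono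
    ; Lt-+ = LtP-⊕ ; Lt-neg = LtP-⊖ ; Lt-* = λ {m} {n} {k} {f} → LtP-⊛ f ; exact = exactP
    ; unit = unitP ; finite = finiteP ; 1≉0 = λ z → 1≉0 (at z 0)
    ; irreducible⇒prime = irreducible⇒primeP }

-- Fields with stable equality and linear algebra over them.

record StableField (c ℓ : Level) : Set (lsuc (c ⊔ ℓ)) where
  field
    ring : CommutativeRing c ℓ
  open CommutativeRing ring using (Carrier; _≈_; _*_; 0#; 1#)
  field
    stable : ∀ {a b} → ¬¬ (a ≈ b) → a ≈ b
    1≉0 : ¬ (1# ≈ 0#)
    inverse : ∀ a → ¬ (a ≈ 0#) → ∃ λ b → a * b ≈ 1#

module FieldGraded {c ℓ} (K : StableField c ℓ) where
  open StableField K
  open CommutativeRing ring hiding (ring; zero)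
  open Divisibility ring

  LtK : ℕ → Carrier → Set ℓ
  LtK zero a = a ≈ 0#
  LtK (suc n) a = Lift ℓ ⊤

  mul-zero : ∀ {a b} → ¬ (a ≈ 0#) → a * b ≈ 0# → b ≈ 0#
  mul-zero {a} {b} a≉0 e = begin
    b ≈⟨ sym (*-identityˡ b) ⟩
    1# * b ≈⟨ *-congʳ (sym (proj₂ (inverse a a≉0))) ⟩
    a * a′ * b ≈⟨ trans (*-congʳ (*-comm a a′)) (*-assoc a′ a b) ⟩
    a′ * (a * b) ≈⟨ *-congˡ e ⟩
    a′ * 0# ≈⟨ zeroʳ a′ ⟩
    0# ∎
    where
    open Relation.Binary.Reasoning.Setoid setoid
    a′ = proj₁ (inverse a a≉0)

  fieldGraded : GradedDomain c ℓ
  fieldGraded = record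
    { ring = ring ; stable = stable ; Lt = LtK
    ; Lt-cong = λ { {zero} e l → trans (sym e) l ; {suc n} _ _ → lift tt }
    ; Lt-stable = λ { {zero} h → stable h ; {suc n} _ → lift tt }
    ; Lt-zero = λ l → l
    ; 0-Lt = λ { zero → refl ; (suc n) → lift tt }
    ; 1-Lt = lift tt
    ; Lt-mono = λ { {zero} {zero} _ l → l ; {m} {suc n} _ _ → lift tt }
    ; Lt-+ = λ { {zero} p q → trans (+-cong p q) (+-identityˡ 0#) ; {suc n} _ _ → lift tt }
    ; Lt-neg = λ { {zero} {a} p → trans (-‿cong p) -0≈0 ; {suc n} _ → lift tt }
    ; Lt-* = λ { {k = suc k} _ _ _ → lift tt
               ; {zero} {n} {zero} {a} {b} p _ _ → trans (*-congʳ p) (zeroˡ b)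
               ; {suc m} {zero} {zero} {a} {b} _ q _ → trans (*-congˡ q) (zeroʳ a)
               ; {suc m} {suc n} {zero} {a} {b} _ _ h → ⊥-elim (absurd m n h) }
    ; exact = λ { {zero} {zero} na nb z → nb (mul-zero na z)
                ; {zero} {suc n} _ nb _ → nb (lift tt)
                ; {suc m} na _ _ → na (lift tt) }
    ; unit = λ {a} _ h → inverse a h
    ; finite = λ a → 1 , lift tt
    ; 1≉0 = 1≉0
    ; irreducible⇒prime = λ {a} irr → ⊥-elim (Irreducible.nonunit irr (inverse a (Irreducible.nonzero irr))) }
    where
    -0≈0 : - 0# ≈ 0#
    -0≈0 = trans (sym (+-identityˡ _)) (-‿inverseʳ 0#)
    absurd : ∀ m n → suc m ℕ.+ suc n ≤ 1 → ⊥
    absurd m n (s≤s h) with () ← ≡.subst (_≤ 0) (ℕₚ.+-suc m n) h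

module Linear {c ℓ} (K : StableField c ℓ) where
  open StableField K renaming (ring to kring; stable to kstable)
  private module K = CommutativeRing kring

  record KAlg : Set (lsuc (c ⊔ ℓ)) where
    field
      ring : CommutativeRing c ℓ
      ιHom : RingHom kring ring
    open CommutativeRing ring public hiding (ring; zero)
    open RingHom ιHom public renaming (ap to ι; ap-cong to ι-cong; ap-+ to ι-+; ap-* to ι-*; ap-1 to ι-1; ap-0 to ι-0; ap-neg to ι-neg)

  kAlg : KAlg
  kAlg = record { ring = kring ; ιHom = record { ap = λ a → a ; ap-cong = λ e → e ; ap-+ = λ _ _ → K.refl ; ap-* = λ _ _ → K.refl ; ap-1 = K.refl } }

  record LinMap (A B : KAlg) : Set (c ⊔ ℓ) where
    private
      module A = KAlg A
      module B = KAlg B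
    field
      fn : A.Carrier → B.Carrier
      fn-cong : ∀ {a b} → a A.≈ b → fn a B.≈ fn b
      fn-+ : ∀ a b → fn (a A.+ b) B.≈ fn a B.+ fn b
      fn-ι : ∀ k a → fn (A.ι k A.* a) B.≈ B.ι k B.* fn a
    fn-0 : fn A.0# B.≈ B.0#
    fn-0 = B.trans (fn-cong (A.sym (A.trans (A.*-congʳ A.ι-0) (A.zeroˡ A.0#)))) (B.trans (fn-ι K.0# A.0#) (B.trans (B.*-congʳ B.ι-0) (B.zeroˡ _)))
  open LinMap public

  _∘ˡ_ : ∀ {A B C} → LinMap B C → LinMap A B → LinMap A C
  _∘ˡ_ {A} {B} {C} g f = record
    { fn = λ a → fn g (fn f a) ; fn-cong = λ e → fn-cong g (fn-cong f e)
    ; fn-+ = λ a b → C.trans (fn-cong g (fn-+ f a b)) (fn-+ g _ _)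
    ; fn-ι = λ k a → C.trans (fn-cong g (fn-ι f k a)) (fn-ι g k _) }
    where
    module C = KAlg C

  Functional : KAlg → Set (c ⊔ ℓ)
  Functional A = LinMap A kAlg

  Zeros : ∀ {u} → Vec K.Carrier u → Set ℓ
  Zeros cs = ∀ i → lookup cs i K.≈ K.0#

  module Comb (A : KAlg) where
    open KAlg A

    comb : ∀ {u} → Vec K.Carrier u → Vec Carrier u → Carrier
    comb [] [] = 0#
    comb (k ∷ ks) (e ∷ es) = ι k * e + comb ks es

    Indep : ∀ {u} → Vec Carrier u → Set (c ⊔ ℓ)
    Indep es = ∀ cs → comb cs es ≈ 0# → Zeros cs

    comb-zeros : ∀ {u} (cs : Vec K.Carrier u) es → Zeros cs → comb cs es ≈ 0#
    comb-zeros [] [] z = refl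
    comb-zeros (k ∷ ks) (e ∷ es) z = trans (+-cong (trans (*-congʳ (trans (ι-cong (z zero)) ι-0)) (zeroˡ e)) (comb-zeros ks es (λ i → z (suc i)))) (+-identityˡ 0#)

    comb-++ : ∀ {m n} (cs : Vec K.Carrier m) (ds : Vec K.Carrier n) es fs → comb (cs ++ ds) (es ++ fs) ≈ comb cs es + comb ds fs
    comb-++ [] ds [] fs = sym (+-identityˡ _)
    comb-++ (k ∷ cs) ds (e ∷ es) fs = trans (+-congˡ (comb-++ cs ds es fs)) (sym (+-assoc _ _ _))

    comb-closed : ∀ {p} (W : Carrier → Set p) → W 0# → (∀ {a b} → W a → W b → W (a + b)) → (∀ k {a} → W a → W (ι k * a)) →
      ∀ {u} (cs : Vec K.Carrier u) es → (∀ i → W (lookup es i)) → W (comb cs es)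
    comb-closed W w0 w+ wι [] [] h = w0
    comb-closed W w0 w+ wι (k ∷ cs) (e ∷ es) h = w+ (wι k (h zero)) (comb-closed W w0 w+ wι cs es (λ i → h (suc i)))

  zeros-++ : ∀ {m n} (cs : Vec K.Carrier m) (ds : Vec K.Carrier n) → Zeros cs → Zeros ds → Zeros (cs ++ ds)
  zeros-++ [] ds p q i = q i
  zeros-++ (k ∷ cs) ds p q zero = p zero
  zeros-++ (k ∷ cs) ds p q (suc i) = zeros-++ cs ds (λ i → p (suc i)) q i

  module _ {A B : KAlg} (h : LinMap A B) where
    private
      module A = KAlg A
      module B = KAlg B
      module CA = Comb A
      module CB = Comb B

    comb-map : ∀ {u} (cs : Vec K.Carrier u) es → CB.comb cs (Vec.map (fn h) es) B.≈ fn h (CA.comb cs es)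
    comb-map [] [] = B.sym (fn-0 h)
    comb-map (k ∷ cs) (e ∷ es) = B.trans (B.+-cong (B.sym (fn-ι h k e)) (comb-map cs es)) (B.sym (fn-+ h _ _))

  module _ {A : KAlg} where
    private
      module A = KAlg A
      module CA = Comb A
      module SA = IntSolver A.ring

    remove : ∀ {x} {X : Set x} {n} → Vec X (suc n) → Fin (suc n) → Vec X n
    remove (x ∷ xs) zero = xs
    remove {n = suc n} (x ∷ xs) (suc i) = x ∷ remove xs i

    insert : ∀ {x} {X : Set x} {n} → Fin (suc n) → X → Vec X n → Vec X (suc n)
    insert zero y xs = y ∷ xs
    insert (suc i) y (x ∷ xs) = x ∷ insert i y xs

    comb-insert : ∀ {n} (i : Fin (suc n)) k cs es → CA.comb (insert i k cs) es A.≈ A.ι k A.* lookup es i A.+ CA.comb cs (remove es i)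
    comb-insert zero k cs (e ∷ es) = A.refl
    comb-insert (suc i) k (k′ ∷ cs) (e ∷ es) = A.trans (A.+-congˡ (comb-insert i k cs es))
      (SA.solve 3 (λ x y z → x SA.:+ (y SA.:+ z) SA.:= y SA.:+ (x SA.:+ z)) A.refl _ _ _)

    zeros-insert : ∀ {n} (i : Fin (suc n)) k (cs : Vec K.Carrier n) → Zeros (insert i k cs) → Zeros cs
    zeros-insert zero k cs z j = z (suc j)
    zeros-insert (suc i) k (k′ ∷ cs) z zero = z zero
    zeros-insert (suc i) k (k′ ∷ cs) z (suc j) = zeros-insert i k cs (λ j → z (suc j)) j

    zeros-fn : ∀ {u} (φ : Functional A) (cs : Vec K.Carrier u) es → (∀ i → fn φ (lookup es i) K.≈ K.0#) → fn φ (CA.comb cs es) K.≈ K.0#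
    zeros-fn φ cs es h = CA.comb-closed (λ a → fn φ a K.≈ K.0#) (fn-0 φ)
      (λ p q → K.trans (fn-+ φ _ _) (K.trans (K.+-cong p q) (K.+-identityˡ _)))
      (λ k p → K.trans (fn-ι φ k _) (K.trans (K.*-congˡ p) (K.zeroʳ k))) cs es h

    -- Gaussian elimination: a vector on which the first functional is nonzero serves to project the
    -- others into its kernel, where the remaining functionals are treated.
    kernel : ∀ {u} (es : Vec A.Carrier u) (φs : List (Functional A)) → length φs < u →
      ¬¬ ∃ λ cs → ¬ Zeros cs × All (λ φ → fn φ (CA.comb cs es) K.≈ K.0#) φs
    kernel {suc u} es [] _ = η (K.1# ∷ replicate u K.0# , (λ z → 1≉0 (z zero)) , [])
    kernel {suc u} es (φ ∷ φs) (s≤s len) = do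
      no ¬all ← em (∀ i → fn φ (lookup es i) K.≈ K.0#)
        where yes all → do
                cs , nz , a ← kernel es φs (ℕₚ.≤-trans len (ℕₚ.n≤1+n u))
                η (cs , nz , zeros-fn φ cs es all ∷ a)
      -- Stability of equality in `K` turns the failure of the universal statement into a pivot,
      -- under double negation.
      i , pivot ← (λ k → ¬all (λ i → kstable (λ h → k (i , h))))
      let e₀ = lookup es i
          v = proj₁ (inverse (fn φ e₀) pivot)
          ratio : A.Carrier → K.Carrier
          ratio e = v K.* fn φ e
          red : A.Carrier → A.Carrier
          red e = e A.+ A.- (A.ι (ratio e) A.* e₀)
          es′ = remove es i
          ratioMap : LinMap A kAlg
          ratioMap = record
            { fn = ratio ; fn-cong = λ e → K.*-congˡ (fn-cong φ e)
            ; fn-+ = λ a b → K.trans (K.*-congˡ (fn-+ φ a b)) (K.distribˡ _ _ _)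
            ; fn-ι = λ k a → K.trans (K.*-congˡ (fn-ι φ k a)) (SK.solve 3 (λ v k x → v SK.:* (k SK.:* x) SK.:= k SK.:* (v SK.:* x)) K.refl v k _) }
          redMap : LinMap A A
          redMap = record
            { fn = red
            ; fn-cong = λ e → A.+-cong e (A.-‿cong (A.*-congʳ (A.ι-cong (fn-cong ratioMap e))))
            ; fn-+ = λ a b → A.trans (A.+-congˡ (A.-‿cong (A.*-congʳ (A.trans (A.ι-cong (fn-+ ratioMap a b)) (A.ι-+ _ _)))))
                (SA.solve 5 (λ a b x y e → (a SA.:+ b) SA.:- (x SA.:+ y) SA.:* e SA.:= (a SA.:- x SA.:* e) SA.:+ (b SA.:- y SA.:* e)) A.refl a b _ _ e₀)
            ; fn-ι = λ k a → A.trans (A.+-congˡ (A.-‿cong (A.*-congʳ (A.trans (A.ι-cong (fn-ι ratioMap k a)) (A.ι-* _ _)))))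
                (SA.solve 4 (λ k a x e → k SA.:* a SA.:- (k SA.:* x) SA.:* e SA.:= k SA.:* (a SA.:- x SA.:* e)) A.refl (A.ι k) a _ e₀) }
      cs , nz , a ← kernel (Vec.map red es′) φs len
      let c₀ = K.- ratio (CA.comb cs es′)
          eq : CA.comb (insert i c₀ cs) es A.≈ red (CA.comb cs es′)
          eq = A.trans (comb-insert i c₀ cs es) (A.trans (A.+-congʳ (A.*-congʳ (A.ι-neg _)))
             (SA.solve 3 (λ x e y → SA.:- x SA.:* e SA.:+ y SA.:= y SA.:- x SA.:* e) A.refl _ e₀ _))
          φ-red : ∀ x → fn φ (red x) K.≈ K.0#
          φ-red x = K.trans (fn-+ φ x _) (K.trans (K.+-congˡ (K.trans (fn-neg φ _) (K.-‿cong (K.trans (fn-ι φ _ e₀)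
             (K.trans (SK.solve 3 (λ v x p → (v SK.:* x) SK.:* p SK.:= (p SK.:* v) SK.:* x) K.refl v (fn φ x) (fn φ e₀))
               (K.trans (K.*-congʳ (proj₂ (inverse (fn φ e₀) pivot))) (K.*-identityˡ _))))))) (K.-‿inverseʳ _))
      η (insert i c₀ cs , (λ z → nz (zeros-insert i c₀ cs z)) ,
         K.trans (fn-cong φ eq) (φ-red _) ∷
         All.map (λ {ψ} p → K.trans (fn-cong ψ (A.trans eq (A.sym (comb-map redMap cs es′)))) p) a)
      where
      module SK = IntSolver kring
      fn-neg : ∀ (φ : Functional A) x → fn φ (A.- x) K.≈ K.- fn φ x
      fn-neg φ x = K.trans (fn-cong φ (A.trans (SA.solve 1 (λ x → SA.:- x SA.:= SA.:- SA.con (+ 1) SA.:* x) A.refl x)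
          (A.*-congʳ (A.sym (A.trans (A.ι-neg K.1#) (A.-‿cong A.ι-1))))))
        (K.trans (fn-ι φ _ x) (SK.solve 1 (λ y → SK.:- SK.con (+ 1) SK.:* y SK.:= SK.:- y) K.refl _))

  -- The number `dim n` is witnessed from both sides: `functionals` limits the size of independent
  -- families below degree `n`, and `basis` exhibits one of exactly that size.
  record GradedAlg : Set (lsuc (c ⊔ ℓ)) where
    field
      graded : GradedDomain c ℓ
    open GradedDomain graded public
    field
      ιHom : RingHom kring ring
    alg : KAlg
    alg = record { ring = ring ; ιHom = ιHom }
    open KAlg alg public using (ι)
    open CommutativeRing ring using (Carrier; _≈_; 0#)
    field
      ι-Lt : ∀ k → Lt 1 (ι k)
      dim : ℕ → ℕ
      functionals : ℕ → List (Functional alg)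
      functionals-length : ∀ n → length (functionals n) ≡ dim n
      detect : ∀ n {a} → Lt n a → All (λ φ → fn φ a K.≈ K.0#) (functionals n) → a ≈ 0#
      basis : ∀ n → Vec Carrier (dim n)
      basis-Lt : ∀ n i → Lt n (lookup (basis n) i)
      basis-indep : ∀ n → Comb.Indep alg (basis n)

  module GradedAlgProps (G : GradedAlg) where
    open GradedAlg G
    open KAlg alg hiding (ring; ιHom; ι)
    open Comb alg public

    ι*-Lt : ∀ {n} k {a} → Lt n a → Lt n (ι k * a)
    ι*-Lt k l = Lt-* (ι-Lt k) l ℕₚ.≤-refl

    comb-Lt : ∀ n {u} (cs : Vec K.Carrier u) es → (∀ i → Lt n (lookup es i)) → Lt n (comb cs es)
    comb-Lt n = comb-closed (Lt n) (0-Lt n) Lt-+ ι*-Lt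

    -- With more vectors than functionals, `kernel` would give a nontrivial combination killed by
    -- all of them, which is zero by `detect`.
    indep-dim : ∀ n {u} (es : Vec Carrier u) → (∀ i → Lt n (lookup es i)) → Indep es → u ≤ dim n
    indep-dim n {u} es les ind = ≤-stable λ h → kernel es (functionals n)
      (≡.subst (_< u) (≡.sym (functionals-length n)) (ℕₚ.≰⇒> h))
      λ { (cs , nz , a) → nz (ind cs (detect n (comb-Lt n cs es les) a)) }

  fieldAlg : GradedAlg
  fieldAlg = record
    { graded = FieldGraded.fieldGraded K
    ; ιHom = KAlg.ιHom kAlg
    ; ι-Lt = λ k → lift tt
    ; dim = λ { zero → 0 ; (suc n) → 1 }
    ; functionals = λ { zero → [] ; (suc n) → idF ∷ [] }
    ; functionals-length = λ { zero → ≡.refl ; (suc n) → ≡.refl }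
    ; detect = λ { zero l _ → l ; (suc n) _ (p ∷ _) → p }
    ; basis = λ { zero → [] ; (suc n) → K.1# ∷ [] }
    ; basis-Lt = λ { (suc n) _ → lift tt }
    ; basis-indep = λ { zero [] e () ; (suc n) (k ∷ []) e zero → K.trans (K.sym (K.trans (K.+-identityʳ _) (K.*-identityʳ k))) e } }
    where
    idF : LinMap kAlg kAlg
    idF = record { fn = λ a → a ; fn-cong = λ e → e ; fn-+ = λ _ _ → K.refl ; fn-ι = λ _ _ → K.refl }

  module PolyAlg (G : GradedAlg) where
    open GradedAlg G
    open GradedAlgProps G using (comb)
    private module R = KAlg alg
    open PolyRing ring
    open PolyGraded graded
    open PolyPrime graded

    polyKAlg : KAlg
    polyKAlg = record { ring = polyRing ; ιHom = constHom ∘ʰ ιHom }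
    private
      module P = KAlg polyKAlg
      module CP = Comb polyKAlg

    constMap : LinMap alg polyKAlg
    constMap = record { fn = const ; fn-cong = C.ap-cong ; fn-+ = C.ap-+ ; fn-ι = λ k a → C.ap-* _ _ }

    shiftMap : LinMap polyKAlg polyKAlg
    shiftMap = record
      { fn = λ f → R.0# ∷ f ; fn-cong = ∷-cong R.refl ; fn-+ = shift-⊕
      ; fn-ι = λ k f → P.trans (∷-cong R.refl (const-⊛ (ι k) f)) (P.sym (P.trans (const-⊛ (ι k) _) (∷-cong (R.zeroʳ _) P.refl))) }

    coefMap : ℕ → LinMap polyKAlg alg
    coefMap i = record
      { fn = λ f → coef f i ; fn-cong = λ e → at e i ; fn-+ = λ f g → coef-⊕ f g i
      ; fn-ι = λ k f → R.trans (at (const-⊛ (ι k) f) i) (coef-∙ (ι k) f i) }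

    tail : Poly → Poly
    tail [] = []
    tail (a ∷ f) = f

    coef-tail : ∀ f i → coef (tail f) i R.≈ coef f (suc i)
    coef-tail [] i = R.refl
    coef-tail (a ∷ f) i = R.refl

    tailMap : LinMap polyKAlg polyKAlg
    tailMap = record
      { fn = tail
      ; fn-cong = λ {f} {g} e → mk λ i → R.trans (coef-tail f i) (R.trans (at e (suc i)) (R.sym (coef-tail g i)))
      ; fn-+ = λ f g → mk λ i → R.trans (coef-tail (f ⊕ g) i) (R.trans (coef-⊕ f g (suc i))
          (R.sym (R.trans (coef-⊕ (tail f) (tail g) i) (R.+-cong (coef-tail f i) (coef-tail g i)))))
      ; fn-ι = λ k f → mk λ i → R.trans (coef-tail (const (ι k) ⊛ f) i) (R.trans (fn-ι (coefMap (suc i)) k f)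
          (R.sym (R.trans (fn-ι (coefMap i) k (tail f)) (R.*-congˡ (coef-tail f i))))) }

    -- Below degree `n + 1` the constant coefficient ranges below degree `n + 1`, and the remaining
    -- coefficients form a polynomial of degree below `n`.
    dimP : ℕ → ℕ
    dimP zero = 0
    dimP (suc n) = dim (suc n) ℕ.+ dimP n

    functionalsP : ℕ → List (Functional polyKAlg)
    functionalsP zero = []
    functionalsP (suc n) = List.map (_∘ˡ coefMap 0) (functionals (suc n)) List.++ List.map (_∘ˡ tailMap) (functionalsP n)

    functionalsP-length : ∀ n → length (functionalsP n) ≡ dimP n
    functionalsP-length zero = ≡.refl
    functionalsP-length (suc n) = ≡.trans (Listₚ.length-++ (List.map (_∘ˡ coefMap 0) (functionals (suc n))))
      (≡.cong₂ ℕ._+_ (≡.trans (Listₚ.length-map _ (functionals (suc n))) (functionals-length (suc n)))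
                     (≡.trans (Listₚ.length-map _ (functionalsP n)) (functionalsP-length n)))

    detectP : ∀ n {f} → LtP n f → All (λ φ → fn φ f K.≈ K.0#) (functionalsP n) → f ≋ []
    detectP zero l _ = LtP-zero l
    detectP (suc n) {f} l a = mk λ
      { zero → detect (suc n) (lt l 0 (suc n) ℕₚ.≤-refl) (Allₚ.map⁻ (Allₚ.++⁻ˡ _ a))
      ; (suc i) → R.trans (R.sym (coef-tail f i)) (at (detectP n {tail f}
          (mkLt λ i j h → Lt-cong (R.sym (coef-tail f i)) (lt l (suc i) j (s≤s h)))
          (Allₚ.map⁻ (Allₚ.++⁻ʳ (List.map (_∘ˡ coefMap 0) (functionals (suc n))) a))) i) }

    basisP : ∀ n → Vec Poly (dimP n)
    basisP zero = []
    basisP (suc n) = Vec.map const (basis (suc n)) ++ Vec.map (R.0# ∷_) (basisP n)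

    lookup-++ : ∀ {m n} (W : Poly → Set ℓ) (es : Vec Poly m) (fs : Vec Poly n) →
      (∀ i → W (lookup es i)) → (∀ i → W (lookup fs i)) → ∀ i → W (lookup (es ++ fs) i)
    lookup-++ W [] fs p q i = q i
    lookup-++ W (e ∷ es) fs p q zero = p zero
    lookup-++ W (e ∷ es) fs p q (suc i) = lookup-++ W es fs (λ i → p (suc i)) q i

    basisP-Lt : ∀ n i → LtP n (lookup (basisP n) i)
    basisP-Lt zero ()
    basisP-Lt (suc n) = lookup-++ (LtP (suc n)) (Vec.map const (basis (suc n))) (Vec.map (R.0# ∷_) (basisP n))
      (λ i → ≡.subst (LtP (suc n)) (≡.sym (Vecₚ.lookup-map i const (basis (suc n)))) (LtP-const (basis-Lt (suc n) i)))
      (λ i → ≡.subst (LtP (suc n)) (≡.sym (Vecₚ.lookup-map i (R.0# ∷_) (basisP n))) (LtP-shift (basisP-Lt n i)))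

    basisP-indep : ∀ n → CP.Indep (basisP n)
    basisP-indep zero [] e ()
    basisP-indep (suc n) cs e with Vec.splitAt (dim (suc n)) cs
    ... | ds , ds′ , ≡.refl = zeros-++ ds ds′
        (basis-indep (suc n) ds (R.trans (R.sym (R.+-identityʳ _)) (at eq 0)))
        (basisP-indep n ds′ (tail-≋0 eq))
      where
      eq : ((comb ds (basis (suc n)) R.+ R.0#) ∷ CP.comb ds′ (basisP n)) ≋ []
      eq = P.trans (P.sym (P.trans (CP.comb-++ ds ds′ (Vec.map const (basis (suc n))) _)
             (P.+-cong (comb-map constMap ds (basis (suc n))) (comb-map shiftMap ds′ (basisP n))))) e

    polyAlg : GradedAlg
    polyAlg = record
      { graded = polyGraded ; ιHom = constHom ∘ʰ ιHom ; ι-Lt = λ k → LtP-const (ι-Lt k)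
      ; dim = dimP ; functionals = functionalsP ; functionals-length = functionalsP-length ; detect = detectP
      ; basis = basisP ; basis-Lt = basisP-Lt ; basis-indep = basisP-indep }

-- Derivatives, roots and differential equations in characteristic `p`.

module NatMultiples {c ℓ} (R : CommutativeRing c ℓ) where
  open CommutativeRing R

  infixr 7 _×ⁿ_
  _×ⁿ_ : ℕ → Carrier → Carrier
  zero ×ⁿ a = 0#
  suc n ×ⁿ a = a + n ×ⁿ a

  ×ⁿ-cong : ∀ n {a b} → a ≈ b → n ×ⁿ a ≈ n ×ⁿ b
  ×ⁿ-cong zero e = refl
  ×ⁿ-cong (suc n) e = +-cong e (×ⁿ-cong n e)

  ×ⁿ-* : ∀ n a b → (n ×ⁿ a) * b ≈ n ×ⁿ (a * b)
  ×ⁿ-* zero a b = zeroˡ b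
  ×ⁿ-* (suc n) a b = trans (distribʳ b a _) (+-congˡ (×ⁿ-* n a b))

  ×ⁿ-+ : ∀ m n a → (m ℕ.+ n) ×ⁿ a ≈ m ×ⁿ a + n ×ⁿ a
  ×ⁿ-+ zero n a = sym (+-identityˡ _)
  ×ⁿ-+ (suc m) n a = trans (+-congˡ (×ⁿ-+ m n a)) (sym (+-assoc _ _ _))

  TorsionFree : ℕ → Set (c ⊔ ℓ)
  TorsionFree p = ∀ n a → 0 < n → n < p → n ×ⁿ a ≈ 0# → a ≈ 0#

module PolyMore {c ℓ} (G : GradedDomain c ℓ) where
  open GradedDomain G
  open CommutativeRing ring hiding (ring; zero)
  open PolyRing ring
  open PolyGraded G
  private
    module P = CommutativeRing polyRing
    module N = NatMultiples ring
    module NP = NatMultiples polyRing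
  open N using (_×ⁿ_)

  deriv-Lt : ∀ n f → LtP (suc n) f → LtP n (deriv f)
  deriv-Lt n [] l = LtP-[] n
  deriv-Lt zero (a ∷ f) l = LtP-⊕ (LtP-tail l) (LtP-cong {0} {[]} (P.sym (0∷-≋ (deriv-≋0 f (LtP-zero (LtP-tail l))))) (LtP-[] 0))
  deriv-Lt (suc n) (a ∷ f) l = LtP-⊕ (LtP-tail l) (LtP-shift (deriv-Lt n f (LtP-tail l)))

  eval-Lt : ∀ r → Lt 2 r → ∀ n f → LtP n f → Lt n (eval r f)
  eval-Lt r lr n [] l = 0-Lt n
  eval-Lt r lr zero (a ∷ f) l = Lt-cong (sym (Eval.eval-≋0 r (a ∷ f) (LtP-zero l))) (0-Lt 0)
  eval-Lt r lr (suc n) (a ∷ f) l = Lt-+ (lt l 0 (suc n) ℕₚ.≤-refl) (Lt-* lr (eval-Lt r lr n f (LtP-tail l)) ℕₚ.≤-refl)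

  coef-deriv : ∀ f i → coef (deriv f) i ≈ suc i ×ⁿ coef f (suc i)
  coef-deriv [] i = sym (trans (N.×ⁿ-cong (suc i) (sym (zeroʳ 0#))) (trans (sym (N.×ⁿ-* (suc i) 0# 0#)) (zeroʳ _)))
  coef-deriv (a ∷ f) zero = coef-⊕ f (0# ∷ deriv f) 0
  coef-deriv (a ∷ f) (suc i) = trans (coef-⊕ f (0# ∷ deriv f) (suc i)) (+-congˡ (coef-deriv f i))

  coef-×ⁿ : ∀ n f i → coef (n NP.×ⁿ f) i ≈ n ×ⁿ coef f i
  coef-×ⁿ zero f i = refl
  coef-×ⁿ (suc n) f i = trans (coef-⊕ f (n NP.×ⁿ f) i) (+-congˡ (coef-×ⁿ n f i))

  torsionFreeP : ∀ {p} → N.TorsionFree p → NP.TorsionFree p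
  torsionFreeP tf n f 0<n n<p e = mk λ i → tf n (coef f i) 0<n n<p (trans (sym (coef-×ⁿ n f i)) (at e i))

  -- Differentiation multiplies the coefficient of index `i` by `i`. For `0 < i < p` this loses
  -- nothing, and from index `p` on the coefficients vanish by the degree bound.
  deriv-zero : ∀ {p} → N.TorsionFree p → ∀ f → LtP p f → deriv f ≋ [] → f ≋ const (coef f 0)
  deriv-zero {p} tf f l e = mk λ
    { zero → refl
    ; (suc i) → higher i (suc i ℕ.<? p) }
    where
    higher : ∀ i → Dec (suc i < p) → coef f (suc i) ≈ 0#
    higher i (yes i<p) = tf (suc i) _ (s≤s z≤n) i<p (trans (sym (coef-deriv f i)) (at e i))
    higher i (no i≮p) = Lt-zero (lt l (suc i) 0 (ℕₚ.≤-trans (ℕₚ.≮⇒≥ i≮p) (ℕₚ.m≤m+n (suc i) 0)))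

  module LiftMore (D : Derivation ring) (lower : ∀ n a → Lt (suc n) a → Lt n (Derivation.δ D a)) where
    open LiftDerivation D
    mapδ-Lt : ∀ n f → LtP (suc n) f → LtP n (mapδ f)
    mapδ-Lt n f l = mkLt λ i j h → Lt-cong (sym (coef-mapδ f i)) (lower j _ (lt l i (suc j) (≡.subst (suc n ≤_) (≡.sym (ℕₚ.+-suc i j)) (s≤s h))))

CharAbove : ∀ {c ℓ} → StableField c ℓ → ℕ → Set ℓ
CharAbove K p = ∀ n → 0 < n → n < p → ¬ (n ×ⁿ 1# ≈ 0#)
  where
  open CommutativeRing (StableField.ring K)
  open NatMultiples (StableField.ring K)

module Univariate {c ℓ} (K : StableField c ℓ) (p : ℕ) (char : CharAbove K p) where
  open StableField K
  open FieldGraded K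
  open CommutativeRing ring hiding (ring; zero)
  open PolyRing ring
  open PolyGraded fieldGraded
  open PolyPrime fieldGraded using (DegLt; polyGraded)
  open PolyMore fieldGraded
  open NatMultiples ring
  private
    module S = IntSolver ring
    module P = CommutativeRing polyRing
    module SP = IntSolver polyRing
    module GP = GradedDomainProps polyGraded

  torsionFree : TorsionFree p
  torsionFree n a 0<n n<p e = mul-zero (char n 0<n n<p) (trans (×ⁿ-* n 1# a) (trans (×ⁿ-cong n (*-identityˡ a)) e))

  Lt⇒DegLt : ∀ {n f} → LtP n f → DegLt n f
  Lt⇒DegLt l i n≤i = lt l i 0 (ℕₚ.≤-trans n≤i (ℕₚ.m≤m+n i 0))

  DegLt⇒Lt : ∀ {n f} → DegLt n f → LtP n f
  DegLt⇒Lt d = mkLt λ { i zero h → d i (≡.subst (_ ≤_) (ℕₚ.+-identityʳ i) h) ; i (suc j) h → lift tt }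

  -- Synthetic division by `X - a`: the coefficients of the quotient are the Horner values of the
  -- tails.
  quotient : Carrier → Poly → Poly
  quotient a [] = []
  quotient a (k ∷ g) = eval a g ∷ quotient a g

  quotient-zero : ∀ a g → quotient a g ≋ [] → eval a g ≈ 0# → g ≋ []
  quotient-zero a [] q e = P.refl
  quotient-zero a (k ∷ g) q e = mk λ
    { zero → trans (trans (sym (+-identityʳ k)) (+-congˡ (sym (trans (*-congˡ (at q 0)) (zeroʳ a))))) e
    ; (suc i) → at (quotient-zero a g (tail-≋0 q) (at q 0)) i }

  quotient-eval : ∀ a x g → eval x g + - eval a g ≈ (x + - a) * eval x (quotient a g)
  quotient-eval a x [] = S.solve 2 (λ x a → S.con (+ 0) S.:- S.con (+ 0) S.:= (x S.:- a) S.:* S.con (+ 0)) refl x a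
  quotient-eval a x (k ∷ g) = begin
    (k + x * gx) + - (k + a * ga) ≈⟨ S.solve 5 (λ k x gx a ga → (k S.:+ x S.:* gx) S.:- (k S.:+ a S.:* ga) S.:= (x S.:- a) S.:* ga S.:+ x S.:* (gx S.:- ga)) refl k x gx a ga ⟩
    (x + - a) * ga + x * (gx + - ga) ≈⟨ +-congˡ (*-congˡ (quotient-eval a x g)) ⟩
    (x + - a) * ga + x * ((x + - a) * eval x (quotient a g)) ≈⟨ S.solve 4 (λ x a ga q → (x S.:- a) S.:* ga S.:+ x S.:* ((x S.:- a) S.:* q) S.:= (x S.:- a) S.:* (ga S.:+ x S.:* q)) refl x a ga _ ⟩
    (x + - a) * (ga + x * eval x (quotient a g)) ∎
    where
    open Relation.Binary.Reasoning.Setoid setoid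
    gx = eval x g
    ga = eval a g

  quotient-DegLt : ∀ n a g → DegLt (suc n) g → DegLt n (quotient a g)
  quotient-DegLt n a [] d i h = refl
  quotient-DegLt n a (k ∷ g) d zero z≤n = Eval.eval-≋0 a g (mk λ i → d (suc i) (s≤s z≤n))
  quotient-DegLt zero a (k ∷ g) d (suc i) h = quotient-DegLt zero a g (λ { i _ → d (suc i) (s≤s z≤n) }) i z≤n
  quotient-DegLt (suc n) a (k ∷ g) d (suc i) (s≤s h) = quotient-DegLt n a g (λ i h → d (suc i) (s≤s h)) i h

  few-roots : ∀ n g → LtP n g → ∀ xs → n ≤ length xs → AllPairs (λ x y → ¬ (x ≈ y)) xs → All (λ x → eval x g ≈ 0#) xs → g ≋ []
  few-roots zero g l xs h d a = LtP-zero l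
  few-roots (suc n) g l (x ∷ xs) (s≤s h) (dx ∷ d) (ax ∷ a) =
    quotient-zero x g (few-roots n (quotient x g) (DegLt⇒Lt (quotient-DegLt n x g (Lt⇒DegLt l))) xs h d (go xs dx a)) ax
    where
    go : ∀ ys → All (λ y → ¬ (x ≈ y)) ys → All (λ y → eval y g ≈ 0#) ys → All (λ y → eval y (quotient x g) ≈ 0#) ys
    go [] [] [] = []
    go (y ∷ ys) (x≉y ∷ ds) (ay ∷ as) = mul-zero (λ e → x≉y (trans (S.solve 2 (λ x y → x S.:= y S.:- (y S.:- x)) refl x y)
        (trans (+-congˡ (-‿cong e)) (S.solve 1 (λ y → y S.:- S.con (+ 0) S.:= y) refl y))))
      (trans (sym (quotient-eval x y g)) (trans (+-cong ay (-‿cong ax)) (S.solve 0 (S.con (+ 0) S.:- S.con (+ 0) S.:= S.con (+ 0)) refl))) ∷ go ys ds as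

  coef-top : ∀ f g m k → DegLt (suc m) f → DegLt (suc k) g → coef (f ⊛ g) (m ℕ.+ k) ≈ coef f m * coef g k
  coef-top [] g m k df dg = sym (zeroˡ _)
  coef-top (a ∷ f) g zero k df dg = trans (coef-⊕ (a ∙ g) (0# ∷ (f ⊛ g)) k)
    (trans (+-cong (coef-∙ a g k) (at (0∷-≋ (P.trans (P.*-congʳ {g} {f} {[]} (mk λ i → df (suc i) (s≤s z≤n))) P.refl)) k)) (+-identityʳ _))
  coef-top (a ∷ f) g (suc m) k df dg = trans (coef-⊕ (a ∙ g) (0# ∷ (f ⊛ g)) (suc (m ℕ.+ k)))
    (trans (+-cong (trans (coef-∙ a g (suc (m ℕ.+ k))) (trans (*-congˡ (dg _ (s≤s (ℕₚ.m≤n+m k m)))) (zeroʳ a)))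
                   (coef-top f g m k (λ i h → df (suc i) (s≤s h)) dg)) (+-identityˡ _))

  -- The Euler operator `X d/dX`; it multiplies coefficients by their index without shifting them,
  -- so leading terms can be compared directly.
  θ : Poly → Poly
  θ f = 0# ∷ deriv f

  coef-θ : ∀ f i → coef (θ f) i ≈ i ×ⁿ coef f i
  coef-θ f zero = refl
  coef-θ f (suc i) = coef-deriv f i

  ×ⁿ-zero : ∀ n → n ×ⁿ 0# ≈ 0#
  ×ⁿ-zero zero = refl
  ×ⁿ-zero (suc n) = trans (+-identityˡ _) (×ⁿ-zero n)

  θ-DegLt : ∀ {n} f → DegLt n f → DegLt n (θ f)
  θ-DegLt f d i h = trans (coef-θ f i) (trans (×ⁿ-cong i (d i h)) (×ⁿ-zero i))

  ×ⁿ-diff : ∀ k m a → m < p → k < m → k ×ⁿ a ≈ m ×ⁿ a → a ≈ 0#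
  ×ⁿ-diff k m a m<p k<m e = torsionFree (m ∸ k) a (ℕₚ.m<n⇒0<n∸m k<m) (ℕₚ.≤-<-trans (ℕₚ.m∸n≤m m k) m<p)
    (trans (S.solve 2 (λ x y → y S.:= (x S.:+ y) S.:- x) refl (k ×ⁿ a) ((m ∸ k) ×ⁿ a))
      (trans (+-congʳ (trans (sym (×ⁿ-+ k (m ∸ k) a)) (reflexive (≡.cong (_×ⁿ a) (ℕₚ.m+[n∸m]≡n (ℕₚ.<⇒≤ k<m))))))
        (trans (+-congˡ (-‿cong e)) (-‿inverseʳ _))))

  ×ⁿ-injective : ∀ k m a → k < p → m < p → ¬ (a ≈ 0#) → k ×ⁿ a ≈ m ×ⁿ a → k ≡ m
  ×ⁿ-injective k m a k<p m<p a≉0 e with ℕₚ.<-cmp k m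
  ... | tri≈ _ k≡m _ = k≡m
  ... | tri< k<m _ _ = ⊥-elim (a≉0 (×ⁿ-diff k m a m<p k<m e))
  ... | tri> _ _ m<k = ⊥-elim (a≉0 (×ⁿ-diff m k a k<p m<k (sym e)))

  lead : ∀ {n f} → n ≤ p → LtP n f → ¬ (f ≋ []) → ¬¬ ∃ λ m → m < p × DegLt (suc m) f × ¬ (coef f m ≈ 0#)
  lead {n} {f} n≤p l h = do
    m , lm , nl ← GP.exact-degree h
    η (m , ℕₚ.≰⇒> (λ p≤m → nl (LtP-mono (ℕₚ.≤-trans n≤p p≤m) l)) , Lt⇒DegLt lm ,
      λ z → nl (DegLt⇒Lt (λ i m≤i → low z i (ℕₚ.m≤n⇒m<n∨m≡n m≤i) (Lt⇒DegLt lm))))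
    where
    low : ∀ {m} → coef f m ≈ 0# → ∀ i → (m < i) ⊎ (m ≡ i) → DegLt (suc m) f → coef f i ≈ 0#
    low z i (inj₁ m<i) d = d i m<i
    low z i (inj₂ ≡.refl) d = z

  -- `U` and `Z` have the same logarithmic derivative. Let `m` be the degree of `Z` and choose `k`
  -- so that `Y = U - k Z` has no term of degree `m`. Then `Y` satisfies the same equation, and if
  -- it is nonzero, comparing leading terms under `θ` gives `deg Y = m` in the field. Both degrees
  -- are below `p`, so they are equal as numbers, a contradiction.
  proportional : ∀ {n U Z} → n ≤ p → LtP n U → LtP n Z → ¬ (Z ≋ []) → deriv U ⊛ Z ≋ U ⊛ deriv Z → ¬¬ ∃ λ k → U ≋ const k ⊛ Z
  proportional {n} {U} {Z} n≤p lU lZ Z≉0 e = do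
    m , m<p , dZ , Zm ← lead n≤p lZ Z≉0
    let v , vZ = inverse (coef Z m) Zm
        k = coef U m * v
        Y = U ⊕ (⊖ (const k ⊛ Z))
        lY : LtP n Y
        lY = LtP-⊕ lU (LtP-⊖ (LtP-⊛ (const k) (LtP-const {1} (lift tt)) lZ ℕₚ.≤-refl))
        Ym : coef Y m ≈ 0#
        Ym = trans (coef-⊕ U (⊖ (const k ⊛ Z)) m) (trans (+-congˡ (trans (coef-⊖ (const k ⊛ Z) m) (-‿cong
              (trans (at (const-⊛ k Z) m) (trans (coef-∙ k Z m) (trans (*-assoc _ _ _)
                (trans (*-congˡ (trans (*-comm v _) vZ)) (*-identityʳ _)))))))) (-‿inverseʳ _))
        dY : deriv Y ≋ deriv U ⊕ (⊖ (const k ⊛ deriv Z))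
        dY = P.trans (deriv-⊕ U _) (P.+-congˡ {deriv U} (P.trans (Derivation.δ-neg derivation (const k ⊛ Z))
               (⊖-cong (P.trans (deriv-cong (const-⊛ k Z)) (P.trans (deriv-∙ k Z) (P.sym (const-⊛ k (deriv Z))))))))
        ode : deriv Y ⊛ Z ≋ Y ⊛ deriv Z
        ode = begin
          deriv Y ⊛ Z ≈⟨ P.*-congʳ {Z} dY ⟩
          (deriv U ⊕ (⊖ (const k ⊛ deriv Z))) ⊛ Z ≈⟨ SP.solve 4 (λ u k z z′ → (u SP.:- k SP.:* z′) SP.:* z SP.:= u SP.:* z SP.:- k SP.:* z SP.:* z′) P.refl (deriv U) (const k) Z (deriv Z) ⟩
          (deriv U ⊛ Z) ⊕ (⊖ ((const k ⊛ Z) ⊛ deriv Z)) ≈⟨ P.+-congʳ {⊖ ((const k ⊛ Z) ⊛ deriv Z)} e ⟩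
          (U ⊛ deriv Z) ⊕ (⊖ ((const k ⊛ Z) ⊛ deriv Z)) ≈⟨ SP.solve 3 (λ u x z′ → u SP.:* z′ SP.:- x SP.:* z′ SP.:= (u SP.:- x) SP.:* z′) P.refl U (const k ⊛ Z) (deriv Z) ⟩
          Y ⊛ deriv Z ∎
        θode : θ Y ⊛ Z ≋ Y ⊛ θ Z
        θode = P.trans (0∷-⊛ (deriv Y) Z) (P.trans (∷-cong refl (P.trans ode (P.*-comm Y (deriv Z))))
               (P.trans (P.sym (0∷-⊛ (deriv Z) Y)) (P.*-comm (θ Z) Y)))
    no Y≉0 ← em (Y ≋ [])
      where yes z → η (k , P.trans (SP.solve 2 (λ u x → u SP.:= (u SP.:- x) SP.:+ x) P.refl U (const k ⊛ Z))
                         (P.trans (P.+-congʳ {const k ⊛ Z} z) P.refl))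
    j , j<p , dY′ , Yj ← lead n≤p lY Y≉0
    let YZ = λ z → Zm (mul-zero Yj z)
        eq : j ×ⁿ (coef Y j * coef Z m) ≈ m ×ⁿ (coef Y j * coef Z m)
        eq = trans (sym (×ⁿ-* j _ _)) (trans (*-congʳ (sym (coef-θ Y j))) (trans (sym (coef-top (θ Y) Z j m (θ-DegLt Y dY′) dZ))
             (trans (at θode (j ℕ.+ m)) (trans (coef-top Y (θ Z) j m dY′ (θ-DegLt Z dZ)) (trans (*-congˡ (coef-θ Z m))
             (trans (*-comm _ _) (trans (×ⁿ-* m _ _) (×ⁿ-cong m (*-comm _ _)))))))))
    ⊥-elim (Yj (≡.subst (λ i → coef Y i ≈ 0#) (≡.sym (×ⁿ-injective j m _ j<p m<p YZ eq)) Ym))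
    where
    open Relation.Binary.Reasoning.Setoid P.setoid

-- Lines in the space of symmetric matrices and polynomials on it.

-- The line y = u - ρx, z = v - ρy. Identifying (x , y , z) with the symmetric matrix g = [[x , y] , [y , z]],
-- it consists of the g with g (ρ , 1) = (u , v).
record NullLine {c ℓ} (K : StableField c ℓ) : Set c where
  constructor nullLine
  open CommutativeRing (StableField.ring K)
  field ρ u v : Carrier
  yAt zAt : Carrier → Carrier
  yAt x = u + - ρ * x
  zAt x = (v + - (ρ * u)) + ρ * ρ * x

SameNullLine : ∀ {c ℓ} {K : StableField c ℓ} (a b : NullLine K) → Set ℓ
SameNullLine {K = K} a b = NullLine.ρ a ≈ NullLine.ρ b × NullLine.u a ≈ NullLine.u b × NullLine.v a ≈ NullLine.v b
  where
  open CommutativeRing (StableField.ring K)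

module GradedAlgOps {c ℓ} (K : StableField c ℓ) (G : Linear.GradedAlg K) where
  open Linear.GradedAlg G public using (graded; Lt; dim; alg)
  open GradedDomain graded public hiding (ring; Lt)
  open GradedDomainProps graded public
  open Linear.KAlg alg public

-- The ring R of polynomials in x, y, z and the ring B of polynomials in x; ev restricts to a line,
-- which is parametrised by x, and pt evaluates.
record Ambient {c ℓ} (K : StableField c ℓ) (p : ℕ) : Set (lsuc (c ⊔ ℓ)) where
  open Linear K public
  open StableField K using () renaming (ring to kring)
  module K = CommutativeRing kring
  field
    R B : GradedAlg
  module R = GradedAlgOps K R
  module B = GradedAlgOps K B
  field
    ev : NullLine K → RingHom R.ring B.ring
    pt : K.Carrier → RingHom B.ring kring
    inj : RingHom B.ring R.ring
    ∂x ∂y ∂z : Derivation R.ring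
    d : Derivation B.ring
    X : B.Carrier
  module E (a : NullLine K) = RingHom (ev a)
  module Pt (x : K.Carrier) = RingHom (pt x)
  module J = RingHom inj
  module Dx = Derivation ∂x
  module Dy = Derivation ∂y
  module Dz = Derivation ∂z
  module D = Derivation d
  field
    ev-ι : ∀ a k → E.ap a (R.ι k) B.≈ B.ι k
    ev-inj : ∀ a g → E.ap a (J.ap g) B.≈ g
    ev-Lt : ∀ a n {f} → R.Lt n f → B.Lt n (E.ap a f)
    inj-ι : ∀ k → J.ap (B.ι k) R.≈ R.ι k
    inj-Lt : ∀ n {g} → B.Lt n g → R.Lt n (J.ap g)
    pt-ι : ∀ x k → Pt.ap x (B.ι k) K.≈ k
    pt-X : ∀ x → Pt.ap x X K.≈ x
    X-Lt : B.Lt 2 X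
    d-ι : ∀ k → D.δ (B.ι k) B.≈ B.0#
    d-X : D.δ X B.≈ B.1#
    d-Lt : ∀ n g → B.Lt (suc n) g → B.Lt n (D.δ g)
    ∂x-Lt : ∀ n f → R.Lt (suc n) f → R.Lt n (Dx.δ f)
    ∂y-Lt : ∀ n f → R.Lt (suc n) f → R.Lt n (Dy.δ f)
    ∂z-Lt : ∀ n f → R.Lt (suc n) f → R.Lt n (Dz.δ f)
    ∂y∂x : ∀ f → Dy.δ (Dx.δ f) R.≈ Dx.δ (Dy.δ f)
    ∂z∂x : ∀ f → Dz.δ (Dx.δ f) R.≈ Dx.δ (Dz.δ f)
    ∂z∂y : ∀ f → Dz.δ (Dy.δ f) R.≈ Dy.δ (Dz.δ f)
    meet : ∀ a b x → NullLine.yAt a x K.≈ NullLine.yAt b x → NullLine.zAt a x K.≈ NullLine.zAt b x →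
      ∀ f → Pt.ap x (E.ap a f) K.≈ Pt.ap x (E.ap b f)
    -- Along the line, `y` changes at rate `-ρ` and `z` at rate `ρ²`; this direction is isotropic
    -- for the determinant `x z - y²`.
    chain : ∀ a f → D.δ (E.ap a f) B.≈
      E.ap a (Dx.δ f) B.+ (B.- B.ι (NullLine.ρ a) B.* E.ap a (Dy.δ f) B.+ B.ι (NullLine.ρ a) B.* B.ι (NullLine.ρ a) B.* E.ap a (Dz.δ f))
    few-roots : ∀ n g → B.Lt n g → ∀ xs → n ≤ length xs → AllPairs (λ x y → ¬ (x K.≈ y)) xs →
      All (λ x → Pt.ap x g K.≈ K.0#) xs → g B.≈ B.0#
    proportional : ∀ {n U Z} → n ≤ p → B.Lt n U → B.Lt n Z → ¬ (Z B.≈ B.0#) → D.δ U B.* Z B.≈ U B.* D.δ Z →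
      ¬¬ ∃ λ k → U B.≈ B.ι k B.* Z
    constant : ∀ f → R.Lt p f → Dx.δ f R.≈ R.0# → Dy.δ f R.≈ R.0# → Dz.δ f R.≈ R.0# → R.Lt 1 f
    separate : ∀ a b → ¬ SameNullLine a b → ¬¬ ∃ λ h → R.Lt 2 h × E.ap b h B.≈ B.0# × ¬ (E.ap a h B.≈ B.0#)
    dim-B : ∀ n → B.dim n ≡ n
    dim-lower : ∀ n → n ℕ.* n ℕ.* n ≤ 6 ℕ.* R.dim n
    dim-upper : ∀ n k → R.dim (k ℕ.+ n) ≤ R.dim n ℕ.+ k ℕ.* ((k ℕ.+ n) ℕ.* (k ℕ.+ n))

-- What is needed about the ring S of polynomials in one variable over R.
record PolyExt {c ℓ} (K : StableField c ℓ) (R : Linear.GradedAlg K) : Set (lsuc (c ⊔ ℓ)) where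
  field
    S : Linear.GradedAlg K
  module R = GradedAlgOps K R
  module S = GradedAlgOps K S
  field
    const : RingHom R.ring S.ring
    eval : R.Carrier → RingHom S.ring R.ring
    X : S.Carrier
    deriv : Derivation S.ring
    lifted : Derivation R.ring → Derivation S.ring
  module C = RingHom const
  module Ev (r : R.Carrier) = RingHom (eval r)
  module D = Derivation deriv
  module L (δ : Derivation R.ring) = Derivation (lifted δ)
  module NR = NatMultiples R.ring
  module NS = NatMultiples S.ring
  field
    const-ι : ∀ k → C.ap (R.ι k) S.≈ S.ι k
    const-Lt : ∀ {n a} → R.Lt n a → S.Lt n (C.ap a)
    const-injective : ∀ {a b} → C.ap a S.≈ C.ap b → a R.≈ b
    eval-const : ∀ r a → Ev.ap r (C.ap a) R.≈ a
    eval-X : ∀ r → Ev.ap r X R.≈ r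
    eval-Lt : ∀ r → R.Lt 2 r → ∀ n f → S.Lt n f → R.Lt n (Ev.ap r f)
    X-Lt : S.Lt 2 X
    hom-ext : (T : CommutativeRing c ℓ) (g h : RingHom S.ring T) →
      (∀ a → CommutativeRing._≈_ T (RingHom.ap g (C.ap a)) (RingHom.ap h (C.ap a))) →
      CommutativeRing._≈_ T (RingHom.ap g X) (RingHom.ap h X) → ∀ f → CommutativeRing._≈_ T (RingHom.ap g f) (RingHom.ap h f)
    deriv-const : ∀ a → D.δ (C.ap a) S.≈ S.0#
    deriv-X : D.δ X S.≈ S.1#
    deriv-Lt : ∀ n f → S.Lt (suc n) f → S.Lt n (D.δ f)
    deriv-zero : ∀ {p} → NR.TorsionFree p → ∀ f → S.Lt p f → D.δ f S.≈ S.0# → ∃ λ a → R.Lt p a × f S.≈ C.ap a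
    torsionFree : ∀ {p} → NR.TorsionFree p → NS.TorsionFree p
    lift-const : ∀ δ a → L.δ δ (C.ap a) S.≈ C.ap (Derivation.δ δ a)
    lift-Lt : ∀ δ → (∀ n a → R.Lt (suc n) a → R.Lt n (Derivation.δ δ a)) → ∀ n f → S.Lt (suc n) f → S.Lt n (L.δ δ f)
    deriv-lift : ∀ δ f → D.δ (L.δ δ f) S.≈ L.δ δ (D.δ f)
    lift-lift : ∀ δ₁ δ₂ → (∀ a → Derivation.δ δ₁ (Derivation.δ δ₂ a) R.≈ Derivation.δ δ₂ (Derivation.δ δ₁ a)) →
      ∀ f → L.δ δ₁ (L.δ δ₂ f) S.≈ L.δ δ₂ (L.δ δ₁ f)
    chain-rule : ∀ δ r f → Derivation.δ δ (Ev.ap r f) R.≈ Ev.ap r (L.δ δ f) R.+ Derivation.δ δ r R.* Ev.ap r (D.δ f)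
    dim-zero : S.dim 0 ≡ 0
    dim-suc : ∀ n → S.dim (suc n) ≡ R.dim (suc n) ℕ.+ S.dim n

module PolyExtension {c ℓ} (K : StableField c ℓ) (A : Linear.GradedAlg K) where
  open Linear K
  open GradedAlg A using (graded)
  open GradedDomain graded using (ring; Lt-cong; Lt-mono; 0-Lt; Lt; 1-Lt)
  open CommutativeRing ring hiding (ring; zero)
  open PolyRing ring
  open PolyGraded graded
  open PolyMore graded
  private module P = CommutativeRing polyRing

  Xᴾ : Poly
  Xᴾ = 0# ∷ const 1#

  split : ∀ a f → (a ∷ f) ≋ const a ⊕ (Xᴾ ⊛ f)
  split a f = P.trans (∷-cong (sym (+-identityʳ a)) P.refl) (P.+-congˡ {const a} (P.sym (X⊛ f)))

  polyExt : PolyExt K A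
  polyExt = record
    { S = PolyAlg.polyAlg A
    ; const = constHom ; eval = evalHom ; X = Xᴾ ; deriv = derivation ; lifted = LiftDerivation.coefficientwise
    ; const-ι = λ k → P.refl
    ; const-Lt = LtP-const
    ; const-injective = const-cong⁻¹
    ; eval-const = eval-const
    ; eval-X = λ r → trans (+-identityˡ _) (trans (*-congˡ (eval-const r 1#)) (*-identityʳ r))
    ; eval-Lt = eval-Lt
    ; X-Lt = LtP-shift (LtP-const 1-Lt)
    ; hom-ext = ext
    ; deriv-const = λ a → 0∷-≋ P.refl
    ; deriv-X = P.trans (P.+-congˡ {const 1#} (0∷-≋ (0∷-≋ P.refl))) P.refl
    ; deriv-Lt = deriv-Lt
    ; deriv-zero = λ tf f l e → coef f 0 , lt l 0 _ ℕₚ.≤-refl , deriv-zero tf f l e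
    ; torsionFree = torsionFreeP
    ; lift-const = λ δ a → P.refl
    ; lift-Lt = LiftMore.mapδ-Lt
    ; deriv-lift = LiftDerivation.deriv-mapδ
    ; lift-lift = λ δ₁ δ₂ comm f → mk λ i →
        trans (LiftDerivation.coef-mapδ δ₁ (LiftDerivation.mapδ δ₂ f) i) (trans (Derivation.δ-cong δ₁ (LiftDerivation.coef-mapδ δ₂ f i))
        (trans (comm (coef f i)) (sym (trans (LiftDerivation.coef-mapδ δ₂ (LiftDerivation.mapδ δ₁ f) i) (Derivation.δ-cong δ₂ (LiftDerivation.coef-mapδ δ₁ f i))))))
    ; chain-rule = λ δ r f → LiftDerivation.chain-rule δ r f
    ; dim-zero = ≡.refl ; dim-suc = λ n → ≡.refl }
    where
    ext : (T : CommutativeRing _ _) (g h : RingHom polyRing T) →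
      (∀ a → CommutativeRing._≈_ T (RingHom.ap g (const a)) (RingHom.ap h (const a))) →
      CommutativeRing._≈_ T (RingHom.ap g Xᴾ) (RingHom.ap h Xᴾ) → ∀ f → CommutativeRing._≈_ T (RingHom.ap g f) (RingHom.ap h f)
    ext T g h ec eX [] = T.trans (RingHom.ap-0 g) (T.sym (RingHom.ap-0 h))
      where
      module T = CommutativeRing T
    ext T g h ec eX (a ∷ f) = T.trans (expand g) (T.trans (T.+-cong (ec a) (T.*-cong eX (ext T g h ec eX f))) (T.sym (expand h)))
      where
      module T = CommutativeRing T
      expand : (g : RingHom polyRing T) → RingHom.ap g (a ∷ f) T.≈ RingHom.ap g (const a) T.+ RingHom.ap g Xᴾ T.* RingHom.ap g f
      expand g = T.trans (RingHom.ap-cong g (split a f)) (T.trans (RingHom.ap-+ g (const a) (Xᴾ ⊛ f)) (T.+-congˡ (RingHom.ap-* g Xᴾ f)))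

record UnivariateExt {c ℓ} (K : StableField c ℓ) (p : ℕ) : Set (lsuc (c ⊔ ℓ)) where
  field
    ext : PolyExt K (Linear.fieldAlg K)
  open PolyExt ext public
  open StableField K using () renaming (ring to kring)
  module K = CommutativeRing kring
  field
    torsionFreeK : NatMultiples.TorsionFree kring p
    few-roots : ∀ n g → S.Lt n g → ∀ xs → n ≤ length xs → AllPairs (λ x y → ¬ (x K.≈ y)) xs →
      All (λ x → Ev.ap x g K.≈ K.0#) xs → g S.≈ S.0#
    proportional : ∀ {n U Z} → n ≤ p → S.Lt n U → S.Lt n Z → ¬ (Z S.≈ S.0#) → D.δ U S.* Z S.≈ U S.* D.δ Z →
      ¬¬ ∃ λ k → U S.≈ S.ι k S.* Z
    dim-value : ∀ n → S.dim n ≡ n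

univariateExt : ∀ {c ℓ} (K : StableField c ℓ) p → CharAbove K p → UnivariateExt K p
univariateExt K p char = record
  { ext = PolyExtension.polyExt K (Linear.fieldAlg K)
  ; torsionFreeK = Univariate.torsionFree K p char
  ; few-roots = Univariate.few-roots K p char
  ; proportional = Univariate.proportional K p char
  ; dim-value = dim }
  where
  dim : ∀ n → Linear.GradedAlg.dim (PolyExt.S (PolyExtension.polyExt K (Linear.fieldAlg K))) n ≡ n
  dim zero = ≡.refl
  dim (suc n) = ≡.cong suc (dim n)

-- Polynomials in three variables as an iterated extension.

module AffineSpace {c ℓ} (K : StableField c ℓ) (p : ℕ) (U₁ : UnivariateExt K p)
    (E₂ : PolyExt K (UnivariateExt.S U₁)) (E₃ : PolyExt K (PolyExt.S E₂)) where
  open StableField K using (stable) renaming (ring to kring)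
  module F = CommutativeRing kring
  module P₁ = UnivariateExt U₁
  module P₂ = PolyExt E₂
  module P₃ = PolyExt E₃
  module R₁ = P₁.S
  module R₂ = P₂.S
  module R₃ = P₃.S
  module SK = IntSolver kring
  module S₁ = IntSolver R₁.ring

  ∂x ∂y ∂z : Derivation R₃.ring
  ∂x = P₃.lifted (P₂.lifted P₁.deriv)
  ∂y = P₃.lifted P₂.deriv
  ∂z = P₃.deriv

  line₁ : F.Carrier → F.Carrier → R₁.Carrier
  line₁ s t = R₁.ι s R₁.+ R₁.ι t R₁.* P₁.X

  ι-Lt : ∀ k → R₁.Lt 1 (R₁.ι k)
  ι-Lt = Linear.GradedAlg.ι-Lt P₁.S

  line₁-Lt : ∀ s t → R₁.Lt 2 (line₁ s t)
  line₁-Lt s t = R₁.Lt-+ (R₁.Lt-mono (s≤s z≤n) (ι-Lt s)) (R₁.Lt-* (ι-Lt t) P₁.X-Lt ℕₚ.≤-refl)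

  eval-ι : ∀ x k → P₁.Ev.ap x (R₁.ι k) F.≈ k
  eval-ι x k = F.trans (P₁.Ev.ap-cong x (R₁.sym (P₁.const-ι k))) (P₁.eval-const x k)

  deriv-ι : ∀ k → P₁.D.δ (R₁.ι k) R₁.≈ R₁.0#
  deriv-ι k = R₁.trans (P₁.D.δ-cong (R₁.sym (P₁.const-ι k))) (P₁.deriv-const k)

  line₁-eval : ∀ s t x → P₁.Ev.ap x (line₁ s t) F.≈ s F.+ t F.* x
  line₁-eval s t x = F.trans (P₁.Ev.ap-+ x _ _) (F.+-cong (eval-ι x s) (F.trans (P₁.Ev.ap-* x _ _) (F.*-cong (eval-ι x t) (P₁.eval-X x))))

  line₁-deriv : ∀ s t → P₁.D.δ (line₁ s t) R₁.≈ R₁.ι t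
  line₁-deriv s t = R₁.trans (P₁.D.δ-+ _ _) (R₁.trans (R₁.+-cong (deriv-ι s)
    (R₁.trans (P₁.D.δ-* _ _) (R₁.+-cong (R₁.trans (R₁.*-congʳ (deriv-ι t)) (R₁.zeroˡ _)) (R₁.*-congˡ P₁.deriv-X))))
    (S₁.solve 1 (λ t → S₁.con (+ 0) S₁.:+ (S₁.con (+ 0) S₁.:+ t S₁.:* S₁.con (+ 1)) S₁.:= t) R₁.refl (R₁.ι t)))

  ι-zero : ∀ {k} → R₁.ι k R₁.≈ R₁.0# → k F.≈ F.0#
  ι-zero {k} e = F.trans (F.sym (eval-ι F.0# k)) (F.trans (P₁.Ev.ap-cong F.0# e) (P₁.Ev.ap-0 F.0#))

  line₁-zero : ∀ s t → line₁ s t R₁.≈ R₁.0# → s F.≈ F.0# × t F.≈ F.0#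
  line₁-zero s t e =
    F.trans (SK.solve 2 (λ s t → s SK.:= s SK.:+ t SK.:* SK.con (+ 0)) F.refl s t)
      (F.trans (F.sym (line₁-eval s t F.0#)) (F.trans (P₁.Ev.ap-cong F.0# e) (P₁.Ev.ap-0 F.0#))) ,
    ι-zero (R₁.trans (R₁.sym (line₁-deriv s t)) (R₁.trans (P₁.D.δ-cong e) P₁.D.δ-0))

  line₁-cong : ∀ {s s′ t t′} → s F.≈ s′ → t F.≈ t′ → line₁ s t R₁.≈ line₁ s′ t′
  line₁-cong es et = R₁.+-cong (R₁.ι-cong es) (R₁.*-congʳ (R₁.ι-cong et))

  module _ (a : NullLine K) where
    open NullLine a

    Y Z : R₁.Carrier
    Y = line₁ u (F.- ρ)
    Z = line₁ (v F.+ F.- (ρ F.* u)) (ρ F.* ρ)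

    evZ : RingHom R₃.ring R₂.ring
    evZ = P₃.eval (P₂.C.ap Z)

    ev : RingHom R₃.ring R₁.ring
    ev = P₂.eval Y ∘ʰ evZ
    module Ev = RingHom ev
    module EvY = RingHom (P₂.eval Y)
    module EvZ = RingHom evZ

    ev-const : ∀ g → Ev.ap (P₃.C.ap (P₂.C.ap g)) R₁.≈ g
    ev-const g = R₁.trans (EvY.ap-cong (P₃.eval-const _ _)) (P₂.eval-const Y g)

    ev-y : Ev.ap (P₃.C.ap P₂.X) R₁.≈ Y
    ev-y = R₁.trans (EvY.ap-cong (P₃.eval-const _ _)) (P₂.eval-X Y)

    ev-z : Ev.ap P₃.X R₁.≈ Z
    ev-z = R₁.trans (EvY.ap-cong (P₃.eval-X _)) (P₂.eval-const Y Z)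

    ev-Lt : ∀ n {f} → R₃.Lt n f → R₁.Lt n (Ev.ap f)
    ev-Lt n {f} l = P₂.eval-Lt Y (line₁-Lt _ _) n _ (P₃.eval-Lt _ (P₂.const-Lt (line₁-Lt _ _)) n f l)

    chain : ∀ f → P₁.D.δ (Ev.ap f) R₁.≈
      Ev.ap (Derivation.δ ∂x f) R₁.+ (R₁.- R₁.ι ρ R₁.* Ev.ap (Derivation.δ ∂y f) R₁.+ R₁.ι ρ R₁.* R₁.ι ρ R₁.* Ev.ap (Derivation.δ ∂z f))
    chain f = begin
      P₁.D.δ (EvY.ap g) ≈⟨ P₂.chain-rule P₁.deriv Y g ⟩
      EvY.ap (P₂.L.δ P₁.deriv g) R₁.+ P₁.D.δ Y R₁.* EvY.ap (P₂.D.δ g) ≈⟨ R₁.+-cong xpart (R₁.*-cong (R₁.trans (line₁-deriv _ _) (R₁.ι-neg ρ)) ypart) ⟩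
      (fx R₁.+ R₁.ι ρ R₁.* R₁.ι ρ R₁.* fz) R₁.+ R₁.- R₁.ι ρ R₁.* fy
        ≈⟨ S₁.solve 3 (λ x y z → (x S₁.:+ y) S₁.:+ z S₁.:= x S₁.:+ (z S₁.:+ y)) R₁.refl fx (R₁.ι ρ R₁.* R₁.ι ρ R₁.* fz) (R₁.- R₁.ι ρ R₁.* fy) ⟩
      fx R₁.+ (R₁.- R₁.ι ρ R₁.* fy R₁.+ R₁.ι ρ R₁.* R₁.ι ρ R₁.* fz) ∎
      where
      open Relation.Binary.Reasoning.Setoid R₁.setoid
      g = EvZ.ap f
      fx = Ev.ap (Derivation.δ ∂x f)
      fy = Ev.ap (Derivation.δ ∂y f)
      fz = Ev.ap (Derivation.δ ∂z f)
      xpart : EvY.ap (P₂.L.δ P₁.deriv g) R₁.≈ fx R₁.+ R₁.ι ρ R₁.* R₁.ι ρ R₁.* fz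
      xpart = R₁.trans (EvY.ap-cong (P₃.chain-rule (P₂.lifted P₁.deriv) (P₂.C.ap Z) f)) (R₁.trans (EvY.ap-+ _ _)
        (R₁.+-congˡ (R₁.trans (EvY.ap-* _ _) (R₁.*-congʳ (R₁.trans (EvY.ap-cong (P₂.lift-const P₁.deriv Z))
          (R₁.trans (P₂.eval-const Y _) (R₁.trans (line₁-deriv _ _) (R₁.ι-* ρ ρ))))))))
      ypart : EvY.ap (P₂.D.δ g) R₁.≈ fy
      ypart = EvY.ap-cong (R₂.trans (P₃.chain-rule P₂.deriv (P₂.C.ap Z) f)
        (R₂.trans (R₂.+-congˡ (R₂.trans (R₂.*-congʳ (P₂.deriv-const Z)) (R₂.zeroˡ _))) (R₂.+-identityʳ _)))

  meet : ∀ a b x → NullLine.yAt a x F.≈ NullLine.yAt b x → NullLine.zAt a x F.≈ NullLine.zAt b x →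
    ∀ f → P₁.Ev.ap x (Ev.ap a f) F.≈ P₁.Ev.ap x (Ev.ap b f)
  meet a b x ey ez = P₃.hom-ext kring (P₁.eval x ∘ʰ ev a) (P₁.eval x ∘ʰ ev b)
    (P₂.hom-ext kring ((P₁.eval x ∘ʰ ev a) ∘ʰ P₃.const) ((P₁.eval x ∘ʰ ev b) ∘ʰ P₃.const)
      (λ g → P₁.Ev.ap-cong x (R₁.trans (ev-const a g) (R₁.sym (ev-const b g))))
      (F.trans (P₁.Ev.ap-cong x (ev-y a)) (F.trans (line₁-eval _ _ x) (F.trans ey (F.sym (F.trans (P₁.Ev.ap-cong x (ev-y b)) (line₁-eval _ _ x)))))))
    (F.trans (P₁.Ev.ap-cong x (ev-z a)) (F.trans (line₁-eval _ _ x) (F.trans ez (F.sym (F.trans (P₁.Ev.ap-cong x (ev-z b)) (line₁-eval _ _ x))))))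

  -- Integrates one variable at a time: below degree `p` a vanishing derivative eliminates the
  -- variable, first `z`, then `y`, then `x`.
  constant : ∀ f → R₃.Lt p f → Derivation.δ ∂x f R₃.≈ R₃.0# → Derivation.δ ∂y f R₃.≈ R₃.0# → Derivation.δ ∂z f R₃.≈ R₃.0# → R₃.Lt 1 f
  constant f l ex ey ez with P₃.deriv-zero (P₂.torsionFree (P₁.torsionFree P₁.torsionFreeK)) f l ez
  ... | g , lg , f≈ with P₂.deriv-zero (P₁.torsionFree P₁.torsionFreeK) g lg
          (P₃.const-injective (R₃.trans (R₃.sym (P₃.lift-const P₂.deriv g)) (R₃.trans (Derivation.δ-cong ∂y (R₃.sym f≈)) (R₃.trans ey (R₃.sym P₃.C.ap-0)))))
  ... | h , lh , g≈ with P₁.deriv-zero P₁.torsionFreeK h lh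
          (P₂.const-injective (P₃.const-injective (R₃.trans (P₃.C.ap-cong (R₂.sym (P₂.lift-const P₁.deriv h)))
            (R₃.trans (R₃.sym (P₃.lift-const (P₂.lifted P₁.deriv) (P₂.C.ap h)))
            (R₃.trans (Derivation.δ-cong ∂x (R₃.sym (R₃.trans f≈ (P₃.C.ap-cong g≈))))
            (R₃.trans ex (R₃.sym (R₃.trans (P₃.C.ap-cong P₂.C.ap-0) P₃.C.ap-0))))))))
  ... | k , _ , h≈ = R₃.Lt-cong (R₃.sym (R₃.trans f≈ (P₃.C.ap-cong (R₂.trans g≈ (P₂.C.ap-cong (R₁.trans h≈ (P₁.const-ι k)))))))
          (P₃.const-Lt (P₂.const-Lt (ι-Lt k)))

  inj : RingHom R₁.ring R₃.ring
  inj = P₃.const ∘ʰ P₂.const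
  module J = RingHom inj

  -- The two linear forms y + ρx - u and z + ρy - v cutting out the line b.
  form₁ form₂ : NullLine K → R₃.Carrier
  form₁ b = P₃.C.ap P₂.X R₃.+ J.ap (line₁ (F.- NullLine.u b) (NullLine.ρ b))
  form₂ b = P₃.X R₃.+ (J.ap (R₁.ι (NullLine.ρ b)) R₃.* P₃.C.ap P₂.X R₃.+ J.ap (R₁.ι (F.- NullLine.v b)))

  J-Lt : ∀ {n g} → R₁.Lt n g → R₃.Lt n (J.ap g)
  J-Lt l = P₃.const-Lt (P₂.const-Lt l)

  form₁-Lt : ∀ b → R₃.Lt 2 (form₁ b)
  form₁-Lt b = R₃.Lt-+ (P₃.const-Lt P₂.X-Lt) (J-Lt (line₁-Lt _ _))

  form₂-Lt : ∀ b → R₃.Lt 2 (form₂ b)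
  form₂-Lt b = R₃.Lt-+ P₃.X-Lt (R₃.Lt-+ (R₃.Lt-* (J-Lt (ι-Lt _)) (P₃.const-Lt P₂.X-Lt) ℕₚ.≤-refl) (R₃.Lt-mono (s≤s z≤n) (J-Lt (ι-Lt _))))

  module _ (a b : NullLine K) where
    private
      module a = NullLine a
      module b = NullLine b

    form₁-value : Ev.ap a (form₁ b) R₁.≈ line₁ (a.u F.+ F.- b.u) (b.ρ F.+ F.- a.ρ)
    form₁-value = R₁.trans (Ev.ap-+ a _ _) (R₁.trans (R₁.+-cong (ev-y a) (ev-const a _))
      (R₁.trans (S₁.solve 5 (λ s t x s′ t′ → (s S₁.:+ t S₁.:* x) S₁.:+ (s′ S₁.:+ t′ S₁.:* x) S₁.:= (s S₁.:+ s′) S₁.:+ (t′ S₁.:+ t) S₁.:* x) R₁.refl _ _ _ _ _)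
        (R₁.+-cong (R₁.sym (R₁.ι-+ _ _)) (R₁.*-congʳ (R₁.sym (R₁.ι-+ _ _))))))

    form₂-value : Ev.ap a (form₂ b) R₁.≈ line₁ ((a.v F.+ F.- b.v) F.+ (b.ρ F.+ F.- a.ρ) F.* a.u) ((b.ρ F.+ F.- a.ρ) F.* F.- a.ρ)
    form₂-value = R₁.trans (Ev.ap-+ a _ _) (R₁.trans (R₁.+-cong (ev-z a) (R₁.trans (Ev.ap-+ a _ _)
        (R₁.+-cong (R₁.trans (Ev.ap-* a _ _) (R₁.*-cong (ev-const a _) (ev-y a))) (ev-const a _))))
      (R₁.trans (S₁.solve 7 (λ s t x r s′ t′ w → (s S₁.:+ t S₁.:* x) S₁.:+ (r S₁.:* (s′ S₁.:+ t′ S₁.:* x) S₁.:+ w) S₁.:= (s S₁.:+ (r S₁.:* s′ S₁.:+ w)) S₁.:+ (t S₁.:+ r S₁.:* t′) S₁.:* x) R₁.refl _ _ _ _ _ _ _)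
      (R₁.trans (R₁.+-cong
          (R₁.trans (R₁.+-congˡ (R₁.trans (R₁.+-congʳ (R₁.sym (R₁.ι-* _ _))) (R₁.sym (R₁.ι-+ _ _)))) (R₁.sym (R₁.ι-+ _ _)))
          (R₁.*-congʳ (R₁.trans (R₁.+-congˡ (R₁.sym (R₁.ι-* _ _))) (R₁.sym (R₁.ι-+ _ _)))))
        (line₁-cong
          (SK.solve 5 (λ av aρ au bρ bv → (av SK.:- aρ SK.:* au) SK.:+ (bρ SK.:* au SK.:+ SK.:- bv) SK.:= (av SK.:- bv) SK.:+ (bρ SK.:- aρ) SK.:* au) F.refl a.v a.ρ a.u b.ρ b.v)
          (SK.solve 2 (λ aρ bρ → aρ SK.:* aρ SK.:+ bρ SK.:* SK.:- aρ SK.:= (bρ SK.:- aρ) SK.:* SK.:- aρ) F.refl a.ρ b.ρ)))))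

  sub-zero : ∀ {x y} → x F.+ F.- y F.≈ F.0# → x F.≈ y
  sub-zero {x} {y} e = F.trans (SK.solve 2 (λ x y → x SK.:= (x SK.:- y) SK.:+ y) F.refl x y) (F.trans (F.+-congʳ e) (F.+-identityˡ y))

  line₁-0 : ∀ {s t} → s F.≈ F.0# → t F.≈ F.0# → line₁ s t R₁.≈ R₁.0#
  line₁-0 es et = R₁.trans (line₁-cong es et) (R₁.trans (R₁.+-cong R₁.ι-0 (R₁.*-congʳ R₁.ι-0)) (R₁.trans (R₁.+-identityˡ _) (R₁.zeroˡ _)))

  -- If the restrictions of both linear forms of `b` to `a` vanish, their coefficients identify the
  -- three parameters of the lines. Otherwise one of the forms separates them.
  separate : ∀ a b → ¬ SameNullLine a b → ¬¬ ∃ λ h → R₃.Lt 2 h × Ev.ap b h R₁.≈ R₁.0# × ¬ (Ev.ap a h R₁.≈ R₁.0#)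
  separate a b distinct = do
    yes e₁ ← em (Ev.ap a (form₁ b) R₁.≈ R₁.0#)
      where no n₁ → η (form₁ b , form₁-Lt b , R₁.trans (form₁-value b b) (line₁-0 (F.-‿inverseʳ _) (F.-‿inverseʳ _)) , n₁)
    let eu , eρ = line₁-zero _ _ (R₁.trans (R₁.sym (form₁-value a b)) e₁)
    η (form₂ b , form₂-Lt b ,
      R₁.trans (form₂-value b b) (line₁-0
        (SK.solve 3 (λ v ρ u → (v SK.:- v) SK.:+ (ρ SK.:- ρ) SK.:* u SK.:= SK.con (+ 0)) F.refl b.v b.ρ b.u)
        (SK.solve 1 (λ ρ → (ρ SK.:- ρ) SK.:* SK.:- ρ SK.:= SK.con (+ 0)) F.refl b.ρ)) ,
      λ e₂ → distinct (F.sym (sub-zero eρ) , sub-zero eu ,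
        sub-zero (F.trans (F.sym (F.trans (F.+-congˡ (F.trans (F.*-congʳ eρ) (F.zeroˡ _))) (F.+-identityʳ _)))
          (proj₁ (line₁-zero _ _ (R₁.trans (R₁.sym (form₂-value a b)) e₂))))))
    where
    module a = NullLine a
    module b = NullLine b

  dim₂ dim₃ : ℕ → ℕ
  dim₂ = R₂.dim
  dim₃ = R₃.dim

  dim₂-value : ∀ n → 2 ℕ.* dim₂ n ≡ n ℕ.* suc n
  dim₂-value zero = ≡.cong (2 ℕ.*_) P₂.dim-zero
  dim₂-value (suc n) = ≡.trans (≡.cong (2 ℕ.*_) (≡.trans (P₂.dim-suc n) (≡.cong (ℕ._+ dim₂ n) (P₁.dim-value (suc n)))))
    (≡.trans (ℕₚ.*-distribˡ-+ 2 (suc n) (dim₂ n)) (≡.trans (≡.cong (2 ℕ.* suc n ℕ.+_) (dim₂-value n)) (e n)))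
    where
    e : ∀ n → 2 ℕ.* suc n ℕ.+ n ℕ.* suc n ≡ suc n ℕ.* suc (suc n)
    e = solve-∀

  dim₂-upper : ∀ n → dim₂ n ≤ n ℕ.* n
  dim₂-upper n = ℕₚ.*-cancelˡ-≤ 2 (≡.subst (_≤ 2 ℕ.* (n ℕ.* n)) (≡.sym (dim₂-value n)) (bound n))
    where
    bound : ∀ n → n ℕ.* suc n ≤ 2 ℕ.* (n ℕ.* n)
    bound zero = z≤n
    bound (suc n) = ℕₚ.≤-trans (ℕₚ.m≤m+n _ (n ℕ.* suc n)) (ℕₚ.≤-reflexive (e n))
      where
      e : ∀ n → suc n ℕ.* suc (suc n) ℕ.+ n ℕ.* suc n ≡ 2 ℕ.* (suc n ℕ.* suc n)
      e = solve-∀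

  dim₃-value : ∀ n → 6 ℕ.* dim₃ n ≡ n ℕ.* suc n ℕ.* suc (suc n)
  dim₃-value zero = ≡.cong (6 ℕ.*_) P₃.dim-zero
  dim₃-value (suc n) = ≡.trans (≡.cong (6 ℕ.*_) (P₃.dim-suc n)) (≡.trans (e₁ (dim₂ (suc n)) (dim₃ n)) (≡.trans (≡.cong₂ (λ x y → 3 ℕ.* x ℕ.+ y) (dim₂-value (suc n)) (dim₃-value n)) (e₂ n)))
    where
    e₁ : ∀ x y → 6 ℕ.* (x ℕ.+ y) ≡ 3 ℕ.* (2 ℕ.* x) ℕ.+ 6 ℕ.* y
    e₁ = solve-∀
    e₂ : ∀ n → 3 ℕ.* (suc n ℕ.* suc (suc n)) ℕ.+ n ℕ.* suc n ℕ.* suc (suc n) ≡ suc n ℕ.* suc (suc n) ℕ.* suc (suc (suc n))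
    e₂ = solve-∀

  dim₃-upper : ∀ n k → dim₃ (k ℕ.+ n) ≤ dim₃ n ℕ.+ k ℕ.* ((k ℕ.+ n) ℕ.* (k ℕ.+ n))
  dim₃-upper n zero = ℕₚ.≤-reflexive (≡.sym (ℕₚ.+-identityʳ _))
  dim₃-upper n (suc k) = begin
    dim₃ (suc m) ≡⟨ P₃.dim-suc m ⟩
    dim₂ (suc m) ℕ.+ dim₃ m ≤⟨ ℕₚ.+-mono-≤ (dim₂-upper (suc m)) (dim₃-upper n k) ⟩
    suc m ℕ.* suc m ℕ.+ (dim₃ n ℕ.+ k ℕ.* (m ℕ.* m)) ≤⟨ ℕₚ.+-monoʳ-≤ (suc m ℕ.* suc m) (ℕₚ.+-monoʳ-≤ (dim₃ n) (ℕₚ.*-monoʳ-≤ k (ℕₚ.*-mono-≤ (ℕₚ.n≤1+n m) (ℕₚ.n≤1+n m)))) ⟩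
    suc m ℕ.* suc m ℕ.+ (dim₃ n ℕ.+ k ℕ.* (suc m ℕ.* suc m)) ≡⟨ e (suc m ℕ.* suc m) (dim₃ n) k ⟩
    dim₃ n ℕ.+ suc k ℕ.* (suc m ℕ.* suc m) ∎
    where
    open ℕₚ.≤-Reasoning
    m = k ℕ.+ n
    e : ∀ s x k → s ℕ.+ (x ℕ.+ k ℕ.* s) ≡ x ℕ.+ (s ℕ.+ k ℕ.* s)
    e = solve-∀

  dim₃-lower : ∀ n → n ℕ.* n ℕ.* n ≤ 6 ℕ.* dim₃ n
  dim₃-lower n = ≡.subst (n ℕ.* n ℕ.* n ≤_) (≡.sym (dim₃-value n)) (ℕₚ.*-mono-≤ (ℕₚ.*-monoʳ-≤ n (ℕₚ.n≤1+n n)) (ℕₚ.≤-trans (ℕₚ.n≤1+n n) (ℕₚ.n≤1+n (suc n))))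

  ambient : Ambient K p
  ambient = record
    { R = P₃.S ; B = P₁.S ; ev = ev ; pt = P₁.eval ; inj = inj
    ; ∂x = ∂x ; ∂y = ∂y ; ∂z = ∂z ; d = P₁.deriv ; X = P₁.X
    ; ev-ι = λ a k → R₁.trans (Ev.ap-cong a (R₃.sym (J-ι k))) (ev-const a (R₁.ι k))
    ; ev-inj = ev-const
    ; ev-Lt = ev-Lt
    ; inj-ι = J-ι
    ; inj-Lt = λ n l → J-Lt l
    ; pt-ι = eval-ι
    ; pt-X = P₁.eval-X
    ; X-Lt = P₁.X-Lt
    ; d-ι = deriv-ι
    ; d-X = P₁.deriv-X
    ; d-Lt = P₁.deriv-Lt
    ; ∂x-Lt = P₃.lift-Lt (P₂.lifted P₁.deriv) (P₂.lift-Lt P₁.deriv P₁.deriv-Lt)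
    ; ∂y-Lt = P₃.lift-Lt P₂.deriv P₂.deriv-Lt ; ∂z-Lt = P₃.deriv-Lt
    ; ∂y∂x = P₃.lift-lift P₂.deriv (P₂.lifted P₁.deriv) (P₂.deriv-lift P₁.deriv)
    ; ∂z∂x = P₃.deriv-lift (P₂.lifted P₁.deriv)
    ; ∂z∂y = P₃.deriv-lift P₂.deriv
    ; meet = meet ; chain = chain ; few-roots = P₁.few-roots ; proportional = P₁.proportional
    ; constant = constant ; separate = separate
    ; dim-B = P₁.dim-value ; dim-lower = dim₃-lower ; dim-upper = dim₃-upper }
    where
    J-ι : ∀ k → J.ap (R₁.ι k) R₃.≈ R₃.ι k
    J-ι k = R₃.trans (P₃.C.ap-cong (P₂.const-ι k)) (P₃.const-ι k)

ambient : ∀ {c ℓ} (K : StableField c ℓ) p → CharAbove K p → Ambient K p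
ambient K p char = AffineSpace.ambient K p U₁ E₂ E₃
  where
  U₁ = univariateExt K p char
  E₂ = PolyExtension.polyExt K (UnivariateExt.S U₁)
  E₃ = PolyExtension.polyExt K (PolyExt.S E₂)

-- Interpolation and a Bezout bound for lines.

module Incidence {c ℓ} (K : StableField c ℓ) (p : ℕ) (Amb : Ambient K p) where
  open Ambient Amb
  private
    module CR = Comb R.alg
    module CB = Comb B.alg
    module SR = IntSolver R.ring
    module GR = GradedAlgProps R
    module AR = GradedAlg R
    module AB = GradedAlg B

  Line : Set c
  Line = NullLine K

  On : R.Carrier → Line → Set ℓ
  On f a = E.ap a f B.≈ B.0#

  On-*ʳ : ∀ f {g} a → On g a → On (f R.* g) a
  On-*ʳ f a q = B.trans (E.ap-* a _ _) (B.trans (B.*-congˡ q) (B.zeroʳ _))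

  On-*ˡ : ∀ {f} g a → On f a → On (f R.* g) a
  On-*ˡ g a q = B.trans (E.ap-* a _ _) (B.trans (B.*-congʳ q) (B.zeroˡ _))

  On-* : ∀ f g a → On (f R.* g) a → ¬ On f a → On g a
  On-* f g a h nf = B.cancel-zero nf (B.trans (B.sym (E.ap-* a f g)) h)

  On-∣ : ∀ {f g} a → f R.∣ g → On f a → On g a
  On-∣ a (k , e) h = B.trans (E.ap-cong a e) (On-*ˡ k a h)

  evMap : Line → LinMap R.alg B.alg
  evMap a = record
    { fn = E.ap a ; fn-cong = E.ap-cong a ; fn-+ = E.ap-+ a
    ; fn-ι = λ k f → B.trans (E.ap-* a _ _) (B.*-congʳ (ev-ι a k)) }

  mulMap : R.Carrier → LinMap R.alg R.alg
  mulMap g = record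
    { fn = g R.*_ ; fn-cong = R.*-congˡ ; fn-+ = R.distribˡ g
    ; fn-ι = λ k f → SR.solve 3 (λ g k f → g SR.:* (k SR.:* f) SR.:= k SR.:* (g SR.:* f)) R.refl g (R.ι k) f }

  injMap : LinMap B.alg R.alg
  injMap = record
    { fn = J.ap ; fn-cong = J.ap-cong ; fn-+ = J.ap-+
    ; fn-ι = λ k g → R.trans (J.ap-* _ _) (R.*-congʳ (inj-ι k)) }

  -- The restriction to a line of a polynomial of degree below `e` has `e` coefficients, so each
  -- line imposes `e` linear conditions.
  vanishing-polynomial : ∀ ls e → length ls ℕ.* e < R.dim e → ¬¬ ∃ λ f → ¬ (f R.≈ R.0#) × R.Lt e f × All (On f) ls
  vanishing-polynomial ls e h = do
    cs , nz , a ← kernel (AR.basis e) (conditions ls) (≡.subst (_< R.dim e) (≡.sym (count ls)) h)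
    let f = CR.comb cs (AR.basis e)
        f-Lt = GR.comb-Lt e cs (AR.basis e) (AR.basis-Lt e)
    η (f , (λ z → nz (AR.basis-indep e cs z)) , f-Lt , vanish f f-Lt ls a)
    where
    conditions : List Line → List (Functional R.alg)
    conditions [] = []
    conditions (a ∷ ls) = map (_∘ˡ evMap a) (AB.functionals e) List.++ conditions ls
    count : ∀ ls → length (conditions ls) ≡ length ls ℕ.* e
    count [] = ≡.refl
    count (a ∷ ls) = ≡.trans (Listₚ.length-++ (map (_∘ˡ evMap a) (AB.functionals e)))
      (≡.cong₂ ℕ._+_ (≡.trans (Listₚ.length-map _ (AB.functionals e)) (≡.trans (AB.functionals-length e) (dim-B e))) (count ls))
    vanish : ∀ f → R.Lt e f → ∀ ls → All (λ φ → fn φ f K.≈ K.0#) (conditions ls) → All (On f) ls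
    vanish f l [] _ = []
    vanish f l (a ∷ ls) h = AB.detect e (ev-Lt a e l) (Allₚ.map⁻ (Allₚ.++⁻ˡ _ h))
      ∷ vanish f l ls (Allₚ.++⁻ʳ (map (_∘ˡ evMap a) (AB.functionals e)) h)

  -- The product over `b` in `ls` of a linear form vanishing on `b` but not on `a`.
  isolate : ∀ a ls → All (λ b → ¬ SameNullLine a b) ls → ¬¬ ∃ λ G → R.Lt (suc (length ls)) G × All (On G) ls × ¬ On G a
  isolate a [] [] = η (R.1# , R.1-Lt , [] , λ z → B.1≉0 (B.trans (B.sym (E.ap-1 a)) z))
  isolate a (b ∷ ls) (ab ∷ h) = do
    G , lG , onG , nG ← isolate a ls h
    k , lk , onk , nk ← separate a b ab
    η (k R.* G , R.Lt-* lk lG ℕₚ.≤-refl , On-*ˡ G b onk ∷ All.map (λ {x} → On-*ʳ k x) onG , λ z → nG (On-* k G a z nk))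

  lookup-++ : ∀ {m n} (W : R.Carrier → Set ℓ) (es : Vec R.Carrier m) (fs : Vec R.Carrier n) →
    (∀ i → W (lookup es i)) → (∀ i → W (lookup fs i)) → ∀ i → W (lookup (es ++ fs) i)
  lookup-++ W [] fs p q i = q i
  lookup-++ W (e ∷ es) fs p q zero = p zero
  lookup-++ W (e ∷ es) fs p q (suc i) = lookup-++ W es fs (λ i → p (suc i)) q i

  lookup-map : ∀ {x} {Y : Set x} {m} (W : R.Carrier → Set ℓ) (h : Y → R.Carrier) (es : Vec Y m) →
    (∀ i → W (h (lookup es i))) → ∀ i → W (lookup (Vec.map h es) i)
  lookup-map W h es p i = ≡.subst W (≡.sym (Vecₚ.lookup-map i h es)) (p i)

  module _ (w : ℕ) where
    size : List Line → ℕ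
    size [] = 0
    size (a ∷ ls) = B.dim w ℕ.+ size ls

    size-value : ∀ ls → size ls ≡ length ls ℕ.* w
    size-value [] = ≡.refl
    size-value (a ∷ ls) = ≡.cong₂ ℕ._+_ (dim-B w) (size-value ls)

    -- These polynomials stay independent as functions on the union of the lines. The family is
    -- triangular: the block of `a` is `G` times the polynomials in `x` of degree below `w`, where
    -- `G` vanishes on the later lines but not on `a`. Restriction to the later lines removes the
    -- block, so induction applies to the rest; restriction to `a` then treats the block.
    restricted-family : ∀ ls → AllPairs (λ a b → ¬ SameNullLine a b) ls → ¬¬ Σ (Vec R.Carrier (size ls)) λ es →
      (∀ i → R.Lt (length ls ℕ.+ w) (lookup es i)) × (∀ cs → All (On (CR.comb cs es)) ls → Zeros cs)
    restricted-family [] [] = η ([] , (λ ()) , λ cs _ ())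
    restricted-family (a ∷ ls) (ha ∷ h) = do
      G , lG , onG , nG ← isolate a ls ha
      es , les , ind ← restricted-family ls h
      η (block G ++ es ,
         lookup-++ (R.Lt _) (block G) es
           (lookup-map (R.Lt _) (λ b → G R.* J.ap b) (AB.basis w) (λ i → R.Lt-* lG (inj-Lt w (AB.basis-Lt w i)) (ℕₚ.n≤1+n _)))
           (λ i → R.Lt-mono (ℕₚ.n≤1+n _) (les i)) ,
         indep G onG nG es ind)
      where
      block : R.Carrier → Vec R.Carrier (B.dim w)
      block G = Vec.map (λ b → G R.* J.ap b) (AB.basis w)
      indep : ∀ G → All (On G) ls → ¬ On G a → ∀ es → (∀ cs → All (On (CR.comb cs es)) ls → Zeros cs) →
        ∀ cs → All (On (CR.comb cs (block G ++ es))) (a ∷ ls) → Zeros cs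
      indep G onG nG es ind cs on with Vec.splitAt (B.dim w) cs
      ... | ds , ds′ , ≡.refl = zeros-++ ds ds′ zds zds′
        where
        γ = CB.comb ds (AB.basis w)
        eq : CR.comb (ds ++ ds′) (block G ++ es) R.≈ G R.* J.ap γ R.+ CR.comb ds′ es
        eq = R.trans (CR.comb-++ ds ds′ (block G) es) (R.+-congʳ (comb-map (mulMap G ∘ˡ injMap) ds (AB.basis w)))
        later : ∀ ls → All (On G) ls → All (On (CR.comb (ds ++ ds′) (block G ++ es))) ls → All (On (CR.comb ds′ es)) ls
        later [] [] [] = []
        later (b ∷ ls) (g ∷ gs) (o ∷ os) = B.trans (B.sym (B.trans (E.ap-cong b eq) (B.trans (E.ap-+ b _ _)
            (B.trans (B.+-congʳ (On-*ˡ (J.ap γ) b g)) (B.+-identityˡ _))))) o ∷ later ls gs os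
        zds′ : Zeros ds′
        zds′ = ind ds′ (later ls onG (All.tail on))
        zds : Zeros ds
        zds = AB.basis-indep w ds (B.trans (B.sym (ev-inj a γ)) (On-* G (J.ap γ) a
          (B.trans (E.ap-cong a (R.sym (R.trans eq (R.trans (R.+-congˡ (CR.comb-zeros ds′ es zds′)) (R.+-identityʳ _))))) (All.head on)) nG))

  module _ {q g : R.Carrier} (prime : R.Prime q) (q∤g : ¬ (q R.∣ g)) {δ D : ℕ} (lq : R.Lt (suc δ) q) (lg : R.Lt (suc D) g) where
    private module Q = R.Prime prime

    -- The blocks `Γ`, `g Γ`, `g² Γ` and so on, `k` of them.
    power-family : ∀ {m} → Vec R.Carrier m → ∀ k → Vec R.Carrier (k ℕ.* m)
    power-family Γ zero = []
    power-family Γ (suc k) = Γ ++ Vec.map (g R.*_) (power-family Γ k)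

    power-family-Lt : ∀ {m} (Γ : Vec R.Carrier m) n → (∀ i → R.Lt n (lookup Γ i)) → ∀ k i → R.Lt (n ℕ.+ k ℕ.* D) (lookup (power-family Γ k) i)
    power-family-Lt Γ n h zero ()
    power-family-Lt Γ n h (suc k) = lookup-++ (R.Lt _) Γ (Vec.map (g R.*_) (power-family Γ k)) (λ i → R.Lt-mono (ℕₚ.m≤m+n n _) (h i))
      (lookup-map (R.Lt _) (g R.*_) (power-family Γ k) λ i → R.Lt-* lg (power-family-Lt Γ n h k i) (ℕₚ.≤-reflexive (e D n k)))
      where
      e : ∀ D n k → suc D ℕ.+ (n ℕ.+ k ℕ.* D) ≡ suc (n ℕ.+ (D ℕ.+ k ℕ.* D))
      e = solve-∀

    -- Independence modulo `q`. On the lines, where `q` and `g` vanish, only the first block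
    -- survives, and `Γ` is independent there. What remains is `g` times a shorter combination, and
    -- the prime `q`, not dividing `g`, divides that combination.
    power-family-indep : ∀ ls {m} (Γ : Vec R.Carrier m) → All (On q) ls → All (On g) ls → (∀ cs → All (On (CR.comb cs Γ)) ls → Zeros cs) →
      ∀ k cs → q R.∣ CR.comb cs (power-family Γ k) → Zeros cs
    power-family-indep ls Γ onq ong ind zero [] _ ()
    power-family-indep ls {m} Γ onq ong ind (suc k) cs q∣ with Vec.splitAt m cs
    ... | ds , ds′ , ≡.refl = zeros-++ ds ds′ zds (λ i → StableField.stable K (¬¬-map (λ z → z i) zds′))
      where
      rest = CR.comb ds′ (power-family Γ k)
      eq : CR.comb (ds ++ ds′) (power-family Γ (suc k)) R.≈ CR.comb ds Γ R.+ g R.* rest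
      eq = R.trans (CR.comb-++ ds ds′ Γ _) (R.+-congˡ (comb-map (mulMap g) ds′ (power-family Γ k)))
      on : ∀ ls → All (On q) ls → All (On g) ls → All (On (CR.comb ds Γ)) ls
      on [] [] [] = []
      on (b ∷ ls) (oq ∷ oqs) (og ∷ ogs) = B.trans (B.sym (B.trans (E.ap-+ b _ _) (B.trans (B.+-congˡ (On-*ˡ rest b og)) (B.+-identityʳ _))))
        (B.trans (E.ap-cong b (R.sym eq)) (On-∣ b q∣ oq)) ∷ on ls oqs ogs
      zds : Zeros ds
      zds = ind ds (on ls onq ong)
      zds′ : ¬¬ Zeros ds′
      zds′ = do
        inj₂ d ← Q.prime g rest (proj₁ q∣ , R.trans (R.sym (R.trans eq (R.trans (R.+-congʳ (CR.comb-zeros ds Γ zds)) (R.+-identityˡ _)))) (proj₂ q∣))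
          where inj₁ q∣g → ⊥-elim (q∤g q∣g)
        η (power-family-indep ls Γ onq ong ind k ds′ d)

    -- A dimension count below degree `δ + n`, with `M` lines. The multiples of `q` contribute
    -- `dim n`, and the power family, independent modulo `q`, another `M · M · w`. This is at most
    -- the growth `δ (δ + n)²` of the dimension over `δ` steps. For `M > δ` the choice `w = M D`
    -- makes `δ + n ≤ 4 w`, whence `M² ≤ 16 δ w`.
    bezout : 1 ≤ D → ∀ ls → AllPairs (λ a b → ¬ SameNullLine a b) ls → All (On q) ls → All (On g) ls → length ls ≤ 16 ℕ.* (δ ℕ.* D)
    bezout 1≤D ls distinct onq ong = ≤-stable do
      Γ , lΓ , indΓ ← restricted-family w ls distinct
      let fam = power-family Γ M
          monos = Vec.map (q R.*_) (AR.basis n)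
          total : R.dim n ℕ.+ M ℕ.* size w ls ≤ R.dim (δ ℕ.+ n)
          total = GR.indep-dim (δ ℕ.+ n) (monos ++ fam)
            (lookup-++ (R.Lt _) monos fam
              (lookup-map (R.Lt _) (q R.*_) (AR.basis n) λ i → R.Lt-* lq (AR.basis-Lt n i) ℕₚ.≤-refl)
              (λ i → R.Lt-mono (ℕₚ.m≤n+m n δ) (power-family-Lt Γ (M ℕ.+ w) lΓ M i)))
            (λ cs e → indep Γ indΓ cs e)
      η (arith (ℕₚ.+-cancelˡ-≤ (R.dim n) _ _ (ℕₚ.≤-trans (≡.subst (λ s → R.dim n ℕ.+ M ℕ.* s ≤ R.dim (δ ℕ.+ n)) (size-value w ls) total) (dim-upper n δ))))
      where
      M = length ls
      w = M ℕ.* D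
      -- The degree of the power family: `M + w` for `Γ` and at most `M D` for the powers of `g`.
      n = M ℕ.+ w ℕ.+ M ℕ.* D
      indep : ∀ Γ → (∀ cs → All (On (CR.comb cs Γ)) ls → Zeros cs) → CR.Indep (Vec.map (q R.*_) (AR.basis n) ++ power-family Γ M)
      indep Γ indΓ cs e with Vec.splitAt (R.dim n) cs
      ... | ds , ds′ , ≡.refl = zeros-++ ds ds′ zds zds′
        where
        monos = Vec.map (q R.*_) (AR.basis n)
        fam = power-family Γ M
        α = CR.comb ds (AR.basis n)
        eq : CR.comb (ds ++ ds′) (monos ++ fam) R.≈ q R.* α R.+ CR.comb ds′ fam
        eq = R.trans (CR.comb-++ ds ds′ monos fam) (R.+-congʳ (comb-map (mulMap q) ds (AR.basis n)))
        zds′ : Zeros ds′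
        zds′ = power-family-indep ls Γ onq ong indΓ M ds′ (R.- α ,
          R.trans (SR.solve 2 (λ x y → y SR.:= (x SR.:+ y) SR.:- x) R.refl (q R.* α) _)
            (R.trans (R.+-congʳ (R.trans (R.sym eq) e)) (SR.solve 2 (λ q α → SR.con (+ 0) SR.:- q SR.:* α SR.:= q SR.:* SR.:- α) R.refl q α)))
        zds : Zeros ds
        zds = AR.basis-indep n ds (R.cancel-zero Q.nonzero (R.trans (R.sym (R.trans eq (R.trans (R.+-congˡ (CR.comb-zeros ds′ fam zds′)) (R.+-identityʳ _)))) e))
      arith : M ℕ.* (M ℕ.* w) ≤ δ ℕ.* ((δ ℕ.+ n) ℕ.* (δ ℕ.+ n)) → M ≤ 16 ℕ.* (δ ℕ.* D)
      arith h with M ℕ.≤? δ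
      ... | yes M≤δ = ℕₚ.≤-trans M≤δ (ℕₚ.≤-trans (ℕₚ.≤-trans (ℕₚ.≤-reflexive (≡.sym (ℕₚ.*-identityʳ δ))) (ℕₚ.*-monoʳ-≤ δ 1≤D)) (ℕₚ.m≤n*m (δ ℕ.* D) 16))
      ... | no M≰δ = ℕₚ.*-cancelʳ-≤ M (16 ℕ.* (δ ℕ.* D)) (M ℕ.* w) {{ℕ.>-nonZero Mw>0}} (begin
          M ℕ.* (M ℕ.* w) ≤⟨ h ⟩
          δ ℕ.* ((δ ℕ.+ n) ℕ.* (δ ℕ.+ n)) ≤⟨ ℕₚ.*-monoʳ-≤ δ (ℕₚ.*-mono-≤ small small) ⟩
          δ ℕ.* (4 ℕ.* w ℕ.* (4 ℕ.* w)) ≡⟨ e δ M D ⟩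
          16 ℕ.* (δ ℕ.* D) ℕ.* (M ℕ.* w) ∎)
        where
        open ℕₚ.≤-Reasoning
        δ<M = ℕₚ.≰⇒> M≰δ
        M≤w : M ≤ w
        M≤w = ℕₚ.≤-trans (ℕₚ.≤-reflexive (≡.sym (ℕₚ.*-identityʳ M))) (ℕₚ.*-monoʳ-≤ M 1≤D)
        small : δ ℕ.+ n ≤ 4 ℕ.* w
        small = begin
          δ ℕ.+ (M ℕ.+ w ℕ.+ w) ≤⟨ ℕₚ.+-mono-≤ (ℕₚ.≤-trans (ℕₚ.<⇒≤ δ<M) M≤w) (ℕₚ.+-monoˡ-≤ w (ℕₚ.+-monoˡ-≤ w M≤w)) ⟩
          w ℕ.+ (w ℕ.+ w ℕ.+ w) ≡⟨ e₄ w ⟩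
          4 ℕ.* w ∎
          where
          e₄ : ∀ w → w ℕ.+ (w ℕ.+ w ℕ.+ w) ≡ 4 ℕ.* w
          e₄ = solve-∀
        Mw>0 : 0 < M ℕ.* w
        Mw>0 = ℕₚ.*-mono-≤ (ℕₚ.≤-trans (s≤s z≤n) δ<M) (ℕₚ.≤-trans (ℕₚ.≤-trans (s≤s z≤n) δ<M) M≤w)
        e : ∀ δ M D → δ ℕ.* (4 ℕ.* (M ℕ.* D) ℕ.* (4 ℕ.* (M ℕ.* D))) ≡ 16 ℕ.* (δ ℕ.* D) ℕ.* (M ℕ.* (M ℕ.* D))
        e = solve-∀

-- Splitting of lists and finite sums.

-- A relation instead of a function, because for an undecidable predicate the two parts exist only
-- under double negation.
data Split {a p} {A : Set a} (P : A → Set p) : List A → List A → List A → Set (a ⊔ p) where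
  [] : Split P [] [] []
  left : ∀ {x xs ys zs} → P x → Split P xs ys zs → Split P (x ∷ xs) (x ∷ ys) zs
  right : ∀ {x xs ys zs} → ¬ P x → Split P xs ys zs → Split P (x ∷ xs) ys (x ∷ zs)

module _ {a p} {A : Set a} {P : A → Set p} where
  split-dec : (∀ x → Dec (P x)) → ∀ xs → ∃₂ (Split P xs)
  split-dec P? [] = [] , [] , []
  split-dec P? (x ∷ xs) with P? x | split-dec P? xs
  ... | yes px | ys , zs , s = x ∷ ys , zs , left px s
  ... | no npx | ys , zs , s = ys , x ∷ zs , right npx s

  split-em : ∀ xs → ¬¬ ∃₂ (Split P xs)
  split-em [] = η ([] , [] , [])
  split-em (x ∷ xs) = do
    ys , zs , s ← split-em xs
    yes px ← em (P x)
      where no npx → η (ys , x ∷ zs , right npx s)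
    η (x ∷ ys , zs , left px s)

  split-yes : ∀ {xs ys zs} → Split P xs ys zs → All P ys
  split-yes [] = []
  split-yes (left px s) = px ∷ split-yes s
  split-yes (right _ s) = split-yes s

  split-no : ∀ {xs ys zs} → Split P xs ys zs → All (λ x → ¬ P x) zs
  split-no [] = []
  split-no (left _ s) = split-no s
  split-no (right npx s) = npx ∷ split-no s

  module _ {q} {Q : A → Set q} where
    split-Allˡ : ∀ {xs ys zs} → Split P xs ys zs → All Q xs → All Q ys
    split-Allˡ [] [] = []
    split-Allˡ (left _ s) (q ∷ qs) = q ∷ split-Allˡ s qs
    split-Allˡ (right _ s) (_ ∷ qs) = split-Allˡ s qs

    split-Allʳ : ∀ {xs ys zs} → Split P xs ys zs → All Q xs → All Q zs
    split-Allʳ [] [] = []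
    split-Allʳ (left _ s) (_ ∷ qs) = split-Allʳ s qs
    split-Allʳ (right _ s) (q ∷ qs) = q ∷ split-Allʳ s qs

  module _ {q} {Q : A → A → Set q} where
    split-Pairsˡ : ∀ {xs ys zs} → Split P xs ys zs → AllPairs Q xs → AllPairs Q ys
    split-Pairsˡ [] [] = []
    split-Pairsˡ (left _ s) (q ∷ qs) = split-Allˡ s q ∷ split-Pairsˡ s qs
    split-Pairsˡ (right _ s) (_ ∷ qs) = split-Pairsˡ s qs

    split-Pairsʳ : ∀ {xs ys zs} → Split P xs ys zs → AllPairs Q xs → AllPairs Q zs
    split-Pairsʳ [] [] = []
    split-Pairsʳ (left _ s) (_ ∷ qs) = split-Pairsʳ s qs
    split-Pairsʳ (right _ s) (q ∷ qs) = split-Allʳ s q ∷ split-Pairsʳ s qs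

module _ {a} {A : Set a} where
  ∑ : (A → ℕ) → List A → ℕ
  ∑ f [] = 0
  ∑ f (x ∷ xs) = f x ℕ.+ ∑ f xs

  ∑-bound : ∀ {f k xs} → All (λ x → f x ≤ k) xs → ∑ f xs ≤ length xs ℕ.* k
  ∑-bound [] = z≤n
  ∑-bound (h ∷ hs) = ℕₚ.+-mono-≤ h (∑-bound hs)

  ∑-mono : ∀ {f g} xs → All (λ x → f x ≤ g x) xs → ∑ f xs ≤ ∑ g xs
  ∑-mono [] [] = z≤n
  ∑-mono (x ∷ xs) (h ∷ hs) = ℕₚ.+-mono-≤ h (∑-mono xs hs)

  ∑-cong : ∀ {f g} xs → (∀ x → f x ≡ g x) → ∑ f xs ≡ ∑ g xs
  ∑-cong [] h = ≡.refl
  ∑-cong (x ∷ xs) h = ≡.cong₂ ℕ._+_ (h x) (∑-cong xs h)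

  ∑-+ : ∀ f g xs → ∑ (λ x → f x ℕ.+ g x) xs ≡ ∑ f xs ℕ.+ ∑ g xs
  ∑-+ f g [] = ≡.refl
  ∑-+ f g (x ∷ xs) = ≡.trans (≡.cong (f x ℕ.+ g x ℕ.+_) (∑-+ f g xs)) (e (f x) (g x) (∑ f xs) (∑ g xs))
    where
    e : ∀ a b c d → a ℕ.+ b ℕ.+ (c ℕ.+ d) ≡ a ℕ.+ c ℕ.+ (b ℕ.+ d)
    e = solve-∀

  ∑-zero : ∀ xs → ∑ (λ _ → 0) xs ≡ 0
  ∑-zero [] = ≡.refl
  ∑-zero (x ∷ xs) = ∑-zero xs

  ∑-++ : ∀ f xs ys → ∑ f (xs List.++ ys) ≡ ∑ f xs ℕ.+ ∑ f ys
  ∑-++ f [] ys = ≡.refl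
  ∑-++ f (x ∷ xs) ys = ≡.trans (≡.cong (f x ℕ.+_) (∑-++ f xs ys)) (≡.sym (ℕₚ.+-assoc (f x) _ _))

  ∑-split : ∀ {p} {P : A → Set p} f {xs ys zs} → Split P xs ys zs → ∑ f xs ≡ ∑ f ys ℕ.+ ∑ f zs
  ∑-split f [] = ≡.refl
  ∑-split f (left {x} _ s) = ≡.trans (≡.cong (f x ℕ.+_) (∑-split f s)) (≡.sym (ℕₚ.+-assoc (f x) _ _))
  ∑-split f (right {x} {ys = ys} {zs} _ s) = ≡.trans (≡.cong (f x ℕ.+_) (∑-split f s)) (e (f x) (∑ f ys) (∑ f zs))
    where
    e : ∀ a b c → a ℕ.+ (b ℕ.+ c) ≡ b ℕ.+ (a ℕ.+ c)
    e = solve-∀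

  length-split : ∀ {p} {P : A → Set p} {xs ys zs} → Split P xs ys zs → length xs ≡ length ys ℕ.+ length zs
  length-split [] = ≡.refl
  length-split (left _ s) = ≡.cong suc (length-split s)
  length-split (right {ys = ys} {zs} _ s) = ≡.trans (≡.cong suc (length-split s)) (≡.sym (ℕₚ.+-suc (length ys) (length zs)))

∑-swap : ∀ {a b} {A : Set a} {B : Set b} (f : A → B → ℕ) xs ys → ∑ (λ x → ∑ (f x) ys) xs ≡ ∑ (λ y → ∑ (λ x → f x y) xs) ys
∑-swap f [] ys = ≡.sym (∑-zero ys)
∑-swap f (x ∷ xs) ys = ≡.trans (≡.cong (∑ (f x) ys ℕ.+_) (∑-swap f xs ys)) (≡.sym (∑-+ (f x) (λ y → ∑ (λ x → f x y) xs) ys))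

⟦_⟧ : Bool → ℕ
⟦ true ⟧ = 1
⟦ false ⟧ = 0

count-split : ∀ {a} {A : Set a} (f : A → Bool) xs → ∃₂ λ ys zs → Split (λ x → T (f x)) xs ys zs × ∑ (λ x → ⟦ f x ⟧) xs ≡ length ys
count-split f [] = [] , [] , [] , ≡.refl
count-split f (x ∷ xs) with f x in eq | count-split f xs
... | true | ys , zs , s , e = x ∷ ys , zs , left (≡.subst T (≡.sym eq) tt) s , ≡.cong suc e
... | false | ys , zs , s , e = ys , x ∷ zs , right (λ t → ≡.subst T eq t) s , e

-- Formulas in the second-order jet of a polynomial.

data Jet : Set where
  jr jx jy jz jxx jxy jyy jxz jyz jzz : Jet

infixl 6 _⊞_
infixl 7 _⊠_
-- Formulas are kept as syntax, so that the same one can be evaluated in the polynomial ring, along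
-- a line and at a point, and its degree can be read off.
data Expr : Set where
  ‵ : Jet → Expr
  _⊞_ _⊠_ : Expr → Expr → Expr
  ⊟_ : Expr → Expr

degᴱ : Expr → ℕ
degᴱ (‵ _) = 1
degᴱ (e ⊞ f) = degᴱ e ℕ.⊔ degᴱ f
degᴱ (e ⊠ f) = degᴱ e ℕ.+ degᴱ f
degᴱ (⊟ e) = degᴱ e

module EvalExpr {c ℓ} (R : CommutativeRing c ℓ) where
  open CommutativeRing R

  ⟦_⟧ᴱ : Expr → (Jet → Carrier) → Carrier
  ⟦ ‵ s ⟧ᴱ ρ = ρ s
  ⟦ e ⊞ f ⟧ᴱ ρ = ⟦ e ⟧ᴱ ρ + ⟦ f ⟧ᴱ ρ
  ⟦ e ⊠ f ⟧ᴱ ρ = ⟦ e ⟧ᴱ ρ * ⟦ f ⟧ᴱ ρ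
  ⟦ ⊟ e ⟧ᴱ ρ = - ⟦ e ⟧ᴱ ρ

  cong-Expr : ∀ e {ρ σ} → (∀ s → ρ s ≈ σ s) → ⟦ e ⟧ᴱ ρ ≈ ⟦ e ⟧ᴱ σ
  cong-Expr (‵ s) h = h s
  cong-Expr (e ⊞ f) h = +-cong (cong-Expr e h) (cong-Expr f h)
  cong-Expr (e ⊠ f) h = *-cong (cong-Expr e h) (cong-Expr f h)
  cong-Expr (⊟ e) h = -‿cong (cong-Expr e h)

hom-Expr : ∀ {c ℓ c′ ℓ′} {R : CommutativeRing c ℓ} {S : CommutativeRing c′ ℓ′} (h : RingHom R S) e ρ →
  CommutativeRing._≈_ S (RingHom.ap h (EvalExpr.⟦_⟧ᴱ R e ρ)) (EvalExpr.⟦_⟧ᴱ S e (λ s → RingHom.ap h (ρ s)))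
hom-Expr {S = S} h (‵ s) ρ = CommutativeRing.refl S
hom-Expr {S = S} h (e ⊞ f) ρ = S.trans (RingHom.ap-+ h _ _) (S.+-cong (hom-Expr h e ρ) (hom-Expr h f ρ))
  where
  module S = CommutativeRing S
hom-Expr {S = S} h (e ⊠ f) ρ = S.trans (RingHom.ap-* h _ _) (S.*-cong (hom-Expr h e ρ) (hom-Expr h f ρ))
  where
  module S = CommutativeRing S
hom-Expr {S = S} h (⊟ e) ρ = S.trans (RingHom.ap-neg h _) (S.-‿cong (hom-Expr h e ρ))
  where
  module S = CommutativeRing S

Lt-Expr : ∀ {c ℓ} (G : GradedDomain c ℓ) d e ρ → (∀ s → GradedDomain.Lt G (suc d) (ρ s)) →
  GradedDomain.Lt G (suc (degᴱ e ℕ.* d)) (EvalExpr.⟦_⟧ᴱ (GradedDomain.ring G) e ρ)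
Lt-Expr G d (‵ s) ρ h = GradedDomain.Lt-mono G (s≤s (ℕₚ.m≤m+n d 0)) (h s)
Lt-Expr G d (e ⊞ f) ρ h = GradedDomain.Lt-+ G
  (GradedDomain.Lt-mono G (s≤s (ℕₚ.*-monoˡ-≤ d (ℕₚ.m≤m⊔n (degᴱ e) (degᴱ f)))) (Lt-Expr G d e ρ h))
  (GradedDomain.Lt-mono G (s≤s (ℕₚ.*-monoˡ-≤ d (ℕₚ.m≤n⊔m (degᴱ e) (degᴱ f)))) (Lt-Expr G d f ρ h))
Lt-Expr G d (e ⊠ f) ρ h = GradedDomain.Lt-* G (Lt-Expr G d e ρ h) (Lt-Expr G d f ρ h)
  (ℕₚ.≤-reflexive (≡.trans (≡.cong suc (ℕₚ.+-suc _ _)) (≡.cong (λ k → suc (suc k)) (≡.sym (ℕₚ.*-distribʳ-+ d (degᴱ e) (degᴱ f))))))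
Lt-Expr G d (⊟ e) ρ h = GradedDomain.Lt-neg G (Lt-Expr G d e ρ h)

-- For f with first and second partial derivatives as named and D = ∂x - r∂y + r²∂z,
-- first is Df and second is D²f. As polynomials in r these have degree 2 and 4, and
-- fz³ second = (quot₀ + quot₁ r + quot₂ r²) first + rem₁ r + rem₀ is pseudo-division.
first second quot₀ quot₁ quot₂ quot rem₀ rem₁ : Expr
first = ‵ jx ⊞ (⊟ ‵ jr ⊠ ‵ jy ⊞ ‵ jr ⊠ ‵ jr ⊠ ‵ jz)
second = (‵ jxx ⊞ (⊟ ‵ jr ⊠ ‵ jxy ⊞ ‵ jr ⊠ ‵ jr ⊠ ‵ jxz)) ⊞
  (⊟ ‵ jr ⊠ (‵ jxy ⊞ (⊟ ‵ jr ⊠ ‵ jyy ⊞ ‵ jr ⊠ ‵ jr ⊠ ‵ jyz)) ⊞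
  ‵ jr ⊠ ‵ jr ⊠ (‵ jxz ⊞ (⊟ ‵ jr ⊠ ‵ jyz ⊞ ‵ jr ⊠ ‵ jr ⊠ ‵ jzz)))
quot₂ = ‵ jz ⊠ ‵ jz ⊠ ‵ jzz
quot₁ = ⊟ (‵ jz ⊠ ‵ jz ⊠ (‵ jyz ⊞ ‵ jyz)) ⊞ ‵ jz ⊠ ‵ jy ⊠ ‵ jzz
quot₀ = ‵ jz ⊠ ‵ jz ⊠ (‵ jyy ⊞ (‵ jxz ⊞ ‵ jxz)) ⊞ (⊟ (‵ jz ⊠ ‵ jy ⊠ (‵ jyz ⊞ ‵ jyz)) ⊞ (‵ jy ⊠ ‵ jy ⊠ ‵ jzz ⊞ ⊟ (‵ jz ⊠ ‵ jx ⊠ ‵ jzz)))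
quot = quot₀ ⊞ (quot₁ ⊠ ‵ jr ⊞ quot₂ ⊠ ‵ jr ⊠ ‵ jr)
rem₁ = ⊟ (‵ jz ⊠ ‵ jz ⊠ ‵ jz ⊠ (‵ jxy ⊞ ‵ jxy)) ⊞ (quot₀ ⊠ ‵ jy ⊞ ⊟ (quot₁ ⊠ ‵ jx))
rem₀ = ‵ jz ⊠ ‵ jz ⊠ ‵ jz ⊠ ‵ jxx ⊞ ⊟ (quot₀ ⊠ ‵ jx)

module PseudoDivision {c ℓ} (R : CommutativeRing c ℓ) where
  open CommutativeRing R
  open EvalExpr R
  private module S = IntSolver R
  open S using (_:=_; _:+_; _:*_; :-_)

  division : ∀ ρ → ρ jz * ρ jz * ρ jz * ⟦ second ⟧ᴱ ρ ≈ ⟦ quot ⟧ᴱ ρ * ⟦ first ⟧ᴱ ρ + (⟦ rem₁ ⟧ᴱ ρ * ρ jr + ⟦ rem₀ ⟧ᴱ ρ)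
  division ρ = S.solve 10 (λ r x y z xx xy yy xz yz zz →
      let fi = x :+ (:- r :* y :+ r :* r :* z)
          se = (xx :+ (:- r :* xy :+ r :* r :* xz)) :+ (:- r :* (xy :+ (:- r :* yy :+ r :* r :* yz)) :+ r :* r :* (xz :+ (:- r :* yz :+ r :* r :* zz)))
          q₂ = z :* z :* zz
          q₁ = :- (z :* z :* (yz :+ yz)) :+ z :* y :* zz
          q₀ = z :* z :* (yy :+ (xz :+ xz)) :+ (:- (z :* y :* (yz :+ yz)) :+ (y :* y :* zz :+ :- (z :* x :* zz)))
          q = q₀ :+ (q₁ :* r :+ q₂ :* r :* r)
          r₁ = :- (z :* z :* z :* (xy :+ xy)) :+ (q₀ :* y :+ :- (q₁ :* x))
          r₀ = z :* z :* z :* xx :+ :- (q₀ :* x)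
      in z :* z :* z :* se := q :* fi :+ (r₁ :* r :+ r₀))
    refl (ρ jr) (ρ jx) (ρ jy) (ρ jz) (ρ jxx) (ρ jxy) (ρ jyy) (ρ jxz) (ρ jyz) (ρ jzz)

  -- The derivative of the division identity with respect to r.
  division′ : ∀ ρ → let w = ρ jy + - (ρ jr * ρ jz + ρ jr * ρ jz)
                        w′ = (ρ jxy + (- ρ jr * ρ jyy + ρ jr * ρ jr * ρ jyz)) + - (ρ jr * (ρ jxz + (- ρ jr * ρ jyz + ρ jr * ρ jr * ρ jzz)) + ρ jr * (ρ jxz + (- ρ jr * ρ jyz + ρ jr * ρ jr * ρ jzz)))
                    in ρ jz * ρ jz * ρ jz * (w′ + w′) ≈
                       ⟦ quot ⟧ᴱ ρ * w + - ((⟦ quot₁ ⟧ᴱ ρ + (⟦ quot₂ ⟧ᴱ ρ * ρ jr + ⟦ quot₂ ⟧ᴱ ρ * ρ jr)) * ⟦ first ⟧ᴱ ρ + ⟦ rem₁ ⟧ᴱ ρ)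
  division′ ρ = S.solve 9 (λ r x y z xy yy xz yz zz →
      let fi = x :+ (:- r :* y :+ r :* r :* z)
          q₂ = z :* z :* zz
          q₁ = :- (z :* z :* (yz :+ yz)) :+ z :* y :* zz
          q₀ = z :* z :* (yy :+ (xz :+ xz)) :+ (:- (z :* y :* (yz :+ yz)) :+ (y :* y :* zz :+ :- (z :* x :* zz)))
          q = q₀ :+ (q₁ :* r :+ q₂ :* r :* r)
          r₁ = :- (z :* z :* z :* (xy :+ xy)) :+ (q₀ :* y :+ :- (q₁ :* x))
          w = y :+ :- (r :* z :+ r :* z)
          w′ = (xy :+ (:- r :* yy :+ r :* r :* yz)) :+ :- (r :* (xz :+ (:- r :* yz :+ r :* r :* zz)) :+ r :* (xz :+ (:- r :* yz :+ r :* r :* zz)))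
      in z :* z :* z :* (w′ :+ w′) := q :* w :+ :- ((q₁ :+ (q₂ :* r :+ q₂ :* r)) :* fi :+ r₁))
    refl (ρ jr) (ρ jx) (ρ jy) (ρ jz) (ρ jxy) (ρ jyy) (ρ jxz) (ρ jyz) (ρ jzz)

-- Calculus of a surface along its isotropic lines.

module LineCalculus {c ℓ} (K : StableField c ℓ) (p : ℕ) (Amb : Ambient K p) where
  open Ambient Amb
  open Incidence K p Amb
  open StableField K using (stable; inverse) renaming (ring to kring)
  open FieldGraded K using (mul-zero)
  private
    module SK = IntSolver kring
    module SB = IntSolver B.ring
    module SR = IntSolver R.ring
    module XR = EvalExpr R.ring
    module XB = EvalExpr B.ring
    module XK = EvalExpr kring

  jet : K.Carrier → R.Carrier → Jet → R.Carrier
  jet ρ q jr = R.ι ρ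
  jet ρ q jx = Dx.δ q
  jet ρ q jy = Dy.δ q
  jet ρ q jz = Dz.δ q
  jet ρ q jxx = Dx.δ (Dx.δ q)
  jet ρ q jxy = Dx.δ (Dy.δ q)
  jet ρ q jyy = Dy.δ (Dy.δ q)
  jet ρ q jxz = Dx.δ (Dz.δ q)
  jet ρ q jyz = Dy.δ (Dz.δ q)
  jet ρ q jzz = Dz.δ (Dz.δ q)

  jet-Lt : ∀ {δ q} ρ → R.Lt (suc δ) q → ∀ s → R.Lt (suc δ) (jet ρ q s)
  jet-Lt {δ} ρ l = λ
    { jr → R.Lt-mono (s≤s z≤n) (GradedAlg.ι-Lt R ρ)
    ; jx → x l ; jy → y l ; jz → z l ; jxx → x (x l) ; jxy → x (y l) ; jyy → y (y l) ; jxz → x (z l) ; jyz → y (z l) ; jzz → z (z l) }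
    where
    x : ∀ {f} → R.Lt (suc δ) f → R.Lt (suc δ) (Dx.δ f)
    x l = R.Lt-mono (ℕₚ.n≤1+n δ) (∂x-Lt δ _ l)
    y : ∀ {f} → R.Lt (suc δ) f → R.Lt (suc δ) (Dy.δ f)
    y l = R.Lt-mono (ℕₚ.n≤1+n δ) (∂y-Lt δ _ l)
    z : ∀ {f} → R.Lt (suc δ) f → R.Lt (suc δ) (Dz.δ f)
    z l = R.Lt-mono (ℕₚ.n≤1+n δ) (∂z-Lt δ _ l)

  -- The formulas `rem₀` and `rem₁` do not contain `jr`, so these polynomials depend on the surface
  -- only and not on a line.
  rem₀-of rem₁-of : R.Carrier → R.Carrier
  rem₀-of q = XR.⟦ rem₀ ⟧ᴱ (jet K.0# q)
  rem₁-of q = XR.⟦ rem₁ ⟧ᴱ (jet K.0# q)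

  module Along (ρ : K.Carrier) where
    r : R.Carrier
    r = R.ι ρ

    𝔻 : R.Carrier → R.Carrier
    𝔻 f = Dx.δ f R.+ (R.- r R.* Dy.δ f R.+ r R.* r R.* Dz.δ f)

    module Commute (∂ : Derivation R.ring) (∂r : Derivation.δ ∂ r R.≈ R.0#)
        (cx : ∀ f → Derivation.δ ∂ (Dx.δ f) R.≈ Dx.δ (Derivation.δ ∂ f))
        (cy : ∀ f → Derivation.δ ∂ (Dy.δ f) R.≈ Dy.δ (Derivation.δ ∂ f))
        (cz : ∀ f → Derivation.δ ∂ (Dz.δ f) R.≈ Dz.δ (Derivation.δ ∂ f)) where
      open Derivation ∂
      ∂𝔻 : ∀ f → δ (𝔻 f) R.≈ 𝔻 (δ f)
      ∂𝔻 f = R.trans (δ-+ _ _) (R.+-cong (cx f) (R.trans (δ-+ _ _) (R.+-cong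
          (R.trans (δ-* _ _) (R.trans (R.+-cong (R.trans (R.*-congʳ (R.trans (δ-neg r) (R.trans (R.-‿cong ∂r) (SR.solve 0 (SR.:- SR.con (+ 0) SR.:= SR.con (+ 0)) R.refl)))) (R.zeroˡ _)) (R.*-congˡ (cy f))) (R.+-identityˡ _)))
          (R.trans (δ-* _ _) (R.trans (R.+-cong (R.trans (R.*-congʳ (R.trans (δ-* r r) (R.trans (R.+-cong (R.*-congʳ ∂r) (R.*-congˡ ∂r))
              (SR.solve 1 (λ r → SR.con (+ 0) SR.:* r SR.:+ r SR.:* SR.con (+ 0) SR.:= SR.con (+ 0)) R.refl r)))) (R.zeroˡ _)) (R.*-congˡ (cz f))) (R.+-identityˡ _))))))

    ∂x-r : Dx.δ r R.≈ R.0#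
    ∂x-r = R.Lt-zero (∂x-Lt 0 r (GradedAlg.ι-Lt R ρ))
    ∂y-r : Dy.δ r R.≈ R.0#
    ∂y-r = R.Lt-zero (∂y-Lt 0 r (GradedAlg.ι-Lt R ρ))
    ∂z-r : Dz.δ r R.≈ R.0#
    ∂z-r = R.Lt-zero (∂z-Lt 0 r (GradedAlg.ι-Lt R ρ))

    ∂x𝔻 : ∀ f → Dx.δ (𝔻 f) R.≈ 𝔻 (Dx.δ f)
    ∂x𝔻 = Commute.∂𝔻 ∂x ∂x-r (λ f → R.refl) (λ f → R.sym (∂y∂x f)) (λ f → R.sym (∂z∂x f))
    ∂y𝔻 : ∀ f → Dy.δ (𝔻 f) R.≈ 𝔻 (Dy.δ f)
    ∂y𝔻 = Commute.∂𝔻 ∂y ∂y-r ∂y∂x (λ f → R.refl) (λ f → R.sym (∂z∂y f))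
    ∂z𝔻 : ∀ f → Dz.δ (𝔻 f) R.≈ 𝔻 (Dz.δ f)
    ∂z𝔻 = Commute.∂𝔻 ∂z ∂z-r ∂z∂x ∂z∂y (λ f → R.refl)

    𝔻x : ∀ f → 𝔻 (Dx.δ f) R.≈ Dx.δ (Dx.δ f) R.+ (R.- r R.* Dx.δ (Dy.δ f) R.+ r R.* r R.* Dx.δ (Dz.δ f))
    𝔻x f = R.+-congˡ (R.+-cong (R.*-congˡ (∂y∂x f)) (R.*-congˡ (∂z∂x f)))
    𝔻y : ∀ f → 𝔻 (Dy.δ f) R.≈ Dx.δ (Dy.δ f) R.+ (R.- r R.* Dy.δ (Dy.δ f) R.+ r R.* r R.* Dy.δ (Dz.δ f))
    𝔻y f = R.+-congˡ (R.+-congˡ (R.*-congˡ (∂z∂y f)))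

    𝔻𝔻 : ∀ q → 𝔻 (𝔻 q) R.≈ XR.⟦ second ⟧ᴱ (jet ρ q)
    𝔻𝔻 q = R.+-cong (R.trans (∂x𝔻 q) (𝔻x q)) (R.+-cong (R.*-congˡ (R.trans (∂y𝔻 q) (𝔻y q))) (R.*-congˡ (∂z𝔻 q)))

  module OnLine (a : Line) where
    open NullLine a using (ρ)
    open Along ρ
    open Relation.Binary.Reasoning.Setoid B.setoid

    ev-𝔻 : ∀ f → E.ap a (𝔻 f) B.≈ D.δ (E.ap a f)
    ev-𝔻 f = B.trans (E.ap-+ a _ _) (B.trans (B.+-congˡ (B.trans (E.ap-+ a _ _) (B.+-cong
        (B.trans (E.ap-* a _ _) (B.*-congʳ (B.trans (E.ap-neg a r) (B.-‿cong (ev-ι a ρ)))))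
        (B.trans (E.ap-* a _ _) (B.*-congʳ (B.trans (E.ap-* a r r) (B.*-cong (ev-ι a ρ) (ev-ι a ρ)))))))) (B.sym (chain a f)))

    D0 : ∀ {g} → g B.≈ B.0# → D.δ g B.≈ B.0#
    D0 e = B.trans (D.δ-cong e) D.δ-0

    on-𝔻 : ∀ {q} → On q a → On (𝔻 q) a
    on-𝔻 {q} h = B.trans (ev-𝔻 q) (D0 h)

    on-𝔻𝔻 : ∀ {q} → On q a → On (𝔻 (𝔻 q)) a
    on-𝔻𝔻 h = on-𝔻 (on-𝔻 h)

    jetB : R.Carrier → Jet → B.Carrier
    jetB q s = E.ap a (jet ρ q s)

    -- On the line, `W` is minus the derivative of `first` with respect to the slope. Where `V` is
    -- nonzero and `ρ′` is the second root of `first`, Vieta gives `W = (ρ′ - ρ) V`; so `W / V`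
    -- measures how far the second isotropic direction is from the line.
    V W : R.Carrier → B.Carrier
    V q = E.ap a (Dz.δ q)
    W q = jetB q jy B.+ B.- (jetB q jr B.* jetB q jz B.+ jetB q jr B.* jetB q jz)

    D-r : ∀ q → D.δ (jetB q jr) B.≈ B.0#
    D-r q = B.trans (D.δ-cong (ev-ι a ρ)) (d-ι ρ)

    expand : ∀ {f x y z} → 𝔻 f R.≈ x R.+ (R.- r R.* y R.+ r R.* r R.* z) →
      D.δ (E.ap a f) B.≈ E.ap a x B.+ (B.- E.ap a r B.* E.ap a y B.+ E.ap a r B.* E.ap a r B.* E.ap a z)
    expand {f} e = B.trans (B.sym (ev-𝔻 f)) (B.trans (E.ap-cong a e) (B.trans (E.ap-+ a _ _) (B.+-congˡ (B.trans (E.ap-+ a _ _) (B.+-cong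
        (B.trans (E.ap-* a _ _) (B.*-congʳ (E.ap-neg a r))) (B.trans (E.ap-* a _ _) (B.*-congʳ (E.ap-* a r r))))))))

    D-const* : ∀ q g → D.δ (jetB q jr B.* g) B.≈ jetB q jr B.* D.δ g
    D-const* q g = B.trans (D.δ-* _ _) (B.trans (B.+-congʳ (B.trans (B.*-congʳ (D-r q)) (B.zeroˡ g))) (B.+-identityˡ _))

    D-W′ : ∀ q → D.δ (W q) B.≈ D.δ (jetB q jy) B.+ B.- (jetB q jr B.* D.δ (V q) B.+ jetB q jr B.* D.δ (V q))
    D-W′ q = B.trans (D.δ-+ _ _) (B.+-congˡ (B.trans (D.δ-neg _) (B.-‿cong (B.trans (D.δ-+ _ _) (B.+-cong (D-const* q _) (D-const* q _))))))

    D-W : ∀ q → D.δ (W q) B.≈ (jetB q jxy B.+ (B.- jetB q jr B.* jetB q jyy B.+ jetB q jr B.* jetB q jr B.* jetB q jyz)) B.+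
      B.- (jetB q jr B.* (jetB q jxz B.+ (B.- jetB q jr B.* jetB q jyz B.+ jetB q jr B.* jetB q jr B.* jetB q jzz)) B.+
           jetB q jr B.* (jetB q jxz B.+ (B.- jetB q jr B.* jetB q jyz B.+ jetB q jr B.* jetB q jr B.* jetB q jzz)))
    D-W q = B.trans (D-W′ q) (B.+-cong (expand (𝔻y q)) (B.-‿cong (B.+-cong (B.*-congˡ dz) (B.*-congˡ dz))))
      where
      dz : D.δ (V q) B.≈ jetB q jxz B.+ (B.- jetB q jr B.* jetB q jyz B.+ jetB q jr B.* jetB q jr B.* jetB q jzz)
      dz = expand (R.refl {𝔻 (Dz.δ q)})

    first-B : ∀ {q} → On q a → XB.⟦ first ⟧ᴱ (jetB q) B.≈ B.0#
    first-B {q} h = B.trans (B.sym (hom-Expr (ev a) first (jet ρ q))) (on-𝔻 h)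

    module _ {q : R.Carrier} (on : On q a) (q∣rem₀ : q R.∣ rem₀-of q) (q∣rem₁ : q R.∣ rem₁-of q) where
      private
        v = V q
        y = jetB q jy
        w = W q
        h = XB.⟦ quot ⟧ᴱ (jetB q)

      -- The pseudo-division identity differentiated in the slope and restricted to the line, where
      -- `first` and all multiples of `q` vanish.
      slope : v B.* v B.* v B.* (D.δ w B.+ D.δ w) B.≈ h B.* w
      slope = begin
        v B.* v B.* v B.* (D.δ w B.+ D.δ w) ≈⟨ B.*-congˡ (B.+-cong (D-W q) (D-W q)) ⟩
        _ ≈⟨ PseudoDivision.division′ B.ring (jetB q) ⟩
        h B.* w B.+ B.- ((XB.⟦ quot₁ ⟧ᴱ (jetB q) B.+ (XB.⟦ quot₂ ⟧ᴱ (jetB q) B.* jetB q jr B.+ XB.⟦ quot₂ ⟧ᴱ (jetB q) B.* jetB q jr)) B.* XB.⟦ first ⟧ᴱ (jetB q) B.+ XB.⟦ rem₁ ⟧ᴱ (jetB q))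
          ≈⟨ B.+-congˡ (B.-‿cong (B.+-cong (B.*-congˡ (first-B on)) rem-zero)) ⟩
        h B.* w B.+ B.- ((XB.⟦ quot₁ ⟧ᴱ (jetB q) B.+ (XB.⟦ quot₂ ⟧ᴱ (jetB q) B.* jetB q jr B.+ XB.⟦ quot₂ ⟧ᴱ (jetB q) B.* jetB q jr)) B.* B.0# B.+ B.0#)
          ≈⟨ SB.solve 2 (λ x k → x SB.:+ SB.:- (k SB.:* SB.con (+ 0) SB.:+ SB.con (+ 0)) SB.:= x) B.refl _ _ ⟩
        h B.* w ∎
        where
        rem-zero : XB.⟦ rem₁ ⟧ᴱ (jetB q) B.≈ B.0#
        rem-zero = B.trans (B.sym (hom-Expr (ev a) rem₁ (jet ρ q))) (On-∣ a q∣rem₁ on)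

      -- The derivation tangent to the level surfaces of q within x = const.
      tangent : Derivation R.ring
      tangent = record
        { δ = λ f → Dz.δ q R.* Dy.δ f R.+ R.- (Dy.δ q R.* Dz.δ f)
        ; δ-cong = λ e → R.+-cong (R.*-congˡ (Dy.δ-cong e)) (R.-‿cong (R.*-congˡ (Dz.δ-cong e)))
        ; δ-+ = λ f g → R.trans (R.+-cong (R.*-congˡ (Dy.δ-+ f g)) (R.-‿cong (R.*-congˡ (Dz.δ-+ f g))))
            (SR.solve 6 (λ z y a b c d → z SR.:* (a SR.:+ b) SR.:- y SR.:* (c SR.:+ d) SR.:= (z SR.:* a SR.:- y SR.:* c) SR.:+ (z SR.:* b SR.:- y SR.:* d)) R.refl (Dz.δ q) (Dy.δ q) _ _ _ _)
        ; δ-* = λ f g → R.trans (R.+-cong (R.*-congˡ (Dy.δ-* f g)) (R.-‿cong (R.*-congˡ (Dz.δ-* f g))))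
            (SR.solve 8 (λ z y f g fy gy fz gz → z SR.:* (fy SR.:* g SR.:+ f SR.:* gy) SR.:- y SR.:* (fz SR.:* g SR.:+ f SR.:* gz) SR.:=
               (z SR.:* fy SR.:- y SR.:* fz) SR.:* g SR.:+ f SR.:* (z SR.:* gy SR.:- y SR.:* gz)) R.refl (Dz.δ q) (Dy.δ q) f g (Dy.δ f) (Dy.δ g) (Dz.δ f) (Dz.δ g)) }
      private module T = Derivation tangent

      T-q : T.δ q R.≈ R.0#
      T-q = SR.solve 2 (λ z y → z SR.:* y SR.:- y SR.:* z SR.:= SR.con (+ 0)) R.refl (Dz.δ q) (Dy.δ q)

      T-multiple : ∀ {g} → q R.∣ g → On (T.δ g) a
      T-multiple {g} (k , e) = B.trans (E.ap-cong a (R.trans (T.δ-cong e) (R.trans (T.δ-* q k) (R.trans (R.+-congʳ (R.trans (R.*-congʳ T-q) (R.zeroˡ k))) (R.+-identityˡ _)))))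
        (On-*ˡ (T.δ k) a on)

      T-product : ∀ f g → On g a → E.ap a (T.δ (f R.* g)) B.≈ E.ap a f B.* E.ap a (T.δ g)
      T-product f g ong = B.trans (E.ap-cong a (T.δ-* f g)) (B.trans (E.ap-+ a _ _) (B.trans (B.+-congʳ (On-*ʳ (T.δ f) a ong)) (B.trans (B.+-identityˡ _) (E.ap-* a f (T.δ g)))))

      ev-T : ∀ f → E.ap a (T.δ f) B.≈ v B.* E.ap a (Dy.δ f) B.+ B.- (y B.* E.ap a (Dz.δ f))
      ev-T f = B.trans (E.ap-+ a _ _) (B.+-cong (E.ap-* a _ _) (B.trans (E.ap-neg a _) (B.-‿cong (E.ap-* a _ _))))

      T-𝔻 : ∀ f → E.ap a (T.δ (𝔻 f)) B.≈ v B.* D.δ (E.ap a (Dy.δ f)) B.+ B.- (y B.* D.δ (E.ap a (Dz.δ f)))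
      T-𝔻 f = B.trans (ev-T (𝔻 f)) (B.+-cong (B.*-congˡ (B.trans (E.ap-cong a (∂y𝔻 f)) (ev-𝔻 _)))
        (B.-‿cong (B.*-congˡ (B.trans (E.ap-cong a (∂z𝔻 f)) (ev-𝔻 _)))))

      T-𝔻𝔻 : ∀ f → E.ap a (T.δ (𝔻 (𝔻 f))) B.≈ v B.* D.δ (D.δ (E.ap a (Dy.δ f))) B.+ B.- (y B.* D.δ (D.δ (E.ap a (Dz.δ f))))
      T-𝔻𝔻 f = B.trans (T-𝔻 (𝔻 f)) (B.+-cong (B.*-congˡ (D.δ-cong (B.trans (E.ap-cong a (∂y𝔻 f)) (ev-𝔻 _))))
        (B.-‿cong (B.*-congˡ (D.δ-cong (B.trans (E.ap-cong a (∂z𝔻 f)) (ev-𝔻 _))))))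

      -- The pseudo-division identity differentiated by `tangent`. That derivation kills `q`, so
      -- multiples of `q` contribute nothing on the line, and in a product with a factor vanishing
      -- on the line only this factor is differentiated.
      curvature : v B.* v B.* v B.* (v B.* D.δ (D.δ y) B.+ B.- (y B.* D.δ (D.δ v))) B.≈ h B.* (v B.* D.δ y B.+ B.- (y B.* D.δ v))
      curvature = begin
        v B.* v B.* v B.* (v B.* D.δ (D.δ y) B.+ B.- (y B.* D.δ (D.δ v))) ≈⟨ B.*-cong (B.sym (B.trans (E.ap-* a _ _) (B.*-congʳ (E.ap-* a _ _)))) (B.sym (T-𝔻𝔻 q)) ⟩
        E.ap a cube B.* E.ap a (T.δ (𝔻 (𝔻 q))) ≈⟨ B.sym (T-product cube (𝔻 (𝔻 q)) (on-𝔻𝔻 on)) ⟩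
        E.ap a (T.δ (cube R.* 𝔻 (𝔻 q))) ≈⟨ E.ap-cong a (T.δ-cong (R.trans (R.*-congˡ (𝔻𝔻 q)) (PseudoDivision.division R.ring (jet ρ q)))) ⟩
        E.ap a (T.δ (H R.* 𝔻 q R.+ (rem₁-of q R.* r R.+ rem₀-of q))) ≈⟨ B.trans (E.ap-cong a (T.δ-+ _ _)) (E.ap-+ a _ _) ⟩
        E.ap a (T.δ (H R.* 𝔻 q)) B.+ E.ap a (T.δ (rem₁-of q R.* r R.+ rem₀-of q)) ≈⟨ B.+-cong (T-product H (𝔻 q) (on-𝔻 on)) rems ⟩
        E.ap a H B.* E.ap a (T.δ (𝔻 q)) B.+ B.0# ≈⟨ B.+-identityʳ _ ⟩
        E.ap a H B.* E.ap a (T.δ (𝔻 q)) ≈⟨ B.*-cong (hom-Expr (ev a) quot (jet ρ q)) (T-𝔻 q) ⟩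
        h B.* (v B.* D.δ y B.+ B.- (y B.* D.δ v)) ∎
        where
        cube = Dz.δ q R.* Dz.δ q R.* Dz.δ q
        H = XR.⟦ quot ⟧ᴱ (jet ρ q)
        rems : E.ap a (T.δ (rem₁-of q R.* r R.+ rem₀-of q)) B.≈ B.0#
        rems = T-multiple {rem₁-of q R.* r R.+ rem₀-of q}
          (proj₁ q∣rem₁ R.* r R.+ proj₁ q∣rem₀ , R.trans (R.+-cong (R.*-congʳ (proj₂ q∣rem₁)) (proj₂ q∣rem₀))
             (SR.solve 4 (λ q k r l → (q SR.:* k) SR.:* r SR.:+ q SR.:* l SR.:= q SR.:* (k SR.:* r SR.:+ l)) R.refl q _ r _))

      private
        U : B.Carrier
        U = v B.* D.δ w B.+ B.- (w B.* D.δ v)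

        D-U : D.δ U B.≈ v B.* D.δ (D.δ w) B.+ B.- (w B.* D.δ (D.δ v))
        D-U = B.trans (D.δ-+ _ _) (B.trans (B.+-cong (D.δ-* _ _) (B.trans (D.δ-neg _) (B.-‿cong (D.δ-* _ _))))
          (SB.solve 6 (λ v w v′ w′ v″ w″ → (v′ SB.:* w′ SB.:+ v SB.:* w″) SB.:- (w′ SB.:* v′ SB.:+ w SB.:* v″) SB.:= v SB.:* w″ SB.:- w SB.:* v″) B.refl v w (D.δ v) (D.δ w) (D.δ (D.δ v)) (D.δ (D.δ w))))

        ρB = jetB q jr

        D-D-W : D.δ (D.δ w) B.≈ D.δ (D.δ y) B.+ B.- (ρB B.* D.δ (D.δ v) B.+ ρB B.* D.δ (D.δ v))
        D-D-W = B.trans (D.δ-cong (D-W′ q)) (B.trans (D.δ-+ _ _) (B.+-congˡ (B.trans (D.δ-neg _) (B.-‿cong (B.trans (D.δ-+ _ _) (B.+-cong (D-const* q _) (D-const* q _)))))))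

        U-y : U B.≈ v B.* D.δ y B.+ B.- (y B.* D.δ v)
        U-y = B.trans (B.+-congʳ (B.*-congˡ (D-W′ q)))
          (SB.solve 5 (λ v y r y′ v′ → v SB.:* (y′ SB.:- (r SB.:* v′ SB.:+ r SB.:* v′)) SB.:- (y SB.:- (r SB.:* v SB.:+ r SB.:* v)) SB.:* v′ SB.:= v SB.:* y′ SB.:- y SB.:* v′) B.refl v y ρB (D.δ y) (D.δ v))

        DU-y : D.δ U B.≈ v B.* D.δ (D.δ y) B.+ B.- (y B.* D.δ (D.δ v))
        DU-y = B.trans D-U (B.trans (B.+-congʳ (B.*-congˡ D-D-W))
          (SB.solve 5 (λ v y r y′ v′ → v SB.:* (y′ SB.:- (r SB.:* v′ SB.:+ r SB.:* v′)) SB.:- (y SB.:- (r SB.:* v SB.:+ r SB.:* v)) SB.:* v′ SB.:= v SB.:* y′ SB.:- y SB.:* v′) B.refl v y ρB (D.δ (D.δ y)) (D.δ (D.δ v))))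

      -- Eliminates the common multiplier `h` from `slope` and `curvature`. The outcome says that
      -- `U / w²` has derivative zero.
      ode : ¬ (v B.≈ B.0#) → D.δ U B.* w B.≈ (D.δ w B.+ D.δ w) B.* U
      ode v≉0 = B.cancel (B.*-nonzero (B.*-nonzero v≉0 v≉0) v≉0) (begin
        v B.* v B.* v B.* (D.δ U B.* w) ≈⟨ B.trans (B.sym (B.*-assoc _ _ _)) (B.*-congʳ (B.*-congˡ DU-y)) ⟩
        v B.* v B.* v B.* (v B.* D.δ (D.δ y) B.+ B.- (y B.* D.δ (D.δ v))) B.* w ≈⟨ B.*-congʳ curvature ⟩
        h B.* (v B.* D.δ y B.+ B.- (y B.* D.δ v)) B.* w ≈⟨ SB.solve 3 (λ h u w → h SB.:* u SB.:* w SB.:= (h SB.:* w) SB.:* u) B.refl h _ w ⟩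
        h B.* w B.* (v B.* D.δ y B.+ B.- (y B.* D.δ v)) ≈⟨ B.*-cong (B.sym slope) (B.sym U-y) ⟩
        v B.* v B.* v B.* (D.δ w B.+ D.δ w) B.* U ≈⟨ B.*-assoc _ _ _ ⟩
        v B.* v B.* v B.* ((D.δ w B.+ D.δ w) B.* U) ∎)

      -- V / W is an affine function of x along the line: the second ruling turns like a Möbius map.
      affine : ∀ {δ} → R.Lt (suc δ) q → 1 ≤ δ → δ ℕ.+ δ ≤ p → ¬ (v B.≈ B.0#) → ¬ (w B.≈ B.0#) →
        ¬¬ ∃₂ λ k l → v B.≈ (B.ι l B.+ B.- (B.ι k B.* X)) B.* w
      affine {δ} lq 1≤δ 2δ≤p v≉0 w≉0 = do
        -- By `ode`, `U` and `w²` have the same logarithmic derivative. Both have degree below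
        -- `2 δ`, which explains the hypothesis on `p`.
        k , ek ← proportional {δ ℕ.+ δ} {U} {w B.* w} 2δ≤p lU (B.Lt-* lw lw (ℕₚ.n≤1+n _)) (B.*-nonzero w≉0 w≉0) (begin
          D.δ U B.* (w B.* w) ≈⟨ B.sym (B.*-assoc _ _ _) ⟩
          D.δ U B.* w B.* w ≈⟨ B.*-congʳ (ode v≉0) ⟩
          (D.δ w B.+ D.δ w) B.* U B.* w ≈⟨ SB.solve 3 (λ w′ u w → (w′ SB.:+ w′) SB.:* u SB.:* w SB.:= u SB.:* (w′ SB.:* w SB.:+ w SB.:* w′)) B.refl (D.δ w) U w ⟩
          U B.* (D.δ w B.* w B.+ w B.* D.δ w) ≈⟨ B.*-congˡ (B.sym (D.δ-* w w)) ⟩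
          U B.* D.δ (w B.* w) ∎)
        let kX = B.ι k B.* X
            V₁ = v B.+ kX B.* w
            D-kX : D.δ kX B.≈ B.ι k
            D-kX = B.trans (D.δ-* _ _) (B.trans (B.+-cong (B.trans (B.*-congʳ (d-ι k)) (B.zeroˡ _)) (B.trans (B.*-congˡ d-X) (B.*-identityʳ _))) (B.+-identityˡ _))
            D-V₁ : D.δ V₁ B.≈ D.δ v B.+ (B.ι k B.* w B.+ kX B.* D.δ w)
            D-V₁ = B.trans (D.δ-+ _ _) (B.+-congˡ (B.trans (D.δ-* _ _) (B.+-congʳ (B.*-congʳ D-kX))))
        -- As `(v / w)′ = - U / w² = - k`, the quotient `(v + k x w) / w` has derivative zero.
        l , el ← proportional {suc δ} {V₁} {w} (ℕₚ.≤-trans (ℕₚ.+-monoˡ-≤ δ 1≤δ) 2δ≤p)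
          (B.Lt-+ (B.Lt-mono (ℕₚ.n≤1+n _) lv) (B.Lt-* {2} {δ} (B.Lt-* (GradedAlg.ι-Lt B k) X-Lt ℕₚ.≤-refl) lw ℕₚ.≤-refl))
          (B.Lt-mono (ℕₚ.n≤1+n _) lw) w≉0 (begin
            D.δ V₁ B.* w ≈⟨ B.*-congʳ D-V₁ ⟩
            (D.δ v B.+ (B.ι k B.* w B.+ kX B.* D.δ w)) B.* w ≈⟨ SB.solve 6 (λ v′ k w x w′ v → (v′ SB.:+ (k SB.:* w SB.:+ x SB.:* w′)) SB.:* w SB.:= k SB.:* (w SB.:* w) SB.:+ (v′ SB.:* w SB.:+ x SB.:* w′ SB.:* w)) B.refl (D.δ v) (B.ι k) w kX (D.δ w) v ⟩
            B.ι k B.* (w B.* w) B.+ (D.δ v B.* w B.+ kX B.* D.δ w B.* w) ≈⟨ B.+-congʳ (B.sym ek) ⟩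
            U B.+ (D.δ v B.* w B.+ kX B.* D.δ w B.* w) ≈⟨ SB.solve 5 (λ v w v′ w′ x → (v SB.:* w′ SB.:- w SB.:* v′) SB.:+ (v′ SB.:* w SB.:+ x SB.:* w′ SB.:* w) SB.:= (v SB.:+ x SB.:* w) SB.:* w′) B.refl v w (D.δ v) (D.δ w) kX ⟩
            V₁ B.* D.δ w ∎)
        η (k , l , (begin
          v ≈⟨ SB.solve 3 (λ v x w → v SB.:= (v SB.:+ x SB.:* w) SB.:- x SB.:* w) B.refl v kX w ⟩
          V₁ B.+ B.- (kX B.* w) ≈⟨ B.+-congʳ el ⟩
          B.ι l B.* w B.+ B.- (kX B.* w) ≈⟨ SB.solve 3 (λ l x w → l SB.:* w SB.:- x SB.:* w SB.:= (l SB.:- x) SB.:* w) B.refl (B.ι l) kX w ⟩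
          (B.ι l B.+ B.- kX) B.* w ∎))
        where
        lv : B.Lt δ v
        lv = ev-Lt a δ (∂z-Lt δ q lq)
        lr : B.Lt 1 (jetB q jr)
        lr = B.Lt-cong (B.sym (ev-ι a ρ)) (GradedAlg.ι-Lt B ρ)
        lw : B.Lt δ w
        lw = B.Lt-+ (ev-Lt a δ (∂y-Lt δ q lq)) (B.Lt-neg (B.Lt-+ (B.Lt-* lr lv ℕₚ.≤-refl) (B.Lt-* lr lv ℕₚ.≤-refl)))
        lower : ∀ {g} → B.Lt δ g → B.Lt δ (D.δ g)
        lower l = d-Lt δ _ (B.Lt-mono (ℕₚ.n≤1+n δ) l)
        lU : B.Lt (δ ℕ.+ δ) U
        lU = B.Lt-+ (B.Lt-* lv (lower lw) (ℕₚ.n≤1+n _)) (B.Lt-neg (B.Lt-* lw (lower lv) (ℕₚ.n≤1+n _)))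

  module Crossing (a b : Line) (x : K.Carrier) (ρ≉ : ¬ (NullLine.ρ a K.≈ NullLine.ρ b))
      (ey : NullLine.yAt a x K.≈ NullLine.yAt b x) (ez : NullLine.zAt a x K.≈ NullLine.zAt b x) {q : R.Carrier}
      (ona : On q a) (onb : On q b) where
    private
      module a = NullLine a
      module b = NullLine b

    val : R.Carrier → K.Carrier
    val f = Pt.ap x (E.ap a f)

    val-b : ∀ f → Pt.ap x (E.ap b f) K.≈ val f
    val-b f = K.sym (meet a b x ey ez f)

    On-val : ∀ {f} → On f a → val f K.≈ K.0#
    On-val h = K.trans (Pt.ap-cong x h) (Pt.ap-0 x)

    On-val-b : ∀ {f} → On f b → val f K.≈ K.0#
    On-val-b h = K.trans (K.sym (val-b _)) (K.trans (Pt.ap-cong x h) (Pt.ap-0 x))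

    jetK : K.Carrier → Jet → K.Carrier
    jetK ρ jr = ρ
    jetK ρ s = val (jet K.0# q s)

    jetK-val : ∀ ρ s → val (jet ρ q s) K.≈ jetK ρ s
    jetK-val ρ jr = K.trans (Pt.ap-cong x (ev-ι a ρ)) (pt-ι x ρ)
    jetK-val ρ jx = K.refl
    jetK-val ρ jy = K.refl
    jetK-val ρ jz = K.refl
    jetK-val ρ jxx = K.refl
    jetK-val ρ jxy = K.refl
    jetK-val ρ jyy = K.refl
    jetK-val ρ jxz = K.refl
    jetK-val ρ jyz = K.refl
    jetK-val ρ jzz = K.refl

    val-Expr : ∀ ρ e → val (XR.⟦ e ⟧ᴱ (jet ρ q)) K.≈ XK.⟦ e ⟧ᴱ (jetK ρ)
    val-Expr ρ e = K.trans (hom-Expr (pt x ∘ʰ ev a) e (jet ρ q)) (XK.cong-Expr e (jetK-val ρ))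

    first-a : XK.⟦ first ⟧ᴱ (jetK a.ρ) K.≈ K.0#
    first-a = K.trans (K.sym (val-Expr a.ρ first)) (On-val (OnLine.on-𝔻 a ona))

    first-b : XK.⟦ first ⟧ᴱ (jetK b.ρ) K.≈ K.0#
    first-b = K.trans (K.sym (val-Expr b.ρ first)) (On-val-b (OnLine.on-𝔻 b onb))

    second-a : XK.⟦ second ⟧ᴱ (jetK a.ρ) K.≈ K.0#
    second-a = K.trans (K.sym (val-Expr a.ρ second)) (On-val (B.trans (E.ap-cong a (R.sym (Along.𝔻𝔻 a.ρ q))) (OnLine.on-𝔻𝔻 a ona)))

    second-b : XK.⟦ second ⟧ᴱ (jetK b.ρ) K.≈ K.0#
    second-b = K.trans (K.sym (val-Expr b.ρ second)) (On-val-b (B.trans (E.ap-cong b (R.sym (Along.𝔻𝔻 b.ρ q))) (OnLine.on-𝔻𝔻 b onb)))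

    private
      vx vy vz r₀ r₁ : K.Carrier
      vx = jetK K.0# jx
      vy = jetK K.0# jy
      vz = jetK K.0# jz
      r₀ = XK.⟦ rem₀ ⟧ᴱ (jetK K.0#)
      r₁ = XK.⟦ rem₁ ⟧ᴱ (jetK K.0#)

      diff≉0 : ¬ (b.ρ K.+ K.- a.ρ K.≈ K.0#)
      diff≉0 e = ρ≉ (K.trans (SK.solve 2 (λ a b → a SK.:= b SK.:- (b SK.:- a)) K.refl a.ρ b.ρ)
        (K.trans (K.+-congˡ (K.-‿cong e)) (SK.solve 1 (λ b → b SK.:- SK.con (+ 0) SK.:= b) K.refl b.ρ)))

    -- A slope at which both `first` and `second` vanish is a root of the linear remainder. At a
    -- crossing both slopes are such roots, and they differ, so the two coefficients vanish.
    remainder : ∀ ρ → XK.⟦ first ⟧ᴱ (jetK ρ) K.≈ K.0# → XK.⟦ second ⟧ᴱ (jetK ρ) K.≈ K.0# → r₁ K.* ρ K.+ r₀ K.≈ K.0#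
    remainder ρ e₁ e₂ = K.trans (SK.solve 2 (λ h x → x SK.:= h SK.:* SK.con (+ 0) SK.:+ x) K.refl (XK.⟦ quot ⟧ᴱ (jetK ρ)) (r₁ K.* ρ K.+ r₀))
      (K.trans (K.+-congʳ (K.*-congˡ (K.sym e₁)))
      (K.trans (K.sym (PseudoDivision.division kring (jetK ρ))) (K.trans (K.*-congˡ e₂) (K.zeroʳ _))))

    r₁≈0 : r₁ K.≈ K.0#
    r₁≈0 = mul-zero diff≉0 (K.trans (SK.solve 4 (λ a b r s → (b SK.:- a) SK.:* r SK.:= (r SK.:* b SK.:+ s) SK.:- (r SK.:* a SK.:+ s)) K.refl a.ρ b.ρ r₁ r₀)
      (K.trans (K.+-cong (remainder b.ρ first-b second-b) (K.-‿cong (remainder a.ρ first-a second-a))) (K.-‿inverseʳ K.0#)))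

    r₀≈0 : r₀ K.≈ K.0#
    r₀≈0 = K.trans (SK.solve 2 (λ r s → s SK.:= SK.con (+ 0) SK.:* r SK.:+ s) K.refl a.ρ r₀)
      (K.trans (K.+-congʳ (K.*-congʳ (K.sym r₁≈0))) (remainder a.ρ first-a second-a))

    rem₁-vanishes : val (rem₁-of q) K.≈ K.0#
    rem₁-vanishes = K.trans (val-Expr K.0# rem₁) r₁≈0

    rem₀-vanishes : val (rem₀-of q) K.≈ K.0#
    rem₀-vanishes = K.trans (val-Expr K.0# rem₀) r₀≈0

    -- Vieta's formula: the two slopes are the roots of `vx - r vy + r² vz`. Subtracting the two
    -- equations and cancelling `b.ρ - a.ρ` avoids dividing by `vz`.
    second-slope : vy K.≈ (a.ρ K.+ b.ρ) K.* vz
    second-slope = K.trans (SK.solve 3 (λ y s z → y SK.:= (s SK.:* z) SK.:- (s SK.:* z SK.:- y)) K.refl vy (a.ρ K.+ b.ρ) vz)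
      (K.trans (K.+-congˡ (K.-‿cong (mul-zero diff≉0
        (K.trans (SK.solve 5 (λ a b x y z → (b SK.:- a) SK.:* ((a SK.:+ b) SK.:* z SK.:- y) SK.:=
              (x SK.:+ (SK.:- b SK.:* y SK.:+ b SK.:* b SK.:* z)) SK.:- (x SK.:+ (SK.:- a SK.:* y SK.:+ a SK.:* a SK.:* z))) K.refl a.ρ b.ρ vx vy vz)
          (K.trans (K.+-cong first-b (K.-‿cong first-a)) (K.-‿inverseʳ K.0#))))))
        (SK.solve 1 (λ s → s SK.:- SK.con (+ 0) SK.:= s) K.refl _))

    W-value : Pt.ap x (OnLine.W a q) K.≈ (b.ρ K.+ K.- a.ρ) K.* vz
    W-value = K.trans (Pt.ap-+ x _ _) (K.trans (K.+-cong second-slope (K.trans (Pt.ap-neg x _) (K.-‿cong (K.trans (Pt.ap-+ x _ _) (K.+-cong prod prod)))))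
      (SK.solve 3 (λ a b z → (a SK.:+ b) SK.:* z SK.:- (a SK.:* z SK.:+ a SK.:* z) SK.:= (b SK.:- a) SK.:* z) K.refl a.ρ b.ρ vz))
      where
      prod : Pt.ap x (E.ap a (R.ι a.ρ) B.* E.ap a (Dz.δ q)) K.≈ a.ρ K.* vz
      prod = K.trans (Pt.ap-* x _ _) (K.*-congʳ (jetK-val a.ρ jr))

    -- If the leading coefficient `vz` is zero, a polynomial of degree at most 1 with two distinct
    -- roots remains, so the whole gradient vanishes and the crossing is a singular point.
    singular-y : vz K.≈ K.0# → vy K.≈ K.0#
    singular-y z = K.trans second-slope (K.trans (K.*-congˡ z) (K.zeroʳ _))

    singular-x : vz K.≈ K.0# → vx K.≈ K.0#
    singular-x z = K.trans (SK.solve 2 (λ x a → x SK.:= x SK.:+ (SK.:- a SK.:* SK.con (+ 0) SK.:+ a SK.:* a SK.:* SK.con (+ 0))) K.refl vx a.ρ)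
      (K.trans (K.+-congˡ (K.+-cong (K.*-congˡ (K.sym (singular-y z))) (K.*-congˡ (K.sym z)))) first-a)

    -- At the crossing `W = (b.ρ - a.ρ) V` by `W-value`, while on the line `V = (l - k x) W`; cancel
    -- `W`.
    affine-value : ∀ {k l} → E.ap a (Dz.δ q) B.≈ (B.ι l B.+ B.- (B.ι k B.* X)) B.* OnLine.W a q →
      ¬ (Pt.ap x (OnLine.W a q) K.≈ K.0#) → (l K.+ K.- (k K.* x)) K.* (b.ρ K.+ K.- a.ρ) K.≈ K.1#
    affine-value {k} {l} e w≉0 = K.trans (SK.solve 2 (λ s t → s SK.:* t SK.:= t SK.:* s) K.refl _ _) (cancelK w≉0 (begin
      wv K.* ((b.ρ K.+ K.- a.ρ) K.* (l K.+ K.- (k K.* x))) ≈⟨ SK.solve 3 (λ w s t → w SK.:* (s SK.:* t) SK.:= s SK.:* (t SK.:* w)) K.refl wv _ _ ⟩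
      (b.ρ K.+ K.- a.ρ) K.* ((l K.+ K.- (k K.* x)) K.* wv) ≈⟨ K.*-congˡ (K.sym vz-value) ⟩
      (b.ρ K.+ K.- a.ρ) K.* vz ≈⟨ K.sym W-value ⟩
      wv ≈⟨ K.sym (K.*-identityʳ wv) ⟩
      wv K.* K.1# ∎))
      where
      open Relation.Binary.Reasoning.Setoid K.setoid
      wv = Pt.ap x (OnLine.W a q)
      cancelK : ∀ {u s t} → ¬ (u K.≈ K.0#) → u K.* s K.≈ u K.* t → s K.≈ t
      cancelK {u} {s} {t} u≉0 e = K.trans (SK.solve 2 (λ s t → s SK.:= t SK.:+ (s SK.:- t)) K.refl s t)
        (K.trans (K.+-congˡ (mul-zero u≉0 (K.trans (SK.solve 3 (λ u s t → u SK.:* (s SK.:- t) SK.:= u SK.:* s SK.:- u SK.:* t) K.refl u s t)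
          (K.trans (K.+-congʳ e) (K.-‿inverseʳ _))))) (K.+-identityʳ t))
      vz-value : vz K.≈ (l K.+ K.- (k K.* x)) K.* wv
      vz-value = K.trans (Pt.ap-cong x e) (K.trans (Pt.ap-* x _ _) (K.*-congʳ (K.trans (Pt.ap-+ x _ _)
        (K.+-cong (pt-ι x l) (K.trans (Pt.ap-neg x _) (K.-‿cong (K.trans (Pt.ap-* x _ _) (K.*-cong (pt-ι x k) (pt-X x)))))))))

-- The bound for crossings between two families of lines.

cube : ℕ → ℕ
cube n = n ℕ.* n ℕ.* n

Distinct : ∀ {a} {A : Set a} → List A → Set a
Distinct = AllPairs _≢_

-- The entry `xc` is the abscissa of a crossing. By `distinct-b` and `distinct-a`, different
-- crossings on one line have different abscissae, so they can be counted as roots. The last two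
-- fields are the input that excludes doubly ruled surfaces with too many crossings.
record Config {c ℓ} (K : StableField c ℓ) : Set (lsuc (c ⊔ ℓ)) where
  open CommutativeRing (StableField.ring K) using (Carrier; _≈_)
  open NullLine using (ρ; yAt; zAt)
  field
    𝔸 𝔹 : Set
    la : 𝔸 → NullLine K
    lb : 𝔹 → NullLine K
    Cr : 𝔸 → 𝔹 → Bool
    xc : 𝔸 → 𝔹 → Carrier
    κ : ℕ
    skew : ∀ {a b} → T (Cr a b) → ¬ (ρ (la a) ≈ ρ (lb b))
    meet-y : ∀ {a b} → T (Cr a b) → yAt (la a) (xc a b) ≈ yAt (lb b) (xc a b)
    meet-z : ∀ {a b} → T (Cr a b) → zAt (la a) (xc a b) ≈ zAt (lb b) (xc a b)
    distinct-b : ∀ {a b b′} → T (Cr a b) → T (Cr a b′) → b ≢ b′ → ¬ (xc a b ≈ xc a b′)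
    distinct-a : ∀ {a a′ b} → T (Cr a b) → T (Cr a′ b) → a ≢ a′ → ¬ (xc a b ≈ xc a′ b)
    lines-a : ∀ {a a′} → a ≢ a′ → ¬ SameNullLine (la a) (la a′)
    lines-b : ∀ {b b′} → b ≢ b′ → ¬ SameNullLine (lb b) (lb b′)
    few-directions : ∀ a bs → Distinct bs → All (λ b → T (Cr a b)) bs → AllPairs (λ b b′ → ¬ (ρ (lb b) ≈ ρ (lb b′))) bs → length bs ≤ κ
    few-parallel : ∀ a bs → Distinct bs → All (λ b → T (Cr a b)) bs → AllPairs (λ b b′ → ρ (lb b) ≈ ρ (lb b′)) bs → length bs ≤ κ

module Counting {c ℓ} (K : StableField c ℓ) (p : ℕ) (Amb : Ambient K p) (Cf : Config K) where
  open Ambient Amb hiding (d)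
  open Incidence K p Amb
  open LineCalculus K p Amb
  open Config Cf
  private module SK = IntSolver (StableField.ring K)

  deg : 𝔸 → List 𝔹 → ℕ
  deg a Bs = ∑ (λ b → ⟦ Cr a b ⟧) Bs

  deg′ : 𝔹 → List 𝔸 → ℕ
  deg′ b As = ∑ (λ a → ⟦ Cr a b ⟧) As

  I : List 𝔸 → List 𝔹 → ℕ
  I As Bs = ∑ (λ a → deg a Bs) As

  I-swap : ∀ As Bs → I As Bs ≡ ∑ (λ b → deg′ b As) Bs
  I-swap As Bs = ∑-swap (λ a b → ⟦ Cr a b ⟧) As Bs

  I-splitˡ : ∀ {p} {P : 𝔸 → Set p} {As As₁ As₂} Bs → Split P As As₁ As₂ → I As Bs ≡ I As₁ Bs ℕ.+ I As₂ Bs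
  I-splitˡ Bs s = ∑-split (λ a → deg a Bs) s

  I-splitʳ : ∀ {p} {P : 𝔹 → Set p} As {Bs Bs₁ Bs₂} → Split P Bs Bs₁ Bs₂ → I As Bs ≡ I As Bs₁ ℕ.+ I As Bs₂
  I-splitʳ As {Bs} {Bs₁} {Bs₂} s = ≡.trans (I-swap As Bs) (≡.trans (∑-split (λ b → deg′ b As) s)
    (≡.sym (≡.cong₂ ℕ._+_ (I-swap As Bs₁) (I-swap As Bs₂))))

  deg-bound : ∀ As Bs {k} → All (λ a → deg a Bs ≤ k) As → I As Bs ≤ length As ℕ.* k
  deg-bound As Bs = ∑-bound

  deg′-bound : ∀ As Bs {k} → All (λ b → deg′ b As ≤ k) Bs → I As Bs ≤ length Bs ℕ.* k
  deg′-bound As Bs h = ℕₚ.≤-trans (ℕₚ.≤-reflexive (I-swap As Bs)) (∑-bound h)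

  ∑-Bool : ∀ {x} {Y : Set x} (f : Y → Bool) ys → ∑ (λ y → ⟦ f y ⟧) ys ≤ length ys
  ∑-Bool f [] = z≤n
  ∑-Bool f (y ∷ ys) with f y
  ... | true = s≤s (∑-Bool f ys)
  ... | false = ℕₚ.≤-trans (∑-Bool f ys) (ℕₚ.n≤1+n _)

  I-trivial : ∀ As Bs → I As Bs ≤ length As ℕ.* length Bs
  I-trivial As Bs = ∑-bound (All.universal (λ a → ∑-Bool (Cr a) Bs) As)

  map-distinct : ∀ {x} {Y : Set x} (xf : Y → K.Carrier) ys → AllPairs (λ y y′ → ¬ (xf y K.≈ xf y′)) ys → AllPairs (λ s t → ¬ (s K.≈ t)) (map xf ys)
  map-distinct xf ys = Pairsₚ.map⁺

  pairs-with : ∀ {x q s t} {Y : Set x} {Q : Y → Set q} {S : Y → Y → Set s} {T : Y → Y → Set t} →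
    (∀ {y y′} → Q y → Q y′ → S y y′ → T y y′) → ∀ {ys} → All Q ys → AllPairs S ys → AllPairs T ys
  pairs-with h [] [] = []
  pairs-with h (q ∷ qs) (s ∷ ss) = go qs s ∷ pairs-with h qs ss
    where
    go : ∀ {zs} → All _ zs → All _ zs → All _ zs
    go [] [] = []
    go (q′ ∷ qs) (s ∷ ss) = h q q′ s ∷ go qs ss

  roots-bound : ∀ {x} {Y : Set x} (f : Y → Bool) (xf : Y → K.Carrier) → (∀ {y y′} → T (f y) → T (f y′) → y ≢ y′ → ¬ (xf y K.≈ xf y′)) →
    ∀ ys → Distinct ys → ∀ n g → B.Lt n g → ¬ (g B.≈ B.0#) → All (λ y → T (f y) → Pt.ap (xf y) g K.≈ K.0#) ys → ∑ (λ y → ⟦ f y ⟧) ys < n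
  roots-bound f xf sep ys dist n g lg g≉0 vanish with count-split f ys
  ... | zs , _ , s , e = ℕₚ.≰⇒> λ n≤ → g≉0 (few-roots n g lg (map xf zs)
      (≡.subst (n ≤_) (≡.trans e (≡.sym (Listₚ.length-map xf zs))) n≤)
      (map-distinct xf zs (pairs-with sep (split-yes s) (split-Pairsˡ s dist)))
      (Allₚ.map⁺ (go (split-yes s) (split-Allˡ s vanish))))
    where
    go : ∀ {zs} → All (λ y → T (f y)) zs → All (λ y → T (f y) → Pt.ap (xf y) g K.≈ K.0#) zs → All (λ y → Pt.ap (xf y) g K.≈ K.0#) zs
    go [] [] = []
    go (t ∷ ts) (h ∷ hs) = h t ∷ go ts hs

  Vanishes : R.Carrier → R.Carrier → Set _
  Vanishes q g = ∀ {a b} → T (Cr a b) → On q (la a) → On q (lb b) → Pt.ap (xc a b) (E.ap (la a) g) K.≈ K.0#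

  module _ {q g : R.Carrier} {n : ℕ} (lg : R.Lt n g) where
    deg-small : Vanishes q g → ∀ a Bs → Distinct Bs → On q (la a) → All (λ b → On q (lb b)) Bs → ¬ On g (la a) → deg a Bs < n
    deg-small v a Bs dist ona onB ng = roots-bound (Cr a) (xc a) distinct-b Bs dist n (E.ap (la a) g) (ev-Lt (la a) n lg) ng
      (All.map (λ onb t → v t ona onb) onB)

    deg′-small : Vanishes q g → ∀ b As → Distinct As → On q (lb b) → All (λ a → On q (la a)) As → ¬ On g (lb b) → deg′ b As < n
    deg′-small v b As dist onb onA ng = roots-bound (λ a → Cr a b) (λ a → xc a b) distinct-a As dist n (E.ap (lb b) g) (ev-Lt (lb b) n lg) ng
      (All.map (λ {a} ona t → K.trans (K.sym (meet (la a) (lb b) (xc a b) (meet-y t) (meet-z t) g)) (v t ona onb)) onA)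

  module _ {g : R.Carrier} {n : ℕ} (lg : R.Lt n g) where
    deg-outside : ∀ a Bs → Distinct Bs → All (λ b → On g (lb b)) Bs → ¬ On g (la a) → deg a Bs < n
    deg-outside a Bs dist onB ng = roots-bound (Cr a) (xc a) distinct-b Bs dist n (E.ap (la a) g) (ev-Lt (la a) n lg) ng
      (All.map (λ {b} onb t → K.trans (meet (la a) (lb b) (xc a b) (meet-y t) (meet-z t) g) (K.trans (Pt.ap-cong _ onb) (Pt.ap-0 _))) onB)

    deg′-outside : ∀ b As → Distinct As → All (λ a → On g (la a)) As → ¬ On g (lb b) → deg′ b As < n
    deg′-outside b As dist onA ng = roots-bound (λ a → Cr a b) (λ a → xc a b) distinct-a As dist n (E.ap (lb b) g) (ev-Lt (lb b) n lg) ng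
      (All.map (λ {a} ona t → K.trans (K.sym (meet (la a) (lb b) (xc a b) (meet-y t) (meet-z t) g)) (K.trans (Pt.ap-cong _ ona) (Pt.ap-0 _))) onA)

  module _ {a : 𝔸} {b : 𝔹} (t : T (Cr a b)) {q : R.Carrier} (ona : On q (la a)) (onb : On q (lb b)) where
    module At = LineCalculus.Crossing K p Amb (la a) (lb b) (xc a b) (skew t) (meet-y t) (meet-z t) {q} ona onb

  -- `H` is the induction hypothesis for the exceptional lines. Their number comes from `bezout`:
  -- `64 δ²` is `16 · δ · 4 δ`, where `4 δ` bounds the degree of the two remainders.
  module PrimeSurface {q : R.Carrier} (prime : R.Prime q) {δ : ℕ} (lq : R.Lt (suc δ) q) (nq : ¬ R.Lt δ q) (2δ≤p : δ ℕ.+ δ ≤ p)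
      {Φ : ℕ} (H : ∀ As Bs → Distinct As → Distinct Bs → length As ≤ 64 ℕ.* (δ ℕ.* δ) → length Bs ≤ 64 ℕ.* (δ ℕ.* δ) → I As Bs ≤ Φ ℕ.+ κ ℕ.* length As) where
    private module Q = R.Prime prime

    1≤δ : 1 ≤ δ
    1≤δ = ℕₚ.n≢0⇒n>0 λ { ≡.refl → Q.nonunit (R.unit lq Q.nonzero) }

    Bound : List 𝔸 → List 𝔹 → Set
    Bound As Bs = I As Bs ≤ 4 ℕ.* δ ℕ.* (length As ℕ.+ length Bs) ℕ.+ (Φ ℕ.+ κ ℕ.* length As)

    few-lines-a : ∀ {g D} → 1 ≤ D → D ≤ 4 ℕ.* δ → R.Lt (suc D) g → ¬ (q R.∣ g) → ∀ As → Distinct As → All (λ a → On q (la a)) As → All (λ a → On g (la a)) As → length As ≤ 64 ℕ.* (δ ℕ.* δ)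
    few-lines-a {g} {D} 1≤D D≤ lg q∤g As dist onq ong = ℕₚ.≤-trans (ℕₚ.≤-trans (ℕₚ.≤-reflexive (≡.sym (Listₚ.length-map la As)))
      (bezout prime q∤g lq lg 1≤D (map la As) (Pairsₚ.map⁺ (pairs-with {Q = λ _ → 𝔸} (λ _ _ → lines-a) (All.universal (λ a → a) As) dist)) (Allₚ.map⁺ onq) (Allₚ.map⁺ ong)))
      (ℕₚ.≤-trans (ℕₚ.*-monoʳ-≤ 16 (ℕₚ.*-monoʳ-≤ δ D≤)) (ℕₚ.≤-reflexive (e δ)))
      where
      e : ∀ δ → 16 ℕ.* (δ ℕ.* (4 ℕ.* δ)) ≡ 64 ℕ.* (δ ℕ.* δ)
      e = solve-∀

    few-lines-b : ∀ {g D} → 1 ≤ D → D ≤ 4 ℕ.* δ → R.Lt (suc D) g → ¬ (q R.∣ g) → ∀ Bs → Distinct Bs → All (λ b → On q (lb b)) Bs → All (λ b → On g (lb b)) Bs → length Bs ≤ 64 ℕ.* (δ ℕ.* δ)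
    few-lines-b {g} {D} 1≤D D≤ lg q∤g Bs dist onq ong = ℕₚ.≤-trans (ℕₚ.≤-trans (ℕₚ.≤-reflexive (≡.sym (Listₚ.length-map lb Bs)))
      (bezout prime q∤g lq lg 1≤D (map lb Bs) (Pairsₚ.map⁺ (pairs-with {Q = λ _ → 𝔹} (λ _ _ → lines-b) (All.universal (λ b → b) Bs) dist)) (Allₚ.map⁺ onq) (Allₚ.map⁺ ong)))
      (ℕₚ.≤-trans (ℕₚ.*-monoʳ-≤ 16 (ℕₚ.*-monoʳ-≤ δ D≤)) (ℕₚ.≤-reflexive (e δ)))
      where
      e : ∀ δ → 16 ℕ.* (δ ℕ.* (4 ℕ.* δ)) ≡ 64 ℕ.* (δ ℕ.* δ)
      e = solve-∀

    module _ (As : List 𝔸) (Bs : List 𝔹) (dA : Distinct As) (dB : Distinct Bs)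
             (onA : All (λ a → On q (la a)) As) (onB : All (λ b → On q (lb b)) Bs) where

      -- A polynomial vanishing at all crossings vanishes on every line with many crossings, so there are few such lines.
      few-rich : ∀ g → Vanishes q g → ¬ (q R.∣ g) → R.Lt (suc (4 ℕ.* δ)) g → Bound As Bs
      few-rich g v q∤g lg with split-dec (λ a → suc (4 ℕ.* δ) ℕ.≤? deg a Bs) As | split-dec (λ b → suc (4 ℕ.* δ) ℕ.≤? deg′ b As) Bs
      ... | A₁ , A₂ , sA | B₁ , B₂ , sB = begin
        I As Bs ≡⟨ I-splitˡ Bs sA ⟩
        I A₁ Bs ℕ.+ I A₂ Bs ≡⟨ ≡.cong (ℕ._+ I A₂ Bs) (I-splitʳ A₁ sB) ⟩
        (I A₁ B₁ ℕ.+ I A₁ B₂) ℕ.+ I A₂ Bs ≤⟨ ℕₚ.+-mono-≤ (ℕₚ.+-mono-≤ (H A₁ B₁ dA₁ dB₁ (few-lines-a 1≤4δ ℕₚ.≤-refl lg q∤g A₁ dA₁ (split-Allˡ sA onA) ongA)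
              (few-lines-b 1≤4δ ℕₚ.≤-refl lg q∤g B₁ dB₁ (split-Allˡ sB onB) ongB))
            (deg′-bound A₁ B₂ (All.map (λ {b} h → ℕₚ.≤-trans (part b) (ℕₚ.≤-pred (ℕₚ.≰⇒> h))) (split-no sB))))
            (deg-bound A₂ Bs (All.map (λ h → ℕₚ.≤-pred (ℕₚ.≰⇒> h)) (split-no sA))) ⟩
        ((Φ ℕ.+ κ ℕ.* length A₁) ℕ.+ length B₂ ℕ.* (4 ℕ.* δ)) ℕ.+ length A₂ ℕ.* (4 ℕ.* δ) ≤⟨ ℕₚ.+-mono-≤ (ℕₚ.+-mono-≤
            (ℕₚ.+-monoʳ-≤ Φ (ℕₚ.*-monoʳ-≤ κ (sub sA))) (ℕₚ.*-monoˡ-≤ (4 ℕ.* δ) (sub′ sB))) (ℕₚ.*-monoˡ-≤ (4 ℕ.* δ) (sub′ sA)) ⟩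
        ((Φ ℕ.+ κ ℕ.* length As) ℕ.+ length Bs ℕ.* (4 ℕ.* δ)) ℕ.+ length As ℕ.* (4 ℕ.* δ) ≡⟨ e (Φ ℕ.+ κ ℕ.* length As) (length As) (length Bs) (4 ℕ.* δ) ⟩
        4 ℕ.* δ ℕ.* (length As ℕ.+ length Bs) ℕ.+ (Φ ℕ.+ κ ℕ.* length As) ∎
        where
        open ℕₚ.≤-Reasoning
        e : ∀ x a b d → (x ℕ.+ b ℕ.* d) ℕ.+ a ℕ.* d ≡ d ℕ.* (a ℕ.+ b) ℕ.+ x
        e = solve-∀
        1≤4δ = ℕₚ.≤-trans 1≤δ (ℕₚ.m≤n*m δ 4)
        sub : ∀ {y p} {Y : Set y} {P : Y → Set p} {xs ys zs} → Split P xs ys zs → length ys ≤ length xs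
        sub s = ℕₚ.≤-trans (ℕₚ.m≤m+n _ _) (ℕₚ.≤-reflexive (≡.sym (length-split s)))
        sub′ : ∀ {y p} {Y : Set y} {P : Y → Set p} {xs ys zs} → Split P xs ys zs → length zs ≤ length xs
        sub′ s = ℕₚ.≤-trans (ℕₚ.m≤n+m _ _) (ℕₚ.≤-reflexive (≡.sym (length-split s)))
        dA₁ = split-Pairsˡ sA dA
        dB₁ = split-Pairsˡ sB dB
        part : ∀ b → deg′ b A₁ ≤ deg′ b As
        part b = ℕₚ.≤-trans (ℕₚ.m≤m+n _ _) (ℕₚ.≤-reflexive (≡.sym (∑-split (λ a → ⟦ Cr a b ⟧) sA)))
        ongA : All (λ a → On g (la a)) A₁
        ongA = All.zipWith (λ { {a} (ona , rich) → B.stable λ ng → ℕₚ.<⇒≱ (deg-small lg v a Bs dB ona onB ng) rich }) (split-Allˡ sA onA , split-yes sA)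
        ongB : All (λ b → On g (lb b)) B₁
        ongB = All.zipWith (λ { {b} (onb , rich) → B.stable λ ng → ℕₚ.<⇒≱ (deg′-small lg v b As dA onb onA ng) rich }) (split-Allˡ sB onB , split-yes sB)

      module _ (d₀ : q R.∣ rem₀-of q) (d₁ : q R.∣ rem₁-of q) where
        -- At a crossing with `w` nonzero, `(l - k x) (ρb - ρa) = 1`. If `k = 0`, all these lines
        -- have the same slope. If not, the slope determines `x`, so different crossings have
        -- different slopes. Either way there are at most `κ`. The zeros of `w`, or those of `v`
        -- when `w` vanishes identically, account for `δ` more.
        good-line : ∀ a → On q (la a) → ¬ On (Dz.δ q) (la a) → deg a Bs ≤ κ ℕ.+ δ
        good-line a ona v≉0 = ≤-stable do
          no w≉0 ← em (w B.≈ B.0#)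
            where yes w≈0 → η (ℕₚ.≤-trans (ℕₚ.<⇒≤ (roots-bound (Cr a) (xc a) distinct-b Bs dB δ (E.ap (la a) (Dz.δ q)) (ev-Lt (la a) δ (∂z-Lt δ q lq)) v≉0
                      (All.map (λ {b} onb t → FieldGraded.mul-zero K (ρ≉ t) (K.trans (K.sym (At.W-value t ona onb)) (K.trans (Pt.ap-cong _ w≈0) (Pt.ap-0 _)))) onB))) (ℕₚ.m≤n+m δ κ))
          k , l , eq ← OnLine.affine (la a) ona d₀ d₁ lq 1≤δ 2δ≤p v≉0 w≉0
          let cs , _ , sC , eC = count-split (Cr a) Bs
          Z₁ , Z₂ , sZ ← split-em {P = λ b → Pt.ap (xc a b) w K.≈ K.0#} cs
          Z₂≤κ ← parallel-or-not k l eq Z₂ (split-Pairsʳ sZ (split-Pairsˡ sC dB)) (split-Allʳ sZ (split-yes sC)) (split-Allʳ sZ (split-Allˡ sC onB)) (split-no sZ)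
          η (begin
            deg a Bs ≡⟨ ≡.trans eC (length-split sZ) ⟩
            length Z₁ ℕ.+ length Z₂ ≤⟨ ℕₚ.+-mono-≤ (Z₁≤δ w≉0 Z₁ (split-Pairsˡ sZ (split-Pairsˡ sC dB)) (split-Allˡ sZ (split-yes sC)) (split-yes sZ)) Z₂≤κ ⟩
            δ ℕ.+ κ ≡⟨ ℕₚ.+-comm δ κ ⟩
            κ ℕ.+ δ ∎)
          where
          open ℕₚ.≤-Reasoning
          w = OnLine.W (la a) q
          lw : B.Lt δ w
          lw = B.Lt-+ (ev-Lt (la a) δ (∂y-Lt δ q lq)) (B.Lt-neg (B.Lt-+ (B.Lt-* lr lv ℕₚ.≤-refl) (B.Lt-* lr lv ℕₚ.≤-refl)))
            where
            lv = ev-Lt (la a) δ (∂z-Lt δ q lq)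
            lr = B.Lt-cong (B.sym (ev-ι (la a) _)) (GradedAlg.ι-Lt B (NullLine.ρ (la a)))
          ρa = NullLine.ρ (la a)
          ρb : 𝔹 → K.Carrier
          ρb b = NullLine.ρ (lb b)
          ρ≉ : ∀ {b} → T (Cr a b) → ¬ (ρb b K.+ K.- ρa K.≈ K.0#)
          ρ≉ {b} t e = skew t (K.trans (SK.solve 2 (λ a b → a SK.:= b SK.:- (b SK.:- a)) K.refl ρa (ρb b))
            (K.trans (K.+-congˡ (K.-‿cong e)) (SK.solve 1 (λ b → b SK.:- SK.con (+ 0) SK.:= b) K.refl (ρb b))))
          Z₁≤δ : ¬ (w B.≈ B.0#) → ∀ Z → Distinct Z → All (λ b → T (Cr a b)) Z → All (λ b → Pt.ap (xc a b) w K.≈ K.0#) Z → length Z ≤ δ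
          Z₁≤δ w≉0 Z dZ ts zs = ℕₚ.<⇒≤ (ℕₚ.≰⇒> λ δ≤ → w≉0 (few-roots δ w lw (map (xc a) Z) (≡.subst (δ ≤_) (≡.sym (Listₚ.length-map (xc a) Z)) δ≤)
            (map-distinct (xc a) Z (pairs-with distinct-b ts dZ)) (Allₚ.map⁺ zs)))
          parallel-or-not : ∀ k l → E.ap (la a) (Dz.δ q) B.≈ (B.ι l B.+ B.- (B.ι k B.* X)) B.* w → ∀ Z → Distinct Z → All (λ b → T (Cr a b)) Z →
            All (λ b → On q (lb b)) Z → All (λ b → ¬ (Pt.ap (xc a b) w K.≈ K.0#)) Z → ¬¬ (length Z ≤ κ)
          parallel-or-not k l eq Z dZ ts onZ nz = do
            no k≉0 ← em (k K.≈ K.0#)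
              where yes k≈0 → η (few-parallel a Z dZ ts (pairs-with (λ {b} {b′} e e′ _ → same-slope k≈0 {b} {b′} e e′) values dZ))
            η (few-directions a Z dZ ts (pairs-with (λ { {b} {b′} (t , e) (t′ , e′) b≢b′ eρ → distinct-b t t′ b≢b′ (same-point k≉0 eρ e e′) }) (All.zip (ts , values)) dZ))
            where
            Value : 𝔹 → Set _
            Value b = (l K.+ K.- (k K.* xc a b)) K.* (ρb b K.+ K.- ρa) K.≈ K.1#
            values : All Value Z
            values = All.zipWith (λ { {b} (t , onb , n) → At.affine-value t ona onb eq n }) (ts , All.zip (onZ , nz))
            cancelˡ : ∀ {u s t} → u K.* s K.≈ K.1# → u K.* t K.≈ K.1# → s K.≈ t
            cancelˡ {u} {s} {t} e e′ = K.trans (K.sym (K.trans (K.*-congˡ e′) (K.*-identityʳ s)))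
              (K.trans (SK.solve 3 (λ s u t → s SK.:* (u SK.:* t) SK.:= (u SK.:* s) SK.:* t) K.refl s u t) (K.trans (K.*-congʳ e) (K.*-identityˡ t)))
            same-slope : k K.≈ K.0# → ∀ {b b′} → Value b → Value b′ → ρb b K.≈ ρb b′
            same-slope k≈0 {b} {b′} e e′ = K.trans (SK.solve 2 (λ b a → b SK.:= (b SK.:- a) SK.:+ a) K.refl (ρb b) ρa)
              (K.trans (K.+-congʳ (cancelˡ (K.trans (K.*-congʳ (K.sym (drop₀ b))) e) (K.trans (K.*-congʳ (K.sym (drop₀ b′))) e′)))
                (SK.solve 2 (λ b a → (b SK.:- a) SK.:+ a SK.:= b) K.refl (ρb b′) ρa))
              where
              drop₀ : ∀ b → l K.+ K.- (k K.* xc a b) K.≈ l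
              drop₀ b = K.trans (K.+-congˡ (K.-‿cong (K.*-congʳ k≈0))) (SK.solve 2 (λ l x → l SK.:- SK.con (+ 0) SK.:* x SK.:= l) K.refl l (xc a b))
            same-point : ¬ (k K.≈ K.0#) → ∀ {b b′} → ρb b K.≈ ρb b′ → Value b → Value b′ → xc a b K.≈ xc a b′
            same-point k≉0 {b} {b′} eρ e e′ = K.trans (SK.solve 2 (λ x y → x SK.:= y SK.:+ (x SK.:- y)) K.refl x x′)
              (K.trans (K.+-congˡ (FieldGraded.mul-zero K k≉0 (K.trans (SK.solve 4 (λ k x y l → k SK.:* (x SK.:- y) SK.:= (l SK.:- k SK.:* y) SK.:- (l SK.:- k SK.:* x)) K.refl k x x′ l)
                (K.trans (K.+-congʳ (K.sym same)) (K.-‿inverseʳ _))))) (K.+-identityʳ x′))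
              where
              x = xc a b
              x′ = xc a b′
              same : l K.+ K.- (k K.* x) K.≈ l K.+ K.- (k K.* x′)
              same = cancelˡ {ρb b K.+ K.- ρa} (K.trans (K.*-comm _ _) e) (K.trans (K.*-comm _ _) (K.trans (K.*-congˡ (K.+-congʳ eρ)) e′))

        -- Modulo `q`, the second derivative along an isotropic tangent direction vanishes wherever
        -- `Dz.δ q` does not, so such directions are asymptotic: the surface is totally umbilic for
        -- the determinant form. Lines inside the zero set of `Dz.δ q` are few by `bezout` and left
        -- to `H`; the others are handled by `good-line` or cross it less than `δ` times.
        umbilic : ¬ (q R.∣ Dz.δ q) → Bound As Bs
        umbilic q∤z = ≤-stable do
          A₀ , A₁ , sA ← split-em {P = λ a → On (Dz.δ q) (la a)} As
          B₀ , B₁ , sB ← split-em {P = λ b → On (Dz.δ q) (lb b)} Bs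
          let lz : R.Lt (suc δ) (Dz.δ q)
              lz = R.Lt-mono (ℕₚ.n≤1+n δ) (∂z-Lt δ q lq)
              dA₀ = split-Pairsˡ sA dA
              dB₀ = split-Pairsˡ sB dB
              δ≤4δ = ℕₚ.m≤n*m δ 4
              bound₀ : I A₀ B₀ ≤ Φ ℕ.+ κ ℕ.* length A₀
              bound₀ = H A₀ B₀ dA₀ dB₀ (few-lines-a 1≤δ δ≤4δ lz q∤z A₀ dA₀ (split-Allˡ sA onA) (split-yes sA))
                                       (few-lines-b 1≤δ δ≤4δ lz q∤z B₀ dB₀ (split-Allˡ sB onB) (split-yes sB))
              bound₁ : I A₀ B₁ ≤ length B₁ ℕ.* δ
              bound₁ = deg′-bound A₀ B₁ (All.map (λ {b} nb → ℕₚ.<⇒≤ (deg′-outside (∂z-Lt δ q lq) b A₀ dA₀ (split-yes sA) nb)) (split-no sB))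
              bound₂ : I A₁ Bs ≤ length A₁ ℕ.* (κ ℕ.+ δ)
              bound₂ = deg-bound A₁ Bs (All.zipWith (λ { {a} (ona , na) → good-line a ona na }) (split-Allʳ sA onA , split-no sA))
          η (begin
            I As Bs ≡⟨ I-splitˡ Bs sA ⟩
            I A₀ Bs ℕ.+ I A₁ Bs ≡⟨ ≡.cong (ℕ._+ I A₁ Bs) (I-splitʳ A₀ sB) ⟩
            (I A₀ B₀ ℕ.+ I A₀ B₁) ℕ.+ I A₁ Bs ≤⟨ ℕₚ.+-mono-≤ (ℕₚ.+-mono-≤ bound₀ bound₁) bound₂ ⟩
            ((Φ ℕ.+ κ ℕ.* length A₀) ℕ.+ length B₁ ℕ.* δ) ℕ.+ length A₁ ℕ.* (κ ℕ.+ δ) ≤⟨ ℕₚ.m≤m+n _ (slack (length A₀) (length A₁) (length B₀) (length B₁) δ) ⟩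
            ((Φ ℕ.+ κ ℕ.* length A₀) ℕ.+ length B₁ ℕ.* δ) ℕ.+ length A₁ ℕ.* (κ ℕ.+ δ) ℕ.+ slack (length A₀) (length A₁) (length B₀) (length B₁) δ
              ≡⟨ e Φ κ δ (length A₀) (length A₁) (length B₀) (length B₁) ⟩
            4 ℕ.* δ ℕ.* ((length A₀ ℕ.+ length A₁) ℕ.+ (length B₀ ℕ.+ length B₁)) ℕ.+ (Φ ℕ.+ κ ℕ.* (length A₀ ℕ.+ length A₁))
              ≡⟨ ≡.cong₂ (λ x y → 4 ℕ.* δ ℕ.* (x ℕ.+ y) ℕ.+ (Φ ℕ.+ κ ℕ.* x)) (≡.sym (length-split sA)) (≡.sym (length-split sB)) ⟩
            4 ℕ.* δ ℕ.* (length As ℕ.+ length Bs) ℕ.+ (Φ ℕ.+ κ ℕ.* length As) ∎)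
          where
          open ℕₚ.≤-Reasoning
          slack : ℕ → ℕ → ℕ → ℕ → ℕ → ℕ
          slack a₀ a₁ b₀ b₁ δ = 4 ℕ.* δ ℕ.* a₀ ℕ.+ 3 ℕ.* δ ℕ.* a₁ ℕ.+ 4 ℕ.* δ ℕ.* b₀ ℕ.+ 3 ℕ.* δ ℕ.* b₁
          e : ∀ Φ κ δ a₀ a₁ b₀ b₁ → ((Φ ℕ.+ κ ℕ.* a₀) ℕ.+ b₁ ℕ.* δ) ℕ.+ a₁ ℕ.* (κ ℕ.+ δ) ℕ.+ (4 ℕ.* δ ℕ.* a₀ ℕ.+ 3 ℕ.* δ ℕ.* a₁ ℕ.+ 4 ℕ.* δ ℕ.* b₀ ℕ.+ 3 ℕ.* δ ℕ.* b₁)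
            ≡ 4 ℕ.* δ ℕ.* ((a₀ ℕ.+ a₁) ℕ.+ (b₀ ℕ.+ b₁)) ℕ.+ (Φ ℕ.+ κ ℕ.* (a₀ ℕ.+ a₁))
          e = solve-∀

      low-degree : ∀ {g} → R.Lt δ g → q R.∣ g → g R.≈ R.0#
      low-degree {g} lg (k , e) = R.stable λ g≉0 → R.exact {δ} {0} nq (R.nonzero-Lt λ k≈0 → g≉0 (R.trans e (R.trans (R.*-congˡ k≈0) (R.zeroʳ q)))) 
        (R.Lt-cong e (R.Lt-mono (ℕₚ.≤-reflexive (≡.sym (ℕₚ.+-identityʳ δ))) lg))

      -- Each alternative supplies a polynomial, not divisible by `q`, that vanishes at all
      -- crossings, or else the umbilic case. If all alternatives fail, every partial derivative of
      -- `q` is zero; its degree is below `p`, so it would be a constant.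
      prime-bound : Bound As Bs
      prime-bound = ≤-stable do
        yes d₀ ← em (q R.∣ rem₀-of q)
          where no n₀ → η (few-rich (rem₀-of q) (λ t ona onb → At.rem₀-vanishes t ona onb) n₀ (Lt-Expr R.graded δ rem₀ _ (jet-Lt K.0# lq)))
        yes d₁ ← em (q R.∣ rem₁-of q)
          where no n₁ → η (few-rich (rem₁-of q) (λ t ona onb → At.rem₁-vanishes t ona onb) n₁ (Lt-Expr R.graded δ rem₁ _ (jet-Lt K.0# lq)))
        yes dz ← em (q R.∣ Dz.δ q)
          where no nz → η (umbilic d₀ d₁ nz)
        -- A multiple of `q` of smaller degree is zero. From here on every crossing is a singular
        -- point of the surface.
        let z≈0 = low-degree (∂z-Lt δ q lq) dz
            val-z : ∀ {a b} → T (Cr a b) → Pt.ap (xc a b) (E.ap (la a) (Dz.δ q)) K.≈ K.0#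
            val-z {a} {b} t = K.trans (Pt.ap-cong _ (B.trans (E.ap-cong (la a) z≈0) (E.ap-0 (la a)))) (Pt.ap-0 _)
            up : ∀ {g} → R.Lt δ g → R.Lt (suc (4 ℕ.* δ)) g
            up = R.Lt-mono (ℕₚ.≤-trans (ℕₚ.m≤n*m δ 4) (ℕₚ.n≤1+n _))
        yes dy ← em (q R.∣ Dy.δ q)
          where no ny → η (few-rich (Dy.δ q) (λ t ona onb → At.singular-y t ona onb (val-z t)) ny (up (∂y-Lt δ q lq)))
        yes dx ← em (q R.∣ Dx.δ q)
          where no nx → η (few-rich (Dx.δ q) (λ t ona onb → At.singular-x t ona onb (val-z t)) nx (up (∂x-Lt δ q lq)))
        ⊥-elim (Q.nonunit (R.unit (constant q (R.Lt-mono (ℕₚ.≤-trans (ℕₚ.+-monoˡ-≤ δ 1≤δ) 2δ≤p) lq)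
          (low-degree (∂x-Lt δ q lq) dx) (low-degree (∂y-Lt δ q lq) dy) z≈0) Q.nonzero))

  -- The recursion hypothesis H is used for the few exceptional lines of each irreducible component.
  module Surface (C d : ℕ) (H : ∀ D → D ≤ d → ∀ As Bs → Distinct As → Distinct Bs →
      length As ℕ.+ length Bs ≤ 12 ℕ.* D ℕ.* (12 ℕ.* D) → I As Bs ≤ C ℕ.* cube (12 ℕ.* D) ℕ.+ κ ℕ.* length As) where

    -- Splits off a prime factor `q` of degree `δ`. Crossings within `q` are covered by
    -- `prime-bound`, a line outside `q` crosses the lines on `q` at most `δ` times, and lines
    -- outside `q` lie on the cofactor. The cubic terms add up because cubes are superadditive; `n`
    -- is a bound for `D` that makes the recursion structural.
    surface-bound : ∀ n D f → D ≤ n → D ≤ d → D ℕ.+ D ≤ p → R.Lt (suc D) f → ¬ (f R.≈ R.0#) → ∀ As Bs → Distinct As → Distinct Bs →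
      All (λ a → On f (la a)) As → All (λ b → On f (lb b)) Bs →
      I As Bs ≤ 4 ℕ.* D ℕ.* (length As ℕ.+ length Bs) ℕ.+ (C ℕ.* cube (12 ℕ.* D) ℕ.+ κ ℕ.* length As)
    surface-bound n D f D≤n D≤d 2D≤p lf f≉0 As Bs dA dB onA onB = ≤-stable do
      no nu ← em (R.Unit f)
        where yes (g , fg) → η (empty g fg As onA)
      q , f′ , prime , e ← R.prime-factor (suc D) f lf f≉0 nu
      let f′≉0 = λ z → f≉0 (R.trans e (R.trans (R.*-congˡ z) (R.zeroʳ q)))
      δ , lq , nq ← R.exact-degree (R.Prime.nonzero prime)
      δ′ , lf′ , nf′ ← R.exact-degree f′≉0
      A₁ , A₂ , sA ← split-em {P = λ a → On q (la a)} As
      B₁ , B₂ , sB ← split-em {P = λ b → On q (lb b)} Bs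
      let sum≤D : δ ℕ.+ δ′ ≤ D
          sum≤D = ℕₚ.≤-pred (ℕₚ.≰⇒> λ D<s → R.exact {δ} {δ′} nq nf′ (R.Lt-cong e (R.Lt-mono D<s lf)))
          1≤δ : 1 ≤ δ
          1≤δ = ℕₚ.n≢0⇒n>0 λ { ≡.refl → R.Prime.nonunit prime (R.unit lq (R.Prime.nonzero prime)) }
          δ≤D = ℕₚ.≤-trans (ℕₚ.m≤m+n δ δ′) sum≤D
          δ′<D = ℕₚ.≤-trans (ℕₚ.+-monoˡ-≤ δ′ 1≤δ) sum≤D
          onA₂ = All.zipWith (λ { {a} (on , n) → On-* q f′ (la a) (B.trans (E.ap-cong (la a) (R.sym e)) on) n }) (split-Allʳ sA onA , split-no sA)
          onB₂ = All.zipWith (λ { {b} (on , n) → On-* q f′ (lb b) (B.trans (E.ap-cong (lb b) (R.sym e)) on) n }) (split-Allʳ sB onB , split-no sB)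
          dA₁ = split-Pairsˡ sA dA
          dB₁ = split-Pairsˡ sB dB
          b₁₁ : I A₁ B₁ ≤ 4 ℕ.* δ ℕ.* (length A₁ ℕ.+ length B₁) ℕ.+ (C ℕ.* cube (12 ℕ.* δ) ℕ.+ κ ℕ.* length A₁)
          b₁₁ = PrimeSurface.prime-bound prime lq nq (ℕₚ.≤-trans (ℕₚ.+-mono-≤ δ≤D δ≤D) 2D≤p)
            (λ As Bs dA dB lA lB → H δ (ℕₚ.≤-trans δ≤D D≤d) As Bs dA dB (ℕₚ.≤-trans (ℕₚ.+-mono-≤ lA lB) (≤144 δ)))
            A₁ B₁ dA₁ dB₁ (split-yes sA) (split-yes sB)
          b₁₂ : I A₁ B₂ ≤ length B₂ ℕ.* δ
          b₁₂ = deg′-bound A₁ B₂ (All.map (λ {b} nb → ℕₚ.≤-pred (deg′-outside lq b A₁ dA₁ (split-yes sA) nb)) (split-no sB))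
          b₂₁ : I A₂ B₁ ≤ length A₂ ℕ.* δ
          b₂₁ = deg-bound A₂ B₁ (All.map (λ {a} na → ℕₚ.≤-pred (deg-outside lq a B₁ dB₁ (split-yes sB) na)) (split-no sA))
          b₂₂ : I A₂ B₂ ≤ 4 ℕ.* δ′ ℕ.* (length A₂ ℕ.+ length B₂) ℕ.+ (C ℕ.* cube (12 ℕ.* δ′) ℕ.+ κ ℕ.* length A₂)
          b₂₂ = rest n δ′ f′ D≤n δ′<D lf′ f′≉0 A₂ B₂ (split-Pairsʳ sA dA) (split-Pairsʳ sB dB) onA₂ onB₂
      η (begin
        I As Bs ≡⟨ I-splitˡ Bs sA ⟩
        I A₁ Bs ℕ.+ I A₂ Bs ≡⟨ ≡.cong₂ ℕ._+_ (I-splitʳ A₁ sB) (I-splitʳ A₂ sB) ⟩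
        (I A₁ B₁ ℕ.+ I A₁ B₂) ℕ.+ (I A₂ B₁ ℕ.+ I A₂ B₂) ≤⟨ ℕₚ.+-mono-≤ (ℕₚ.+-mono-≤ b₁₁ b₁₂) (ℕₚ.+-mono-≤ b₂₁ b₂₂) ⟩
        ((4 ℕ.* δ ℕ.* (a₁ A₁ ℕ.+ b₁ B₁) ℕ.+ (C ℕ.* cube (12 ℕ.* δ) ℕ.+ κ ℕ.* a₁ A₁)) ℕ.+ b₁ B₂ ℕ.* δ) ℕ.+
          (a₁ A₂ ℕ.* δ ℕ.+ (4 ℕ.* δ′ ℕ.* (a₁ A₂ ℕ.+ b₁ B₂) ℕ.+ (C ℕ.* cube (12 ℕ.* δ′) ℕ.+ κ ℕ.* a₁ A₂)))
          ≤⟨ ℕₚ.m≤m+n _ (slack δ δ′ (a₁ A₁) (a₁ A₂) (b₁ B₁) (b₁ B₂)) ⟩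
        _ ≡⟨ arith δ δ′ (a₁ A₁) (a₁ A₂) (b₁ B₁) (b₁ B₂) C κ 12 ⟩
        4 ℕ.* (δ ℕ.+ δ′) ℕ.* ((a₁ A₁ ℕ.+ a₁ A₂) ℕ.+ (b₁ B₁ ℕ.+ b₁ B₂)) ℕ.+ (C ℕ.* cube (12 ℕ.* (δ ℕ.+ δ′)) ℕ.+ κ ℕ.* (a₁ A₁ ℕ.+ a₁ A₂))
          ≡⟨ ≡.cong₂ (λ x y → 4 ℕ.* (δ ℕ.+ δ′) ℕ.* (x ℕ.+ y) ℕ.+ (C ℕ.* cube (12 ℕ.* (δ ℕ.+ δ′)) ℕ.+ κ ℕ.* x)) (≡.sym (length-split sA)) (≡.sym (length-split sB)) ⟩
        4 ℕ.* (δ ℕ.+ δ′) ℕ.* (length As ℕ.+ length Bs) ℕ.+ (C ℕ.* cube (12 ℕ.* (δ ℕ.+ δ′)) ℕ.+ κ ℕ.* length As)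
          ≤⟨ ℕₚ.+-mono-≤ (ℕₚ.*-monoˡ-≤ (length As ℕ.+ length Bs) (ℕₚ.*-monoʳ-≤ 4 sum≤D))
               (ℕₚ.+-monoˡ-≤ (κ ℕ.* length As) (ℕₚ.*-monoʳ-≤ C (cube-mono (ℕₚ.*-monoʳ-≤ 12 sum≤D)))) ⟩
        4 ℕ.* D ℕ.* (length As ℕ.+ length Bs) ℕ.+ (C ℕ.* cube (12 ℕ.* D) ℕ.+ κ ℕ.* length As) ∎)
      where
      open ℕₚ.≤-Reasoning
      a₁ : List 𝔸 → ℕ
      a₁ = length
      b₁ : List 𝔹 → ℕ
      b₁ = length
      empty : ∀ g → f R.* g R.≈ R.1# → ∀ As → All (λ a → On f (la a)) As → I As Bs ≤ 4 ℕ.* D ℕ.* (length As ℕ.+ length Bs) ℕ.+ (C ℕ.* cube (12 ℕ.* D) ℕ.+ κ ℕ.* length As)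
      empty g fg [] [] = z≤n
      empty g fg (a ∷ As) (on ∷ _) = ⊥-elim (B.1≉0 (B.trans (B.sym (B.trans (E.ap-cong (la a) fg) (E.ap-1 (la a)))) (On-*ˡ g (la a) on)))
      cube-mono : ∀ {m n} → m ≤ n → cube m ≤ cube n
      cube-mono h = ℕₚ.*-mono-≤ (ℕₚ.*-mono-≤ h h) h
      -- Origin of the factor 12: the exceptional lines of both families number at most `128 δ²`, to
      -- be covered by the square of the radius `12 δ`.
      ≤144 : ∀ δ → 64 ℕ.* (δ ℕ.* δ) ℕ.+ 64 ℕ.* (δ ℕ.* δ) ≤ 12 ℕ.* δ ℕ.* (12 ℕ.* δ)
      ≤144 δ = ℕₚ.≤-trans (ℕₚ.m≤m+n _ (16 ℕ.* (δ ℕ.* δ))) (ℕₚ.≤-reflexive (e δ))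
        where
        e : ∀ δ → 64 ℕ.* (δ ℕ.* δ) ℕ.+ 64 ℕ.* (δ ℕ.* δ) ℕ.+ 16 ℕ.* (δ ℕ.* δ) ≡ 12 ℕ.* δ ℕ.* (12 ℕ.* δ)
        e = solve-∀
      slack : ℕ → ℕ → ℕ → ℕ → ℕ → ℕ → ℕ
      slack δ δ′ a₁ a₂ b₁ b₂ = 4 ℕ.* δ′ ℕ.* (a₁ ℕ.+ b₁) ℕ.+ 3 ℕ.* δ ℕ.* (a₂ ℕ.+ b₂) ℕ.+ C ℕ.* (12 ℕ.* 12 ℕ.* 12 ℕ.* (3 ℕ.* δ ℕ.* δ ℕ.* δ′ ℕ.+ 3 ℕ.* δ ℕ.* δ′ ℕ.* δ′))
      arith : ∀ δ δ′ a₁ a₂ b₁ b₂ C κ W → ((4 ℕ.* δ ℕ.* (a₁ ℕ.+ b₁) ℕ.+ (C ℕ.* (W ℕ.* δ ℕ.* (W ℕ.* δ) ℕ.* (W ℕ.* δ)) ℕ.+ κ ℕ.* a₁)) ℕ.+ b₂ ℕ.* δ) ℕ.+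
          (a₂ ℕ.* δ ℕ.+ (4 ℕ.* δ′ ℕ.* (a₂ ℕ.+ b₂) ℕ.+ (C ℕ.* (W ℕ.* δ′ ℕ.* (W ℕ.* δ′) ℕ.* (W ℕ.* δ′)) ℕ.+ κ ℕ.* a₂))) ℕ.+
          (4 ℕ.* δ′ ℕ.* (a₁ ℕ.+ b₁) ℕ.+ 3 ℕ.* δ ℕ.* (a₂ ℕ.+ b₂) ℕ.+ C ℕ.* (W ℕ.* W ℕ.* W ℕ.* (3 ℕ.* δ ℕ.* δ ℕ.* δ′ ℕ.+ 3 ℕ.* δ ℕ.* δ′ ℕ.* δ′)))
        ≡ 4 ℕ.* (δ ℕ.+ δ′) ℕ.* ((a₁ ℕ.+ a₂) ℕ.+ (b₁ ℕ.+ b₂)) ℕ.+ (C ℕ.* (W ℕ.* (δ ℕ.+ δ′) ℕ.* (W ℕ.* (δ ℕ.+ δ′)) ℕ.* (W ℕ.* (δ ℕ.+ δ′))) ℕ.+ κ ℕ.* (a₁ ℕ.+ a₂))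
      arith = solve-∀
      rest : ∀ n δ′ f′ → D ≤ n → δ′ < D → R.Lt (suc δ′) f′ → ¬ (f′ R.≈ R.0#) → ∀ As Bs → Distinct As → Distinct Bs →
        All (λ a → On f′ (la a)) As → All (λ b → On f′ (lb b)) Bs →
        I As Bs ≤ 4 ℕ.* δ′ ℕ.* (length As ℕ.+ length Bs) ℕ.+ (C ℕ.* cube (12 ℕ.* δ′) ℕ.+ κ ℕ.* length As)
      rest zero δ′ f′ D≤n δ′<D = ⊥-elim (ℕₚ.<⇒≱ δ′<D (ℕₚ.≤-trans D≤n z≤n))
      rest (suc n) δ′ f′ D≤n δ′<D = surface-bound n δ′ f′ (ℕₚ.≤-pred (ℕₚ.≤-trans δ′<D D≤n)) (ℕₚ.≤-trans (ℕₚ.<⇒≤ δ′<D) D≤d)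
        (ℕₚ.≤-trans (ℕₚ.+-mono-≤ (ℕₚ.<⇒≤ δ′<D) (ℕₚ.<⇒≤ δ′<D)) 2D≤p)

  -- Surfaces have degree proportional to `d = r / N`. `N-large` makes the recursive calls cost at
  -- most half of `C r³`, and `C-value` fits the remaining terms into the other half.
  module Induction (N C : ℕ) (72<N : 72 < N) (N-large : ∀ x → 8 ℕ.* cube (72 ℕ.* x) ≤ N ℕ.* cube x) (C-value : C ≡ 300 ℕ.* N) where

    instance
      N≢0 : ℕ.NonZero N
      N≢0 = ℕ.>-nonZero (ℕₚ.≤-trans (s≤s z≤n) 72<N)

    Statement : ℕ → Set
    Statement r = r ≤ p → ∀ As Bs → Distinct As → Distinct Bs → length As ℕ.+ length Bs ≤ r ℕ.* r → I As Bs ≤ C ℕ.* cube r ℕ.+ κ ℕ.* length As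

    module Step (r : ℕ) (ih : ∀ {s} → s < r → Statement s) (r≤p : r ≤ p) (N≤r : N ≤ r) where
      d = r / N

      Nd≤r : N ℕ.* d ≤ r
      Nd≤r = ≡.subst (_≤ r) (ℕₚ.*-comm d N) (m/n*n≤m r N)

      d≢0 : 0 < d
      d≢0 = ℕₚ.n≢0⇒n>0 λ d≡0 → ℕₚ.<⇒≱ (m%n<n r N) (≡.subst (N ≤_) (≡.trans (m≡m%n+[m/n]*n r N) (≡.trans (≡.cong (λ x → r % N ℕ.+ x ℕ.* N) d≡0) (ℕₚ.+-identityʳ _))) N≤r)

      r≤2Nd : r ≤ 2 ℕ.* (N ℕ.* d)
      r≤2Nd = begin
        r ≡⟨ m≡m%n+[m/n]*n r N ⟩
        r % N ℕ.+ d ℕ.* N ≤⟨ ℕₚ.+-monoˡ-≤ (d ℕ.* N) (ℕₚ.<⇒≤ (m%n<n r N)) ⟩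
        N ℕ.+ d ℕ.* N ≤⟨ ℕₚ.+-monoˡ-≤ (d ℕ.* N) (ℕₚ.m≤n*m N d {{ℕ.>-nonZero d≢0}}) ⟩
        d ℕ.* N ℕ.+ d ℕ.* N ≡⟨ e d N ⟩
        2 ℕ.* (N ℕ.* d) ∎
        where
        open ℕₚ.≤-Reasoning
        e : ∀ d N → d ℕ.* N ℕ.+ d ℕ.* N ≡ 2 ℕ.* (N ℕ.* d)
        e = solve-∀

      72d<r : 72 ℕ.* d < r
      72d<r = ℕₚ.<-≤-trans (ℕₚ.*-monoˡ-< d {{ℕ.>-nonZero d≢0}} {72} 72<N) Nd≤r

      ≤72 : ∀ {D} → D ≤ 6 ℕ.* d → 12 ℕ.* D ≤ 72 ℕ.* d
      ≤72 {D} h = ℕₚ.≤-trans (ℕₚ.*-monoʳ-≤ 12 h) (ℕₚ.≤-reflexive (≡.sym (ℕₚ.*-assoc 12 6 d)))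

      recursion : ∀ D → D ≤ 6 ℕ.* d → ∀ As Bs → Distinct As → Distinct Bs →
        length As ℕ.+ length Bs ≤ 12 ℕ.* D ℕ.* (12 ℕ.* D) → I As Bs ≤ C ℕ.* cube (12 ℕ.* D) ℕ.+ κ ℕ.* length As
      recursion D D≤ = ih smaller (ℕₚ.≤-trans (ℕₚ.<⇒≤ smaller) r≤p)
        where smaller = ℕₚ.≤-<-trans (≤72 D≤) 72d<r

      module S = Surface C (6 ℕ.* d) recursion

      -- Degree `6 d` suffices, since `d²` lines impose `6 d³` conditions and the dimension is at
      -- least `36 d³`. The coefficient `30 d` covers `4 · 6 d` from the surface and `6 d` for each
      -- line of `Bs` that is not on it. The recursion happens at radius `12 · 6 d = 72 d`.
      group-bound : ∀ As Bs → Distinct As → Distinct Bs → length As ≤ d ℕ.* d →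
        I As Bs ≤ 30 ℕ.* d ℕ.* (length As ℕ.+ length Bs) ℕ.+ (C ℕ.* cube (72 ℕ.* d) ℕ.+ κ ℕ.* length As)
      group-bound As Bs dA dB small = ≤-stable do
        f , f≉0 , lf , onA ← vanishing-polynomial (map la As) (6 ℕ.* d) enough
        B₁ , B₂ , sB ← split-em {P = λ b → On f (lb b)} Bs
        let b₁ : I As B₁ ≤ 4 ℕ.* (6 ℕ.* d) ℕ.* (length As ℕ.+ length B₁) ℕ.+ (Z ℕ.+ κ ℕ.* length As)
            b₁ = ≡.subst (λ x → I As B₁ ≤ 4 ℕ.* (6 ℕ.* d) ℕ.* (length As ℕ.+ length B₁) ℕ.+ (C ℕ.* cube x ℕ.+ κ ℕ.* length As)) (≡.sym (ℕₚ.*-assoc 12 6 d)) (S.surface-bound (6 ℕ.* d) (6 ℕ.* d) f ℕₚ.≤-refl ℕₚ.≤-refl 12d≤p (R.Lt-mono (ℕₚ.n≤1+n _) lf) f≉0 As B₁ dA (split-Pairsˡ sB dB) (Allₚ.map⁻ onA) (split-yes sB))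
            b₂ : I As B₂ ≤ length B₂ ℕ.* (6 ℕ.* d)
            b₂ = deg′-bound As B₂ (All.map (λ {b} nb → ℕₚ.<⇒≤ (deg′-outside lf b As dA (Allₚ.map⁻ onA) nb)) (split-no sB))
        η (begin
          I As Bs ≡⟨ I-splitʳ As sB ⟩
          I As B₁ ℕ.+ I As B₂ ≤⟨ ℕₚ.+-mono-≤ b₁ b₂ ⟩
          (4 ℕ.* (6 ℕ.* d) ℕ.* (length As ℕ.+ length B₁) ℕ.+ (Z ℕ.+ κ ℕ.* length As)) ℕ.+ length B₂ ℕ.* (6 ℕ.* d)
            ≤⟨ ℕₚ.m≤m+n _ (6 ℕ.* d ℕ.* (length As ℕ.+ length B₁) ℕ.+ 24 ℕ.* d ℕ.* length B₂) ⟩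
          _ ≡⟨ e d (length As) (length B₁) (length B₂) Z κ ⟩
          30 ℕ.* d ℕ.* (length As ℕ.+ (length B₁ ℕ.+ length B₂)) ℕ.+ (Z ℕ.+ κ ℕ.* length As)
            ≡⟨ ≡.cong (λ b → 30 ℕ.* d ℕ.* (length As ℕ.+ b) ℕ.+ (Z ℕ.+ κ ℕ.* length As)) (≡.sym (length-split sB)) ⟩
          30 ℕ.* d ℕ.* (length As ℕ.+ length Bs) ℕ.+ (Z ℕ.+ κ ℕ.* length As) ∎)
        where
        open ℕₚ.≤-Reasoning
        e : ∀ d a b₁ b₂ Z κ → (4 ℕ.* (6 ℕ.* d) ℕ.* (a ℕ.+ b₁) ℕ.+ (Z ℕ.+ κ ℕ.* a)) ℕ.+ b₂ ℕ.* (6 ℕ.* d) ℕ.+ (6 ℕ.* d ℕ.* (a ℕ.+ b₁) ℕ.+ 24 ℕ.* d ℕ.* b₂)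
          ≡ 30 ℕ.* d ℕ.* (a ℕ.+ (b₁ ℕ.+ b₂)) ℕ.+ (Z ℕ.+ κ ℕ.* a)
        e = solve-∀
        Z = C ℕ.* cube (72 ℕ.* d)
        12d≤p : 6 ℕ.* d ℕ.+ 6 ℕ.* d ≤ p
        12d≤p = begin
          6 ℕ.* d ℕ.+ 6 ℕ.* d ≤⟨ ℕₚ.m≤m+n _ (60 ℕ.* d) ⟩
          6 ℕ.* d ℕ.+ 6 ℕ.* d ℕ.+ 60 ℕ.* d ≡⟨ e′ d ⟩
          72 ℕ.* d ≤⟨ ℕₚ.≤-trans (ℕₚ.<⇒≤ 72d<r) r≤p ⟩
          p ∎
          where
          e′ : ∀ d → 6 ℕ.* d ℕ.+ 6 ℕ.* d ℕ.+ 60 ℕ.* d ≡ 72 ℕ.* d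
          e′ = solve-∀
        enough : length (map la As) ℕ.* (6 ℕ.* d) < R.dim (6 ℕ.* d)
        enough = ℕₚ.*-cancelˡ-< 6 _ _ (begin-strict
          6 ℕ.* (length (map la As) ℕ.* (6 ℕ.* d)) ≡⟨ ≡.cong (λ l → 6 ℕ.* (l ℕ.* (6 ℕ.* d))) (Listₚ.length-map la As) ⟩
          6 ℕ.* (length As ℕ.* (6 ℕ.* d)) ≤⟨ ℕₚ.*-monoʳ-≤ 6 (ℕₚ.*-monoˡ-≤ (6 ℕ.* d) small) ⟩
          6 ℕ.* (d ℕ.* d ℕ.* (6 ℕ.* d)) ≡⟨ e₁ d ⟩
          36 ℕ.* (d ℕ.* d ℕ.* d) <⟨ ℕₚ.*-monoˡ-< (d ℕ.* d ℕ.* d) {{ℕ.>-nonZero (ℕₚ.*-mono-≤ (ℕₚ.*-mono-≤ d≢0 d≢0) d≢0)}} {36} {216} (ℕₚ.≤ᵇ⇒≤ 37 216 _) ⟩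
          216 ℕ.* (d ℕ.* d ℕ.* d) ≡⟨ e₂ d ⟩
          6 ℕ.* d ℕ.* (6 ℕ.* d) ℕ.* (6 ℕ.* d) ≤⟨ dim-lower (6 ℕ.* d) ⟩
          6 ℕ.* R.dim (6 ℕ.* d) ∎)
          where
          e₁ : ∀ d → 6 ℕ.* (d ℕ.* d ℕ.* (6 ℕ.* d)) ≡ 36 ℕ.* (d ℕ.* d ℕ.* d)
          e₁ = solve-∀
          e₂ : ∀ d → 216 ℕ.* (d ℕ.* d ℕ.* d) ≡ 6 ℕ.* d ℕ.* (6 ℕ.* d) ℕ.* (6 ℕ.* d)
          e₂ = solve-∀

      -- The groups partition `As`, so the terms with `κ` add up to a single one, whereas `Bs` is
      -- compared afresh with every group.
      groups-bound : ∀ Bs → Distinct Bs → ∀ m As → Distinct As → length As ≤ m ℕ.* (d ℕ.* d) →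
        I As Bs ≤ 30 ℕ.* d ℕ.* (length As ℕ.+ m ℕ.* length Bs) ℕ.+ (m ℕ.* (C ℕ.* cube (72 ℕ.* d)) ℕ.+ κ ℕ.* length As)
      groups-bound Bs dB zero [] dA len = z≤n
      groups-bound Bs dB (suc m) As dA len = begin
        I As Bs ≡⟨ ≡.trans (≡.cong (λ xs → I xs Bs) (≡.sym (Listₚ.take++drop≡id s As))) (∑-++ (λ a → deg a Bs) A₁ A₂) ⟩
        I A₁ Bs ℕ.+ I A₂ Bs ≤⟨ ℕₚ.+-mono-≤ (group-bound A₁ Bs (Pairsₚ.take⁺ s dA) dB len₁) (groups-bound Bs dB m A₂ (Pairsₚ.drop⁺ s dA) len₂) ⟩
        (30 ℕ.* d ℕ.* (length A₁ ℕ.+ length Bs) ℕ.+ (Z ℕ.+ κ ℕ.* length A₁)) ℕ.+ (30 ℕ.* d ℕ.* (length A₂ ℕ.+ m ℕ.* length Bs) ℕ.+ (m ℕ.* Z ℕ.+ κ ℕ.* length A₂))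
          ≡⟨ e d (length A₁) (length A₂) (length Bs) m Z κ ⟩
        30 ℕ.* d ℕ.* ((length A₁ ℕ.+ length A₂) ℕ.+ suc m ℕ.* length Bs) ℕ.+ (suc m ℕ.* Z ℕ.+ κ ℕ.* (length A₁ ℕ.+ length A₂))
          ≡⟨ ≡.cong (λ l → 30 ℕ.* d ℕ.* (l ℕ.+ suc m ℕ.* length Bs) ℕ.+ (suc m ℕ.* Z ℕ.+ κ ℕ.* l)) (≡.trans (≡.sym (Listₚ.length-++ A₁)) (≡.cong length (Listₚ.take++drop≡id s As))) ⟩
        30 ℕ.* d ℕ.* (length As ℕ.+ suc m ℕ.* length Bs) ℕ.+ (suc m ℕ.* Z ℕ.+ κ ℕ.* length As) ∎
        where
        open ℕₚ.≤-Reasoning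
        s = d ℕ.* d
        Z = C ℕ.* cube (72 ℕ.* d)
        A₁ = take s As
        A₂ = drop s As
        len₁ : length A₁ ≤ s
        len₁ = ℕₚ.≤-trans (ℕₚ.≤-reflexive (Listₚ.length-take s As)) (ℕₚ.m⊓n≤m s (length As))
        len₂ : length A₂ ≤ m ℕ.* s
        len₂ = ℕₚ.≤-trans (ℕₚ.≤-reflexive (Listₚ.length-drop s As)) (ℕₚ.≤-trans (ℕₚ.∸-monoˡ-≤ s len) (ℕₚ.≤-reflexive (ℕₚ.m+n∸m≡n s (m ℕ.* s))))
        e : ∀ d a₁ a₂ b m Z κ → (30 ℕ.* d ℕ.* (a₁ ℕ.+ b) ℕ.+ (Z ℕ.+ κ ℕ.* a₁)) ℕ.+ (30 ℕ.* d ℕ.* (a₂ ℕ.+ m ℕ.* b) ℕ.+ (m ℕ.* Z ℕ.+ κ ℕ.* a₂))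
          ≡ 30 ℕ.* d ℕ.* ((a₁ ℕ.+ a₂) ℕ.+ suc m ℕ.* b) ℕ.+ (suc m ℕ.* Z ℕ.+ κ ℕ.* (a₁ ℕ.+ a₂))
        e = solve-∀

      conclusion : ∀ As Bs → Distinct As → Distinct Bs → length As ℕ.+ length Bs ≤ r ℕ.* r → I As Bs ≤ C ℕ.* cube r ℕ.+ κ ℕ.* length As
      conclusion As Bs dA dB len = ℕₚ.*-cancelˡ-≤ 2 (begin
        2 ℕ.* I As Bs ≤⟨ ℕₚ.*-monoʳ-≤ 2 (groups-bound Bs dB m As dA lenA) ⟩
        2 ℕ.* (30 ℕ.* d ℕ.* (length As ℕ.+ m ℕ.* length Bs) ℕ.+ (m ℕ.* (C ℕ.* cube (72 ℕ.* d)) ℕ.+ κ ℕ.* length As))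
          ≤⟨ ℕₚ.*-monoʳ-≤ 2 (ℕₚ.+-monoˡ-≤ _ (ℕₚ.*-monoʳ-≤ (30 ℕ.* d) (ℕₚ.+-mono-≤ (ℕₚ.≤-trans (ℕₚ.m≤m+n _ _) len) (ℕₚ.*-monoʳ-≤ m (ℕₚ.≤-trans (ℕₚ.m≤n+m _ _) len))))) ⟩
        2 ℕ.* (30 ℕ.* d ℕ.* (r ℕ.* r ℕ.+ m ℕ.* (r ℕ.* r)) ℕ.+ (m ℕ.* (C ℕ.* cube (72 ℕ.* d)) ℕ.+ κ ℕ.* length As)) ≡⟨ e₁ d N r C κ (length As) (cube (72 ℕ.* d)) ⟩
        60 ℕ.* d ℕ.* (r ℕ.* r) ℕ.* (1 ℕ.+ 4 ℕ.* N ℕ.* N) ℕ.+ (N ℕ.* N ℕ.* (C ℕ.* (8 ℕ.* cube (72 ℕ.* d))) ℕ.+ 2 ℕ.* (κ ℕ.* length As))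
          ≤⟨ ℕₚ.+-mono-≤ part₁ (ℕₚ.+-monoˡ-≤ _ part₂) ⟩
        C ℕ.* cube r ℕ.+ (C ℕ.* cube r ℕ.+ 2 ℕ.* (κ ℕ.* length As)) ≡⟨ e₂ (C ℕ.* cube r) (κ ℕ.* length As) ⟩
        2 ℕ.* (C ℕ.* cube r ℕ.+ κ ℕ.* length As) ∎)
        where
        open ℕₚ.≤-Reasoning
        -- As `r ≤ 2 N d`, this many groups of `d²` lines exhaust the at most `r²` lines.
        m = 4 ℕ.* N ℕ.* N
        lenA : length As ≤ m ℕ.* (d ℕ.* d)
        lenA = begin
          length As ≤⟨ ℕₚ.≤-trans (ℕₚ.m≤m+n _ _) len ⟩
          r ℕ.* r ≤⟨ ℕₚ.*-mono-≤ r≤2Nd r≤2Nd ⟩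
          2 ℕ.* (N ℕ.* d) ℕ.* (2 ℕ.* (N ℕ.* d)) ≡⟨ e N d ⟩
          4 ℕ.* N ℕ.* N ℕ.* (d ℕ.* d) ∎
          where
          e : ∀ N d → 2 ℕ.* (N ℕ.* d) ℕ.* (2 ℕ.* (N ℕ.* d)) ≡ 4 ℕ.* N ℕ.* N ℕ.* (d ℕ.* d)
          e = solve-∀
        e₁ : ∀ d N r C κ l Z → 2 ℕ.* (30 ℕ.* d ℕ.* (r ℕ.* r ℕ.+ 4 ℕ.* N ℕ.* N ℕ.* (r ℕ.* r)) ℕ.+ (4 ℕ.* N ℕ.* N ℕ.* (C ℕ.* Z) ℕ.+ κ ℕ.* l))
          ≡ 60 ℕ.* d ℕ.* (r ℕ.* r) ℕ.* (1 ℕ.+ 4 ℕ.* N ℕ.* N) ℕ.+ (N ℕ.* N ℕ.* (C ℕ.* (8 ℕ.* Z)) ℕ.+ 2 ℕ.* (κ ℕ.* l))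
        e₁ = solve-∀
        e₂ : ∀ x y → x ℕ.+ (x ℕ.+ 2 ℕ.* y) ≡ 2 ℕ.* (x ℕ.+ y)
        e₂ = solve-∀
        1≤N : 1 ≤ N
        1≤N = ℕ.>-nonZero⁻¹ N
        part₁ : 60 ℕ.* d ℕ.* (r ℕ.* r) ℕ.* (1 ℕ.+ 4 ℕ.* N ℕ.* N) ≤ C ℕ.* cube r
        part₁ = begin
          60 ℕ.* d ℕ.* (r ℕ.* r) ℕ.* (1 ℕ.+ 4 ℕ.* N ℕ.* N) ≤⟨ ℕₚ.*-monoʳ-≤ (60 ℕ.* d ℕ.* (r ℕ.* r)) (ℕₚ.+-monoˡ-≤ (4 ℕ.* N ℕ.* N) (ℕₚ.*-mono-≤ 1≤N 1≤N)) ⟩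
          60 ℕ.* d ℕ.* (r ℕ.* r) ℕ.* (N ℕ.* N ℕ.+ 4 ℕ.* N ℕ.* N) ≡⟨ e d r N ⟩
          300 ℕ.* N ℕ.* (r ℕ.* r ℕ.* (N ℕ.* d)) ≤⟨ ℕₚ.*-monoʳ-≤ (300 ℕ.* N) (ℕₚ.*-monoʳ-≤ (r ℕ.* r) Nd≤r) ⟩
          300 ℕ.* N ℕ.* (r ℕ.* r ℕ.* r) ≡⟨ ≡.cong (ℕ._* cube r) (≡.sym C-value) ⟩
          C ℕ.* cube r ∎
          where
          e : ∀ d r N → 60 ℕ.* d ℕ.* (r ℕ.* r) ℕ.* (N ℕ.* N ℕ.+ 4 ℕ.* N ℕ.* N) ≡ 300 ℕ.* N ℕ.* (r ℕ.* r ℕ.* (N ℕ.* d))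
          e = solve-∀
        part₂ : N ℕ.* N ℕ.* (C ℕ.* (8 ℕ.* cube (72 ℕ.* d))) ≤ C ℕ.* cube r
        part₂ = begin
          N ℕ.* N ℕ.* (C ℕ.* (8 ℕ.* cube (72 ℕ.* d))) ≤⟨ ℕₚ.*-monoʳ-≤ (N ℕ.* N) (ℕₚ.*-monoʳ-≤ C (N-large d)) ⟩
          N ℕ.* N ℕ.* (C ℕ.* (N ℕ.* (d ℕ.* d ℕ.* d))) ≡⟨ e N C d ⟩
          C ℕ.* (N ℕ.* d ℕ.* (N ℕ.* d) ℕ.* (N ℕ.* d)) ≤⟨ ℕₚ.*-monoʳ-≤ C (ℕₚ.*-mono-≤ (ℕₚ.*-mono-≤ Nd≤r Nd≤r) Nd≤r) ⟩
          C ℕ.* cube r ∎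
          where
          e : ∀ N C d → N ℕ.* N ℕ.* (C ℕ.* (N ℕ.* (d ℕ.* d ℕ.* d))) ≡ C ℕ.* (N ℕ.* d ℕ.* (N ℕ.* d) ℕ.* (N ℕ.* d))
          e = solve-∀

    incidence-bound : ∀ r → Statement r
    incidence-bound = <-rec Statement step
      where
      step : ∀ r → (∀ {s} → s < r → Statement s) → Statement r
      step r ih r≤p As Bs dA dB len with N ℕ.≤? r
      ... | yes N≤r = Step.conclusion r ih r≤p N≤r As Bs dA dB len
      -- For `r < N` the quotient `d` would be 0, but the trivial bound `r⁴` is already below
      -- `C r³`.
      ... | no N≰r = begin
        I As Bs ≤⟨ I-trivial As Bs ⟩
        length As ℕ.* length Bs ≤⟨ ℕₚ.*-mono-≤ {length As} {r ℕ.* r} {length Bs} {r ℕ.* r} (ℕₚ.≤-trans (ℕₚ.m≤m+n (length As) (length Bs)) len) (ℕₚ.≤-trans (ℕₚ.m≤n+m (length Bs) (length As)) len) ⟩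
        r ℕ.* r ℕ.* (r ℕ.* r) ≡⟨ e r ⟩
        r ℕ.* cube r ≤⟨ ℕₚ.*-monoˡ-≤ (cube r) (ℕₚ.≤-trans (ℕₚ.<⇒≤ (ℕₚ.≰⇒> N≰r)) (ℕₚ.≤-trans (ℕₚ.m≤n*m N 300) (ℕₚ.≤-reflexive (≡.sym C-value)))) ⟩
        C ℕ.* cube r ≤⟨ ℕₚ.m≤m+n _ _ ⟩
        C ℕ.* cube r ℕ.+ κ ℕ.* length As ∎
        where
        open ℕₚ.≤-Reasoning
        e : ∀ r → r ℕ.* r ℕ.* (r ℕ.* r) ≡ r ℕ.* (r ℕ.* r ℕ.* r)
        e = solve-∀

-- Averaging, pigeonhole and collision counting.

∑-* : ∀ {a} {A : Set a} (f : A → ℕ) k xs → ∑ f xs ℕ.* k ≡ ∑ (λ x → f x ℕ.* k) xs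
∑-* f k [] = ≡.refl
∑-* f k (x ∷ xs) = ≡.trans (ℕₚ.*-distribʳ-+ k (f x) (∑ f xs)) (≡.cong (f x ℕ.* k ℕ.+_) (∑-* f k xs))

∑-constant : ∀ {a} {A : Set a} k (xs : List A) → ∑ (λ _ → k) xs ≡ length xs ℕ.* k
∑-constant k [] = ≡.refl
∑-constant k (x ∷ xs) = ≡.cong (k ℕ.+_) (∑-constant k xs)

∑-product : ∀ {a b} {A : Set a} {B : Set b} (f : A × B → ℕ) xs ys → ∑ f (cartesianProduct xs ys) ≡ ∑ (λ x → ∑ (λ y → f (x , y)) ys) xs
∑-product f [] ys = ≡.refl
∑-product f (x ∷ xs) ys = ≡.trans (∑-++ f (map (x ,_) ys) (cartesianProduct xs ys)) (≡.cong₂ ℕ._+_ (∑-map ys) (∑-product f xs ys))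
  where
  ∑-map : ∀ ys → ∑ f (map (x ,_) ys) ≡ ∑ (λ y → f (x , y)) ys
  ∑-map [] = ≡.refl
  ∑-map (y ∷ ys) = ≡.cong (f (x , y) ℕ.+_) (∑-map ys)

∑-∈ : ∀ {a} {A : Set a} (f : A → ℕ) {x xs} → x ∈ xs → f x ≤ ∑ f xs
∑-∈ f (here ≡.refl) = ℕₚ.m≤m+n _ _
∑-∈ f (there h) = ℕₚ.≤-trans (∑-∈ f h) (ℕₚ.m≤n+m _ _)

∑-≤ : ∀ {a} {A : Set a} {f g : A → ℕ} xs → (∀ x → f x ≤ g x) → ∑ f xs ≤ ∑ g xs
∑-≤ xs h = ∑-mono xs (All.universal h xs)

below-average : ∀ {a} {A : Set a} (f : A → ℕ) xs → 0 < length xs → ∃ λ x → x ∈ xs × length xs ℕ.* f x ≤ ∑ f xs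
below-average f (x ∷ []) _ = x , here ≡.refl , ℕₚ.≤-refl
below-average f (x ∷ y ∷ xs) _ with below-average f (y ∷ xs) (s≤s z≤n)
... | z , z∈ , h with ℕₚ.≤-total (f x) (f z)
...   | inj₁ x≤z = x , here ≡.refl , ℕₚ.+-monoʳ-≤ (f x) (ℕₚ.≤-trans (ℕₚ.*-monoʳ-≤ (length (y ∷ xs)) x≤z) h)
...   | inj₂ z≤x = z , there z∈ , ℕₚ.+-mono-≤ z≤x h

at-most-one : ∀ {a} {A : Set a} (f : A → Bool) xs → Distinct xs → (∀ x y → T (f x) → T (f y) → x ≡ y) → ∑ (λ x → ⟦ f x ⟧) xs ≤ 1
at-most-one f xs dist h with count-split f xs
... | ys , zs , s , e = ≡.subst (_≤ 1) (≡.sym e) (go ys (split-yes s) (split-Pairsˡ s dist))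
  where
  go : ∀ ys → All (λ y → T (f y)) ys → Distinct ys → length ys ≤ 1
  go [] _ _ = z≤n
  go (y ∷ []) _ _ = s≤s z≤n
  go (y ∷ z ∷ ys) (ty ∷ tz ∷ _) ((y≢z ∷ _) ∷ _) = ⊥-elim (y≢z (h y z ty tz))

lookup-All : ∀ {a p} {A : Set a} {P : A → Set p} {xs} → All P xs → ∀ i → P (List.lookup xs i)
lookup-All (h ∷ _) zero = h
lookup-All (_ ∷ hs) (suc i) = lookup-All hs i

lookup-Pairs : ∀ {a p} {A : Set a} {P : A → A → Set p} {xs} → (∀ {x y} → P x y → P y x) → AllPairs P xs → ∀ {i j} → i ≢ j → P (List.lookup xs i) (List.lookup xs j)
lookup-Pairs sym (h ∷ hs) {zero} {zero} n = ⊥-elim (n ≡.refl)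
lookup-Pairs sym (h ∷ hs) {zero} {suc j} n = lookup-All h j
lookup-Pairs sym (h ∷ hs) {suc i} {zero} n = sym (lookup-All h i)
lookup-Pairs sym (h ∷ hs) {suc i} {suc j} n = lookup-Pairs sym hs (λ e → n (≡.cong suc e))

pairs-map : ∀ {a b p q} {A : Set a} {B : Set b} {P : A → A → Set p} {Q : B → B → Set q} (f : A → B) → (∀ {x y} → P x y → Q (f x) (f y)) →
  ∀ {xs} → AllPairs P xs → AllPairs Q (map f xs)
pairs-map f h ps = Pairsₚ.map⁺ (AllPairs.map h ps)

injective-length : ∀ {a n} {A : Set a} (f : A → Fin n) xs → AllPairs (λ x y → f x ≢ f y) xs → length xs ≤ n
injective-length f xs inj = ℕₚ.≮⇒≥ λ n<l →
  let i , j , i<j , e = Finₚ.pigeonhole n<l (λ i → f (List.lookup xs i)) in lookup-Pairs (λ n e → n (≡.sym e)) inj (Finₚ.<⇒≢ i<j) e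

⟦⟧-≤ : ∀ b {k} → (T b → 1 ≤ k) → ⟦ b ⟧ ≤ k
⟦⟧-≤ true h = h tt
⟦⟧-≤ false h = z≤n

⟦⟧-∧ : ∀ b c → ⟦ b ∧ c ⟧ ≡ ⟦ b ⟧ ℕ.* ⟦ c ⟧
⟦⟧-∧ true true = ≡.refl
⟦⟧-∧ true false = ≡.refl
⟦⟧-∧ false c = ≡.refl

⟦⟧-1 : ∀ {b} → T b → 1 ≤ ⟦ b ⟧
⟦⟧-1 {true} _ = s≤s z≤n

-- Cauchy-Schwarz for the fibres of a map to a set with t elements.
collisions : ∀ {a t} {A : Set a} (f : A → Fin t) xs →
  length xs ℕ.* length xs ≤ t ℕ.* ∑ (λ x → ∑ (λ y → ⟦ ⌊ f x Fin.≟ f y ⌋ ⟧) xs) xs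
collisions {t = t} f xs = ℕₚ.≤-trans (ℕₚ.≤-reflexive (≡.sym (≡.cong₂ ℕ._*_ total total))) (ℕₚ.≤-trans cauchy (ℕₚ.*-monoʳ-≤ t squares))
  where
  open ℕₚ.≤-Reasoning
  ks = allFin t
  is : Fin t → _ → ℕ
  is k x = ⟦ ⌊ f x Fin.≟ k ⌋ ⟧
  r : Fin t → ℕ
  r k = ∑ (is k) xs
  total : ∑ r ks ≡ length xs
  total = ≡.trans (∑-swap is ks xs) (≡.trans (∑-cong xs one) (≡.trans (∑-constant 1 xs) (ℕₚ.*-identityʳ _)))
    where
    one : ∀ x → ∑ (λ k → is k x) ks ≡ 1
    one x = ℕₚ.≤-antisym (at-most-one (λ k → ⌊ f x Fin.≟ k ⌋) ks distinct-allFin (λ k l p q → ≡.trans (≡.sym (toWitness p)) (toWitness q)))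
      (ℕₚ.≤-trans (⟦⟧-1 (fromWitness {a? = f x Fin.≟ f x} ≡.refl)) (∑-∈ (λ k → is k x) (∈ₚ.∈-allFin (f x))))
      where
      distinct-allFin = allFin⁺ t
  am-gm : ∀ a b → 2 ℕ.* (a ℕ.* b) ≤ a ℕ.* a ℕ.+ b ℕ.* b
  am-gm a b with ℕₚ.≤-total a b
  ... | inj₁ a≤b = ≡.subst (λ b → 2 ℕ.* (a ℕ.* b) ≤ a ℕ.* a ℕ.+ b ℕ.* b) (ℕₚ.m+[n∸m]≡n a≤b) (main a (b ∸ a))
    where
    main : ∀ a d → 2 ℕ.* (a ℕ.* (a ℕ.+ d)) ≤ a ℕ.* a ℕ.+ (a ℕ.+ d) ℕ.* (a ℕ.+ d)
    main a d = ℕₚ.≤-trans (ℕₚ.m≤m+n _ (d ℕ.* d)) (ℕₚ.≤-reflexive (e a d))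
      where
      e : ∀ a d → 2 ℕ.* (a ℕ.* (a ℕ.+ d)) ℕ.+ d ℕ.* d ≡ a ℕ.* a ℕ.+ (a ℕ.+ d) ℕ.* (a ℕ.+ d)
      e = solve-∀
  ... | inj₂ b≤a = ≡.subst (λ a → 2 ℕ.* (a ℕ.* b) ≤ a ℕ.* a ℕ.+ b ℕ.* b) (ℕₚ.m+[n∸m]≡n b≤a) (main b (a ∸ b))
    where
    main : ∀ b d → 2 ℕ.* ((b ℕ.+ d) ℕ.* b) ≤ (b ℕ.+ d) ℕ.* (b ℕ.+ d) ℕ.+ b ℕ.* b
    main b d = ℕₚ.≤-trans (ℕₚ.m≤m+n _ (d ℕ.* d)) (ℕₚ.≤-reflexive (e b d))
      where
      e : ∀ b d → 2 ℕ.* ((b ℕ.+ d) ℕ.* b) ℕ.+ d ℕ.* d ≡ (b ℕ.+ d) ℕ.* (b ℕ.+ d) ℕ.+ b ℕ.* b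
      e = solve-∀
  ∑-*ˡ : ∀ {b} {B : Set b} k (g : B → ℕ) ys → k ℕ.* ∑ g ys ≡ ∑ (λ y → k ℕ.* g y) ys
  ∑-*ˡ k g ys = ≡.trans (ℕₚ.*-comm k _) (≡.trans (∑-* g k ys) (∑-cong ys (λ y → ℕₚ.*-comm (g y) k)))
  cauchy : ∑ r ks ℕ.* ∑ r ks ≤ t ℕ.* ∑ (λ k → r k ℕ.* r k) ks
  cauchy = ℕₚ.*-cancelˡ-≤ 2 (begin
    2 ℕ.* (∑ r ks ℕ.* ∑ r ks) ≡⟨ ≡.cong (2 ℕ.*_) (≡.trans (∑-* r (∑ r ks) ks) (∑-cong ks (λ k → ∑-*ˡ (r k) r ks))) ⟩
    2 ℕ.* ∑ (λ k → ∑ (λ l → r k ℕ.* r l) ks) ks ≡⟨ ≡.trans (∑-*ˡ 2 _ ks) (∑-cong ks (λ k → ∑-*ˡ 2 (λ l → r k ℕ.* r l) ks)) ⟩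
    ∑ (λ k → ∑ (λ l → 2 ℕ.* (r k ℕ.* r l)) ks) ks ≤⟨ ∑-≤ ks (λ k → ∑-≤ ks (λ l → am-gm (r k) (r l))) ⟩
    ∑ (λ k → ∑ (λ l → sq k ℕ.+ sq l) ks) ks ≡⟨ ∑-cong ks (λ k → ≡.trans (∑-+ (λ _ → sq k) sq ks) (≡.cong (ℕ._+ ∑ sq ks) (∑-constant (sq k) ks))) ⟩
    ∑ (λ k → length ks ℕ.* sq k ℕ.+ ∑ sq ks) ks ≡⟨ ≡.trans (∑-+ (λ k → length ks ℕ.* sq k) (λ _ → ∑ sq ks) ks) (≡.cong₂ ℕ._+_ (≡.sym (∑-*ˡ (length ks) sq ks)) (∑-constant (∑ sq ks) ks)) ⟩
    length ks ℕ.* ∑ sq ks ℕ.+ length ks ℕ.* ∑ sq ks ≡⟨ ≡.cong (λ m → m ℕ.* ∑ sq ks ℕ.+ m ℕ.* ∑ sq ks) (Listₚ.length-tabulate {n = t} (λ i → i)) ⟩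
    t ℕ.* ∑ sq ks ℕ.+ t ℕ.* ∑ sq ks ≡⟨ e t (∑ sq ks) ⟩
    2 ℕ.* (t ℕ.* ∑ sq ks) ∎)
    where
    sq : Fin t → ℕ
    sq k = r k ℕ.* r k
    e : ∀ t s → t ℕ.* s ℕ.+ t ℕ.* s ≡ 2 ℕ.* (t ℕ.* s)
    e = solve-∀
  squares : ∑ (λ k → r k ℕ.* r k) ks ≤ ∑ (λ x → ∑ (λ y → ⟦ ⌊ f x Fin.≟ f y ⌋ ⟧) xs) xs
  squares = begin
    ∑ (λ k → r k ℕ.* r k) ks ≡⟨ ∑-cong ks (λ k → ≡.trans (∑-* (is k) (r k) xs) (∑-cong xs (λ x → ∑-*ˡ (is k x) (is k) xs))) ⟩
    ∑ (λ k → ∑ (λ x → ∑ (λ y → is k x ℕ.* is k y) xs) xs) ks ≡⟨ ∑-swap (λ k x → ∑ (λ y → is k x ℕ.* is k y) xs) ks xs ⟩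
    ∑ (λ x → ∑ (λ k → ∑ (λ y → is k x ℕ.* is k y) xs) ks) xs ≡⟨ ∑-cong xs (λ x → ∑-swap (λ k y → is k x ℕ.* is k y) ks xs) ⟩
    ∑ (λ x → ∑ (λ y → ∑ (λ k → is k x ℕ.* is k y) ks) xs) xs ≤⟨ ∑-≤ xs (λ x → ∑-≤ xs (λ y → both x y)) ⟩
    ∑ (λ x → ∑ (λ y → ⟦ ⌊ f x Fin.≟ f y ⌋ ⟧) xs) xs ∎
    where
    both : ∀ x y → ∑ (λ k → is k x ℕ.* is k y) ks ≤ ⟦ ⌊ f x Fin.≟ f y ⌋ ⟧
    both x y with f x Fin.≟ f y
    ... | yes _ = ℕₚ.≤-trans (ℕₚ.≤-reflexive (∑-cong ks (λ k → ≡.sym (⟦⟧-∧ ⌊ f x Fin.≟ k ⌋ ⌊ f y Fin.≟ k ⌋))))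
          (at-most-one (λ k → ⌊ f x Fin.≟ k ⌋ ∧ ⌊ f y Fin.≟ k ⌋) ks (allFin⁺ t)
            (λ k l p q → ≡.trans (≡.sym (fst k p)) (fst l q)))
          where
          fst : ∀ k → T (⌊ f x Fin.≟ k ⌋ ∧ ⌊ f y Fin.≟ k ⌋) → f x ≡ k
          fst k t with f x Fin.≟ k
          ... | yes e = e
    ... | no fx≢fy = ℕₚ.≤-reflexive (≡.trans (∑-cong ks zeroes) (∑-zero ks))
      where
      zeroes : ∀ k → is k x ℕ.* is k y ≡ 0
      zeroes k with f x Fin.≟ k | f y Fin.≟ k
      ... | yes ≡.refl | yes fy≡k = ⊥-elim (fx≢fy (≡.sym fy≡k))
      ... | yes _ | no _ = ≡.refl
      ... | no _ | _ = ≡.refl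

-- Removing crossings that share a point on a common line.

-- `sameᴮ a b b′` says that `b` and `b′` cross `a` at the same point, and `MB` marks pairs that
-- meet. `transᴮ` and `transᴬ` express that two lines of one family have at most one common point.
record CrossingData : Set₁ where
  field
    A B : Set
    _≟ᴬ_ : DecidableEquality A
    _≟ᴮ_ : DecidableEquality B
    As : List A
    Bs : List B
    dA : Distinct As
    dB : Distinct Bs
    allA : ∀ a → a ∈ As
    allB : ∀ b → b ∈ Bs
    Cr : A → B → Bool
    sameᴮ : A → B → B → Bool
    sameᴬ : B → A → A → Bool
    sameᴮ-sym : ∀ {a b b′} → T (sameᴮ a b b′) → T (sameᴮ a b′ b)
    sameᴬ-sym : ∀ {b a a′} → T (sameᴬ b a a′) → T (sameᴬ b a′ a)
    MA : A → A → Bool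
    MB : B → B → Bool
    meetᴮ : ∀ {a b b′} → T (Cr a b) → T (Cr a b′) → b ≢ b′ → T (sameᴮ a b b′) → T (MB b b′)
    meetᴬ : ∀ {b a a′} → T (Cr a b) → T (Cr a′ b) → a ≢ a′ → T (sameᴬ b a a′) → T (MA a a′)
    transᴮ : ∀ {a₁ a₂ b b′} → T (Cr a₁ b) → T (Cr a₁ b′) → T (Cr a₂ b) → T (Cr a₂ b′) → b ≢ b′ →
      T (sameᴮ a₁ b b′) → T (sameᴮ a₂ b b′) → T (sameᴬ b′ a₁ a₂)
    transᴬ : ∀ {b₁ b₂ a a′} → T (Cr a b₁) → T (Cr a′ b₁) → T (Cr a b₂) → T (Cr a′ b₂) → a ≢ a′ →
      T (sameᴬ b₁ a a′) → T (sameᴬ b₂ a a′) → T (sameᴮ a′ b₁ b₂)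

-- A maximal set of crossings no two of which lie on a common line at the same point;
-- each crossing left out is charged to a pair of lines of the same family meeting at that point.
module Thinning (crossings : CrossingData) where
  open CrossingData crossings

  Pair : Set
  Pair = A × B

  _≟_ : DecidableEquality Pair
  (a , b) ≟ (a′ , b′) with a ≟ᴬ a′ | b ≟ᴮ b′
  ... | yes ≡.refl | yes ≡.refl = yes ≡.refl
  ... | no n | _ = no λ { ≡.refl → n ≡.refl }
  ... | yes _ | no n = no λ { ≡.refl → n ≡.refl }

  data Clash : Pair → Pair → Set where
    onA : ∀ {a b b′} → b ≢ b′ → T (sameᴮ a b b′) → Clash (a , b) (a , b′)
    onB : ∀ {a a′ b} → a ≢ a′ → T (sameᴬ b a a′) → Clash (a , b) (a′ , b)

  clash-sym : ∀ {x y} → Clash x y → Clash y x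
  clash-sym (onA n t) = onA (λ e → n (≡.sym e)) (sameᴮ-sym t)
  clash-sym (onB n t) = onB (λ e → n (≡.sym e)) (sameᴬ-sym t)

  T? : ∀ b → Dec (T b)
  T? true = yes tt
  T? false = no λ ()

  clash? : ∀ x y → Dec (Clash x y)
  clash? (a , b) (a′ , b′) with a ≟ᴬ a′ | b ≟ᴮ b′
  ... | yes ≡.refl | yes ≡.refl = no λ { (onA n _) → n ≡.refl ; (onB n _) → n ≡.refl }
  ... | no n | no m = no λ { (onA _ _) → n ≡.refl ; (onB _ _) → m ≡.refl }
  ... | yes ≡.refl | no m with T? (sameᴮ a b b′)
  ...   | yes t = yes (onA m t)
  ...   | no nt = no λ { (onA _ t) → nt t ; (onB n _) → n ≡.refl }
  clash? (a , b) (a′ , b′) | no n | yes ≡.refl with T? (sameᴬ b a a′)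
  ...   | yes t = yes (onB n t)
  ...   | no nt = no λ { (onA m _) → m ≡.refl ; (onB _ t) → nt t }

  Crossing : Pair → Set
  Crossing (a , b) = T (Cr a b)

  greedy : ∀ ps → ∃ λ ks → All Crossing ks × AllPairs (λ x y → ¬ Clash x y) ks × (∀ {x} → x ∈ ps → Crossing x → x ∈ ks ⊎ Any (Clash x) ks)
  greedy [] = [] , [] , [] , λ ()
  greedy (x ∷ ps) with greedy ps
  ... | ks , cr , free , max with T? (Cr (proj₁ x) (proj₂ x)) | any? (clash? x) ks
  ...   | no nc | _ = ks , cr , free , λ { (here ≡.refl) c → ⊥-elim (nc c) ; (there h) c → max h c }
  ...   | yes c | yes clash = ks , cr , free , λ { (here ≡.refl) _ → inj₂ clash ; (there h) c → max h c }
  ...   | yes c | no ok = x ∷ ks , c ∷ cr , ¬Any⇒All ks ok ∷ free ,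
          λ { (here ≡.refl) _ → inj₁ (here ≡.refl) ; (there h) c → grow (max h c) }
    where
    ¬Any⇒All : ∀ ks → ¬ Any (Clash x) ks → All (λ y → ¬ Clash x y) ks
    ¬Any⇒All [] _ = []
    ¬Any⇒All (k ∷ ks) n = (λ h → n (here h)) ∷ ¬Any⇒All ks (λ h → n (there h))
    grow : ∀ {y} → y ∈ ks ⊎ Any (Clash y) ks → y ∈ x ∷ ks ⊎ Any (Clash y) (x ∷ ks)
    grow (inj₁ h) = inj₁ (there h)
    grow (inj₂ h) = inj₂ (there h)

  private
    G = greedy (cartesianProduct As Bs)
    ks = proj₁ G

  ∈ks? : ∀ x → Dec (x ∈ ks)
  ∈ks? x = any? (x ≟_) ks

  abstract
    kept : A → B → Bool
    kept a b = ⌊ ∈ks? (a , b) ⌋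

    ∈⇒kept : ∀ {a b} → (a , b) ∈ ks → T (kept a b)
    ∈⇒kept {a} {b} = fromWitness {a? = ∈ks? (a , b)}

    kept⇒∈ : ∀ {a b} → T (kept a b) → (a , b) ∈ ks
    kept⇒∈ = toWitness

  kept⇒Cr : ∀ {a b} → T (kept a b) → T (Cr a b)
  kept⇒Cr t = All.lookup (proj₁ (proj₂ G)) (kept⇒∈ t)

  free : ∀ {x y} → x ∈ ks → y ∈ ks → x ≢ y → ¬ Clash x y
  free = go ks (proj₁ (proj₂ (proj₂ G)))
    where
    go : ∀ ks → AllPairs (λ x y → ¬ Clash x y) ks → ∀ {x y} → x ∈ ks → y ∈ ks → x ≢ y → ¬ Clash x y
    go (k ∷ ks) (h ∷ hs) (here ≡.refl) (here ≡.refl) n = ⊥-elim (n ≡.refl)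
    go (k ∷ ks) (h ∷ hs) (here ≡.refl) (there q) n c = All.lookup h q c
    go (k ∷ ks) (h ∷ hs) (there p) (here ≡.refl) n c = All.lookup h p (clash-sym c)
    go (k ∷ ks) (h ∷ hs) (there p) (there q) n = go ks hs p q n

  kept-b : ∀ {a b b′} → T (kept a b) → T (kept a b′) → b ≢ b′ → ¬ T (sameᴮ a b b′)
  kept-b p q n t = free (kept⇒∈ p) (kept⇒∈ q) (λ { ≡.refl → n ≡.refl }) (onA n t)

  kept-a : ∀ {a a′ b} → T (kept a b) → T (kept a′ b) → a ≢ a′ → ¬ T (sameᴬ b a a′)
  kept-a p q n t = free (kept⇒∈ p) (kept⇒∈ q) (λ { ≡.refl → n ≡.refl }) (onB n t)

  neqᴮ : B → B → Bool
  neqᴮ b b′ with b ≟ᴮ b′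
  ... | yes _ = false
  ... | no _ = true

  neqᴬ : A → A → Bool
  neqᴬ a a′ with a ≟ᴬ a′
  ... | yes _ = false
  ... | no _ = true

  neqᴮ-T : ∀ {b b′} → b ≢ b′ → T (neqᴮ b b′)
  neqᴮ-T {b} {b′} n with b ≟ᴮ b′
  ... | yes e = n e
  ... | no _ = tt

  T-neqᴮ : ∀ {b b′} → T (neqᴮ b b′) → b ≢ b′
  T-neqᴮ {b} {b′} t with b ≟ᴮ b′
  ... | no n = n

  neqᴬ-T : ∀ {a a′} → a ≢ a′ → T (neqᴬ a a′)
  neqᴬ-T {a} {a′} n with a ≟ᴬ a′
  ... | yes e = n e
  ... | no _ = tt

  T-neqᴬ : ∀ {a a′} → T (neqᴬ a a′) → a ≢ a′
  T-neqᴬ {a} {a′} t with a ≟ᴬ a′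
  ... | no n = n

  chargeᴮ : A → B → B → Bool
  chargeᴮ a b b′ = Cr a b ∧ (kept a b′ ∧ (neqᴮ b b′ ∧ sameᴮ a b b′))

  chargeᴬ : A → B → A → Bool
  chargeᴬ a b a′ = Cr a b ∧ (kept a′ b ∧ (neqᴬ a a′ ∧ sameᴬ b a a′))

  ∧-T : ∀ {b c} → T b → T c → T (b ∧ c)
  ∧-T {true} _ q = q

  T-∧ : ∀ {b c} → T (b ∧ c) → T b × T c
  T-∧ {true} q = tt , q

  charge : ∀ a b → ⟦ Cr a b ⟧ ≤ ⟦ kept a b ⟧ ℕ.+ (∑ (λ b′ → ⟦ chargeᴮ a b b′ ⟧) Bs ℕ.+ ∑ (λ a′ → ⟦ chargeᴬ a b a′ ⟧) As)
  charge a b = ⟦⟧-≤ (Cr a b) λ c → go c (proj₂ (proj₂ (proj₂ G)) (∈ₚ.∈-cartesianProduct⁺ (allA a) (allB b)) c)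
    where
    by : T (Cr a b) → (∃ λ y → y ∈ ks × Clash (a , b) y) → 1 ≤ ∑ (λ b′ → ⟦ chargeᴮ a b b′ ⟧) Bs ℕ.+ ∑ (λ a′ → ⟦ chargeᴬ a b a′ ⟧) As
    by c ((_ , b′) , y∈ , onA n t) = ℕₚ.≤-trans (ℕₚ.≤-trans (⟦⟧-1 (∧-T c (∧-T {kept a b′} (∈⇒kept y∈) (∧-T (neqᴮ-T n) t)))) (∑-∈ (λ b′ → ⟦ chargeᴮ a b b′ ⟧) (allB b′))) (ℕₚ.m≤m+n _ _)
    by c ((a′ , _) , y∈ , onB n t) = ℕₚ.≤-trans (ℕₚ.≤-trans (⟦⟧-1 (∧-T c (∧-T {kept a′ b} (∈⇒kept y∈) (∧-T (neqᴬ-T n) t)))) (∑-∈ (λ a′ → ⟦ chargeᴬ a b a′ ⟧) (allA a′))) (ℕₚ.m≤n+m _ _)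
    go : T (Cr a b) → (a , b) ∈ ks ⊎ Any (Clash (a , b)) ks → 1 ≤ ⟦ kept a b ⟧ ℕ.+ (∑ (λ b′ → ⟦ chargeᴮ a b b′ ⟧) Bs ℕ.+ ∑ (λ a′ → ⟦ chargeᴬ a b a′ ⟧) As)
    go c (inj₁ h) = ℕₚ.≤-trans (⟦⟧-1 (∈⇒kept h)) (ℕₚ.m≤m+n _ _)
    go c (inj₂ h) = ℕₚ.≤-trans (by c (find h)) (ℕₚ.m≤n+m _ ⟦ kept a b ⟧)

  -- Two lines charging the same pair would both pass through the common point of `b` and `b′`.
  -- Their crossings with `b′` were both kept, yet lie at the same point of `b′`: a clash.
  chargeᴮ-bound : ∀ b b′ → ∑ (λ a → ⟦ chargeᴮ a b b′ ⟧) As ≤ ⟦ MB b b′ ⟧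
  chargeᴮ-bound b b′ with MB b b′ in eq
  ... | true = at-most-one (λ a → chargeᴮ a b b′) As dA unique
    where
    unique : ∀ a₁ a₂ → T (chargeᴮ a₁ b b′) → T (chargeᴮ a₂ b b′) → a₁ ≡ a₂
    unique a₁ a₂ t₁ t₂ with a₁ ≟ᴬ a₂ | T-∧ t₁ | T-∧ t₂
    ... | yes e | _ | _ = e
    ... | no n | c₁ , s₁ | c₂ , s₂ with T-∧ s₁ | T-∧ s₂
    ... | k₁ , u₁ | k₂ , u₂ with T-∧ u₁ | T-∧ u₂
    ... | n₁ , v₁ | n₂ , v₂ = ⊥-elim (kept-a k₁ k₂ n (transᴮ c₁ (kept⇒Cr k₁) c₂ (kept⇒Cr k₂) (T-neqᴮ n₁) v₁ v₂))
  ... | false = ℕₚ.≤-trans (∑-≤ As (λ a → ⟦⟧-≤ (chargeᴮ a b b′) (none a))) (ℕₚ.≤-reflexive (∑-zero As))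
    where
    none : ∀ a → T (chargeᴮ a b b′) → 1 ≤ 0
    none a t with T-∧ t
    ... | c , s with T-∧ s
    ... | k , u with T-∧ u
    ... | n , v = ⊥-elim (≡.subst T eq (meetᴮ c (kept⇒Cr k) (T-neqᴮ n) v))

  chargeᴬ-bound : ∀ a a′ → ∑ (λ b → ⟦ chargeᴬ a b a′ ⟧) Bs ≤ ⟦ MA a a′ ⟧
  chargeᴬ-bound a a′ with MA a a′ in eq
  ... | true = at-most-one (λ b → chargeᴬ a b a′) Bs dB unique
    where
    unique : ∀ b₁ b₂ → T (chargeᴬ a b₁ a′) → T (chargeᴬ a b₂ a′) → b₁ ≡ b₂
    unique b₁ b₂ t₁ t₂ with b₁ ≟ᴮ b₂ | T-∧ t₁ | T-∧ t₂
    ... | yes e | _ | _ = e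
    ... | no n | c₁ , s₁ | c₂ , s₂ with T-∧ s₁ | T-∧ s₂
    ... | k₁ , u₁ | k₂ , u₂ with T-∧ u₁ | T-∧ u₂
    ... | n₁ , v₁ | n₂ , v₂ = ⊥-elim (kept-b k₁ k₂ n (transᴬ c₁ (kept⇒Cr k₁) c₂ (kept⇒Cr k₂) (T-neqᴬ n₁) v₁ v₂))
  ... | false = ℕₚ.≤-trans (∑-≤ Bs (λ b → ⟦⟧-≤ (chargeᴬ a b a′) (none b))) (ℕₚ.≤-reflexive (∑-zero Bs))
    where
    none : ∀ b → T (chargeᴬ a b a′) → 1 ≤ 0
    none b t with T-∧ t
    ... | c , s with T-∧ s
    ... | k , u with T-∧ u
    ... | n , v = ⊥-elim (≡.subst T eq (meetᴬ c (kept⇒Cr k) (T-neqᴬ n) v))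

  thinning : ∑ (λ a → ∑ (λ b → ⟦ Cr a b ⟧) Bs) As ≤
    ∑ (λ a → ∑ (λ b → ⟦ kept a b ⟧) Bs) As ℕ.+ (∑ (λ b → ∑ (λ b′ → ⟦ MB b b′ ⟧) Bs) Bs ℕ.+ ∑ (λ a → ∑ (λ a′ → ⟦ MA a a′ ⟧) As) As)
  thinning = begin
    ∑ (λ a → ∑ (λ b → ⟦ Cr a b ⟧) Bs) As ≤⟨ ∑-≤ As (λ a → ∑-≤ Bs (λ b → charge a b)) ⟩
    ∑ (λ a → ∑ (λ b → k a b ℕ.+ (cb a b ℕ.+ ca a b)) Bs) As ≡⟨ ∑-cong As (λ a → ≡.trans (∑-+ (k a) (λ b → cb a b ℕ.+ ca a b) Bs) (≡.cong (∑ (k a) Bs ℕ.+_) (∑-+ (cb a) (ca a) Bs))) ⟩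
    ∑ (λ a → ∑ (k a) Bs ℕ.+ (∑ (cb a) Bs ℕ.+ ∑ (ca a) Bs)) As ≡⟨ ≡.trans (∑-+ (λ a → ∑ (k a) Bs) _ As) (≡.cong (∑ (λ a → ∑ (k a) Bs) As ℕ.+_) (∑-+ (λ a → ∑ (cb a) Bs) (λ a → ∑ (ca a) Bs) As)) ⟩
    ∑ (λ a → ∑ (k a) Bs) As ℕ.+ (∑ (λ a → ∑ (cb a) Bs) As ℕ.+ ∑ (λ a → ∑ (ca a) Bs) As) ≤⟨ ℕₚ.+-monoʳ-≤ (∑ (λ a → ∑ (k a) Bs) As) (ℕₚ.+-mono-≤ boundᴮ boundᴬ) ⟩
    ∑ (λ a → ∑ (k a) Bs) As ℕ.+ (∑ (λ b → ∑ (λ b′ → ⟦ MB b b′ ⟧) Bs) Bs ℕ.+ ∑ (λ a → ∑ (λ a′ → ⟦ MA a a′ ⟧) As) As) ∎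
    where
    open ℕₚ.≤-Reasoning
    k cb ca : A → B → ℕ
    k a b = ⟦ kept a b ⟧
    cb a b = ∑ (λ b′ → ⟦ chargeᴮ a b b′ ⟧) Bs
    ca a b = ∑ (λ a′ → ⟦ chargeᴬ a b a′ ⟧) As
    boundᴮ : ∑ (λ a → ∑ (cb a) Bs) As ≤ ∑ (λ b → ∑ (λ b′ → ⟦ MB b b′ ⟧) Bs) Bs
    boundᴮ = begin
      ∑ (λ a → ∑ (cb a) Bs) As ≡⟨ ∑-swap cb As Bs ⟩
      ∑ (λ b → ∑ (λ a → cb a b) As) Bs ≡⟨ ∑-cong Bs (λ b → ∑-swap (λ a b′ → ⟦ chargeᴮ a b b′ ⟧) As Bs) ⟩
      ∑ (λ b → ∑ (λ b′ → ∑ (λ a → ⟦ chargeᴮ a b b′ ⟧) As) Bs) Bs ≤⟨ ∑-≤ Bs (λ b → ∑-≤ Bs (λ b′ → chargeᴮ-bound b b′)) ⟩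
      ∑ (λ b → ∑ (λ b′ → ⟦ MB b b′ ⟧) Bs) Bs ∎
    boundᴬ : ∑ (λ a → ∑ (ca a) Bs) As ≤ ∑ (λ a → ∑ (λ a′ → ⟦ MA a a′ ⟧) As) As
    boundᴬ = begin
      ∑ (λ a → ∑ (ca a) Bs) As ≡⟨ ∑-cong As (λ a → ∑-swap (λ b a′ → ⟦ chargeᴬ a b a′ ⟧) Bs As) ⟩
      ∑ (λ a → ∑ (λ a′ → ∑ (λ b → ⟦ chargeᴬ a b a′ ⟧) Bs) As) As ≤⟨ ∑-≤ As (λ a → ∑-≤ As (λ a′ → chargeᴬ-bound a a′)) ⟩
      ∑ (λ a → ∑ (λ a′ → ⟦ MA a a′ ⟧) As) As ∎

-- When two isotropic lines meet.

module Lines {c ℓ} (K : StableField c ℓ) where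
  open StableField K renaming (ring to kring)
  open FieldGraded K using (mul-zero)
  open CommutativeRing kring hiding (ring; zero)
  open NullLine using (ρ; u; v; yAt; zAt)
  private module S = IntSolver kring
  open S using (_:=_; _:+_; _:*_; _:-_; :-_; con)
  open Relation.Binary.Reasoning.Setoid setoid

  sub-zero : ∀ {x y} → x + - y ≈ 0# → x ≈ y
  sub-zero {x} {y} e = trans (S.solve 2 (λ x y → x := (x :- y) :+ y) refl x y) (trans (+-congʳ e) (+-identityˡ y))

  zero-sub : ∀ {x y} → x ≈ y → x + - y ≈ 0#
  zero-sub e = trans (+-congʳ e) (-‿inverseʳ _)

  cancelˡ : ∀ {a x y} → ¬ (a ≈ 0#) → a * x ≈ a * y → x ≈ y
  cancelˡ {a} {x} {y} h e = sub-zero (mul-zero h (trans (S.solve 3 (λ a x y → a :* (x :- y) := a :* x :- a :* y) refl a x y) (zero-sub e)))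

  Shared : NullLine K → NullLine K → Carrier → Set ℓ
  Shared a b x = yAt a x ≈ yAt b x × zAt a x ≈ zAt b x

  -- The symmetry condition on a common matrix `g`: from `g (ρa , 1) = (ua , va)` and
  -- `g (ρb , 1) = (ub , vb)`, both sides are the value of the bilinear form of `g` at the two
  -- vectors.
  Linked : NullLine K → NullLine K → Set ℓ
  Linked a b = ρ b * u a + v a ≈ ρ a * u b + v b

  shared-sym : ∀ {a b x} → Shared a b x → Shared b a x
  shared-sym (p , q) = sym p , sym q

  shared-trans : ∀ {a b d x} → Shared a b x → Shared b d x → Shared a d x
  shared-trans (p , q) (p′ , q′) = trans p p′ , trans q q′

  shared-cong : ∀ {a b x x′} → x ≈ x′ → Shared a b x → Shared a b x′
  shared-cong e (p , q) = trans (+-congˡ (*-congˡ (sym e))) (trans p (+-congˡ (*-congˡ e))) , trans (+-congˡ (*-congˡ (sym e))) (trans q (+-congˡ (*-congˡ e)))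

  shared⇒linked : ∀ {a b x} → Shared a b x → Linked a b
  shared⇒linked {a} {b} {x} (p , q) = sub-zero (begin
    (ρ b * u a + v a) + - (ρ a * u b + v b)
      ≈⟨ S.solve 7 (λ ra ua va rb ub vb x → (rb :* ua :+ va) :- (ra :* ub :+ vb) :=
           (((va :- ra :* ua) :+ ra :* ra :* x) :- ((vb :- rb :* ub) :+ rb :* rb :* x)) :+ (ra :+ rb) :* ((ua :+ :- ra :* x) :- (ub :+ :- rb :* x))) refl
           (ρ a) (u a) (v a) (ρ b) (u b) (v b) x ⟩
    (zAt a x + - zAt b x) + (ρ a + ρ b) * (yAt a x + - yAt b x) ≈⟨ +-cong (zero-sub q) (*-congˡ (zero-sub p)) ⟩
    0# + (ρ a + ρ b) * 0# ≈⟨ trans (+-identityˡ _) (zeroʳ _) ⟩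
    0# ∎)

  -- The equation for `y` determines `x` because the slopes differ; `Linked` is then what the
  -- equation for `z` amounts to.
  linked⇒shared : ∀ {a b k} → (ρ a + - ρ b) * k ≈ 1# → Linked a b → Shared a b ((u a + - u b) * k)
  linked⇒shared {a} {b} {k} e l = p , q
    where
    x = (u a + - u b) * k
    x-eq : (ρ a + - ρ b) * x ≈ u a + - u b
    x-eq = trans (S.solve 3 (λ d w k → d :* (w :* k) := w :* (d :* k)) refl _ _ k) (trans (*-congˡ e) (*-identityʳ _))
    p : yAt a x ≈ yAt b x
    p = sub-zero (begin
      yAt a x + - yAt b x ≈⟨ S.solve 5 (λ ra ua rb ub x → (ua :+ :- ra :* x) :- (ub :+ :- rb :* x) := (ua :- ub) :- (ra :- rb) :* x) refl (ρ a) (u a) (ρ b) (u b) x ⟩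
      (u a + - u b) + - ((ρ a + - ρ b) * x) ≈⟨ zero-sub (sym x-eq) ⟩
      0# ∎)
    q : zAt a x ≈ zAt b x
    q = sub-zero (begin
      zAt a x + - zAt b x
        ≈⟨ S.solve 7 (λ ra ua va rb ub vb x → ((va :- ra :* ua) :+ ra :* ra :* x) :- ((vb :- rb :* ub) :+ rb :* rb :* x) :=
           ((rb :* ua :+ va) :- (ra :* ub :+ vb)) :- (ra :+ rb) :* ((ua :+ :- ra :* x) :- (ub :+ :- rb :* x))) refl
           (ρ a) (u a) (v a) (ρ b) (u b) (v b) x ⟩
      ((ρ b * u a + v a) + - (ρ a * u b + v b)) + - ((ρ a + ρ b) * (yAt a x + - yAt b x)) ≈⟨ +-cong (zero-sub l) (-‿cong (*-congˡ (zero-sub p))) ⟩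
      0# + - ((ρ a + ρ b) * 0#) ≈⟨ S.solve 1 (λ s → con (+ 0) :- s :* con (+ 0) := con (+ 0)) refl (ρ a + ρ b) ⟩
      0# ∎)

  shared-unique : ∀ {a b x x′} → ¬ (ρ a ≈ ρ b) → Shared a b x → Shared a b x′ → x ≈ x′
  shared-unique {a} {b} {x} {x′} n (p , _) (p′ , _) = cancelˡ (λ e → n (sub-zero e)) (trans (go p) (sym (go p′)))
    where
    go : ∀ {x} → yAt a x ≈ yAt b x → (ρ a + - ρ b) * x ≈ u a + - u b
    go {x} p = sub-zero (trans (S.solve 5 (λ ra ua rb ub x → (ra :- rb) :* x :- (ua :- ub) := (ub :+ :- rb :* x) :- (ua :+ :- ra :* x)) refl (ρ a) (u a) (ρ b) (u b) x)
      (zero-sub (sym p)))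

  shared-parallel : ∀ {a b x} → ρ a ≈ ρ b → Shared a b x → u a ≈ u b × v a ≈ v b
  shared-parallel {a} {b} {x} e (p , q) = eu , sub-zero (begin
      v a + - v b ≈⟨ S.solve 7 (λ ra ua va rb ub vb x → va :- vb := (((va :- ra :* ua) :+ ra :* ra :* x) :- ((vb :- rb :* ub) :+ rb :* rb :* x)) :+ (ra :* ((ua :+ :- ra :* x) :- (ub :+ :- rb :* x)) :+ (ra :- rb) :* (ub :- rb :* x))) refl
           (ρ a) (u a) (v a) (ρ b) (u b) (v b) x ⟩
      (zAt a x + - zAt b x) + (ρ a * (yAt a x + - yAt b x) + (ρ a + - ρ b) * (u b + - (ρ b * x))) ≈⟨ +-cong (zero-sub q) (+-cong (*-congˡ (zero-sub p)) (*-congʳ (zero-sub e))) ⟩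
      0# + (ρ a * 0# + 0# * (u b + - (ρ b * x))) ≈⟨ S.solve 2 (λ r s → con (+ 0) :+ (r :* con (+ 0) :+ con (+ 0) :* s) := con (+ 0)) refl _ _ ⟩
      0# ∎)
    where
    eu : u a ≈ u b
    eu = sub-zero (begin
      u a + - u b ≈⟨ S.solve 5 (λ ra ua rb ub x → ua :- ub := ((ua :+ :- ra :* x) :- (ub :+ :- rb :* x)) :+ (ra :- rb) :* x) refl (ρ a) (u a) (ρ b) (u b) x ⟩
      (yAt a x + - yAt b x) + (ρ a + - ρ b) * x ≈⟨ +-cong (zero-sub p) (*-congʳ (zero-sub e)) ⟩
      0# + 0# * x ≈⟨ trans (+-identityˡ _) (zeroˡ x) ⟩
      0# ∎)

  -- The line { g : g (s₁ , s₂) = (m₁ , m₂) }, where k inverts s₂.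
  through : (s₁ k m₁ m₂ : Carrier) → NullLine K
  through s₁ k m₁ m₂ = nullLine (s₁ * k) (m₁ * k) (m₂ * k)

  module _ {s₁ s₂ k m₁ m₂ s₁′ s₂′ k′ m₁′ m₂′ : Carrier} (e : s₂ * k ≈ 1#) (e′ : s₂′ * k′ ≈ 1#) where
    private
      a = through s₁ k m₁ m₂
      b = through s₁′ k′ m₁′ m₂′

      k≉0 : ∀ {s k} → s * k ≈ 1# → ¬ (k ≈ 0#)
      k≉0 {s} e z = 1≉0 (trans (sym e) (trans (*-congˡ z) (zeroʳ s)))

      linkˡ : ρ b * u a + v a ≈ (k * k′) * (s₁′ * m₁ + s₂′ * m₂)
      linkˡ = trans (+-congˡ (trans (sym (*-identityʳ _)) (*-congˡ (sym e′))))
        (S.solve 6 (λ p k′ m k n q → (p :* k′) :* (m :* k) :+ (n :* k) :* (q :* k′) := (k :* k′) :* (p :* m :+ q :* n)) refl s₁′ k′ m₁ k m₂ s₂′)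

      linkʳ : ρ a * u b + v b ≈ (k * k′) * (s₁ * m₁′ + s₂ * m₂′)
      linkʳ = trans (+-congˡ (trans (sym (*-identityʳ _)) (*-congˡ (sym e))))
        (S.solve 6 (λ p k m k′ n q → (p :* k) :* (m :* k′) :+ (n :* k′) :* (q :* k) := (k :* k′) :* (p :* m :+ q :* n)) refl s₁ k m₁′ k′ m₂′ s₂)

    linked⇒ : Linked a b → s₁′ * m₁ + s₂′ * m₂ ≈ s₁ * m₁′ + s₂ * m₂′
    linked⇒ l = cancelˡ (λ z → k≉0 e′ (mul-zero (k≉0 e) z)) (trans (sym linkˡ) (trans l linkʳ))

    linked⇐ : s₁′ * m₁ + s₂′ * m₂ ≈ s₁ * m₁′ + s₂ * m₂′ → Linked a b
    linked⇐ h = trans linkˡ (trans (*-congˡ h) (sym linkʳ))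

    slopes : s₁ * k ≈ s₁′ * k′ → s₁ * s₂′ ≈ s₁′ * s₂
    slopes h = begin
      s₁ * s₂′ ≈⟨ trans (sym (*-identityʳ _)) (*-congˡ (sym e)) ⟩
      s₁ * s₂′ * (s₂ * k) ≈⟨ S.solve 4 (λ a b c k → a :* b :* (c :* k) := (a :* k) :* (b :* c)) refl s₁ s₂′ s₂ k ⟩
      (s₁ * k) * (s₂′ * s₂) ≈⟨ *-congʳ h ⟩
      (s₁′ * k′) * (s₂′ * s₂) ≈⟨ S.solve 4 (λ a b c k → (a :* k) :* (b :* c) := a :* c :* (b :* k)) refl s₁′ s₂′ s₂ k′ ⟩
      s₁′ * s₂ * (s₂′ * k′) ≈⟨ trans (*-congˡ e′) (*-identityʳ _) ⟩
      s₁′ * s₂ ∎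

-- Two families of lines attached to two point sets.

-- `s` and `t` stand for the points of the two sets, `x` and `y` for their images under the matrix
-- of the form, so that `ω` is both `s · y` and `x · t`. The first family of lines is built from `s`
-- and `t`, the second from `x` and `y`. `κ` bounds the number of directions as well as the fibres
-- of `ω i`.
record Families {c ℓ} (K : StableField c ℓ) (n N t κ : ℕ) : Set (c ⊔ ℓ) where
  open CommutativeRing (StableField.ring K) hiding (zero)
  field
    s₁ s₂ x₁ x₂ : Fin n → Carrier
    t₁ t₂ y₁ y₂ : Fin N → Carrier
    ω : Fin n → Fin N → Carrier
    ω-s : ∀ i j → s₁ i * y₁ j + s₂ i * y₂ j ≈ ω i j
    ω-x : ∀ i j → x₁ i * t₁ j + x₂ i * t₂ j ≈ ω i j
    s₂≉0 : ∀ i → ¬ (s₂ i ≈ 0#)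
    s-independent : ∀ {i i′} → i ≢ i′ → ¬ (s₁ i * s₂ i′ ≈ s₁ i′ * s₂ i)
    x-independent : ∀ {i i′} → i ≢ i′ → ¬ (x₁ i * x₂ i′ ≈ x₁ i′ * x₂ i)
    x≉0 : ∀ i → ¬ (x₁ i ≈ 0# × x₂ i ≈ 0#)
    t≉0 : ∀ j → ¬ (t₁ j ≈ 0# × t₂ j ≈ 0#)
    y≉0 : ∀ j → ¬ (y₁ j ≈ 0# × y₂ j ≈ 0#)
    t-distinct : ∀ {j j′} → j ≢ j′ → ¬ (t₁ j ≈ t₁ j′ × t₂ j ≈ t₂ j′)
    y-distinct : ∀ {j j′} → j ≢ j′ → ¬ (y₁ j ≈ y₁ j′ × y₂ j ≈ y₂ j′)
    idx : Fin n → Fin N → Fin t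
    idx-eq : ∀ {i j i′ j′} → idx i j ≡ idx i′ j′ → ω i j ≈ ω i′ j′
    few : ∀ i js → Distinct js → AllPairs (λ j j′ → ω i j ≈ ω i j′) js → length js ≤ κ
    n≤κ : n ≤ κ

¬¬-Fin² : ∀ {a n N} {P : Fin n × Fin N → Set a} → (∀ x → ¬¬ P x) → ¬¬ (∀ x → P x)
¬¬-Fin² h = ¬¬-map (λ f x → f (proj₁ x) (proj₂ x)) (¬¬-Fin (λ i → ¬¬-Fin (λ j → h (i , j))))

¬¬-All : ∀ {a p} {A : Set a} {P : A → Set p} {xs} → All (λ x → ¬¬ P x) xs → ¬¬ All P xs
¬¬-All [] = η []
¬¬-All (h ∷ hs) = do
  p ← h
  ps ← ¬¬-All hs
  η (p ∷ ps)

module Parameters {c ℓ} (K : StableField c ℓ) (p : ℕ) (char : CharAbove K p) where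
  open StableField K renaming (ring to kring)
  open FieldGraded K using (mul-zero)
  open CommutativeRing kring hiding (ring; zero)
  open Lines K using (sub-zero; zero-sub; cancelˡ)
  open NatMultiples kring
  open Univariate K p char
  open PolyRing kring using (_≋_; at)
  private module S = IntSolver kring
  open S using (_:=_; _:+_; _:*_; _:-_; :-_; con)

  Apart : List Carrier → Set (c ⊔ ℓ)
  Apart = AllPairs (λ x y → ¬ (x ≈ y))

  cubic : (c₀ c₁ c₂ c₃ : Carrier) → ¬ (c₀ ≈ 0# × c₁ ≈ 0# × c₂ ≈ 0# × c₃ ≈ 0#) → ∀ xs → Apart xs →
    All (λ l → c₀ + l * (c₁ + l * (c₂ + l * (c₃ + l * 0#))) ≈ 0#) xs → length xs ≤ 3
  cubic c₀ c₁ c₂ c₃ nz xs apart roots = ℕₚ.≤-pred (ℕₚ.≰⇒> λ 4≤ →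
    let z = few-roots 4 (c₀ ∷ c₁ ∷ c₂ ∷ c₃ ∷ []) (DegLt⇒Lt λ { (suc zero) (s≤s ()) ; (suc (suc zero)) (s≤s (s≤s ())) ; (suc (suc (suc zero))) (s≤s (s≤s (s≤s ()))) ; (suc (suc (suc (suc i)))) _ → refl }) xs 4≤ apart roots
    in nz (at z 0 , at z 1 , at z 2 , at z 3))

  -- Each nonzero vector spoils at most one parameter, the root of `v₂ + l v₁`, so mapping a bad
  -- parameter to a vector that it spoils is injective.
  avoid : ∀ {n} (v₁ v₂ : Fin n → Carrier) → (∀ i → ¬ (v₁ i ≈ 0# × v₂ i ≈ 0#)) → ∀ xs → Apart xs →
    ¬¬ ∃₂ λ ys zs → Split (λ l → ∀ i → ¬ (v₂ i + l * v₁ i ≈ 0#)) xs ys zs × length zs ≤ n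
  avoid {n} v₁ v₂ nz xs apart = do
    ys , zs , s ← split-em xs
    hits ← ¬¬-All (All.map (λ {l} h k → h (λ i e → k (i , e))) (split-no s))
    η (ys , zs , s , bound zs hits (split-Pairsʳ s apart))
    where
    Hit : Carrier → Set ℓ
    Hit l = ∃ λ i → v₂ i + l * v₁ i ≈ 0#
    same : ∀ {l l′ i i′} → v₂ i + l * v₁ i ≈ 0# → v₂ i′ + l′ * v₁ i′ ≈ 0# → i ≡ i′ → l ≈ l′
    same {l} {l′} {i} e e′ ≡.refl = sub-zero (stable λ n → nz i (v₁≈0 n , trans (S.solve 3 (λ v l w → v := (v :+ l :* w) :- l :* w) refl (v₂ i) l (v₁ i))
        (trans (+-cong e (-‿cong (*-congˡ (v₁≈0 n)))) (S.solve 1 (λ l → con (+ 0) :- l :* con (+ 0) := con (+ 0)) refl l))))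
      where
      v₁≈0 : ¬ (l + - l′ ≈ 0#) → v₁ i ≈ 0#
      v₁≈0 n = mul-zero n (trans (S.solve 4 (λ l l′ v w → (l :- l′) :* w := (v :+ l :* w) :- (v :+ l′ :* w)) refl l l′ (v₂ i) (v₁ i)) (zero-sub (trans e (sym e′))))
    bound : ∀ zs → All Hit zs → Apart zs → length zs ≤ n
    bound zs hits apart = ≡.subst (_≤ n) (len zs hits) (injective-length (λ i → i) (All.reduce proj₁ hits) (pairs zs hits apart))
      where
      len : ∀ zs (hits : All Hit zs) → length (All.reduce proj₁ hits) ≡ length zs
      len [] [] = ≡.refl
      len (z ∷ zs) (h ∷ hs) = ≡.cong suc (len zs hs)
      pairs : ∀ zs (hits : All Hit zs) → Apart zs → AllPairs _≢_ (All.reduce proj₁ hits)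
      pairs [] [] [] = []
      pairs (z ∷ zs) ((i , e) ∷ hs) (a ∷ as) = row zs hs a ∷ pairs zs hs as
        where
        row : ∀ zs (hits : All Hit zs) → All (λ y → ¬ (z ≈ y)) zs → All (i ≢_) (All.reduce proj₁ hits)
        row [] [] [] = []
        row (y ∷ ys) ((j , e′) ∷ hs) (n ∷ ns) = (λ i≡j → n (same {i = i} e e′ i≡j)) ∷ row ys hs ns

  -- The list starts at 2 to leave out 0 and 1, where `l² - l⁴` vanishes; the third root, -1, is
  -- left out by stopping early enough.
  scalars : ℕ → List Carrier
  scalars m = tabulate {n = m} (λ k → (2 ℕ.+ toℕ k) ×ⁿ 1#)

  scalars-length : ∀ m → length (scalars m) ≡ m
  scalars-length m = Listₚ.length-tabulate {n = m} (λ k → (2 ℕ.+ toℕ k) ×ⁿ 1#)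

  scalars-apart : ∀ m → 2 ℕ.+ m ≤ p → Apart (scalars m)
  scalars-apart m m≤p = Pairsₚ.tabulate⁺ {f = λ k → (2 ℕ.+ toℕ k) ×ⁿ 1#} λ {k} {k′} k≢k′ e → k≢k′ (Finₚ.toℕ-injective
    (ℕₚ.suc-injective (ℕₚ.suc-injective (×ⁿ-injective (2 ℕ.+ toℕ k) (2 ℕ.+ toℕ k′) 1# (lt k) (lt k′) 1≉0 e))))
    where
    lt : ∀ (k : Fin m) → 2 ℕ.+ toℕ k < p
    lt k = ℕₚ.<-≤-trans (s≤s (s≤s (Finₚ.toℕ<n k))) m≤p

  scalars-regular : ∀ m → 4 ℕ.+ m ≤ p → All (λ l → ¬ (l * l + - (l * l * (l * l)) ≈ 0#)) (scalars m)
  scalars-regular m m≤p = Allₚ.tabulate⁺ {f = λ k → (2 ℕ.+ toℕ k) ×ⁿ 1#} λ k e →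
    let l = (2 ℕ.+ toℕ k) ×ⁿ 1#
        l≉0 : ¬ (l ≈ 0#)
        l≉0 = char (2 ℕ.+ toℕ k) (s≤s z≤n) (lt k 1)
    in l≉0 (mul-zero {1# + l} (char (3 ℕ.+ toℕ k) (s≤s z≤n) (lt k 0))
       (mul-zero {1# + - l} (λ z → char (1 ℕ.+ toℕ k) (s≤s z≤n) (lt k 2) (trans (S.solve 1 (λ x → x := :- (con (+ 1) :- (con (+ 1) :+ x))) refl ((1 ℕ.+ toℕ k) ×ⁿ 1#)) (trans (-‿cong z) -0≈0)))
         (mul-zero l≉0 (trans (S.solve 1 (λ l → l :* ((con (+ 1) :- l) :* ((con (+ 1) :+ l) :* l)) := l :* l :- l :* l :* (l :* l)) refl l) e))))
    where
    -0≈0 : - 0# ≈ 0#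
    -0≈0 = S.solve 0 (:- con (+ 0) := con (+ 0)) refl
    lt : ∀ (k : Fin m) (d : ℕ) → suc (3 ℕ.∸ d) ℕ.+ toℕ k ≤ p
    lt k d = ℕₚ.≤-trans (ℕₚ.+-mono-≤ (s≤s (ℕₚ.m∸n≤m 3 d)) (ℕₚ.<⇒≤ (Finₚ.toℕ<n k))) m≤p

-- Crossings, collisions and coincidences for one parameter.

module Core {c ℓ} (K : StableField c ℓ) (p : ℕ) (char : CharAbove K p) {n N t κ : ℕ} (Fam : Families K n N t κ) where
  open StableField K renaming (ring to kring)
  open FieldGraded K using (mul-zero)
  open CommutativeRing kring hiding (ring; zero)
  open Lines K
  open Parameters K p char
  open Families Fam
  open NullLine using (ρ; u; v; yAt; zAt)
  private module S = IntSolver kring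
  open S using (_:=_; _:+_; _:*_; _:-_; :-_; con)

  Index : Set
  Index = Fin n × Fin N

  _≟ᴵ_ : (a b : Index) → Dec (a ≡ b)
  _≟ᴵ_ = ≡-dec Fin._≟_ Fin._≟_

  abstract
    indices : List Index
    indices = cartesianProduct (allFin n) (allFin N)

    indices-distinct : Distinct indices
    indices-distinct = cartesianProduct⁺ (allFin⁺ n) (allFin⁺ N)

    ∈-indices : ∀ a → a ∈ indices
    ∈-indices (i , j) = ∈ₚ.∈-cartesianProduct⁺ (∈ₚ.∈-allFin i) (∈ₚ.∈-allFin j)

    indices-length : length indices ≡ n ℕ.* N
    indices-length = begin
      length indices ≡⟨ ≡.sym (≡.trans (∑-constant 1 indices) (ℕₚ.*-identityʳ _)) ⟩
      ∑ (λ _ → 1) indices ≡⟨ ∑-product (λ _ → 1) (allFin n) (allFin N) ⟩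
      ∑ (λ _ → ∑ (λ _ → 1) (allFin N)) (allFin n) ≡⟨ ∑-constant (∑ (λ _ → 1) (allFin N)) (allFin n) ⟩
      length (allFin n) ℕ.* ∑ (λ _ → 1) (allFin N) ≡⟨ ≡.cong₂ ℕ._*_ (Listₚ.length-tabulate {n = n} (λ i → i)) (≡.trans (∑-constant 1 (allFin N)) (ℕₚ.*-identityʳ (length (allFin N)))) ⟩
      n ℕ.* length (allFin N) ≡⟨ ≡.cong (n ℕ.*_) (Listₚ.length-tabulate {n = N} (λ i → i)) ⟩
      n ℕ.* N ∎
      where
      open ≡.≡-Reasoning

    ∑-indices : (f : Index → ℕ) → ∑ f indices ≡ ∑ (λ i → ∑ (λ j → f (i , j)) (allFin N)) (allFin n)
    ∑-indices f = ∑-product f (allFin n) (allFin N)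

  -- The matrix [[1 , l] , [l³ , l²]], of determinant Δ l, and the transpose of its adjugate.
  P₁ P₂ : Carrier → Fin N → Carrier
  P₁ l j = t₁ j + l * t₂ j
  P₂ l j = l * l * l * t₁ j + l * l * t₂ j

  q₁ q₂ : Carrier → Fin n → Carrier
  q₁ l i = l * l * x₁ i + - (l * l * l * x₂ i)
  q₂ l i = x₂ i + l * - x₁ i

  Δ : Carrier → Carrier
  Δ l = l * l + - (l * l * (l * l))

  -- `Linked` for two lines of one family, with denominators and the factor `Δ l` cleared.
  MeetA MeetB : Carrier → Index → Index → Set ℓ
  MeetA l (i , j) (i′ , j′) = s₁ i′ * P₁ l j + s₂ i′ * P₂ l j ≈ s₁ i * P₁ l j′ + s₂ i * P₂ l j′
  MeetB l (i , j) (i′ , j′) = q₁ l i′ * y₁ j + q₂ l i′ * y₂ j ≈ q₁ l i * y₁ j′ + q₂ l i * y₂ j′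

  -- The matrix entries `1`, `l`, `l²`, `l³` are different powers, so the condition is a cubic in
  -- `l`, each of whose coefficients involves one coordinate of `s` and one of `t`. If all four
  -- vanished, independence of the two vectors `s` would force `t` to be zero.
  few-meetA : ∀ a a′ → proj₁ a ≢ proj₁ a′ → ∀ ls → Apart ls → All (λ l → MeetA l a a′) ls → length ls ≤ 3
  few-meetA (i , j) (i′ , j′) n ls apart meets = cubic
    (s₁ i′ * t₁ j + - (s₁ i * t₁ j′)) (s₁ i′ * t₂ j + - (s₁ i * t₂ j′)) (s₂ i′ * t₂ j + - (s₂ i * t₂ j′)) (s₂ i′ * t₁ j + - (s₂ i * t₁ j′))
    (λ { (z₀ , z₁ , z₂ , z₃) → t≉0 j (zero-of z₀ z₃ , zero-of z₁ z₂) })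
    ls apart (All.map (λ {l} e → trans
      (S.solve 9 (λ l s₁′ s₂′ s₁ s₂ t₁ t₂ t₁′ t₂′ →
        (s₁′ :* t₁ :- s₁ :* t₁′) :+ l :* ((s₁′ :* t₂ :- s₁ :* t₂′) :+ l :* ((s₂′ :* t₂ :- s₂ :* t₂′) :+ l :* ((s₂′ :* t₁ :- s₂ :* t₁′) :+ l :* con (+ 0)))) :=
        (s₁′ :* (t₁ :+ l :* t₂) :+ s₂′ :* (l :* l :* l :* t₁ :+ l :* l :* t₂)) :- (s₁ :* (t₁′ :+ l :* t₂′) :+ s₂ :* (l :* l :* l :* t₁′ :+ l :* l :* t₂′)))
        refl l (s₁ i′) (s₂ i′) (s₁ i) (s₂ i) (t₁ j) (t₂ j) (t₁ j′) (t₂ j′)) (zero-sub e)) meets)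
    where
    zero-of : ∀ {w w′} → s₁ i′ * w + - (s₁ i * w′) ≈ 0# → s₂ i′ * w + - (s₂ i * w′) ≈ 0# → w ≈ 0#
    zero-of {w} {w′} e e′ = mul-zero (λ z → s-independent n (sub-zero z))
      (trans (S.solve 6 (λ a b a′ b′ w w′ → (a :* b′ :- a′ :* b) :* w := a :* (b′ :* w :- b :* w′) :- b :* (a′ :* w :- a :* w′)) refl (s₁ i) (s₂ i) (s₁ i′) (s₂ i′) w w′)
        (trans (+-cong (*-congˡ e′) (-‿cong (*-congˡ e))) (S.solve 2 (λ a b → a :* con (+ 0) :- b :* con (+ 0) := con (+ 0)) refl _ _)))

  few-meetB : ∀ b b′ → proj₁ b ≢ proj₁ b′ → ∀ ls → Apart ls → All (λ l → MeetB l b b′) ls → length ls ≤ 3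
  few-meetB (i , j) (i′ , j′) n ls apart meets = cubic
    (x₂ i′ * y₂ j + - (x₂ i * y₂ j′)) (- (x₁ i′ * y₂ j + - (x₁ i * y₂ j′))) (x₁ i′ * y₁ j + - (x₁ i * y₁ j′)) (- (x₂ i′ * y₁ j + - (x₂ i * y₁ j′)))
    (λ { (z₀ , z₁ , z₂ , z₃) → y≉0 j (zero-of z₂ (neg z₃) , zero-of (neg z₁) z₀) })
    ls apart (All.map (λ {l} e → trans
      (S.solve 9 (λ l a′ b′ a b y₁ y₂ y₁′ y₂′ →
        (b′ :* y₂ :- b :* y₂′) :+ l :* (:- (a′ :* y₂ :- a :* y₂′) :+ l :* ((a′ :* y₁ :- a :* y₁′) :+ l :* (:- (b′ :* y₁ :- b :* y₁′) :+ l :* con (+ 0)))) :=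
        ((l :* l :* a′ :- l :* l :* l :* b′) :* y₁ :+ (b′ :+ l :* :- a′) :* y₂) :- ((l :* l :* a :- l :* l :* l :* b) :* y₁′ :+ (b :+ l :* :- a) :* y₂′))
        refl l (x₁ i′) (x₂ i′) (x₁ i) (x₂ i) (y₁ j) (y₂ j) (y₁ j′) (y₂ j′)) (zero-sub e)) meets)
    where
    neg : ∀ {w} → - w ≈ 0# → w ≈ 0#
    neg {w} e = trans (S.solve 1 (λ w → w := :- (:- w)) refl w) (trans (-‿cong e) (S.solve 0 (:- con (+ 0) := con (+ 0)) refl))
    zero-of : ∀ {w w′} → x₁ i′ * w + - (x₁ i * w′) ≈ 0# → x₂ i′ * w + - (x₂ i * w′) ≈ 0# → w ≈ 0#
    zero-of {w} {w′} e e′ = mul-zero (λ z → x-independent n (sub-zero z))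
      (trans (S.solve 6 (λ a b a′ b′ w w′ → (a :* b′ :- a′ :* b) :* w := a :* (b′ :* w :- b :* w′) :- b :* (a′ :* w :- a :* w′)) refl (x₁ i) (x₂ i) (x₁ i′) (x₂ i′) w w′)
        (trans (+-cong (*-congˡ e′) (-‿cong (*-congˡ e))) (S.solve 2 (λ a b → a :* con (+ 0) :- b :* con (+ 0) := con (+ 0)) refl _ _)))

  total-meets : (MA MB : Index → Index → Bool) → ℕ
  total-meets MA MB = ∑ (λ b → ∑ (λ b′ → ⟦ MB b b′ ⟧) indices) indices ℕ.+ ∑ (λ a → ∑ (λ a′ → ⟦ MA a a′ ⟧) indices) indices

  module Choice (ls : List Carrier) (apart : Apart ls)
      (decA : ∀ (k : Fin (length ls)) a a′ → Dec (proj₁ a ≢ proj₁ a′ × MeetA (List.lookup ls k) a a′))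
      (decB : ∀ (k : Fin (length ls)) b b′ → Dec (proj₁ b ≢ proj₁ b′ × MeetB (List.lookup ls k) b b′)) where

    private
      ks = allFin (length ls)
      L = length indices

    few-hits : ∀ {M : Carrier → Set ℓ} {P : Set} → (∀ {xs} → Apart xs → P → All M xs → length xs ≤ 3) →
      (dec : ∀ (k : Fin (length ls)) → Dec (P × M (List.lookup ls k))) → ∑ (λ k → ⟦ ⌊ dec k ⌋ ⟧) ks ≤ 3
    few-hits few dec with count-split (λ k → ⌊ dec k ⌋) ks
    ... | [] , _ , s , e = ≡.subst (_≤ 3) (≡.sym e) z≤n
    ... | y ∷ ys , _ , s , e = ≡.subst (_≤ 3) (≡.trans (Listₚ.length-map (List.lookup ls) (y ∷ ys)) (≡.sym e))
      (few (pairs-map (List.lookup ls) (lookup-Pairs (λ n e → n (sym e)) apart) (split-Pairsˡ s (allFin⁺ (length ls))))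
        (proj₁ (toWitness (All.head (split-yes s)))) (Allₚ.map⁺ (All.map (λ t → proj₂ (toWitness t)) (split-yes s))))

    sum-bound : ∑ (λ k → total-meets (λ a a′ → ⌊ decA k a a′ ⌋) (λ b b′ → ⌊ decB k b b′ ⌋)) ks ≤ 6 ℕ.* (L ℕ.* L)
    sum-bound = begin
      ∑ (λ k → total-meets (λ a a′ → ⌊ decA k a a′ ⌋) (λ b b′ → ⌊ decB k b b′ ⌋)) ks ≡⟨ ∑-+ _ _ ks ⟩
      ∑ (λ k → ∑ (λ b → ∑ (λ b′ → ⟦ ⌊ decB k b b′ ⌋ ⟧) indices) indices) ks ℕ.+ ∑ (λ k → ∑ (λ a → ∑ (λ a′ → ⟦ ⌊ decA k a a′ ⌋ ⟧) indices) indices) ks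
        ≤⟨ ℕₚ.+-mono-≤ (half (λ k b b′ → ⟦ ⌊ decB k b b′ ⌋ ⟧) (λ b b′ → few-hits (λ {xs} ap n → few-meetB b b′ n xs ap) (λ k → decB k b b′)))
                       (half (λ k a a′ → ⟦ ⌊ decA k a a′ ⌋ ⟧) (λ a a′ → few-hits (λ {xs} ap n → few-meetA a a′ n xs ap) (λ k → decA k a a′))) ⟩
      L ℕ.* (L ℕ.* 3) ℕ.+ L ℕ.* (L ℕ.* 3) ≡⟨ e L ⟩
      6 ℕ.* (L ℕ.* L) ∎
      where
      open ℕₚ.≤-Reasoning
      e : ∀ L → L ℕ.* (L ℕ.* 3) ℕ.+ L ℕ.* (L ℕ.* 3) ≡ 6 ℕ.* (L ℕ.* L)
      e = solve-∀
      half : (f : Fin (length ls) → Index → Index → ℕ) → (∀ a a′ → ∑ (λ k → f k a a′) ks ≤ 3) → ∑ (λ k → ∑ (λ a → ∑ (f k a) indices) indices) ks ≤ L ℕ.* (L ℕ.* 3)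
      half f h = begin
        ∑ (λ k → ∑ (λ a → ∑ (f k a) indices) indices) ks ≡⟨ ∑-swap (λ k a → ∑ (f k a) indices) ks indices ⟩
        ∑ (λ a → ∑ (λ k → ∑ (f k a) indices) ks) indices ≡⟨ ∑-cong indices (λ a → ∑-swap (λ k a′ → f k a a′) ks indices) ⟩
        ∑ (λ a → ∑ (λ a′ → ∑ (λ k → f k a a′) ks) indices) indices ≤⟨ ∑-bound (All.universal (λ a → ∑-bound (All.universal (h a) indices)) indices) ⟩
        L ℕ.* (L ℕ.* 3) ∎

    total : Fin (length ls) → ℕ
    total k = total-meets (λ a a′ → ⌊ decA k a a′ ⌋) (λ b b′ → ⌊ decB k b b′ ⌋)

    -- Averaging over the parameters: each ordered pair within a family satisfies the meeting
    -- condition for at most 3 of them, and there are two families, whence the 6.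
    choice : 0 < length ls → ∃ λ k → length ls ℕ.* total k ≤ 6 ℕ.* (L ℕ.* L)
    choice pos with below-average total ks (≡.subst (0 <_) (≡.sym (Listₚ.length-tabulate {n = length ls} (λ i → i))) pos)
    ... | k , _ , h = k , ℕₚ.≤-trans (ℕₚ.≤-reflexive (≡.cong (ℕ._* total k) (≡.sym (Listₚ.length-tabulate {n = length ls} (λ i → i))))) (ℕₚ.≤-trans h sum-bound)

  module AtParameter (l : Carrier) (Δ≉0 : ¬ (Δ l ≈ 0#)) (q₂≉0 : ∀ i → ¬ (q₂ l i ≈ 0#)) where
    invA : ∀ i → ∃ λ k → s₂ i * k ≈ 1#
    invA i = inverse (s₂ i) (s₂≉0 i)
    invB : ∀ i → ∃ λ k → q₂ l i * k ≈ 1#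
    invB i = inverse (q₂ l i) (q₂≉0 i)

    la lb : Index → NullLine K
    la (i , j) = through (s₁ i) (proj₁ (invA i)) (P₁ l j) (P₂ l j)
    lb (i , j) = through (q₁ l i) (proj₁ (invB i)) (Δ l * y₁ j) (Δ l * y₂ j)

    ρA ρB : Fin n → Carrier
    ρA i = s₁ i * proj₁ (invA i)
    ρB i = q₁ l i * proj₁ (invB i)

    ρA-injective : ∀ {i i′} → ρA i ≈ ρA i′ → i ≡ i′
    ρA-injective {i} {i′} e with i Fin.≟ i′
    ... | yes i≡i′ = i≡i′
    ... | no n = ⊥-elim (s-independent n (slopes {m₁ = 0#} {m₂ = 0#} {m₁′ = 0#} {m₂′ = 0#} (proj₂ (invA i)) (proj₂ (invA i′)) e))

    ρB-injective : ∀ {i i′} → ρB i ≈ ρB i′ → i ≡ i′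
    ρB-injective {i} {i′} e with i Fin.≟ i′
    ... | yes i≡i′ = i≡i′
    ... | no n = ⊥-elim (x-independent n (cancelˡ Δ≉0 (sub-zero (trans
        (S.solve 5 (λ l a b a′ b′ → (l :* l :- l :* l :* (l :* l)) :* (a :* b′) :- (l :* l :- l :* l :* (l :* l)) :* (a′ :* b) :=
           (l :* l :* a :- l :* l :* l :* b) :* (b′ :+ l :* :- a′) :- (l :* l :* a′ :- l :* l :* l :* b′) :* (b :+ l :* :- a)) refl l (x₁ i) (x₂ i) (x₁ i′) (x₂ i′))
        (zero-sub (slopes {m₁ = 0#} {m₂ = 0#} {m₁′ = 0#} {m₂′ = 0#} (proj₂ (invB i)) (proj₂ (invB i′)) e))))))

    cancel-inv : ∀ {s k x x′} → s * k ≈ 1# → x * k ≈ x′ * k → x ≈ x′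
    cancel-inv {s} {k} {x} {x′} e h = trans (sym (trans (*-congˡ e) (*-identityʳ x)))
      (trans (S.solve 3 (λ x s k → x :* (s :* k) := (x :* k) :* s) refl x s k) (trans (*-congʳ h)
      (trans (S.solve 3 (λ x s k → (x :* k) :* s := x :* (s :* k)) refl x′ s k) (trans (*-congˡ e) (*-identityʳ x′)))))

    la-injective : ∀ {i j j′} → u (la (i , j)) ≈ u (la (i , j′)) → v (la (i , j)) ≈ v (la (i , j′)) → j ≡ j′
    la-injective {i} {j} {j′} eu ev with j Fin.≟ j′
    ... | yes j≡j′ = j≡j′
    ... | no n = ⊥-elim (t-distinct n
        ( cancelˡ Δ≉0 (trans (recover₁ t₁₂) (trans (+-cong (*-congˡ e₁) (-‿cong (*-congˡ e₂))) (sym (recover₁ t₁₂′))))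
        , cancelˡ Δ≉0 (trans (recover₂ t₁₂) (trans (+-cong e₂ (-‿cong (*-congˡ e₁))) (sym (recover₂ t₁₂′))))))
      where
      e₁ = cancel-inv (proj₂ (invA i)) eu
      e₂ = cancel-inv (proj₂ (invA i)) ev
      t₁₂ = t₁ j , t₂ j
      t₁₂′ = t₁ j′ , t₂ j′
      recover₁ : ∀ t → Δ l * proj₁ t ≈ l * l * (proj₁ t + l * proj₂ t) + - (l * (l * l * l * proj₁ t + l * l * proj₂ t))
      recover₁ t = S.solve 3 (λ l a b → (l :* l :- l :* l :* (l :* l)) :* a := l :* l :* (a :+ l :* b) :- l :* (l :* l :* l :* a :+ l :* l :* b)) refl l (proj₁ t) (proj₂ t)
      recover₂ : ∀ t → Δ l * proj₂ t ≈ (l * l * l * proj₁ t + l * l * proj₂ t) + - (l * l * l * (proj₁ t + l * proj₂ t))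
      recover₂ t = S.solve 3 (λ l a b → (l :* l :- l :* l :* (l :* l)) :* b := (l :* l :* l :* a :+ l :* l :* b) :- l :* l :* l :* (a :+ l :* b)) refl l (proj₁ t) (proj₂ t)

    lb-injective : ∀ {i j j′} → u (lb (i , j)) ≈ u (lb (i , j′)) → v (lb (i , j)) ≈ v (lb (i , j′)) → j ≡ j′
    lb-injective {i} {j} {j′} eu ev with j Fin.≟ j′
    ... | yes j≡j′ = j≡j′
    ... | no n = ⊥-elim (y-distinct n (cancelˡ Δ≉0 (cancel-inv (proj₂ (invB i)) eu) , cancelˡ Δ≉0 (cancel-inv (proj₂ (invB i)) ev)))

    module SharedPoint (line : Index → NullLine K) (slope : Fin n → Carrier) (line-slope : ∀ a → ρ (line a) ≡ slope (proj₁ a))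
        (slope-injective : ∀ {i i′} → slope i ≈ slope i′ → i ≡ i′)
        (line-injective : ∀ {i j j′} → u (line (i , j)) ≈ u (line (i , j′)) → v (line (i , j)) ≈ v (line (i , j′)) → j ≡ j′) where

      same-slope : ∀ {a a′} → ρ (line a) ≈ ρ (line a′) → proj₁ a ≡ proj₁ a′
      same-slope {a} {a′} e = slope-injective (trans (reflexive (≡.sym (line-slope a))) (trans e (reflexive (line-slope a′))))

      distinct-lines : ∀ {a a′} → a ≢ a′ → ¬ SameNullLine (line a) (line a′)
      distinct-lines {i , j} {i′ , j′} n (eρ , eu , ev) with same-slope {i , j} {i′ , j′} eρ
      ... | ≡.refl = n (≡.cong (i ,_) (line-injective eu ev))

      shared-skew : ∀ {a a′ x} → a ≢ a′ → Shared (line a) (line a′) x → ¬ (ρ (line a) ≈ ρ (line a′))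
      shared-skew n sh e = distinct-lines n (e , shared-parallel e sh)

      shared-index : ∀ {a a′ x} → a ≢ a′ → Shared (line a) (line a′) x → proj₁ a ≢ proj₁ a′
      shared-index {a} {a′} n sh e = shared-skew n sh (reflexive (≡.trans (line-slope a) (≡.trans (≡.cong slope e) (≡.sym (line-slope a′)))))

    module SA = SharedPoint la ρA (λ a → ≡.refl) ρA-injective la-injective
    module SB = SharedPoint lb ρB (λ b → ≡.refl) ρB-injective lb-injective

    shared⇒MeetA : ∀ {a a′ x} → Shared (la a) (la a′) x → MeetA l a a′
    shared⇒MeetA {i , j} {i′ , j′} sh = linked⇒ (proj₂ (invA i)) (proj₂ (invA i′)) (shared⇒linked sh)

    shared⇒MeetB : ∀ {b b′ x} → Shared (lb b) (lb b′) x → MeetB l b b′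
    shared⇒MeetB {i , j} {i′ , j′} sh = cancelˡ Δ≉0 (trans (pull _ _ _ _) (trans (linked⇒ (proj₂ (invB i)) (proj₂ (invB i′)) (shared⇒linked sh)) (sym (pull _ _ _ _))))
      where
      pull : ∀ a b y z → Δ l * (a * y + b * z) ≈ a * (Δ l * y) + b * (Δ l * z)
      pull a b y z = S.solve 5 (λ D a b y z → D :* (a :* y :+ b :* z) := a :* (D :* y) :+ b :* (D :* z)) refl (Δ l) a b y z

    -- With `P` the matrix, `q · P t = x · adj(P) P t = Δ (x · t)`, which is to be compared with
    -- `s · Δ y`; both inner products are values of `ω`.
    linkedAB : ∀ {i j i′ j′} → ω i j′ ≈ ω i′ j → Linked (la (i , j)) (lb (i′ , j′))
    linkedAB {i} {j} {i′} {j′} e = linked⇐ (proj₂ (invA i)) (proj₂ (invB i′)) (trans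
      (S.solve 5 (λ l x₁ x₂ t₁ t₂ → (l :* l :* x₁ :- l :* l :* l :* x₂) :* (t₁ :+ l :* t₂) :+ (x₂ :+ l :* :- x₁) :* (l :* l :* l :* t₁ :+ l :* l :* t₂) :=
         (l :* l :- l :* l :* (l :* l)) :* (x₁ :* t₁ :+ x₂ :* t₂)) refl l (x₁ i′) (x₂ i′) (t₁ j) (t₂ j))
      (trans (*-congˡ (trans (ω-x i′ j) (trans (sym e) (sym (ω-s i j′)))))
        (S.solve 5 (λ D a b y z → D :* (a :* y :+ b :* z) := a :* (D :* y) :+ b :* (D :* z)) refl (Δ l) (s₁ i) (s₂ i) (y₁ j′) (y₂ j′))))

    module Crossings (par? : ∀ i i′ → Dec (ρA i ≈ ρB i′)) where
      xAt : ∀ {i i′} → Dec (ρA i ≈ ρB i′) → Carrier → Carrier → Carrier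
      -- A default value: parallel pairs have no common point and are excluded from `Cr`.
      xAt (yes _) _ _ = 0#
      xAt {i} {i′} (no n) p q = (p + - q) * proj₁ (inverse (ρA i + - ρB i′) (λ e → n (sub-zero e)))

      xc : Index → Index → Carrier
      xc (i , j) (i′ , j′) = xAt (par? i i′) (u (la (i , j))) (u (lb (i′ , j′)))

      skewB : ∀ {i i′} → Dec (ρA i ≈ ρB i′) → Bool
      skewB (yes _) = false
      skewB (no _) = true

      Cr₀ Cr : Index → Index → Bool
      Cr₀ (i , j) (i′ , j′) = ⌊ idx i j′ Fin.≟ idx i′ j ⌋
      Cr (i , j) (i′ , j′) = Cr₀ (i , j) (i′ , j′) ∧ skewB (par? i i′)

      T-∧ : ∀ {b c} → T (b ∧ c) → T b × T c
      T-∧ {true} q = tt , q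

      Cr-idx : ∀ a b → T (Cr a b) → idx (proj₁ a) (proj₂ b) ≡ idx (proj₁ b) (proj₂ a)
      Cr-idx (i , j) (i′ , j′) t = toWitness {a? = idx i j′ Fin.≟ idx i′ j} (proj₁ (T-∧ t))

      Cr-skew : ∀ a b → T (Cr a b) → ¬ (ρ (la a) ≈ ρ (lb b))
      Cr-skew (i , j) (i′ , j′) t = go (par? i i′) (proj₂ (T-∧ {Cr₀ (i , j) (i′ , j′)} t))
        where
        go : (d : Dec (ρA i ≈ ρB i′)) → T (skewB d) → ¬ (ρA i ≈ ρB i′)
        go (no n) _ = n

      Cr-shared : ∀ a b → T (Cr a b) → Shared (la a) (lb b) (xc a b)
      Cr-shared (i , j) (i′ , j′) t = go (par? i i′) (proj₂ (T-∧ {Cr₀ (i , j) (i′ , j′)} t))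
        where
        go : (d : Dec (ρA i ≈ ρB i′)) → T (skewB d) → Shared (la (i , j)) (lb (i′ , j′)) (xAt d (u (la (i , j))) (u (lb (i′ , j′))))
        go (no n) _ = linked⇒shared (proj₂ (inverse (ρA i + - ρB i′) (λ e → n (sub-zero e)))) (linkedAB (idx-eq (Cr-idx (i , j) (i′ , j′) t)))

      pencil : ∀ i i′ j → ∑ (λ j′ → ⟦ ⌊ idx i j′ Fin.≟ idx i′ j ⌋ ⟧) (allFin N) ≤ κ
      pencil i i′ j with count-split (λ j′ → ⌊ idx i j′ Fin.≟ idx i′ j ⌋) (allFin N)
      ... | js , _ , s , e = ≡.subst (_≤ κ) (≡.sym e) (few i js (split-Pairsˡ s (allFin⁺ N)) (go (split-yes s)))
        where
        go : ∀ {js} → All (λ j′ → T ⌊ idx i j′ Fin.≟ idx i′ j ⌋) js → AllPairs (λ j j′ → ω i j ≈ ω i j′) js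
        go [] = []
        go (t ∷ ts) = All.map (λ t′ → idx-eq (≡.trans (toWitness t) (≡.sym (toWitness t′)))) ts ∷ go ts

      E₀ E₁ : ℕ
      E₀ = ∑ (λ a → ∑ (λ b → ⟦ Cr₀ a b ⟧) indices) indices
      E₁ = ∑ (λ a → ∑ (λ b → ⟦ Cr a b ⟧) indices) indices

      collision-bound : length indices ℕ.* length indices ≤ t ℕ.* E₀
      collision-bound = ≡.subst (λ e → length indices ℕ.* length indices ≤ t ℕ.* e) reorder (collisions (λ a → idx (proj₁ a) (proj₂ a)) indices)
        where
        is = allFin n
        js = allFin N
        g : Fin n → Fin N → Fin n → Fin N → ℕ
        g i j′ i′ j = ⟦ ⌊ idx i j′ Fin.≟ idx i′ j ⌋ ⟧
        -- A collision compares `(i , j′)` with `(i′ , j)`, while a crossing joins the lines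
        -- `(i , j)` and `(i′ , j′)`: the second coordinates are exchanged.
        reorder : ∑ (λ x → ∑ (λ y → g (proj₁ x) (proj₂ x) (proj₁ y) (proj₂ y)) indices) indices ≡ E₀
        reorder = ≡.trans (∑-indices _) (≡.trans (∑-cong is (λ i →
            ≡.trans (∑-cong js (λ j′ → ∑-indices _))
            (≡.trans (∑-swap (λ j′ i′ → ∑ (g i j′ i′) js) js is)
            (≡.trans (∑-cong is (λ i′ → ∑-swap (λ j′ j → g i j′ i′ j) js js))
            (≡.trans (∑-swap (λ i′ j → ∑ (λ j′ → g i j′ i′ j) js) is js)
            (∑-cong js (λ j → ≡.sym (∑-indices _))))))))
          (≡.sym (∑-indices _)))

      -- For a line with indices `(i , j)` at most one `i′` gives a parallel slope, and the `j′`
      -- with `ω i j′` equal to `ω i′ j` lie in one fibre.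
      parallel-loss : E₀ ≤ E₁ ℕ.+ length indices ℕ.* κ
      parallel-loss = begin
        E₀ ≤⟨ ∑-≤ indices (λ a → ∑-≤ indices (λ b → pointwise a b)) ⟩
        ∑ (λ a → ∑ (λ b → ⟦ Cr a b ⟧ ℕ.+ lost a b) indices) indices ≡⟨ ≡.trans (∑-cong indices (λ a → ∑-+ (λ b → ⟦ Cr a b ⟧) (lost a) indices)) (∑-+ (λ a → ∑ (λ b → ⟦ Cr a b ⟧) indices) (λ a → ∑ (lost a) indices) indices) ⟩
        E₁ ℕ.+ ∑ (λ a → ∑ (lost a) indices) indices ≤⟨ ℕₚ.+-monoʳ-≤ E₁ (∑-bound (All.universal lost-bound indices)) ⟩
        E₁ ℕ.+ length indices ℕ.* κ ∎
        where
        open ℕₚ.≤-Reasoning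
        parB : ∀ i i′ → Bool
        parB i i′ = ⌊ par? i i′ ⌋
        lost : Index → Index → ℕ
        lost (i , j) (i′ , j′) = ⟦ parB i i′ ⟧ ℕ.* ⟦ Cr₀ (i , j) (i′ , j′) ⟧
        pointwise : ∀ a b → ⟦ Cr₀ a b ⟧ ≤ ⟦ Cr a b ⟧ ℕ.+ lost a b
        pointwise (i , j) (i′ , j′) with idx i j′ Fin.≟ idx i′ j | par? i i′
        ... | yes _ | yes _ = s≤s z≤n
        ... | yes _ | no _ = s≤s z≤n
        ... | no _ | _ = z≤n
        lost-bound : ∀ a → ∑ (lost a) indices ≤ κ
        lost-bound (i , j) = begin
          ∑ (lost (i , j)) indices ≡⟨ ∑-indices (lost (i , j)) ⟩
          ∑ (λ i′ → ∑ (λ j′ → ⟦ parB i i′ ⟧ ℕ.* ⟦ Cr₀ (i , j) (i′ , j′) ⟧) (allFin N)) (allFin n)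
            ≡⟨ ∑-cong (allFin n) (λ i′ → ≡.trans (∑-cong (allFin N) (λ j′ → ℕₚ.*-comm ⟦ parB i i′ ⟧ _)) (≡.trans (≡.sym (∑-* (λ j′ → ⟦ Cr₀ (i , j) (i′ , j′) ⟧) ⟦ parB i i′ ⟧ (allFin N))) (ℕₚ.*-comm _ ⟦ parB i i′ ⟧))) ⟩
          ∑ (λ i′ → ⟦ parB i i′ ⟧ ℕ.* ∑ (λ j′ → ⟦ Cr₀ (i , j) (i′ , j′) ⟧) (allFin N)) (allFin n) ≤⟨ ∑-≤ (allFin n) (λ i′ → ℕₚ.*-monoʳ-≤ ⟦ parB i i′ ⟧ (pencil i i′ j)) ⟩
          ∑ (λ i′ → ⟦ parB i i′ ⟧ ℕ.* κ) (allFin n) ≡⟨ ≡.sym (∑-* (λ i′ → ⟦ parB i i′ ⟧) κ (allFin n)) ⟩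
          ∑ (λ i′ → ⟦ parB i i′ ⟧) (allFin n) ℕ.* κ ≤⟨ ℕₚ.*-monoˡ-≤ κ (at-most-one (parB i) (allFin n) (allFin⁺ n) (λ i′ i″ e e′ → ρB-injective (trans (sym (toWitness e)) (toWitness e′)))) ⟩
          1 ℕ.* κ ≡⟨ ℕₚ.*-identityˡ κ ⟩
          κ ∎

      module Decided (sameᴮ? : ∀ a b b′ → Dec (xc a b ≈ xc a b′)) (sameᴬ? : ∀ b a a′ → Dec (xc a b ≈ xc a′ b))
          (MA MB : Index → Index → Bool) (MA-hit : ∀ a a′ → proj₁ a ≢ proj₁ a′ → MeetA l a a′ → T (MA a a′)) (MB-hit : ∀ b b′ → proj₁ b ≢ proj₁ b′ → MeetB l b b′ → T (MB b b′)) where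

        share-b : ∀ {a b b′} → T (Cr a b) → T (Cr a b′) → xc a b ≈ xc a b′ → Shared (lb b) (lb b′) (xc a b)
        share-b {a} {b} {b′} t t′ e = shared-trans (shared-sym (Cr-shared a b t)) (shared-cong (sym e) (Cr-shared a b′ t′))

        share-a : ∀ {a a′ b} → T (Cr a b) → T (Cr a′ b) → xc a b ≈ xc a′ b → Shared (la a) (la a′) (xc a b)
        share-a {a} {a′} {b} t t′ e = shared-trans (Cr-shared a b t) (shared-cong (sym e) (shared-sym (Cr-shared a′ b t′)))

        meetᴮ : ∀ {a b b′} → T (Cr a b) → T (Cr a b′) → b ≢ b′ → T ⌊ sameᴮ? a b b′ ⌋ → T (MB b b′)
        meetᴮ {a} {b} {b′} t t′ n e = MB-hit b b′ (SB.shared-index n sh) (shared⇒MeetB {b} {b′} sh)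
          where sh = share-b {a} {b} {b′} t t′ (toWitness e)

        meetᴬ : ∀ {b a a′} → T (Cr a b) → T (Cr a′ b) → a ≢ a′ → T ⌊ sameᴬ? b a a′ ⌋ → T (MA a a′)
        meetᴬ {b} {a} {a′} t t′ n e = MA-hit a a′ (SA.shared-index n sh) (shared⇒MeetA {a} {a′} sh)
          where sh = share-a {a} {a′} {b} t t′ (toWitness e)

        transᴮ : ∀ {a₁ a₂ b b′} → T (Cr a₁ b) → T (Cr a₁ b′) → T (Cr a₂ b) → T (Cr a₂ b′) → b ≢ b′ →
          T ⌊ sameᴮ? a₁ b b′ ⌋ → T ⌊ sameᴮ? a₂ b b′ ⌋ → T ⌊ sameᴬ? b′ a₁ a₂ ⌋
        transᴮ {a₁} {a₂} {b} {b′} t₁ t₁′ t₂ t₂′ n e₁ e₂ = fromWitness (trans (sym (toWitness e₁)) (trans (shared-unique (SB.shared-skew n sh₁) sh₁ sh₂) (toWitness e₂)))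
          where
          sh₁ = share-b {a₁} {b} {b′} t₁ t₁′ (toWitness e₁)
          sh₂ = share-b {a₂} {b} {b′} t₂ t₂′ (toWitness e₂)

        transᴬ : ∀ {b₁ b₂ a a′} → T (Cr a b₁) → T (Cr a′ b₁) → T (Cr a b₂) → T (Cr a′ b₂) → a ≢ a′ →
          T ⌊ sameᴬ? b₁ a a′ ⌋ → T ⌊ sameᴬ? b₂ a a′ ⌋ → T ⌊ sameᴮ? a′ b₁ b₂ ⌋
        transᴬ {b₁} {b₂} {a} {a′} t₁ t₁′ t₂ t₂′ n e₁ e₂ = fromWitness (trans (sym (toWitness e₁)) (trans (shared-unique (SA.shared-skew n sh₁) sh₁ sh₂) (toWitness e₂)))
          where
          sh₁ = share-a {a} {a′} {b₁} t₁ t₁′ (toWitness e₁)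
          sh₂ = share-a {a} {a′} {b₂} t₂ t₂′ (toWitness e₂)

        crossings : CrossingData
        crossings = record
          { A = Index ; B = Index ; _≟ᴬ_ = _≟ᴵ_ ; _≟ᴮ_ = _≟ᴵ_ ; As = indices ; Bs = indices ; dA = indices-distinct ; dB = indices-distinct ; allA = ∈-indices ; allB = ∈-indices
          ; Cr = Cr ; sameᴮ = λ a b b′ → ⌊ sameᴮ? a b b′ ⌋ ; sameᴬ = λ b a a′ → ⌊ sameᴬ? b a a′ ⌋
          ; sameᴮ-sym = λ t → fromWitness (sym (toWitness t)) ; sameᴬ-sym = λ t → fromWitness (sym (toWitness t)) ; MA = MA ; MB = MB
          ; meetᴮ = λ {a} {b} {b′} → meetᴮ {a} {b} {b′} ; meetᴬ = λ {b} {a} {a′} → meetᴬ {b} {a} {a′}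
          ; transᴮ = λ {a₁} {a₂} {b} {b′} → transᴮ {a₁} {a₂} {b} {b′} ; transᴬ = λ {b₁} {b₂} {a} {a′} → transᴬ {b₁} {b₂} {a} {a′} }

        private module Th = Thinning crossings

        abstract
          kept : Index → Index → Bool
          kept = Th.kept

          kept⇒Cr : ∀ a b → T (kept a b) → T (Cr a b)
          kept⇒Cr a b = Th.kept⇒Cr {a} {b}

          kept-b : ∀ a b b′ → T (kept a b) → T (kept a b′) → b ≢ b′ → ¬ (xc a b ≈ xc a b′)
          kept-b a b b′ t t′ n e = Th.kept-b {a} {b} {b′} t t′ n (fromWitness e)

          kept-a : ∀ a a′ b → T (kept a b) → T (kept a′ b) → a ≢ a′ → ¬ (xc a b ≈ xc a′ b)
          kept-a a a′ b t t′ n e = Th.kept-a {a} {a′} {b} t t′ n (fromWitness e)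

          thinning : E₁ ≤ ∑ (λ a → ∑ (λ b → ⟦ kept a b ⟧) indices) indices ℕ.+ total-meets MA MB
          thinning = Th.thinning

        few-directions : ∀ bs → AllPairs (λ b b′ → ¬ (ρB (proj₁ b) ≈ ρB (proj₁ b′))) bs → length bs ≤ κ
        few-directions bs h = ℕₚ.≤-trans (injective-length {A = Index} proj₁ bs (AllPairs.map (λ n e → n (reflexive (≡.cong ρB e))) h)) n≤κ

        -- Equal slopes mean a common first index `i′`. Then all the values `ω i j′` equal `ω i′ j`,
        -- so the `j′` lie in one fibre of `ω i`.
        few-parallel : ∀ a bs → Distinct bs → All (λ b → T (kept a b)) bs → AllPairs (λ b b′ → ρB (proj₁ b) ≈ ρB (proj₁ b′)) bs → length bs ≤ κ
        few-parallel a bs d ts es = ≡.subst (_≤ κ) (Listₚ.length-map proj₂ bs)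
          (few (proj₁ a) (map proj₂ bs) (distinct bs d es) (Pairsₚ.map⁺ (values bs ts es)))
          where
          distinct : ∀ bs → Distinct bs → AllPairs (λ b b′ → ρB (proj₁ b) ≈ ρB (proj₁ b′)) bs → Distinct (map proj₂ bs)
          distinct [] [] [] = []
          distinct (b ∷ bs) (n ∷ ns) (e ∷ es) = Allₚ.map⁺ (All.zipWith (λ { {b′} (n , e) j≡j′ → n (≡.cong₂ _,_ (ρB-injective e) j≡j′) }) (n , e)) ∷ distinct bs ns es
          values : ∀ bs → All (λ b → T (kept a b)) bs → AllPairs (λ b b′ → ρB (proj₁ b) ≈ ρB (proj₁ b′)) bs → AllPairs (λ b b′ → ω (proj₁ a) (proj₂ b) ≈ ω (proj₁ a) (proj₂ b′)) bs
          values [] [] [] = []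
          values (b ∷ bs) (t ∷ ts) (e ∷ es) = All.zipWith (λ { {b′} (t′ , e) → idx-eq (≡.trans (Cr-idx a b (kept⇒Cr a b t))
            (≡.trans (≡.cong (λ i → idx i (proj₂ a)) (ρB-injective e)) (≡.sym (Cr-idx a b′ (kept⇒Cr a b′ t′))))) }) (ts , e) ∷ values bs ts es

        config : Config K
        config = record
          { 𝔸 = Index ; 𝔹 = Index ; la = la ; lb = lb ; Cr = kept ; xc = xc ; κ = κ
          ; skew = λ {a} {b} t → Cr-skew a b (kept⇒Cr a b t)
          ; meet-y = λ {a} {b} t → proj₁ (Cr-shared a b (kept⇒Cr a b t))
          ; meet-z = λ {a} {b} t → proj₂ (Cr-shared a b (kept⇒Cr a b t))
          ; distinct-b = λ {a} {b} {b′} t t′ n e → kept-b a b b′ t t′ n e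
          ; distinct-a = λ {a} {a′} {b} t t′ n e → kept-a a a′ b t t′ n e
          ; lines-a = λ {a} {a′} → SA.distinct-lines {a} {a′}
          ; lines-b = λ {b} {b′} → SB.distinct-lines {b} {b′}
          ; few-directions = λ a bs _ _ → few-directions bs
          ; few-parallel = few-parallel }

        energy : ∀ (M C : ℕ) → 72 < M → (∀ x → 8 ℕ.* cube (72 ℕ.* x) ≤ M ℕ.* cube x) → C ≡ 300 ℕ.* M →
          ∀ r → 2 ℕ.* r ≤ p → n ℕ.* N ≤ 2 ℕ.* (r ℕ.* r) →
          (n ℕ.* N) ℕ.* (n ℕ.* N) ≤ t ℕ.* ((C ℕ.* cube (2 ℕ.* r) ℕ.+ κ ℕ.* (n ℕ.* N) ℕ.+ total-meets MA MB) ℕ.+ n ℕ.* N ℕ.* κ)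
        energy M C h₁ h₂ h₃ r 2r≤p nN≤ = ≡.subst (λ L → L ℕ.* L ≤ t ℕ.* ((C ℕ.* cube (2 ℕ.* r) ℕ.+ κ ℕ.* L ℕ.+ total-meets MA MB) ℕ.+ L ℕ.* κ)) indices-length
          (ℕₚ.≤-trans collision-bound (ℕₚ.*-monoʳ-≤ t (ℕₚ.≤-trans parallel-loss (ℕₚ.+-monoˡ-≤ (length indices ℕ.* κ)
            (ℕₚ.≤-trans thinning (ℕₚ.+-monoˡ-≤ (total-meets MA MB) bound))))))
          where
          module Co = Counting K p (ambient K p char) config
          bound : ∑ (λ a → ∑ (λ b → ⟦ kept a b ⟧) indices) indices ≤ C ℕ.* cube (2 ℕ.* r) ℕ.+ κ ℕ.* length indices
          -- Each family has `n N ≤ 2 r²` lines, so together they number at most `(2 r)²`.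
          bound = Co.Induction.incidence-bound M C h₁ h₂ h₃ (2 ℕ.* r) 2r≤p indices indices indices-distinct indices-distinct
            (≡.subst (λ L → L ℕ.+ L ≤ 2 ℕ.* r ℕ.* (2 ℕ.* r)) (≡.sym indices-length) (ℕₚ.≤-trans (ℕₚ.+-mono-≤ nN≤ nN≤) (ℕₚ.≤-reflexive (e r))))
            where
            e : ∀ r → 2 ℕ.* (r ℕ.* r) ℕ.+ 2 ℕ.* (r ℕ.* r) ≡ 2 ℕ.* r ℕ.* (2 ℕ.* r)
            e = solve-∀

-- Choice of the parameter and the resulting inequality.

module CoreBound {c ℓ} (K : StableField c ℓ) (p : ℕ) (char : CharAbove K p) {n N t κ : ℕ} (Fam : Families K n N t κ) where
  open StableField K renaming (ring to kring)
  open CommutativeRing kring hiding (ring; zero)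
  open Parameters K p char
  open Families Fam
  open Core K p char Fam
  private module S = IntSolver kring
  open S using (_:=_; :-_; con)

  -- From `r⁴ ≤ (n N)² ≤ t (8 C + 2 + 24 + 2) r³`: the terms are the incidence bound at radius
  -- `2 r`, its part with `κ`, the pairs meeting within a family, and the parallel pairs. The 24 is
  -- `6 (2 r²)² / r`, as the average is over at least `r` parameters.
  core : ∀ (M C : ℕ) → 72 < M → (∀ x → 8 ℕ.* cube (72 ℕ.* x) ≤ M ℕ.* cube x) → C ≡ 300 ℕ.* M →
    ∀ r → 1 ≤ r → 6 ℕ.* r ≤ p → r ℕ.* r ≤ n ℕ.* N → n ℕ.* N ≤ 2 ℕ.* (r ℕ.* r) → κ ≤ r → r ≤ (8 ℕ.* C ℕ.+ 28) ℕ.* t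
  core M C 72<M M-large C-value r@(suc r′) 1≤r 6r≤p r²≤nN nN≤2r² κ≤r = ≤-stable (do
    ls , zs , s , few-bad ← avoid (λ i → - x₁ i) x₂ (λ i e → x≉0 i (neg (proj₁ e) , proj₂ e)) (scalars m) all-apart
    let ls-apart = split-Pairsˡ s all-apart
        r≤ls : r ≤ length ls
        r≤ls = many (≡.trans (≡.sym (scalars-length m)) (length-split s)) few-bad
    decA ← ¬¬-Fin (λ k → ¬¬-Fin² (λ a → ¬¬-Fin² (λ a′ → em (proj₁ a ≢ proj₁ a′ × MeetA (List.lookup ls k) a a′))))
    decB ← ¬¬-Fin (λ k → ¬¬-Fin² (λ b → ¬¬-Fin² (λ b′ → em (proj₁ b ≢ proj₁ b′ × MeetB (List.lookup ls k) b b′))))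
    let k , h = Choice.choice ls ls-apart decA decB (ℕₚ.≤-trans 1≤r r≤ls)
    finish (List.lookup ls k) (lookup-All (split-Allˡ s (scalars-regular m 4+m≤p)) k) (lookup-All (split-yes s) k) (decA k) (decB k)
      (ℕₚ.≤-trans (ℕₚ.*-monoˡ-≤ _ r≤ls) (ℕₚ.≤-trans h (ℕₚ.≤-reflexive (≡.cong (λ L → 6 ℕ.* (L ℕ.* L)) indices-length)))))
    where
    open ℕₚ.≤-Reasoning
    -- The parameters are then the multiples of one from 2 to `p - 3`.
    m = p ∸ 4
    4≤p : 4 ≤ p
    4≤p = ℕₚ.≤-trans (ℕₚ.m≤m+n 4 2) (ℕₚ.≤-trans (ℕₚ.*-monoʳ-≤ 6 1≤r) 6r≤p)
    4+m≤p : 4 ℕ.+ m ≤ p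
    4+m≤p = ℕₚ.≤-reflexive (ℕₚ.m+[n∸m]≡n 4≤p)
    all-apart = scalars-apart m (ℕₚ.≤-trans (ℕₚ.m≤n+m (2 ℕ.+ m) 2) 4+m≤p)
    neg : ∀ {w} → - w ≈ 0# → w ≈ 0#
    neg {w} e = trans (S.solve 1 (λ w → w := :- (:- w)) refl w) (trans (-‿cong e) (S.solve 0 (:- con (+ 0) := con (+ 0)) refl))

    -- At most `n ≤ r` parameters are bad, and `6 r ≤ p` makes room for `r` good ones beside them
    -- and the 4 left out.
    many : ∀ {y z} → m ≡ y ℕ.+ z → z ≤ n → r ≤ y
    many {y} {z} e z≤ = ℕₚ.+-cancelʳ-≤ (4 ℕ.+ r) r y (begin
      r ℕ.+ (4 ℕ.+ r) ≤⟨ ℕₚ.m≤m+n _ (4 ℕ.* r′) ⟩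
      r ℕ.+ (4 ℕ.+ r) ℕ.+ 4 ℕ.* r′ ≡⟨ e₁ r′ ⟩
      6 ℕ.* r ≤⟨ 6r≤p ⟩
      p ≡⟨ ≡.sym (ℕₚ.m+[n∸m]≡n 4≤p) ⟩
      4 ℕ.+ m ≡⟨ ≡.cong (4 ℕ.+_) e ⟩
      4 ℕ.+ (y ℕ.+ z) ≤⟨ ℕₚ.+-monoʳ-≤ 4 (ℕₚ.+-monoʳ-≤ y (ℕₚ.≤-trans z≤ (ℕₚ.≤-trans n≤κ κ≤r))) ⟩
      4 ℕ.+ (y ℕ.+ r) ≡⟨ e₂ y r ⟩
      y ℕ.+ (4 ℕ.+ r) ∎)
      where
      e₁ : ∀ r′ → suc r′ ℕ.+ (4 ℕ.+ suc r′) ℕ.+ 4 ℕ.* r′ ≡ 6 ℕ.* suc r′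
      e₁ = solve-∀
      e₂ : ∀ y r → 4 ℕ.+ (y ℕ.+ r) ≡ y ℕ.+ (4 ℕ.+ r)
      e₂ = solve-∀

    conclude : ∀ total → r ℕ.* total ≤ 6 ℕ.* (n ℕ.* N ℕ.* (n ℕ.* N)) →
      n ℕ.* N ℕ.* (n ℕ.* N) ≤ t ℕ.* ((C ℕ.* cube (2 ℕ.* r) ℕ.+ κ ℕ.* (n ℕ.* N) ℕ.+ total) ℕ.+ n ℕ.* N ℕ.* κ) → r ≤ (8 ℕ.* C ℕ.+ 28) ℕ.* t
    conclude total few-meets energy = ℕₚ.*-cancelʳ-≤ r ((8 ℕ.* C ℕ.+ 28) ℕ.* t) (cube r) {{cube-nonZero}} (begin
      r ℕ.* cube r ≡⟨ e₁ r ⟩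
      r ℕ.* r ℕ.* (r ℕ.* r) ≤⟨ ℕₚ.*-mono-≤ r²≤nN r²≤nN ⟩
      n ℕ.* N ℕ.* (n ℕ.* N) ≤⟨ energy ⟩
      t ℕ.* ((C ℕ.* cube (2 ℕ.* r) ℕ.+ κ ℕ.* (n ℕ.* N) ℕ.+ total) ℕ.+ n ℕ.* N ℕ.* κ)
        ≤⟨ ℕₚ.*-monoʳ-≤ t (ℕₚ.+-mono-≤ (ℕₚ.+-mono-≤ (ℕₚ.+-monoʳ-≤ (C ℕ.* cube (2 ℕ.* r)) (ℕₚ.*-mono-≤ κ≤r nN≤2r²)) total-bound) (ℕₚ.*-mono-≤ nN≤2r² κ≤r)) ⟩
      t ℕ.* ((C ℕ.* cube (2 ℕ.* r) ℕ.+ r ℕ.* (2 ℕ.* (r ℕ.* r)) ℕ.+ 24 ℕ.* cube r) ℕ.+ 2 ℕ.* (r ℕ.* r) ℕ.* r) ≡⟨ e₂ t C r ⟩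
      (8 ℕ.* C ℕ.+ 28) ℕ.* t ℕ.* cube r ∎)
      where
      cube-nonZero : ℕ.NonZero (cube r)
      cube-nonZero = _
      e₁ : ∀ r → r ℕ.* (r ℕ.* r ℕ.* r) ≡ r ℕ.* r ℕ.* (r ℕ.* r)
      e₁ = solve-∀
      e₂ : ∀ t C r → t ℕ.* ((C ℕ.* (2 ℕ.* r ℕ.* (2 ℕ.* r) ℕ.* (2 ℕ.* r)) ℕ.+ r ℕ.* (2 ℕ.* (r ℕ.* r)) ℕ.+ 24 ℕ.* (r ℕ.* r ℕ.* r)) ℕ.+ 2 ℕ.* (r ℕ.* r) ℕ.* r) ≡ (8 ℕ.* C ℕ.+ 28) ℕ.* t ℕ.* (r ℕ.* r ℕ.* r)
      e₂ = solve-∀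
      e₃ : ∀ r → 6 ℕ.* (2 ℕ.* (r ℕ.* r) ℕ.* (2 ℕ.* (r ℕ.* r))) ≡ r ℕ.* (24 ℕ.* (r ℕ.* r ℕ.* r))
      e₃ = solve-∀
      total-bound : total ≤ 24 ℕ.* cube r
      total-bound = ℕₚ.*-cancelˡ-≤ r (ℕₚ.≤-trans few-meets (ℕₚ.≤-trans (ℕₚ.*-monoʳ-≤ 6 (ℕₚ.*-mono-≤ nN≤2r² nN≤2r²)) (ℕₚ.≤-reflexive (e₃ r))))

    finish : ∀ l → ¬ (Δ l ≈ 0#) → (∀ i → ¬ (q₂ l i ≈ 0#)) →
      (decA : ∀ a a′ → Dec (proj₁ a ≢ proj₁ a′ × MeetA l a a′)) (decB : ∀ b b′ → Dec (proj₁ b ≢ proj₁ b′ × MeetB l b b′)) →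
      r ℕ.* total-meets (λ a a′ → ⌊ decA a a′ ⌋) (λ b b′ → ⌊ decB b b′ ⌋) ≤ 6 ℕ.* (n ℕ.* N ℕ.* (n ℕ.* N)) → ¬¬ (r ≤ (8 ℕ.* C ℕ.+ 28) ℕ.* t)
    finish l Δ≉0 q₂≉0 decA decB few-meets = do
      par? ← ¬¬-Fin (λ i → ¬¬-Fin (λ i′ → em (At.ρA i ≈ At.ρB i′)))
      sameᴮ? ← ¬¬-Fin² (λ a → ¬¬-Fin² (λ b → ¬¬-Fin² (λ b′ → em (At.Crossings.xc par? a b ≈ At.Crossings.xc par? a b′))))
      sameᴬ? ← ¬¬-Fin² (λ b → ¬¬-Fin² (λ a → ¬¬-Fin² (λ a′ → em (At.Crossings.xc par? a b ≈ At.Crossings.xc par? a′ b))))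
      η (conclude _ few-meets (At.Crossings.Decided.energy par? sameᴮ? sameᴬ? (λ a a′ → ⌊ decA a a′ ⌋) (λ b b′ → ⌊ decB b b′ ⌋)
        (λ a a′ i≢i′ h → fromWitness (i≢i′ , h)) (λ b b′ i≢i′ h → fromWitness (i≢i′ , h)) M C 72<M M-large C-value r
        (ℕₚ.≤-trans (ℕₚ.*-monoˡ-≤ r (ℕₚ.m≤m+n 2 4)) 6r≤p) nN≤2r²))
      where
      module At = AtParameter l Δ≉0 q₂≉0

-- The least factor that satisfies `N-large` when the recursion is at radius `W d`.
dominating : ℕ → ℕ
dominating W = 8 ℕ.* (W ℕ.* W ℕ.* W)

dominating-cube : ∀ W x → 8 ℕ.* cube (W ℕ.* x) ≤ dominating W ℕ.* cube x
dominating-cube W x = ℕₚ.≤-reflexive (e W x)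
  where
  e : ∀ W x → 8 ℕ.* (W ℕ.* x ℕ.* (W ℕ.* x) ℕ.* (W ℕ.* x)) ≡ 8 ℕ.* (W ℕ.* W ℕ.* W) ℕ.* (x ℕ.* x ℕ.* x)
  e = solve-∀

<-dominating : ∀ W → .{{ℕ.NonZero W}} → W < dominating W
<-dominating W@(suc _) = ℕₚ.≤-<-trans (ℕₚ.≤-trans (ℕₚ.m≤m*n W W) (ℕₚ.m≤m*n (W ℕ.* W) W)) (ℕₚ.m<m+n (W ℕ.* W ℕ.* W) (s≤s z≤n))

abstract
  B : ℕ
  B = 8 ℕ.* (300 ℕ.* dominating 72) ℕ.+ 28

  1≤B : 1 ≤ B
  1≤B = ℕₚ.≤-trans (s≤s z≤n) (ℕₚ.m≤n+m 28 (8 ℕ.* (300 ℕ.* dominating 72)))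

  families-bound : ∀ {c ℓ} (K : StableField c ℓ) (p : ℕ) → CharAbove K p → ∀ {n N t κ} → Families K n N t κ →
    ∀ r → 1 ≤ r → 6 ℕ.* r ≤ p → r ℕ.* r ≤ n ℕ.* N → n ℕ.* N ≤ 2 ℕ.* (r ℕ.* r) → κ ≤ r → r ≤ B ℕ.* t
  families-bound K p char Fam = CoreBound.core K p char Fam (dominating 72) (300 ℕ.* dominating 72) (<-dominating 72) (dominating-cube 72) ≡.refl

-- Vectors in the plane and selections from lists.

module Plane {c ℓ} (K : StableField c ℓ) where
  open StableField K renaming (ring to kring)
  open FieldGraded K using (mul-zero)
  open CommutativeRing kring hiding (ring; zero)
  open Lines K using (sub-zero; zero-sub; cancelˡ)
  private module S = IntSolver kring
  open S using (_:=_; _:+_; _:*_; _:-_; :-_; con)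

  Point : Set c
  Point = Carrier × Carrier

  Zero : Point → Set ℓ
  Zero u = proj₁ u ≈ 0# × proj₂ u ≈ 0#

  Same Parallel : Point → Point → Set ℓ
  Same u v = proj₁ u ≈ proj₁ v × proj₂ u ≈ proj₂ v
  Parallel u v = proj₁ u * proj₂ v ≈ proj₁ v * proj₂ u

  dot : Point → Point → Carrier
  dot f u = proj₁ f * proj₁ u + proj₂ f * proj₂ u

  same⇒parallel : ∀ {u v} → Same u v → Parallel u v
  same⇒parallel (e₁ , e₂) = *-cong e₁ (sym e₂)

  combination : ∀ {a b} x y → a ≈ 0# → b ≈ 0# → x * a + y * b ≈ 0#
  combination x y ea eb = trans (+-cong (*-congˡ ea) (*-congˡ eb)) (S.solve 2 (λ x y → x :* con (+ 0) :+ y :* con (+ 0) := con (+ 0)) refl x y)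

  annihilated : ∀ {w x} → ¬ Zero w → proj₁ w * x ≈ 0# → proj₂ w * x ≈ 0# → x ≈ 0#
  annihilated w≉0 e₁ e₂ = stable λ n → w≉0 (stable (λ n₁ → n (mul-zero n₁ e₁)) , stable (λ n₂ → n (mul-zero n₂ e₂)))

  -- Each coordinate of `w` times the determinant of `u` and `v` is a combination of the two
  -- vanishing determinants. The zero vector is parallel to everything, so `w` has to be nonzero.
  parallel-trans : ∀ {u v} w → ¬ Zero w → Parallel u w → Parallel w v → Parallel u v
  parallel-trans {u₁ , u₂} {v₁ , v₂} w@(w₁ , w₂) w≉0 e e′ = sub-zero (annihilated w≉0
    (trans (S.solve 6 (λ u₁ u₂ v₁ v₂ w₁ w₂ → w₁ :* (u₁ :* v₂ :- v₁ :* u₂) := v₁ :* (u₁ :* w₂ :- w₁ :* u₂) :+ u₁ :* (w₁ :* v₂ :- v₁ :* w₂)) refl u₁ u₂ v₁ v₂ w₁ w₂)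
      (combination v₁ u₁ (zero-sub e) (zero-sub e′)))
    (trans (S.solve 6 (λ u₁ u₂ v₁ v₂ w₁ w₂ → w₂ :* (u₁ :* v₂ :- v₁ :* u₂) := v₂ :* (u₁ :* w₂ :- w₁ :* u₂) :+ u₂ :* (w₁ :* v₂ :- v₁ :* w₂)) refl u₁ u₂ v₁ v₂ w₁ w₂)
      (combination v₂ u₂ (zero-sub e) (zero-sub e′))))

  kernel-parallel : ∀ f {u v} → ¬ Zero f → dot f u ≈ 0# → dot f v ≈ 0# → Parallel u v
  kernel-parallel f@(f₁ , f₂) {u₁ , u₂} {v₁ , v₂} f≉0 e e′ = sub-zero (annihilated f≉0
    (trans (S.solve 6 (λ u₁ u₂ v₁ v₂ f₁ f₂ → f₁ :* (u₁ :* v₂ :- v₁ :* u₂) := v₂ :* (f₁ :* u₁ :+ f₂ :* u₂) :+ :- u₂ :* (f₁ :* v₁ :+ f₂ :* v₂)) refl u₁ u₂ v₁ v₂ f₁ f₂)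
      (combination v₂ (- u₂) e e′))
    (trans (S.solve 6 (λ u₁ u₂ v₁ v₂ f₁ f₂ → f₂ :* (u₁ :* v₂ :- v₁ :* u₂) := :- v₁ :* (f₁ :* u₁ :+ f₂ :* u₂) :+ u₁ :* (f₁ :* v₁ :+ f₂ :* v₂)) refl u₁ u₂ v₁ v₂ f₁ f₂)
      (combination (- v₁) u₁ e e′)))

  -- A functional that is nonzero at `x` is injective on the line spanned by `x`.
  separated : ∀ f x {u v} → ¬ (dot f x ≈ 0#) → Parallel u x → Parallel v x → dot f u ≈ dot f v → Same u v
  separated (f₁ , f₂) (x₁ , x₂) {u₁ , u₂} {v₁ , v₂} fx≉0 eu ev e =
    cancelˡ fx≉0 (sub-zero (trans
      (S.solve 8 (λ f₁ f₂ x₁ x₂ u₁ u₂ v₁ v₂ → (f₁ :* x₁ :+ f₂ :* x₂) :* u₁ :- (f₁ :* x₁ :+ f₂ :* x₂) :* v₁ :=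
        x₁ :* ((f₁ :* u₁ :+ f₂ :* u₂) :- (f₁ :* v₁ :+ f₂ :* v₂)) :+ f₂ :* ((u₁ :* x₂ :- x₁ :* u₂) :- (v₁ :* x₂ :- x₁ :* v₂))) refl f₁ f₂ x₁ x₂ u₁ u₂ v₁ v₂)
      (combination x₁ f₂ (zero-sub e) difference))) ,
    cancelˡ fx≉0 (sub-zero (trans
      (S.solve 8 (λ f₁ f₂ x₁ x₂ u₁ u₂ v₁ v₂ → (f₁ :* x₁ :+ f₂ :* x₂) :* u₂ :- (f₁ :* x₁ :+ f₂ :* x₂) :* v₂ :=
        x₂ :* ((f₁ :* u₁ :+ f₂ :* u₂) :- (f₁ :* v₁ :+ f₂ :* v₂)) :+ :- f₁ :* ((u₁ :* x₂ :- x₁ :* u₂) :- (v₁ :* x₂ :- x₁ :* v₂))) refl f₁ f₂ x₁ x₂ u₁ u₂ v₁ v₂)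
      (combination x₂ (- f₁) (zero-sub e) difference)))
    where
    difference = zero-sub (trans (zero-sub eu) (sym (zero-sub ev)))

greedy-representatives : ∀ {a r} {A : Set a} (R : A → A → Set r) → (∀ {x} → R x x) → ∀ xs →
  ¬¬ ∃ λ ys → All (_∈ xs) ys × AllPairs (λ y y′ → ¬ R y y′) ys × All (λ x → Any (R x) ys) xs
greedy-representatives R R-refl [] = η ([] , [] , [] , [])
greedy-representatives R R-refl (x ∷ xs) = do
  ys , ys∈ , free , cover ← greedy-representatives R R-refl xs
  no n ← em (Any (R x) ys)
    where yes h → η (ys , All.map there ys∈ , free , h ∷ cover)
  η (x ∷ ys , here ≡.refl ∷ All.map there ys∈ , Allₚ.¬Any⇒All¬ ys n ∷ free , here R-refl ∷ All.map there cover)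

cover-bound : ∀ {a b p q r t} {A : Set a} {B : Set b} {P : A → Set p} {Q : A → A → Set q} (R : A → B → Set r) ys zs → All P ys → AllPairs Q ys →
  All (λ y → Any (R y) zs) ys → All (λ z → ∀ us → All P us → AllPairs Q us → All (λ u → R u z) us → length us ≤ t) zs → length ys ≤ length zs ℕ.* t
cover-bound R [] [] _ _ _ _ = z≤n
cover-bound R (y ∷ ys) [] _ _ (() ∷ _) _
cover-bound R ys (z ∷ zs) ps qs cover (few ∷ fews) = ≤-stable (do
  us , vs , s ← split-em {P = λ y → R y z} ys
  η (ℕₚ.≤-trans (ℕₚ.≤-reflexive (length-split s)) (ℕₚ.+-mono-≤ (few us (split-Allˡ s ps) (split-Pairsˡ s qs) (split-yes s))
    (cover-bound R vs zs (split-Allʳ s ps) (split-Pairsʳ s qs) (All.zipWith (λ { (n , here h) → ⊥-elim (n h) ; (n , there h) → h }) (split-no s , split-Allʳ s cover)) fews))))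

-- Takes the least `z` with `s ≤ n z`; as `n ≤ s`, the last step overshoots by at most `s`.
enough : ∀ s n y → s ≤ n ℕ.* y → n ≤ s → ∃ λ z → z ≤ y × s ≤ n ℕ.* z × n ℕ.* z ≤ 2 ℕ.* s
enough s n zero h n≤s = 0 , z≤n , h , ℕₚ.≤-trans (ℕₚ.≤-reflexive (ℕₚ.*-zeroʳ n)) z≤n
enough s n (suc y) h n≤s with s ℕ.≤? n ℕ.* y
... | yes h′ with enough s n y h′ n≤s
...   | z , z≤y , b = z , ℕₚ.m≤n⇒m≤1+n z≤y , b
enough s n (suc y) h n≤s | no h′ = suc y , ℕₚ.≤-refl , h , (begin
  n ℕ.* suc y ≡⟨ ℕₚ.*-suc n y ⟩
  n ℕ.+ n ℕ.* y ≤⟨ ℕₚ.+-mono-≤ n≤s (ℕₚ.<⇒≤ (ℕₚ.≰⇒> h′)) ⟩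
  s ℕ.+ s ≡⟨ ≡.cong (s ℕ.+_) (≡.sym (ℕₚ.+-identityʳ s)) ⟩
  2 ℕ.* s ∎)
  where
  open ℕₚ.≤-Reasoning

-- The bilinear form in coordinates.

module Form {c ℓ} (K : StableField c ℓ) (p : ℕ) (char : CharAbove K p) (w₁₁ w₁₂ w₂₁ w₂₂ : CommutativeRing.Carrier (StableField.ring K)) where
  open StableField K renaming (ring to kring)
  open CommutativeRing kring hiding (ring; zero)
  open Lines K using (sub-zero; zero-sub; cancelˡ)
  open Plane K
  open Parameters K p char using (avoid; scalars; scalars-apart; scalars-length)
  private module S = IntSolver kring
  open S using (_:=_; _:+_; _:*_; _:-_; :-_; con)

  det : Carrier
  det = w₁₁ * w₂₂ + - (w₁₂ * w₂₁)

  leftᵂ rightᵂ : Point → Point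
  leftᵂ (u₁ , u₂) = u₁ * w₁₁ + u₂ * w₂₁ , u₁ * w₁₂ + u₂ * w₂₂
  rightᵂ (v₁ , v₂) = w₁₁ * v₁ + w₁₂ * v₂ , w₂₁ * v₁ + w₂₂ * v₂

  form : Point → Point → Carrier
  form u v = dot (leftᵂ u) v

  form-right : ∀ u v → dot u (rightᵂ v) ≈ form u v
  form-right (u₁ , u₂) (v₁ , v₂) = S.solve 8 (λ a b c d u₁ u₂ v₁ v₂ → u₁ :* (a :* v₁ :+ b :* v₂) :+ u₂ :* (c :* v₁ :+ d :* v₂) :=
    (u₁ :* a :+ u₂ :* c) :* v₁ :+ (u₁ :* b :+ u₂ :* d) :* v₂) refl w₁₁ w₁₂ w₂₁ w₂₂ u₁ u₂ v₁ v₂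

  module NonSingular (det≉0 : ¬ (det ≈ 0#)) where
    leftᵂ-zero : ∀ u → Zero (leftᵂ u) → Zero u
    leftᵂ-zero (u₁ , u₂) (e₁ , e₂) =
      FieldGraded.mul-zero K det≉0 (trans (S.solve 6 (λ a b c d u₁ u₂ → (a :* d :- b :* c) :* u₁ := d :* (u₁ :* a :+ u₂ :* c) :+ :- c :* (u₁ :* b :+ u₂ :* d)) refl w₁₁ w₁₂ w₂₁ w₂₂ u₁ u₂) (combination _ _ e₁ e₂)) ,
      FieldGraded.mul-zero K det≉0 (trans (S.solve 6 (λ a b c d u₁ u₂ → (a :* d :- b :* c) :* u₂ := :- b :* (u₁ :* a :+ u₂ :* c) :+ a :* (u₁ :* b :+ u₂ :* d)) refl w₁₁ w₁₂ w₂₁ w₂₂ u₁ u₂) (combination _ _ e₁ e₂))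

    rightᵂ-injective : ∀ {u v} → Same (rightᵂ u) (rightᵂ v) → Same u v
    rightᵂ-injective {u₁ , u₂} {v₁ , v₂} (e₁ , e₂) =
      cancelˡ det≉0 (trans (recover₁ u₁ u₂) (trans (+-cong (*-congˡ e₁) (*-congˡ e₂)) (sym (recover₁ v₁ v₂)))) ,
      cancelˡ det≉0 (trans (recover₂ u₁ u₂) (trans (+-cong (*-congˡ e₁) (*-congˡ e₂)) (sym (recover₂ v₁ v₂))))
      where
      recover₁ : ∀ u₁ u₂ → det * u₁ ≈ w₂₂ * (w₁₁ * u₁ + w₁₂ * u₂) + - w₁₂ * (w₂₁ * u₁ + w₂₂ * u₂)
      recover₁ = S.solve 6 (λ a b c d u₁ u₂ → (a :* d :- b :* c) :* u₁ := d :* (a :* u₁ :+ b :* u₂) :+ :- b :* (c :* u₁ :+ d :* u₂)) refl w₁₁ w₁₂ w₂₁ w₂₂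
      recover₂ : ∀ u₁ u₂ → det * u₂ ≈ - w₂₁ * (w₁₁ * u₁ + w₁₂ * u₂) + w₁₁ * (w₂₁ * u₁ + w₂₂ * u₂)
      recover₂ = S.solve 6 (λ a b c d u₁ u₂ → (a :* d :- b :* c) :* u₂ := :- c :* (a :* u₁ :+ b :* u₂) :+ a :* (c :* u₁ :+ d :* u₂)) refl w₁₁ w₁₂ w₂₁ w₂₂

    rightᵂ-zero : ∀ v → Zero (rightᵂ v) → Zero v
    rightᵂ-zero v (e₁ , e₂) = rightᵂ-injective {v} {0# , 0#} (trans e₁ (sym (null _ _)) , trans e₂ (sym (null _ _)))
      where
      null : ∀ a b → a * 0# + b * 0# ≈ 0#
      null a b = combination a b refl refl

    -- Some shear with parameter μ makes every second coordinate of the left vectors non-zero;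
    -- the right vectors are sheared by the inverse transpose.
    families : ∀ {n N t r} (X : Fin n → Point) (Y : Fin N → Point) (idx : Fin n → Fin N → Fin t) →
      (∀ {i i′} → i ≢ i′ → ¬ Parallel (X i) (X i′)) → (∀ i → ¬ Zero (X i)) → (∀ j → ¬ Zero (Y j)) → (∀ {j j′} → j ≢ j′ → ¬ Same (Y j) (Y j′)) →
      (∀ {i j i′ j′} → idx i j ≡ idx i′ j′ → form (X i) (Y j) ≈ form (X i′) (Y j′)) →
      (∀ i js → Distinct js → AllPairs (λ j j′ → form (X i) (Y j) ≈ form (X i) (Y j′)) js → length js ≤ r) →
      n ≤ r → 3 ℕ.+ n ≤ p → ¬¬ Families K n N t r
    families {n} {N} {t} {r} X Y idx X-independent X≉0 Y≉0 Y-distinct idx-eq few n≤r 3+n≤p = do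
      -- At most `n` of these `n + 1` scalars are bad, so one good shear remains.
      ys , zs , s , zs≤n ← avoid (λ i → proj₁ (X i)) (λ i → proj₂ (X i)) X≉0 (scalars (suc n)) (scalars-apart (suc n) 3+n≤p)
      η (go ys zs (≡.trans (≡.sym (scalars-length (suc n))) (length-split s)) zs≤n (split-yes s))
      where
      sheared : ∀ μ → (∀ i → ¬ (proj₂ (X i) + μ * proj₁ (X i) ≈ 0#)) → Families K n N t r
      sheared μ good = record
        { s₁ = λ i → proj₁ (X i) ; s₂ = λ i → proj₂ (X i) + μ * proj₁ (X i)
        ; x₁ = λ i → proj₁ (leftᵂ (X i)) ; x₂ = λ i → proj₂ (leftᵂ (X i))
        ; t₁ = λ j → proj₁ (Y j) ; t₂ = λ j → proj₂ (Y j)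
        ; y₁ = λ j → proj₁ (rightᵂ (Y j)) + - (μ * proj₂ (rightᵂ (Y j))) ; y₂ = λ j → proj₂ (rightᵂ (Y j))
        ; ω = λ i j → form (X i) (Y j)
        ; ω-s = λ i j → trans (S.solve 5 (λ m a b y z → a :* (y :- m :* z) :+ (b :+ m :* a) :* z := a :* y :+ b :* z) refl μ _ _ _ _) (form-right (X i) (Y j))
        ; ω-x = λ i j → refl
        ; s₂≉0 = good
        ; s-independent = λ {i} {i′} i≢i′ e → X-independent i≢i′ (sub-zero (trans
            (S.solve 5 (λ m a b a′ b′ → a :* b′ :- a′ :* b := a :* (b′ :+ m :* a′) :- a′ :* (b :+ m :* a)) refl μ _ _ _ _) (zero-sub e)))
        ; x-independent = λ {i} {i′} i≢i′ e → X-independent i≢i′ (cancelˡ det≉0 (sub-zero (trans (wedge (X i) (X i′)) (zero-sub e))))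
        ; x≉0 = λ i z → X≉0 i (leftᵂ-zero (X i) z)
        ; t≉0 = Y≉0
        ; y≉0 = λ j z → Y≉0 j (rightᵂ-zero (Y j) (unshear-zero z , proj₂ z))
        ; t-distinct = Y-distinct
        ; y-distinct = λ {j} {j′} j≢j′ e → Y-distinct j≢j′ (rightᵂ-injective (unshear e , proj₂ e))
        ; idx = idx ; idx-eq = idx-eq ; few = few ; n≤κ = n≤r }
        where
        wedge : ∀ u v → det * (proj₁ u * proj₂ v) + - (det * (proj₁ v * proj₂ u)) ≈ proj₁ (leftᵂ u) * proj₂ (leftᵂ v) + - (proj₁ (leftᵂ v) * proj₂ (leftᵂ u))
        wedge (u₁ , u₂) (v₁ , v₂) = S.solve 8 (λ a b c d u₁ u₂ v₁ v₂ → (a :* d :- b :* c) :* (u₁ :* v₂) :- (a :* d :- b :* c) :* (v₁ :* u₂) :=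
          (u₁ :* a :+ u₂ :* c) :* (v₁ :* b :+ v₂ :* d) :- (v₁ :* a :+ v₂ :* c) :* (u₁ :* b :+ u₂ :* d)) refl w₁₁ w₁₂ w₂₁ w₂₂ u₁ u₂ v₁ v₂
        unshear : ∀ {y z y′ z′} → y + - (μ * z) ≈ y′ + - (μ * z′) × z ≈ z′ → y ≈ y′
        unshear {y} {z} {y′} {z′} (e , e′) = trans (S.solve 3 (λ m y z → y := (y :- m :* z) :+ m :* z) refl μ y z)
          (trans (+-cong e (*-congˡ e′)) (S.solve 3 (λ m y z → (y :- m :* z) :+ m :* z := y) refl μ y′ z′))
        unshear-zero : ∀ {y z} → y + - (μ * z) ≈ 0# × z ≈ 0# → y ≈ 0#
        unshear-zero {y} {z} (e , e′) = trans (S.solve 3 (λ m y z → y := (y :- m :* z) :+ m :* z) refl μ y z)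
          (trans (+-cong e (*-congˡ e′)) (S.solve 1 (λ m → con (+ 0) :+ m :* con (+ 0) := con (+ 0)) refl μ))
      go : ∀ ys zs → suc n ≡ length ys ℕ.+ length zs → length zs ≤ n → All (λ l → ∀ i → ¬ (proj₂ (X i) + l * proj₁ (X i) ≈ 0#)) ys → Families K n N t r
      go [] zs e zs≤n _ = ⊥-elim (ℕₚ.<-irrefl ≡.refl (ℕₚ.≤-trans (ℕₚ.≤-reflexive e) zs≤n))
      go (μ ∷ _) _ _ _ (good ∷ _) = sheared μ good

at-most-one-zero : ∀ {c ℓ} (K : StableField c ℓ) → ∀ zs → All (λ z → ¬¬ Plane.Zero K z) zs → AllPairs (λ u v → ¬ Plane.Same K u v) zs → length zs ≤ 1
at-most-one-zero K [] _ _ = z≤n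
at-most-one-zero K (z ∷ []) _ _ = s≤s z≤n
at-most-one-zero K (z ∷ z′ ∷ zs) (h ∷ h′ ∷ _) ((n ∷ _) ∷ _) = ⊥-elim (h λ e → h′ λ e′ → n (trans (proj₁ e) (sym (proj₁ e′)) , trans (proj₂ e) (sym (proj₂ e′))))
  where
  open CommutativeRing (StableField.ring K) using (trans; sym)

-- Here `y` counts the nonzero points, `z` the possible zero vector and `n` the directions. The core
-- is `y² ≤ n t y ≤ r² t ≤ D² t³`.
square-estimate : ∀ {N y z n t r D} → N ≡ y ℕ.+ z → z ≤ 1 → y ≤ n ℕ.* t → n ℕ.* y ≤ r ℕ.* r → r ≤ D ℕ.* t → 1 ≤ D → 1 ≤ t → N ℕ.^ 2 ≤ (6 ℕ.* D ℕ.* t) ℕ.^ 3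
square-estimate {N} {y} {z} {n} {t} {r} {D} N≡ z≤1 y≤nt ny≤r² r≤Dt 1≤D 1≤t = begin
  N ℕ.^ 2 ≡⟨ ≡.cong (N ℕ.*_) (ℕₚ.*-identityʳ N) ⟩
  N ℕ.* N ≤⟨ ℕₚ.*-mono-≤ N≤ N≤ ⟩
  suc y ℕ.* suc y ≤⟨ double y ⟩
  2 ℕ.* (y ℕ.* y) ℕ.+ 2 ≤⟨ ℕₚ.+-mono-≤ (ℕₚ.*-monoʳ-≤ 2 y²≤) (ℕₚ.*-monoʳ-≤ 2 (ℕₚ.*-mono-≤ (ℕₚ.*-mono-≤ 1≤x 1≤x) 1≤x)) ⟩
  2 ℕ.* (x ℕ.* x ℕ.* x) ℕ.+ 2 ℕ.* (x ℕ.* x ℕ.* x) ≡⟨ e₂ x ⟩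
  2 ℕ.* x ℕ.* (2 ℕ.* x ℕ.* (x ℕ.* 1)) ≤⟨ ℕₚ.*-mono-≤ (scale 2 6 (ℕₚ.m≤m+n 2 4)) (ℕₚ.*-mono-≤ (scale 2 6 (ℕₚ.m≤m+n 2 4)) (ℕₚ.*-monoˡ-≤ 1 (ℕₚ.≤-trans (ℕₚ.≤-reflexive (≡.sym (ℕₚ.*-identityˡ x))) (scale 1 6 (ℕₚ.m≤m+n 1 5))))) ⟩
  (6 ℕ.* D ℕ.* t) ℕ.^ 3 ∎
  where
  open ℕₚ.≤-Reasoning
  x = D ℕ.* t
  1≤x : 1 ≤ x
  1≤x = ℕₚ.*-mono-≤ 1≤D 1≤t
  scale : ∀ a b → a ≤ b → a ℕ.* x ≤ b ℕ.* D ℕ.* t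
  scale a b a≤b = ℕₚ.≤-trans (ℕₚ.*-monoˡ-≤ x a≤b) (ℕₚ.≤-reflexive (≡.sym (ℕₚ.*-assoc b D t)))
  N≤ : N ≤ suc y
  N≤ = ℕₚ.≤-trans (ℕₚ.≤-reflexive N≡) (ℕₚ.≤-trans (ℕₚ.+-monoʳ-≤ y z≤1) (ℕₚ.≤-reflexive (ℕₚ.+-comm y 1)))
  double : ∀ y → suc y ℕ.* suc y ≤ 2 ℕ.* (y ℕ.* y) ℕ.+ 2
  double zero = s≤s z≤n
  double (suc k) = ℕₚ.≤-trans (ℕₚ.m≤m+n _ (k ℕ.* k)) (ℕₚ.≤-reflexive (e k))
    where
    e : ∀ k → suc (suc k) ℕ.* suc (suc k) ℕ.+ k ℕ.* k ≡ 2 ℕ.* (suc k ℕ.* suc k) ℕ.+ 2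
    e = solve-∀
  e₁ : ∀ n t y → n ℕ.* t ℕ.* y ≡ n ℕ.* y ℕ.* t
  e₁ = solve-∀
  e₂ : ∀ x → 2 ℕ.* (x ℕ.* x ℕ.* x) ℕ.+ 2 ℕ.* (x ℕ.* x ℕ.* x) ≡ 2 ℕ.* x ℕ.* (2 ℕ.* x ℕ.* (x ℕ.* 1))
  e₂ = solve-∀
  y²≤ : y ℕ.* y ≤ x ℕ.* x ℕ.* x
  y²≤ = begin
    y ℕ.* y ≤⟨ ℕₚ.*-monoˡ-≤ y y≤nt ⟩
    n ℕ.* t ℕ.* y ≡⟨ e₁ n t y ⟩
    n ℕ.* y ℕ.* t ≤⟨ ℕₚ.*-mono-≤ (ℕₚ.≤-trans ny≤r² (ℕₚ.*-mono-≤ r≤Dt r≤Dt)) (ℕₚ.≤-trans (ℕₚ.≤-reflexive (≡.sym (ℕₚ.*-identityˡ t))) (ℕₚ.*-monoˡ-≤ t 1≤D)) ⟩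
    x ℕ.* x ℕ.* x ∎

-- Lower bounds for the number of values of the form.

module Image {c ℓ} (K : StableField c ℓ) (p : ℕ) (char : CharAbove K p) (w₁₁ w₁₂ w₂₁ w₂₂ : CommutativeRing.Carrier (StableField.ring K)) where
  open StableField K renaming (ring to kring)
  open CommutativeRing kring hiding (ring; zero)
  open Plane K
  open Form K p char w₁₁ w₁₂ w₂₁ w₂₂
  private module S = IntSolver kring
  open S using (_:=_; _:+_; _:*_; _:-_; :-_; con)

  Covers : List Point → ∀ {t} → (Fin t → Carrier) → Set (c ⊔ ℓ)
  Covers S T = ∀ {u v} → u ∈ S → v ∈ S → ∃ λ k → form u v ≈ T k

  Spread : List Point → Set (c ⊔ ℓ)
  Spread S = ∀ u → ¬ Zero u → ¬ All (Parallel u) S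

  same-sym : ∀ {u v} → ¬ Same u v → ¬ Same v u
  same-sym n e = n (sym (proj₁ e) , sym (proj₂ e))

  module Bounds (det≉0 : ¬ (det ≈ 0#)) (S : List Point) {t : ℕ} (T : Fin t → Carrier) (covers : Covers S T) where
    open NonSingular det≉0

    value : ∀ {u v} → u ∈ S → v ∈ S → Fin t
    value u∈ v∈ = proj₁ (covers u∈ v∈)

    value-eq : ∀ {u v u′ v′} (u∈ : u ∈ S) (v∈ : v ∈ S) (u′∈ : u′ ∈ S) (v′∈ : v′ ∈ S) → value u∈ v∈ ≡ value u′∈ v′∈ → form u v ≈ form u′ v′
    value-eq u∈ v∈ u′∈ v′∈ e = trans (proj₂ (covers u∈ v∈)) (trans (reflexive (≡.cong T e)) (sym (proj₂ (covers u′∈ v′∈))))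

    list-bound : ∀ r X Y → 1 ≤ r → 6 ℕ.* r ≤ p → All (_∈ S) X → All (_∈ S) Y → AllPairs (λ u v → ¬ Parallel u v) X →
      All (λ u → ¬ Zero u) X → All (λ u → ¬ Zero u) Y → AllPairs (λ u v → ¬ Same u v) Y → length X ≤ r →
      (∀ i js → Distinct js → AllPairs (λ j j′ → form (List.lookup X i) (List.lookup Y j) ≈ form (List.lookup X i) (List.lookup Y j′)) js → length js ≤ r) →
      r ℕ.* r ≤ length X ℕ.* length Y → length X ℕ.* length Y ≤ 2 ℕ.* (r ℕ.* r) → r ≤ B ℕ.* t
    list-bound r X Y 1≤r 6r≤p X∈ Y∈ X-free X≉0 Y≉0 Y-distinct X≤r few lower upper = ≤-stable (do
      fam ← families (List.lookup X) (List.lookup Y) (λ i j → value (lookup-All X∈ i) (lookup-All Y∈ j))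
        (lookup-Pairs (λ n e → n (sym e)) X-free) (lookup-All X≉0) (lookup-All Y≉0) (lookup-Pairs same-sym Y-distinct)
        (λ {i} {j} {i′} {j′} → value-eq (lookup-All X∈ i) (lookup-All Y∈ j) (lookup-All X∈ i′) (lookup-All Y∈ j′)) few X≤r 3+X≤p
      η (families-bound K p char fam r 1≤r 6r≤p lower upper ℕₚ.≤-refl))
      where
      3+X≤p : 3 ℕ.+ length X ≤ p
      3+X≤p = ℕₚ.≤-trans (ℕₚ.+-mono-≤ (ℕₚ.*-monoʳ-≤ 3 1≤r) (ℕₚ.≤-trans X≤r (ℕₚ.m≤n*m r 3))) (ℕₚ.≤-trans (ℕₚ.≤-reflexive (≡.sym (ℕₚ.*-distribʳ-+ r 3 3))) 6r≤p)

    -- With both point sets equal to `X` and `r = |X|`, a fibre trivially has at most `r` points.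
    square-bound : ∀ X → All (_∈ S) X → All (λ u → ¬ Zero u) X → AllPairs (λ u v → ¬ Parallel u v) X → 1 ≤ length X → 6 ℕ.* length X ≤ p → length X ≤ B ℕ.* t
    square-bound X X∈ X≉0 X-free 1≤ 6≤ = list-bound (length X) X X 1≤ 6≤ X∈ X∈ X-free X≉0 X≉0 (AllPairs.map (λ n e → n (same⇒parallel e)) X-free) ℕₚ.≤-refl
      (λ i js d _ → injective-length (λ j → j) js d) ℕₚ.≤-refl (ℕₚ.m≤m+n _ _)

    -- A longer list would be cut to exactly `B t + 1` points, few enough for `square-bound` to
    -- apply and too many for its conclusion.
    independent-bound : 6 ℕ.* suc (B ℕ.* t) ≤ p → ∀ X → All (_∈ S) X → All (λ u → ¬ Zero u) X → AllPairs (λ u v → ¬ Parallel u v) X → length X ≤ B ℕ.* t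
    independent-bound 6r≤p X X∈ X≉0 X-free = ℕₚ.≮⇒≥ λ lt →
      let r = suc (B ℕ.* t)
          len : length (List.take r X) ≡ r
          len = ≡.trans (Listₚ.length-take r X) (ℕₚ.m≤n⇒m⊓n≡m lt)
      in ℕₚ.<-irrefl ≡.refl (≡.subst (_≤ B ℕ.* t) len (square-bound (List.take r X) (Allₚ.take⁺ r X∈) (Allₚ.take⁺ r X≉0) (Pairsₚ.take⁺ r X-free)
        (≡.subst (1 ≤_) (≡.sym len) (s≤s z≤n)) (≡.subst (λ l → 6 ℕ.* l ≤ p) (≡.sym len) 6r≤p)))

    -- Some `z` in `S` has `form z x` nonzero, since otherwise `S` would lie on the line orthogonal
    -- to `x`. Pairing with `z` is then injective on multiples of `x` and takes at most `t` values.
    direction-bound : Spread S → ∀ x vs → ¬ Zero x → All (_∈ S) vs → AllPairs (λ u v → ¬ Same u v) vs → All (λ v → Parallel v x) vs → length vs ≤ t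
    direction-bound spread x vs x≉0 vs∈ vs-distinct vs∥x = ≤-stable (do
      yes sep ← em (Any (λ z → ¬ (form z x ≈ 0#)) S)
        where no n → ⊥-elim (collinear (All.map stable (Allₚ.¬Any⇒All¬ S n)))
      let z , z∈ , zx≉0 = find sep
      η (Finₚ.injective⇒≤ {f = λ i → value z∈ (lookup-All vs∈ i)} (λ {i} {j} → injective z∈ zx≉0 i j)))
      where
      f = rightᵂ x
      collinear : ¬ All (λ z → form z x ≈ 0#) S
      collinear null = spread (- proj₂ f , proj₁ f)
        (λ { (e₂ , e₁) → x≉0 (rightᵂ-zero x (e₁ , trans (S.solve 1 (λ a → a := :- (:- a)) refl (proj₂ f)) (trans (-‿cong e₂) (S.solve 0 (:- con (+ 0) := con (+ 0)) refl)))) })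
        (All.map (λ {z} e → trans (S.solve 4 (λ a b y z → :- b :* z := y :* a :+ :- (y :* a :+ z :* b)) refl (proj₁ f) (proj₂ f) (proj₁ z) (proj₂ z))
          (trans (+-congˡ (-‿cong (trans (form-right z x) e))) (S.solve 1 (λ a → a :+ :- con (+ 0) := a) refl _))) null)
      injective : ∀ {z} (z∈ : z ∈ S) → ¬ (form z x ≈ 0#) → ∀ i j → value z∈ (lookup-All vs∈ i) ≡ value z∈ (lookup-All vs∈ j) → i ≡ j
      injective {z} z∈ zx≉0 i j e with i Fin.≟ j
      ... | yes i≡j = i≡j
      ... | no i≢j = ⊥-elim (lookup-Pairs same-sym vs-distinct i≢j
              (separated (leftᵂ z) x zx≉0 (lookup-All vs∥x i) (lookup-All vs∥x j) (value-eq z∈ (lookup-All vs∈ i) z∈ (lookup-All vs∈ j) e)))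

    t≤ : t ≤ suc (B ℕ.* t)
    t≤ = ℕₚ.m≤n⇒m≤1+n (ℕₚ.≤-trans (ℕₚ.≤-reflexive (≡.sym (ℕₚ.*-identityˡ t))) (ℕₚ.*-monoˡ-≤ t 1≤B))

    -- On a fibre over a non-zero value distinct points are not parallel; the fibre over zero is a line through the origin.
    fibre-bound : Spread S → 6 ℕ.* suc (B ℕ.* t) ≤ p → ∀ x vs → ¬ Zero x → All (_∈ S) vs → All (λ v → ¬ Zero v) vs → AllPairs (λ u v → ¬ Same u v) vs →
      AllPairs (λ u v → form x u ≈ form x v) vs → length vs ≤ suc (B ℕ.* t)
    fibre-bound spread 6r≤p x [] _ _ _ _ _ = z≤n
    fibre-bound spread 6r≤p x vs@(v ∷ _) x≉0 vs∈ vs≉0@(v≉0 ∷ _) distinct level@(level-v ∷ _) = ≤-stable (do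
      yes e ← em (form x v ≈ 0#)
        where no n → η (ℕₚ.m≤n⇒m≤1+n (independent-bound 6r≤p vs vs∈ vs≉0 (free (n ∷ All.map (λ h z → n (trans h z)) level-v) distinct level)))
      η (ℕₚ.≤-trans (direction-bound spread v vs v≉0 vs∈ distinct
        (All.map (λ z → kernel-parallel (leftᵂ x) (λ z → x≉0 (leftᵂ-zero x z)) z e) (e ∷ All.map (λ h → trans (sym h) e) level-v))) t≤))
      where
      free : ∀ {us} → All (λ u → ¬ (form x u ≈ 0#)) us → AllPairs (λ u v → ¬ Same u v) us → AllPairs (λ u v → form x u ≈ form x v) us → AllPairs (λ u v → ¬ Parallel u v) us
      free [] [] [] = []
      free (n ∷ ns) (d ∷ ds) (e ∷ es) = All.zipWith (λ { {w} (n′ , d , e) par → d (separated (leftᵂ x) w n′ par refl e) }) (ns , All.zip (d , e)) ∷ free ns ds es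

    -- Otherwise `Y` could be shortened until `|X| |Y|` lies between `r²` and `2 r²`, where
    -- `list-bound` gives `r ≤ B t`, against the hypothesis.
    few-incidences : ∀ r → B ℕ.* t < r → 6 ℕ.* r ≤ p → ∀ X Y → All (_∈ S) X → All (_∈ S) Y → AllPairs (λ u v → ¬ Parallel u v) X →
      All (λ u → ¬ Zero u) X → All (λ u → ¬ Zero u) Y → AllPairs (λ u v → ¬ Same u v) Y → length X ≤ r →
      (∀ x vs → ¬ Zero x → All (_∈ S) vs → All (λ v → ¬ Zero v) vs → AllPairs (λ u v → ¬ Same u v) vs → AllPairs (λ u v → form x u ≈ form x v) vs → length vs ≤ r) →
      length X ℕ.* length Y ≤ r ℕ.* r
    few-incidences r@(suc _) Bt<r 6r≤p X Y X∈ Y∈ X-free X≉0 Y≉0 Y-distinct X≤r fibres = ℕₚ.<⇒≤ (ℕₚ.≰⇒> λ big → large (enough (r ℕ.* r) (length X) (length Y) big (ℕₚ.≤-trans X≤r (ℕₚ.m≤m*n r r))))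
      where
      module _ (m : ℕ) (m≤Y : m ≤ length Y) where
        Z = List.take m Y
        len : length Z ≡ m
        len = ≡.trans (Listₚ.length-take m Y) (ℕₚ.m≤n⇒m⊓n≡m m≤Y)
        Z∈ : All (_∈ S) Z
        Z∈ = Allₚ.take⁺ m Y∈
        Z≉0 : All (λ u → ¬ Zero u) Z
        Z≉0 = Allₚ.take⁺ m Y≉0
        Z-distinct : AllPairs (λ u v → ¬ Same u v) Z
        Z-distinct = Pairsₚ.take⁺ m Y-distinct
        few : ∀ i js → Distinct js → AllPairs (λ j j′ → form (List.lookup X i) (List.lookup Z j) ≈ form (List.lookup X i) (List.lookup Z j′)) js → length js ≤ r
        few i js d level = ≡.subst (_≤ r) (Listₚ.length-map (List.lookup Z) js) (fibres (List.lookup X i) (map (List.lookup Z) js) (lookup-All X≉0 i)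
          (Allₚ.map⁺ (All.universal (lookup-All Z∈) js)) (Allₚ.map⁺ (All.universal (lookup-All Z≉0) js))
          (pairs-map (List.lookup Z) (lookup-Pairs same-sym Z-distinct) d) (Pairsₚ.map⁺ level))
      large : ¬ (∃ λ m → m ≤ length Y × r ℕ.* r ≤ length X ℕ.* m × length X ℕ.* m ≤ 2 ℕ.* (r ℕ.* r))
      large (m , m≤Y , lower , upper) = ℕₚ.<⇒≱ Bt<r (list-bound r X (Z m m≤Y) (s≤s z≤n) 6r≤p X∈ (Z∈ m m≤Y) X-free X≉0 (Z≉0 m m≤Y) (Z-distinct m m≤Y) X≤r (few m m≤Y)
        (≡.subst (λ l → r ℕ.* r ≤ length X ℕ.* l) (≡.sym (len m m≤Y)) lower)
        (≡.subst (λ l → length X ℕ.* l ≤ 2 ℕ.* (r ℕ.* r)) (≡.sym (len m m≤Y)) upper))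

    -- With `X` one point per direction, `|Y| ≤ |X| t` by `direction-bound`. The radius `B t + 1` is
    -- the least one that contradicts `list-bound`, and it dominates the fibres and the number of
    -- directions.
    size-bound : Spread S → AllPairs (λ u v → ¬ Same u v) S → 1 ≤ t → 6 ℕ.* suc (B ℕ.* t) ≤ p → length S ℕ.^ 2 ≤ (6 ℕ.* suc B ℕ.* t) ℕ.^ 3
    size-bound spread S-distinct 1≤t 6r≤p = ≤-stable (do
      Y , zs , s ← split-em {P = λ u → ¬ Zero u} S
      X , X∈Y , X-free , X-cover ← greedy-representatives Parallel refl Y
      let Y∈ = split-Allˡ s (All.tabulate (λ h → h))
          X∈ = All.map (All.lookup Y∈) X∈Y
          Y≉0 = split-yes s
          X≉0 = All.map (All.lookup Y≉0) X∈Y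
          Y-distinct = split-Pairsˡ s S-distinct
      η (square-estimate {length S} {length Y} {length zs} {length X} {t} {suc (B ℕ.* t)} {suc B} (length-split s) (at-most-one-zero K zs (split-no s) (split-Pairsʳ s S-distinct))
        (cover-bound Parallel Y X Y∈ Y-distinct X-cover (All.map (λ {x} x≉0 us → direction-bound spread x us x≉0) X≉0))
        (few-incidences (suc (B ℕ.* t)) ℕₚ.≤-refl 6r≤p X Y X∈ Y∈ X-free X≉0 Y≉0 Y-distinct (ℕₚ.m≤n⇒m≤1+n (independent-bound 6r≤p X X∈ X≉0 X-free)) (fibre-bound spread 6r≤p))
        (ℕₚ.+-monoˡ-≤ (B ℕ.* t) 1≤t) (s≤s z≤n) 1≤t))

    -- The origin lies on every line considered, so one point may be zero; the others are pairwise
    -- not parallel. Assuming the bound fails, `|X| < p` gives the room below `p` that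
    -- `independent-bound` asks for.
    directions-bound : 1 ≤ t → ∀ X → All (_∈ S) X → AllPairs (λ u v → ¬ Same u v) X → AllPairs (λ u v → ¬ Zero u → ¬ Zero v → ¬ Parallel u v) X →
      length X < p → length X ≤ 6 ℕ.* suc B ℕ.* t
    directions-bound 1≤t X X∈ X-distinct X-free X<p = ℕₚ.≮⇒≥ λ lt → ℕₚ.<⇒≱ lt (≤-stable (do
      ys , zs , s ← split-em {P = λ u → ¬ Zero u} X
      η (begin
        length X ≡⟨ length-split s ⟩
        length ys ℕ.+ length zs ≤⟨ ℕₚ.+-mono-≤ (independent-bound (ℕₚ.≤-trans scale (ℕₚ.<⇒≤ (ℕₚ.<-trans lt X<p))) ys (split-Allˡ s X∈) (split-yes s) (nonzero (split-yes s) (split-Pairsˡ s X-free)))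
                                              (at-most-one-zero K zs (split-no s) (split-Pairsʳ s X-distinct)) ⟩
        B ℕ.* t ℕ.+ 1 ≡⟨ ℕₚ.+-comm (B ℕ.* t) 1 ⟩
        suc (B ℕ.* t) ≤⟨ ℕₚ.m≤n*m (suc (B ℕ.* t)) 6 ⟩
        6 ℕ.* suc (B ℕ.* t) ≤⟨ scale ⟩
        6 ℕ.* suc B ℕ.* t ∎)))
      where
      open ℕₚ.≤-Reasoning
      scale : 6 ℕ.* suc (B ℕ.* t) ≤ 6 ℕ.* suc B ℕ.* t
      scale = ℕₚ.≤-trans (ℕₚ.*-monoʳ-≤ 6 (ℕₚ.+-monoˡ-≤ (B ℕ.* t) 1≤t)) (ℕₚ.≤-reflexive (≡.sym (ℕₚ.*-assoc 6 (suc B) t)))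
      nonzero : ∀ {us} → All (λ u → ¬ Zero u) us → AllPairs (λ u v → ¬ Zero u → ¬ Zero v → ¬ Parallel u v) us → AllPairs (λ u v → ¬ Parallel u v) us
      nonzero [] [] = []
      nonzero (n ∷ ns) (f ∷ fs) = All.zipWith (λ { (f , n′) → f n n′ }) (f , ns) ∷ nonzero ns fs

-- Transfer to the given field, lines and form.

open import Defs
open import Data.List.Relation.Binary.Pointwise using (Pointwise; []; _∷_)

-- Equality in F need not be decidable or stable; double negation makes it stable without affecting inequations.
module Stabilised {c ℓ} (F : Field c ℓ) where
  open Field F

  stable-ring : CommutativeRing c ℓ
  stable-ring = record
    { Carrier = Carrier ; _≈_ = λ a b → ¬¬ (a ≈ b) ; _+_ = _+_ ; _*_ = _*_ ; -_ = -_ ; 0# = 0# ; 1# = 1#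
    ; isCommutativeRing = record
      { isRing = record
        { +-isAbelianGroup = record
          { isGroup = record
            { isMonoid = record
              { isSemigroup = record
                { isMagma = record
                  { isEquivalence = record { refl = η refl ; sym = ¬¬-map sym ; trans = λ d e → d >>= λ d′ → ¬¬-map (trans d′) e }
                  ; ∙-cong = λ d e → d >>= λ d′ → ¬¬-map (+-cong d′) e }
                ; assoc = λ x y z → η (+-assoc x y z) }
              ; identity = (λ x → η (+-identityˡ x)) , (λ x → η (+-identityʳ x)) }
            ; inverse = (λ x → η (-‿inverseˡ x)) , (λ x → η (-‿inverseʳ x))
            ; ⁻¹-cong = ¬¬-map -‿cong }
          ; comm = λ x y → η (+-comm x y) }
        ; *-cong = λ d e → d >>= λ d′ → ¬¬-map (*-cong d′) e
        ; *-assoc = λ x y z → η (*-assoc x y z)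
        ; *-identity = (λ x → η (*-identityˡ x)) , (λ x → η (*-identityʳ x))
        ; distrib = (λ x y z → η (distribˡ x y z)) , (λ x y z → η (distribʳ x y z)) }
      ; *-comm = λ x y → η (*-comm x y) } }

  K : StableField c ℓ
  K = record
    { ring = stable-ring
    ; stable = λ h k → h (λ h′ → h′ k)
    ; 1≉0 = λ h → h (λ e → 0≉1 (sym e))
    ; inverse = λ a a≉0 → let b , e = inverse a (λ e → a≉0 (η e)) in b , η e }

  char-above : ∀ {p} → HasCharacteristic F p → CharAbove K p
  char-above (_ , h) n 0<n n<p e = e λ e′ → h n 0<n n<p (trans (reflexive (≡.sym (multiple n))) e′)
    where
    multiple : ∀ n → NatMultiples._×ⁿ_ stable-ring n 1# ≡ ι F n
    multiple zero = ≡.refl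
    multiple (suc n) = ≡.cong (λ a → 1# + a) (multiple n)

module LinesThroughOrigin {c ℓ} (F : Field c ℓ) where
  open Field F
  open Stabilised F
  open Plane K
  private module S = IntSolver commutativeRing
  open S using (_:=_; _:+_; _:*_; _:-_; :-_; con)
  open Relation.Binary.Reasoning.Setoid setoid

  zero-product : ∀ {x} y → x ≈ 0# → y * x ≈ 0#
  zero-product y e = trans (*-congˡ e) (zeroʳ y)

  -- Parallel normals are proportional. The factor is `a′ / a` or `b′ / b`, according to which
  -- coefficient of `L` is nonzero.
  contained : ∀ L L′ → ThroughOrigin F L → ThroughOrigin F L′ → ¬¬ (Line.a L * Line.b L′ ≈ Line.a L′ * Line.b L) → ¬¬ (∀ P → OnLine F P L → OnLine F P L′)
  contained (line a b d nz) (line a′ b′ d′ _) d≈0 d′≈0 parallel = do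
    e ← parallel
    yes a≈0 ← em (a ≈ 0#)
      where no a≉0 → let i , ai≈1 = inverse a a≉0 in η (multiple (a′ * i)
              (trans (sym (trans (*-congˡ ai≈1) (*-identityʳ a′))) (S.solve 3 (λ a′ a i → a′ :* (a :* i) := a′ :* i :* a) refl a′ a i))
              (trans (sym (trans (*-congˡ ai≈1) (*-identityʳ b′))) (trans (S.solve 3 (λ b′ a i → b′ :* (a :* i) := a :* b′ :* i) refl b′ a i)
                (trans (*-congʳ e) (S.solve 3 (λ a′ b i → a′ :* b :* i := a′ :* i :* b) refl a′ b i)))))
    let i , bi≈1 = inverse b (λ b≈0 → nz (a≈0 , b≈0))
    η (multiple (b′ * i)
      (trans (sym (trans (*-congˡ bi≈1) (*-identityʳ a′))) (trans (S.solve 3 (λ a′ b i → a′ :* (b :* i) := a′ :* b :* i) refl a′ b i)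
        (trans (*-congʳ (sym e)) (S.solve 3 (λ a b′ i → a :* b′ :* i := b′ :* i :* a) refl a b′ i))))
      (trans (sym (trans (*-congˡ bi≈1) (*-identityʳ b′))) (S.solve 3 (λ b′ b i → b′ :* (b :* i) := b′ :* i :* b) refl b′ b i)))
    where
    multiple : ∀ k → a′ ≈ k * a → b′ ≈ k * b → ∀ P → OnLine F P (line a b d nz) → a′ * proj₁ P + b′ * proj₂ P ≈ d′
    multiple k ea eb (x , y) on = begin
      a′ * x + b′ * y ≈⟨ +-cong (*-congʳ ea) (*-congʳ eb) ⟩
      k * a * x + k * b * y ≈⟨ S.solve 5 (λ k a b x y → k :* a :* x :+ k :* b :* y := k :* (a :* x :+ b :* y)) refl k a b x y ⟩
      k * (a * x + b * y) ≈⟨ zero-product k (trans on d≈0) ⟩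
      0# ≈⟨ sym d′≈0 ⟩
      d′ ∎

  rotated-zero : ∀ {u} → ¬ Zero u → ¬ Zero (- proj₂ u , proj₁ u)
  rotated-zero u≉0 (e₂ , e₁) = u≉0 (e₁ , ¬¬-map (λ e → trans (S.solve 1 (λ x → x := :- (:- x)) refl _) (trans (-‿cong e) (S.solve 0 (:- con (+ 0) := con (+ 0)) refl))) e₂)

  -- The normal vectors of the two lines are parallel to the points rotated by a right angle.
  not-parallel : ∀ {u v L L′} → OnLine F u L → OnLine F v L′ → ThroughOrigin F L → ThroughOrigin F L′ → ¬ SameLine F L L′ → ¬ Zero u → ¬ Zero v → ¬ Parallel u v
  not-parallel {u₁ , u₂} {v₁ , v₂} {L@(line a b d _)} {L′@(line a′ b′ d′ _)} onL onL′ d≈0 d′≈0 distinct u≉0 v≉0 par =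
    contained L L′ d≈0 d′≈0 normals λ f → contained L′ L d′≈0 d≈0 (¬¬-map sym normals) λ g → distinct (λ P → f P , g P)
    where
    perpendicular : ∀ {a b x y} → a * x + b * y ≈ 0# → a * x ≈ - y * b
    perpendicular {a} {b} {x} {y} e = trans (S.solve 4 (λ a b x y → a :* x := (a :* x :+ b :* y) :+ :- y :* b) refl a b x y) (trans (+-congʳ e) (+-identityˡ _))
    normals : ¬¬ (a * b′ ≈ a′ * b)
    normals = parallel-trans {a , b} {a′ , b′} (- u₂ , u₁) (rotated-zero u≉0) (η (perpendicular (trans onL d≈0)))
      (parallel-trans {(- u₂) , u₁} {a′ , b′} (- v₂ , v₁) (rotated-zero v≉0)
        (¬¬-map (λ e → trans (S.solve 2 (λ x y → :- x :* y := :- (y :* x)) refl u₂ v₁) (trans (-‿cong (sym e)) (S.solve 2 (λ x y → :- (x :* y) := :- y :* x) refl u₁ v₂))) par)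
        (η (sym (perpendicular (trans onL′ d′≈0)))))

  -- The multiples of a nonzero `u` lie on the line through the origin with normal `(- u₂ , u₁)`.
  spread : ∀ {S} → ¬ ContainedInALine F S → ∀ u → ¬ Zero u → ¬ All (Parallel u) S
  spread {S} h u@(u₁ , u₂) u≉0 pars = ¬¬-All pars λ es → h
    ( line (- u₂) u₁ 0# (λ { (e₂ , e₁) → rotated-zero u≉0 (η e₂ , η e₁) })
    , All.map (λ {z} e → trans (+-congˡ e) (S.solve 2 (λ x y → :- y :* x :+ x :* y := con (+ 0)) refl (proj₁ z) u₂)) es )

  independent : ∀ {S Ls} → Pointwise (OnLine F) S Ls → All (ThroughOrigin F) Ls → AllPairs (λ L L′ → ¬ SameLine F L L′) Ls →
    AllPairs (λ u v → ¬ Zero u → ¬ Zero v → ¬ Parallel u v) S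
  independent [] [] [] = []
  independent (_∷_ {x = u} {y = L} on ons) (o ∷ os) (n ∷ ns) = row u L on o ons os n ∷ independent ons os ns
    where
    row : ∀ u L {S Ls} → OnLine F u L → ThroughOrigin F L → Pointwise (OnLine F) S Ls → All (ThroughOrigin F) Ls → All (λ L′ → ¬ SameLine F L L′) Ls →
      All (λ v → ¬ Zero u → ¬ Zero v → ¬ Parallel u v) S
    row u L on o [] [] [] = []
    row u L on o (_∷_ {x = v} {y = L′} on′ ons) (o′ ∷ os) (n ∷ ns) = not-parallel {u} {v} {L} {L′} on on′ o o′ n ∷ row u L on o ons os ns

module Bilinear {c ℓ} (F : Field c ℓ) (ω : Pt F → Pt F → Field.Carrier F) (bilinear : IsBilinear F ω) where
  open Field F
  open IsBilinear bilinear renaming (cong to ω-cong)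
  private module S = IntSolver commutativeRing
  open S using (_:=_; _:+_; _:*_; _:-_; :-_; con)
  open Relation.Binary.Reasoning.Setoid setoid

  i₁ i₂ : Pt F
  i₁ = 1# , 0#
  i₂ = 0# , 1#

  w₁₁ w₁₂ w₂₁ w₂₂ : Carrier
  w₁₁ = ω i₁ i₁
  w₁₂ = ω i₁ i₂
  w₂₁ = ω i₂ i₁
  w₂₂ = ω i₂ i₂

  basis : ∀ u → _≈ᵖ_ F u (_+ᵖ_ F (_·ᵖ_ F (proj₁ u) i₁) (_·ᵖ_ F (proj₂ u) i₂))
  basis (u₁ , u₂) = S.solve 2 (λ x y → x := x :* con (+ 1) :+ y :* con (+ 0)) refl u₁ u₂ , S.solve 2 (λ x y → y := x :* con (+ 0) :+ y :* con (+ 1)) refl u₁ u₂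

  expandˡ : ∀ u v → ω u v ≈ proj₁ u * ω i₁ v + proj₂ u * ω i₂ v
  expandˡ u v = trans (ω-cong (basis u) (refl , refl)) (trans (+-left _ _ v) (+-cong (·-left _ i₁ v) (·-left _ i₂ v)))

  expandʳ : ∀ u v → ω u v ≈ proj₁ v * ω u i₁ + proj₂ v * ω u i₂
  expandʳ u v = trans (ω-cong (refl , refl) (basis v)) (trans (+-right u _ _) (+-cong (·-right _ u i₁) (·-right _ u i₂)))

  matrix : ∀ u v → ω u v ≈ (proj₁ u * w₁₁ + proj₂ u * w₂₁) * proj₁ v + (proj₁ u * w₁₂ + proj₂ u * w₂₂) * proj₂ v
  matrix u v = trans (expandˡ u v) (trans (+-cong (*-congˡ (expandʳ i₁ v)) (*-congˡ (expandʳ i₂ v)))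
    (S.solve 8 (λ u₁ u₂ v₁ v₂ a b c d → u₁ :* (v₁ :* a :+ v₂ :* b) :+ u₂ :* (v₁ :* c :+ v₂ :* d) := (u₁ :* a :+ u₂ :* c) :* v₁ :+ (u₁ :* b :+ u₂ :* d) :* v₂)
      refl (proj₁ u) (proj₂ u) (proj₁ v) (proj₂ v) w₁₁ w₁₂ w₂₁ w₂₂))

  left-kernel : ∀ u → proj₁ u * w₁₁ + proj₂ u * w₂₁ ≈ 0# → proj₁ u * w₁₂ + proj₂ u * w₂₂ ≈ 0# → ∀ v → ω u v ≈ 0#
  left-kernel u e e′ v = trans (matrix u v) (trans (+-cong (*-congʳ e) (*-congʳ e′)) (S.solve 2 (λ x y → con (+ 0) :* x :+ con (+ 0) :* y := con (+ 0)) refl _ _))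

  -- The rows of the adjugate matrix lie in the left kernel of a singular matrix.
  nonsingular : NonDegenerate F ω → ¬ (w₁₁ * w₂₂ + - (w₁₂ * w₂₁) ≈ 0#)
  nonsingular nondegenerate e = 0≉1 (sym (proj₁ (nondegenerate i₁ (left-kernel i₁ (combine (proj₂ r₂)) (combine (neg (proj₂ r₁)))))))
    where
    neg : ∀ {x} → - x ≈ 0# → x ≈ 0#
    neg {x} e = trans (S.solve 1 (λ x → x := :- (:- x)) refl x) (trans (-‿cong e) (S.solve 0 (:- con (+ 0) := con (+ 0)) refl))
    r₁ : _≈ᵖ_ F (w₂₂ , - w₁₂) (0ᵖ F)
    r₁ = nondegenerate _ (left-kernel _ (trans (S.solve 4 (λ a b c d → d :* a :+ :- b :* c := a :* d :- b :* c) refl w₁₁ w₁₂ w₂₁ w₂₂) e)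
      (S.solve 2 (λ b d → d :* b :+ :- b :* d := con (+ 0)) refl w₁₂ w₂₂))
    r₂ : _≈ᵖ_ F (- w₂₁ , w₁₁) (0ᵖ F)
    r₂ = nondegenerate _ (left-kernel _ (S.solve 2 (λ a c → :- c :* a :+ a :* c := con (+ 0)) refl w₁₁ w₂₁)
      (trans (S.solve 4 (λ a b c d → :- c :* b :+ a :* d := a :* d :- b :* c) refl w₁₁ w₁₂ w₂₁ w₂₂) e))
    combine : ∀ {a c} → a ≈ 0# → 1# * a + 0# * c ≈ 0#
    combine {a} {c} e = trans (S.solve 2 (λ a c → con (+ 1) :* a :+ con (+ 0) :* c := a) refl a c) e

module Conclusion {c ℓ} (F : Field c ℓ) (p : ℕ) (characteristic : HasCharacteristic F p) (ω : Pt F → Pt F → Field.Carrier F)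
    (bilinear : IsBilinear F ω) (nondegenerate : NonDegenerate F ω) (S : List (Pt F)) (T : List (Field.Carrier F)) (covers : CoversImage F ω S T) where
  open Field F hiding (zero)
  open Stabilised F
  open LinesThroughOrigin F
  open Bilinear F ω bilinear

  k-covers : Image.Covers K p (char-above characteristic) w₁₁ w₁₂ w₂₁ w₂₂ S (List.lookup T)
  k-covers {u} {v} u∈ v∈ = Any.index found , η (trans (sym (matrix u v)) (Anyₚ.lookup-index found))
    where found = covers u v u∈ v∈

  open Image.Bounds K p (char-above characteristic) w₁₁ w₁₂ w₂₁ w₂₂ (λ e → e (nonsingular nondegenerate)) S (List.lookup T) k-covers

  distinct : ∀ {S} → DistinctPts F S → AllPairs (λ u v → ¬ Plane.Same K u v) S
  distinct = AllPairs.map (λ n e → proj₁ e λ e₁ → proj₂ e λ e₂ → n (e₁ , e₂))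

  image-nonempty : ∀ {u} → u ∈ S → 1 ≤ length T
  image-nonempty {u} u∈ = ℕₚ.≤-trans (s≤s z≤n) (Finₚ.toℕ<n (Any.index (covers u u u∈ u∈)))

  -- If the second alternative fails, `p` exceeds `6 (B + 1) t`, which is at least `6 (B t + 1)`
  -- once `t ≥ 1`; this is the origin of the factor `6 (B + 1)`. A point of `S` gives `t ≥ 1`, so
  -- the empty list is treated apart.
  size : DistinctPts F S → ¬ ContainedInALine F S → (length S ℕ.^ 2 ≤ (6 ℕ.* suc B ℕ.* length T) ℕ.^ 3) ⊎ (p ≤ 6 ℕ.* suc B ℕ.* length T)
  size S-distinct noncollinear with p ℕ.≤? 6 ℕ.* suc B ℕ.* length T
  ... | yes p≤ = inj₂ p≤
  ... | no p≰ = inj₁ (by S ≡.refl)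
    where
    by : ∀ S₀ → S₀ ≡ S → length S ℕ.^ 2 ≤ (6 ℕ.* suc B ℕ.* length T) ℕ.^ 3
    by [] ≡.refl = z≤n
    by (u ∷ _) ≡.refl = size-bound (spread noncollinear) (distinct S-distinct) 1≤t
      (ℕₚ.≤-trans (ℕₚ.*-monoʳ-≤ 6 (ℕₚ.+-monoˡ-≤ (B ℕ.* length T) 1≤t)) (ℕₚ.≤-trans (ℕₚ.≤-reflexive (≡.sym (ℕₚ.*-assoc 6 (suc B) (length T)))) (ℕₚ.<⇒≤ (ℕₚ.≰⇒> p≰))))
      where
      1≤t : 1 ≤ length T
      1≤t = image-nonempty (here ≡.refl)

  directions : ∀ S′ → All (_∈ S) S′ → DistinctPts F S′ → length S′ < p → OnDistinctLinesThroughOrigin F S′ → length S′ ≤ 6 ℕ.* suc B ℕ.* length T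
  directions [] _ _ _ _ = z≤n
  directions S′@(_ ∷ _) S′∈@(u∈ ∷ _) S′-distinct S′<p (_ , on , through , lines) =
    directions-bound (image-nonempty u∈) S′ S′∈ (distinct S′-distinct) (independent on through lines) S′<p


open import Data.Nat using (_^_; _*_)
open import Data.Nat.Primality using (Prime)

theorem13 : ∃ℕ⁺ω λ k →
    (∀ {c ℓ : Level} (F : Field c ℓ) (p : ℕ) → Prime p → ¬ (p ≡ 2) →
    HasCharacteristic F p →
    (ω : Pt F → Pt F → Field.Carrier F) → IsBilinear F ω → NonDegenerate F ω →
    (Symmetric F ω ⊎ SkewSymmetric F ω) →
    (S : List (Pt F)) → DistinctPts F S → ¬ ContainedInALine F S →
    ScaledImageSize F ω S k (λ m → (length S ^ 2 ≤ m ^ 3) ⊎ (p ≤ m))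
    × ((S′ : List (Pt F)) → All (_∈ S) S′ → DistinctPts F S′ → length S′ < p →
    OnDistinctLinesThroughOrigin F S′ →
    ScaledImageSize F ω S k (λ m → length S′ ≤ m)))
theorem13 = record
  { witness = 6 * suc B
  ; positive = s≤s z≤n
  ; proof = λ F p _ _ characteristic ω bilinear nondegenerate _ S S-distinct noncollinear →
      (λ T covers → Conclusion.size F p characteristic ω bilinear nondegenerate S T covers S-distinct noncollinear)
    , (λ S′ S′∈ S′-distinct S′<p on-lines T covers → Conclusion.directions F p characteristic ω bilinear nondegenerate S T covers S′ S′∈ S′-distinct S′<p on-lines) }
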